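{- Let $K$ be a field of characteristic not $2$ or $3$, let $n\in\{2,3,4\}$, and let $f,f'$ be genus one models of degree $n$ over $K$. If $n=3$ suppose $f(0,0,1)\ne0$ and $f'(0,0,1)\ne0$. If $n=4$ suppose $C_f$ and $C_{f'}$ do not meet the line $\{x_3=x_4=0\}$. Suppose $f'=\gamma f$ for some $\gamma\in\mathcal G_n(K)$. Write $\xi,\eta,D$ for the central elements and derivation of $A_f$ and $\xi',\eta',D'$ for those of $A_{f'}$. Then there is a $K$-algebra isomorphism $\psi:A_{f'}\to A_f$ such that $\psi(\xi')=(\det\gamma)^2\xi+\rho$ and $\psi(\eta')=(\det\gamma)^3\eta+\sigma\xi+\tau$ for some $\rho,\sigma,\tau\in K$, with $\sigma=\tau=0$ if $n\in\{2,4\}$. Moreover there exists $\kappa\in A_f$ such that $\psi(D'(x))=(\det\gamma)\,D(\psi(x))+[\kappa,\psi(x)]$ for all $x\in A_{f'}$, where $[u,v]=uv-vu$.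
   Context: Genus one models and $A_f$. For $n=2$: $f(x,z)=ax^4+bx^3z+cx^2z^2+dxz^3+ez^4$; $A_f$ is the associative $K$-algebra generated by $r,s,t$ subject to $r^2=a$, $rs+sr=b$, $rt+tr+s^2=c$, $st+ts=d$, $t^2=e$. For $n=3$: $f=ax^3+by^3+cz^3+a_2x^2y+a_3x^2z+b_1xy^2+b_3y^2z+c_1xz^2+c_2yz^2+mxyz$ with $c\ne0$; $A_f$ is generated by $x,y$ subject to $cx^3+c_1x^2+a_3x+a=0$, $c(x^2y+xyx+yx^2)+c_1(xy+yx)+c_2x^2+mx+a_3y+a_2=0$, $c(xy^2+yxy+y^2x)+c_2(xy+yx)+c_1y^2+my+b_3x+b_1=0$, $cy^3+c_2y^2+b_3y+b=0$. For $n=4$: $f=(f_1,f_2)$ quadratic forms in $x_1,\dots,x_4$, $f_1=\sum_{i\le j}a_{ij}x_ix_j$, $f_2=\sum_{i\le j}b_{ij}x_ix_j$, $C_f=\{f_1=f_2=0\}\subset\mathbb P^3$; $A_f$ is generated by $p,q,r,s$ subject to, for both $(g_{ij})=(a_{ij})$ and $(g_{ij})=(b_{ij})$: $g_{11}p^2+g_{12}pq+g_{22}q^2+g_{13}p+g_{23}q+g_{33}=0$, $g_{11}(pr+rp)+g_{12}(ps+rq)+g_{22}(qs+sq)+g_{14}p+g_{24}q+g_{13}r+g_{23}s+g_{34}=0$, $g_{11}r^2+g_{12}rs+g_{22}s^2+g_{14}r+g_{24}s+g_{44}=0$, and $pq=qp$, $ps+rq=qr+sp$, $rs=sr$. Central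 elements and derivations. $n=2$: $\xi=s^2-c$, $\eta=rst-tsr$; $D$ is the derivation with $Dr=[s,r]$, $Ds=[t,r]$, $Dt=0$. $n=3$: $\xi=c^2(xy)^2-(cy^2+c_2y+b_3)(cx^2+c_1x+a_3)+(cm-c_1c_2)xy+a_3b_3$; $D$ is the derivation with $Dx=c[xy,x]$, $Dy=c[y,yx]$; $\eta=\tfrac12(D\xi-m\xi-a'_3)$ where $a'_3=9abc-(ab_3c_2+ba_3c_1+ca_2b_1)-(a_2b_3c_1+a_3b_1c_2)$. $n=4$: let $a_1,\dots,a_{10}$ (resp. $b_1,\dots,b_{10}$) be the coefficients of $f_1$ (resp. $f_2$) on the monomials $x_1^2,x_1x_2,x_1x_3,x_1x_4,x_2^2,x_2x_3,x_2x_4,x_3^2,x_3x_4,x_4^2$ in that order, $d_{ij}=a_ib_j-a_jb_i$, and $p_i=d_{1i}p+d_{2i}q+d_{3i}$, $q_i=d_{2i}p+d_{5i}q+d_{6i}$, $r_i=d_{1i}r+d_{2i}s+d_{4i}$, $s_i=d_{2i}r+d_{5i}s+d_{7i}$, $t=qr-ps$. Then $\xi=(p_5s)^2+(s_1p)^2+(d_{56}p_4+d_{29}p_5+d_{37}p_5-d_{27}p_6)s-d_{56}(d_{13}r+d_{23}s-d_{17}q+d_{12}t-d_{19})s+(d_{14}s_6+d_{29}s_1-d_{37}s_1-d_{23}s_4)p-d_{14}(d_{27}p+d_{57}q+d_{35}r-d_{25}t-d_{59})p$; with $\varepsilon=d_{12}(pr+rp)+d_{15}(ps+qr+sp+rq)+d_{25}(qs+sq)$,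 $D$ is the derivation with $Dp=\tfrac12[p,\varepsilon]$, $Dq=\tfrac12[q,\varepsilon]$, $Dr=Ds=0$; and $\eta=\tfrac12D\xi$. (These $D$ are well-defined derivations and $\xi,\eta$ are central.) Group actions. $\mathcal G_2(K)=K^\times\times\operatorname{GL}_2(K)$ acts on binary quartics by $(\lambda,M):f(x,z)\mapsto\lambda^2f(m_{11}x+m_{21}z,\,m_{12}x+m_{22}z)$. $\mathcal G_3(K)=K^\times\times\operatorname{GL}_3(K)$ acts on ternary cubics by $(\lambda,M):f(x,y,z)\mapsto\lambda f(m_{11}x+m_{21}y+m_{31}z,\,m_{12}x+m_{22}y+m_{32}z,\,m_{13}x+m_{23}y+m_{33}z)$. $\mathcal G_4(K)=\operatorname{GL}_2(K)\times\operatorname{GL}_4(K)$ acts on pairs of quadratic forms by $(\Lambda,I_4):(f_1,f_2)\mapsto(\lambda_{11}f_1+\lambda_{12}f_2,\lambda_{21}f_1+\lambda_{22}f_2)$ and $(I_2,M):(f_1,f_2)\mapsto(f_1(\sum_im_{i1}x_i,\dots,\sum_im_{i4}x_i),f_2(\sum_im_{i1}x_i,\dots,\sum_im_{i4}x_i))$. $\det(\lambda,M)=\lambda\det M$ for $n=2,3$ and $\det(\Lambda,M)=\det\Lambda\det M$ for $n=4$. -}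

module Defs where

open import Level using (Level; _⊔_; Lift) renaming (suc to lsuc)
open import Algebra.Bundles using (CommutativeRing)
open import Data.Nat as ℕ using (ℕ; zero; suc)
open import Data.Fin using (Fin; zero; suc; #_; punchIn; splitAt; _↑ˡ_; _↑ʳ_)
open import Data.Vec using (Vec; []; _∷_; lookup)
open import Data.List using (List; map; concatMap; upTo; foldr) renaming ([_] to [_]ₗ)
open import Data.Bool using (Bool; true; false; if_then_else_)
open import Data.Product using (_×_; _,_)
open import Data.Sum using ([_,_]′)
open import Data.Empty using (⊥)
open import Data.Unit.Polymorphic using (⊤)
open import Relation.Nullary using (¬_)
open import Function using (_∘_)

-- Fields (stdlib has none): a commutative ring with 0 ≠ 1 in which every
-- nonzero element has an inverse.  The inverse is a total operation whose
-- value on 0 is unconstrained.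

record Field (c ℓ : Level) : Set (lsuc (c ⊔ ℓ)) where
  field
    commutativeRing : CommutativeRing c ℓ
  open CommutativeRing commutativeRing public
  infix 8 _⁻¹
  field
    _⁻¹     : Carrier → Carrier
    0≉1     : ¬ (0# ≈ 1#)
    inverse : ∀ x → ¬ (x ≈ 0#) → (x * x ⁻¹) ≈ 1#

record FieldHom {c ℓ c′ ℓ′} (F : Field c ℓ) (L : Field c′ ℓ′) : Set (c ⊔ ℓ ⊔ c′ ⊔ ℓ′) where
  private
    module F = Field F
    module L = Field L
  field
    ⟦_⟧    : F.Carrier → L.Carrier
    ⟦⟧-cong : ∀ {x y} → x F.≈ y → ⟦ x ⟧ L.≈ ⟦ y ⟧
    +-hom  : ∀ x y → ⟦ x F.+ y ⟧ L.≈ (⟦ x ⟧ L.+ ⟦ y ⟧)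
    *-hom  : ∀ x y → ⟦ x F.* y ⟧ L.≈ (⟦ x ⟧ L.* ⟦ y ⟧)
    1-hom  : ⟦ F.1# ⟧ L.≈ L.1#

data Deg : Set where
  two three four : Deg

module _ {c ℓ : Level} (F : Field c ℓ) where
  open Field F hiding (zero)

  infixl 6 _−_
  _−_ : Carrier → Carrier → Carrier
  x − y = x + (- y)

  nat : ℕ → Carrier
  nat zero    = 0#
  nat (suc k) = 1# + nat k

  half : Carrier
  half = (1# + 1#) ⁻¹

  sumF : ∀ {m} → (Fin m → Carrier) → Carrier
  sumF {zero}  g = 0#
  sumF {suc m} g = g zero + sumF (g ∘ suc)

  altSum : ∀ {m} → (Fin m → Carrier) → Carrier
  altSum {zero}  g = 0#
  altSum {suc m} g = g zero − altSum (g ∘ suc)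

  Mat : ℕ → Set c
  Mat m = Fin m → Fin m → Carrier

  det : ∀ {m} → Mat m → Carrier
  det {zero}  M = 1#
  det {suc m} M = altSum (λ j → M zero j * det (λ r s → M (suc r) (punchIn j s)))

  infixl 6 _p+_
  infixl 7 _p*_
  data Poly (m : ℕ) : Set c where
    pc   : Carrier → Poly m
    pv   : Fin m → Poly m
    _p+_ : Poly m → Poly m → Poly m
    _p*_ : Poly m → Poly m → Poly m

  allZero : ∀ {m} → Vec ℕ m → Bool
  allZero []          = true
  allZero (zero ∷ α)  = allZero α
  allZero (suc _ ∷ _) = false

  isUnit : ∀ {m} → Fin m → Vec ℕ m → Bool
  isUnit zero    (suc zero ∷ α) = allZero α
  isUnit zero    _              = false
  isUnit (suc i) (zero ∷ α)     = isUnit i α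
  isUnit (suc i) (suc _ ∷ _)    = false

  splits : ∀ {m} → Vec ℕ m → List (Vec ℕ m × Vec ℕ m)
  splits []      = [ ([] , []) ]ₗ
  splits (a ∷ α) = concatMap (λ i → map (λ { (β , γ) → (i ∷ β , (a ℕ.∸ i) ∷ γ) }) (splits α)) (upTo (suc a))

  sumL : List Carrier → Carrier
  sumL = foldr _+_ 0#

  coeff : ∀ {m} → Poly m → Vec ℕ m → Carrier
  coeff (pc a)   α = if allZero α then a else 0#
  coeff (pv i)   α = if isUnit i α then 1# else 0#
  coeff (p p+ q) α = coeff p α + coeff q α
  coeff (p p* q) α = sumL (map (λ { (β , γ) → coeff p β * coeff q γ }) (splits α))

  subst : ∀ {m k} → (Fin m → Poly k) → Poly m → Poly k
  subst σ (pc a)   = pc a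
  subst σ (pv i)   = σ i
  subst σ (p p+ q) = subst σ p p+ subst σ q
  subst σ (p p* q) = subst σ p p* subst σ q

  psum : ∀ {m k} → (Fin m → Poly k) → Poly k
  psum {zero}  g = pc 0#
  psum {suc m} g = g zero p+ psum (g ∘ suc)

  ppow : ∀ {m} → Poly m → ℕ → Poly m
  ppow x zero    = pc 1#
  ppow x (suc e) = x p* ppow x e

  mono : ∀ {m} → Vec ℕ m → Poly m
  mono []      = pc 1#
  mono (e ∷ α) = ppow (pv zero) e p* subst (pv ∘ suc) (mono α)

  formOf : ∀ {k m} → (Fin k → Vec ℕ m) → (Fin k → Carrier) → Poly m
  formOf E f = psum (λ i → pc (f i) p* mono (E i))

  coeffsOf : ∀ {k m} → (Fin k → Vec ℕ m) → Poly m → Fin k → Carrier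
  coeffsOf E P i = coeff P (E i)

  lin : ∀ {m} → Mat m → Fin m → Poly m
  lin M i = psum (λ j → pc (M j i) p* pv j)

  ncoef : Deg → ℕ
  ncoef two   = 5
  ncoef three = 10
  ncoef four  = 20

  Model : Deg → Set c
  Model n = Fin (ncoef n) → Carrier

  -- n = 2: a x^4 + b x^3 z + c x^2 z^2 + d x z^3 + e z^4   (variables x, z)
  E2 : Fin 5 → Vec ℕ 2
  E2 = lookup ((4 ∷ 0 ∷ []) ∷ (3 ∷ 1 ∷ []) ∷ (2 ∷ 2 ∷ []) ∷ (1 ∷ 3 ∷ []) ∷ (0 ∷ 4 ∷ []) ∷ [])

  -- n = 3: coefficients in the order a, b, c, a2, a3, b1, b3, c1, c2, m
  -- on x^3, y^3, z^3, x^2y, x^2z, xy^2, y^2z, xz^2, yz^2, xyz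
  E3 : Fin 10 → Vec ℕ 3
  E3 = lookup ((3 ∷ 0 ∷ 0 ∷ []) ∷ (0 ∷ 3 ∷ 0 ∷ []) ∷ (0 ∷ 0 ∷ 3 ∷ []) ∷ (2 ∷ 1 ∷ 0 ∷ [])
             ∷ (2 ∷ 0 ∷ 1 ∷ []) ∷ (1 ∷ 2 ∷ 0 ∷ []) ∷ (0 ∷ 2 ∷ 1 ∷ []) ∷ (1 ∷ 0 ∷ 2 ∷ [])
             ∷ (0 ∷ 1 ∷ 2 ∷ []) ∷ (1 ∷ 1 ∷ 1 ∷ []) ∷ [])

  E4 : Fin 10 → Vec ℕ 4
  E4 = lookup ((2 ∷ 0 ∷ 0 ∷ 0 ∷ []) ∷ (1 ∷ 1 ∷ 0 ∷ 0 ∷ []) ∷ (1 ∷ 0 ∷ 1 ∷ 0 ∷ []) ∷ (1 ∷ 0 ∷ 0 ∷ 1 ∷ [])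
             ∷ (0 ∷ 2 ∷ 0 ∷ 0 ∷ []) ∷ (0 ∷ 1 ∷ 1 ∷ 0 ∷ []) ∷ (0 ∷ 1 ∷ 0 ∷ 1 ∷ []) ∷ (0 ∷ 0 ∷ 2 ∷ 0 ∷ [])
             ∷ (0 ∷ 0 ∷ 1 ∷ 1 ∷ []) ∷ (0 ∷ 0 ∷ 0 ∷ 2 ∷ []) ∷ [])

  fst4 snd4 : Model four → Fin 10 → Carrier
  fst4 f i = f (i ↑ˡ 10)
  snd4 f i = f (10 ↑ʳ i)

  GElt : Deg → Set c
  GElt two   = Carrier × Mat 2
  GElt three = Carrier × Mat 3
  GElt four  = Mat 2 × Mat 4

  Valid : (n : Deg) → GElt n → Set ℓ
  Valid two   (λ′ , M) = ¬ (λ′ ≈ 0#) × ¬ (det M ≈ 0#)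
  Valid three (λ′ , M) = ¬ (λ′ ≈ 0#) × ¬ (det M ≈ 0#)
  Valid four  (Λ , M)  = ¬ (det Λ ≈ 0#) × ¬ (det M ≈ 0#)

  detG : (n : Deg) → GElt n → Carrier
  detG two   (λ′ , M) = λ′ * det M
  detG three (λ′ , M) = λ′ * det M
  detG four  (Λ , M)  = det Λ * det M

  act : (n : Deg) → GElt n → Model n → Model n
  act two   (λ′ , M) f = coeffsOf E2 (pc (λ′ * λ′) p* subst (lin M) (formOf E2 f))
  act three (λ′ , M) f = coeffsOf E3 (pc λ′ p* subst (lin M) (formOf E3 f))
  act four  (Λ , M)  f = [ coeffsOf E4 new1 , coeffsOf E4 new2 ]′ ∘ splitAt 10
    where
      g1 g2 new1 new2 : Poly 4
      g1 = subst (lin M) (formOf E4 (fst4 f))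
      g2 = subst (lin M) (formOf E4 (snd4 f))
      new1 = pc (Λ zero zero) p* g1 p+ pc (Λ zero (suc zero)) p* g2
      new2 = pc (Λ (suc zero) zero) p* g1 p+ pc (Λ (suc zero) (suc zero)) p* g2

  -- C_f does not meet {x3 = x4 = 0}: there is no point (x1 : x2 : 0 : 0) of C_f
  -- over any field extension L of K.
  -- value of the binary quadratic g(x1, x2, 0, 0) at a point over an extension L
  Qval : (L : Field c ℓ) → FieldHom F L → (Fin 10 → Carrier) → (x1 x2 : Field.Carrier L) → Field.Carrier L
  Qval L h g x1 x2 =
    (⟦ g (# 0) ⟧ L.* (x1 L.* x1)) L.+ (⟦ g (# 1) ⟧ L.* (x1 L.* x2)) L.+ (⟦ g (# 4) ⟧ L.* (x2 L.* x2))
    where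
      module L = Field L
      open FieldHom h

  NoMeet : Model four → Set (lsuc (c ⊔ ℓ))
  NoMeet f = (L : Field c ℓ) (h : FieldHom F L) (x1 x2 : Field.Carrier L) →
    ¬ ((Field._≈_ L x1 (Field.0# L)) × (Field._≈_ L x2 (Field.0# L))) →
    ¬ ((Field._≈_ L (Qval L h (fst4 f) x1 x2) (Field.0# L))
       × (Field._≈_ L (Qval L h (snd4 f) x1 x2) (Field.0# L)))

  Hyp : (n : Deg) → Model n → Set (lsuc (c ⊔ ℓ))
  Hyp two   f = ⊤
  Hyp three f = Lift (lsuc (c ⊔ ℓ)) (¬ (f (# 2) ≈ 0#))   -- f(0,0,1) = c ≠ 0
  Hyp four  f = NoMeet f

  infixl 6 _⊕_ _⊖_
  infixl 7 _⊗_ _·_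
  data NC (g : ℕ) : Set c where
    con : Carrier → NC g
    gen : Fin g → NC g
    _⊕_ : NC g → NC g → NC g
    _⊗_ : NC g → NC g → NC g

  _·_ : ∀ {g} → Carrier → NC g → NC g
  a · x = con a ⊗ x

  _⊖_ : ∀ {g} → NC g → NC g → NC g
  x ⊖ y = x ⊕ (- 1#) · y

  ⟦_,_⟧ : ∀ {g} → NC g → NC g → NC g
  ⟦ u , v ⟧ = u ⊗ v ⊖ v ⊗ u

  -- equality in K⟨gen⟩ / (two-sided ideal generated by R i, i : Fin k):
  -- the least congruence containing the K-algebra axioms and R i = 0
  infix 4 Eqv
  data Eqv {g k : ℕ} (R : Fin k → NC g) : NC g → NC g → Set (c ⊔ ℓ) where
    refl′  : ∀ {x} → Eqv R x x
    sym′   : ∀ {x y} → Eqv R x y → Eqv R y x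
    trans′ : ∀ {x y z} → Eqv R x y → Eqv R y z → Eqv R x z
    ⊕-cong : ∀ {x x′ y y′} → Eqv R x x′ → Eqv R y y′ → Eqv R (x ⊕ y) (x′ ⊕ y′)
    ⊗-cong : ∀ {x x′ y y′} → Eqv R x x′ → Eqv R y y′ → Eqv R (x ⊗ y) (x′ ⊗ y′)
    ⊕-assoc : ∀ x y z → Eqv R ((x ⊕ y) ⊕ z) (x ⊕ (y ⊕ z))
    ⊕-comm  : ∀ x y → Eqv R (x ⊕ y) (y ⊕ x)
    ⊕-idˡ   : ∀ x → Eqv R (con 0# ⊕ x) x
    ⊕-invˡ  : ∀ x → Eqv R ((- 1#) · x ⊕ x) (con 0#)
    ⊗-assoc : ∀ x y z → Eqv R ((x ⊗ y) ⊗ z) (x ⊗ (y ⊗ z))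
    ⊗-idˡ   : ∀ x → Eqv R (con 1# ⊗ x) x
    ⊗-idʳ   : ∀ x → Eqv R (x ⊗ con 1#) x
    ⊗-distribˡ : ∀ x y z → Eqv R (x ⊗ (y ⊕ z)) (x ⊗ y ⊕ x ⊗ z)
    ⊗-distribʳ : ∀ x y z → Eqv R ((y ⊕ z) ⊗ x) (y ⊗ x ⊕ z ⊗ x)
    con-cong : ∀ {a b} → a ≈ b → Eqv R (con a) (con b)
    con-+    : ∀ a b → Eqv R (con (a + b)) (con a ⊕ con b)
    con-*    : ∀ a b → Eqv R (con (a * b)) (con a ⊗ con b)
    central  : ∀ a x → Eqv R (con a ⊗ x) (x ⊗ con a)
    rel      : ∀ i → Eqv R (R i) (con 0#)

  record AlgHom {g k g′ k′} (R : Fin k → NC g) (S : Fin k′ → NC g′) : Set (c ⊔ ℓ) where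
    field
      fun     : NC g → NC g′
      fun-cong : ∀ {x y} → Eqv R x y → Eqv S (fun x) (fun y)
      ⊕-hom   : ∀ x y → Eqv S (fun (x ⊕ y)) (fun x ⊕ fun y)
      ⊗-hom   : ∀ x y → Eqv S (fun (x ⊗ y)) (fun x ⊗ fun y)
      con-hom : ∀ a → Eqv S (fun (con a)) (con a)

  record AlgIso {g k g′ k′} (R : Fin k → NC g) (S : Fin k′ → NC g′) : Set (c ⊔ ℓ) where
    field
      to   : AlgHom R S
      from : AlgHom S R
      from∘to : ∀ x → Eqv R (AlgHom.fun from (AlgHom.fun to x)) x
      to∘from : ∀ y → Eqv S (AlgHom.fun to (AlgHom.fun from y)) y
    ψ : NC g → NC g′
    ψ = AlgHom.fun to

  extDer : ∀ {g} → (Fin g → NC g) → NC g → NC g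
  extDer d (con a) = con 0#
  extDer d (gen i) = d i
  extDer d (x ⊕ y) = extDer d x ⊕ extDer d y
  extDer d (x ⊗ y) = extDer d x ⊗ y ⊕ x ⊗ extDer d y

  ngen : Deg → ℕ
  ngen two   = 3
  ngen three = 2
  ngen four  = 4

  nrel : Deg → ℕ
  nrel two   = 5
  nrel three = 4
  nrel four  = 9

  at : (Fin 10 → Carrier) → ℕ → Carrier
  at g 1  = g (# 0)
  at g 2  = g (# 1)
  at g 3  = g (# 2)
  at g 4  = g (# 3)
  at g 5  = g (# 4)
  at g 6  = g (# 5)
  at g 7  = g (# 6)
  at g 8  = g (# 7)
  at g 9  = g (# 8)
  at g 10 = g (# 9)
  at g _  = 0#

  module Two (f : Model two) where
    a b c′ d e : Carrier
    a = f (# 0) ; b = f (# 1) ; c′ = f (# 2) ; d = f (# 3) ; e = f (# 4)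
    r s t : NC 3
    r = gen (# 0) ; s = gen (# 1) ; t = gen (# 2)
    rels : Fin 5 → NC 3
    rels = lookup ((r ⊗ r ⊖ con a) ∷ (r ⊗ s ⊕ s ⊗ r ⊖ con b) ∷ (r ⊗ t ⊕ t ⊗ r ⊕ s ⊗ s ⊖ con c′)
                   ∷ (s ⊗ t ⊕ t ⊗ s ⊖ con d) ∷ (t ⊗ t ⊖ con e) ∷ [])
    ξ η : NC 3
    ξ = s ⊗ s ⊖ con c′
    η = r ⊗ s ⊗ t ⊖ t ⊗ s ⊗ r
    Dgen : Fin 3 → NC 3
    Dgen = lookup (⟦ s , r ⟧ ∷ ⟦ t , r ⟧ ∷ con 0# ∷ [])

  module Three (f : Model three) where
    a b c′ a2 a3 b1 b3 c1 c2 m : Carrier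
    a = f (# 0) ; b = f (# 1) ; c′ = f (# 2) ; a2 = f (# 3) ; a3 = f (# 4)
    b1 = f (# 5) ; b3 = f (# 6) ; c1 = f (# 7) ; c2 = f (# 8) ; m = f (# 9)
    x y : NC 2
    x = gen (# 0) ; y = gen (# 1)
    rels : Fin 4 → NC 2
    rels = lookup
      ((c′ · x ⊗ x ⊗ x ⊕ c1 · x ⊗ x ⊕ a3 · x ⊕ con a)
      ∷ (c′ · (x ⊗ x ⊗ y ⊕ x ⊗ y ⊗ x ⊕ y ⊗ x ⊗ x) ⊕ c1 · (x ⊗ y ⊕ y ⊗ x) ⊕ c2 · x ⊗ x
          ⊕ m · x ⊕ a3 · y ⊕ con a2)
      ∷ (c′ · (x ⊗ y ⊗ y ⊕ y ⊗ x ⊗ y ⊕ y ⊗ y ⊗ x) ⊕ c2 · (x ⊗ y ⊕ y ⊗ x) ⊕ c1 · y ⊗ y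
          ⊕ m · y ⊕ b3 · x ⊕ con b1)
      ∷ (c′ · y ⊗ y ⊗ y ⊕ c2 · y ⊗ y ⊕ b3 · y ⊕ con b)
      ∷ [])
    ξ : NC 2
    ξ = (c′ * c′) · ((x ⊗ y) ⊗ (x ⊗ y))
        ⊖ (c′ · y ⊗ y ⊕ c2 · y ⊕ con b3) ⊗ (c′ · x ⊗ x ⊕ c1 · x ⊕ con a3)
        ⊕ (c′ * m − c1 * c2) · (x ⊗ y) ⊕ con (a3 * b3)
    Dgen : Fin 2 → NC 2
    Dgen = lookup ((c′ · ⟦ x ⊗ y , x ⟧) ∷ (c′ · ⟦ y , y ⊗ x ⟧) ∷ [])
    a3′ : Carrier
    a3′ = nat 9 * a * b * c′ − (a * b3 * c2 + b * a3 * c1 + c′ * a2 * b1)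
          − (a2 * b3 * c1 + a3 * b1 * c2)
    η : NC 2
    η = half · (extDer Dgen ξ ⊖ m · ξ ⊖ con a3′)

  module Four (f : Model four) where
    f1 f2 : Fin 10 → Carrier
    f1 = fst4 f ; f2 = snd4 f
    p q r s : NC 4
    p = gen (# 0) ; q = gen (# 1) ; r = gen (# 2) ; s = gen (# 3)
    relA relB relC : (Fin 10 → Carrier) → NC 4
    relA g = at g 1 · p ⊗ p ⊕ at g 2 · p ⊗ q ⊕ at g 5 · q ⊗ q ⊕ at g 3 · p ⊕ at g 6 · q ⊕ con (at g 8)
    relB g = at g 1 · (p ⊗ r ⊕ r ⊗ p) ⊕ at g 2 · (p ⊗ s ⊕ r ⊗ q) ⊕ at g 5 · (q ⊗ s ⊕ s ⊗ q)
             ⊕ at g 4 · p ⊕ at g 7 · q ⊕ at g 3 · r ⊕ at g 6 · s ⊕ con (at g 9)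
    relC g = at g 1 · r ⊗ r ⊕ at g 2 · r ⊗ s ⊕ at g 5 · s ⊗ s ⊕ at g 4 · r ⊕ at g 7 · s ⊕ con (at g 10)
    rels : Fin 9 → NC 4
    rels = lookup (relA f1 ∷ relB f1 ∷ relC f1 ∷ relA f2 ∷ relB f2 ∷ relC f2
                   ∷ (p ⊗ q ⊖ q ⊗ p) ∷ (p ⊗ s ⊕ r ⊗ q ⊖ q ⊗ r ⊖ s ⊗ p) ∷ (r ⊗ s ⊖ s ⊗ r) ∷ [])
    d : ℕ → ℕ → Carrier
    d i j = at f1 i * at f2 j − at f1 j * at f2 i
    P Q S R : ℕ → NC 4
    P i = d 1 i · p ⊕ d 2 i · q ⊕ con (d 3 i)
    Q i = d 2 i · p ⊕ d 5 i · q ⊕ con (d 6 i)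
    R i = d 1 i · r ⊕ d 2 i · s ⊕ con (d 4 i)
    S i = d 2 i · r ⊕ d 5 i · s ⊕ con (d 7 i)
    T : NC 4
    T = q ⊗ r ⊖ p ⊗ s
    ξ : NC 4
    ξ = (P 5 ⊗ s) ⊗ (P 5 ⊗ s) ⊕ (S 1 ⊗ p) ⊗ (S 1 ⊗ p)
        ⊕ (d 5 6 · P 4 ⊕ d 2 9 · P 5 ⊕ d 3 7 · P 5 ⊖ d 2 7 · P 6) ⊗ s
        ⊖ d 5 6 · (d 1 3 · r ⊕ d 2 3 · s ⊖ d 1 7 · q ⊕ d 1 2 · T ⊖ con (d 1 9)) ⊗ s
        ⊕ (d 1 4 · S 6 ⊕ d 2 9 · S 1 ⊖ d 3 7 · S 1 ⊖ d 2 3 · S 4) ⊗ p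
        ⊖ d 1 4 · (d 2 7 · p ⊕ d 5 7 · q ⊕ d 3 5 · r ⊖ d 2 5 · T ⊖ con (d 5 9)) ⊗ p
    ε : NC 4
    ε = d 1 2 · (p ⊗ r ⊕ r ⊗ p) ⊕ d 1 5 · (p ⊗ s ⊕ q ⊗ r ⊕ s ⊗ p ⊕ r ⊗ q) ⊕ d 2 5 · (q ⊗ s ⊕ s ⊗ q)
    Dgen : Fin 4 → NC 4
    Dgen = lookup ((half · ⟦ p , ε ⟧) ∷ (half · ⟦ q , ε ⟧) ∷ con 0# ∷ con 0# ∷ [])
    η : NC 4
    η = half · extDer Dgen ξ

  relsA : (n : Deg) → Model n → Fin (nrel n) → NC (ngen n)
  relsA two   f = Two.rels f
  relsA three f = Three.rels f
  relsA four  f = Four.rels f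

  ξA ηA : (n : Deg) → Model n → NC (ngen n)
  ξA two   f = Two.ξ f
  ξA three f = Three.ξ f
  ξA four  f = Four.ξ f
  ηA two   f = Two.η f
  ηA three f = Three.η f
  ηA four  f = Four.η f

  DA : (n : Deg) → Model n → NC (ngen n) → NC (ngen n)
  DA two   f = extDer (Two.Dgen f)
  DA three f = extDer (Three.Dgen f)
  DA four  f = extDer (Four.Dgen f)

  SigmaTauZero : Deg → Carrier → Carrier → Set ℓ
  SigmaTauZero three σ τ = ⊤ {ℓ}
  SigmaTauZero _     σ τ = (σ ≈ 0#) × (τ ≈ 0#)

{-# OPTIONS --safe #-}
module Submission where

-- The group is generated by elementary substitutions, and A_f is compared along
-- each of them: the relation "there is an isomorphism ψ : A_{f′} → A_f with
-- ψ(ξ′) = δ²ξ + ρ and ψ D′ = δ D ψ + [κ, ψ −]" is transitive, with multiplicative δ,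
-- and for an elementary substitution all identities reduce to a finite
-- computation in a free algebra.  For n = 3, 4 only the substitutions that
-- respect the point (0:0:1), respectively the line {x₃ = x₄ = 0}, give such
-- isomorphisms directly; a swap that moves it is available if the new point or
-- line misses the curve as well, its image being a rational substitution in
-- A_f.  A general matrix is reached through frames: vectors are exchanged one at
-- a time, through an auxiliary vector chosen generically.  The clause on η
-- follows from the one on D, as D is well defined and ξ is central (for n = 2
-- it is carried along).

-- The relations of A_f say that a generic point lies on the model, with α, β central: (rα² + sαβ +
-- tβ²)² = f(α, β) for n = 2; f(α, β, αx + βy) = 0 for n = 3; fᵢ(αp + βr, αq + βs, α, β) = 0 for n =
-- 4, where the two linear forms commute. The images of generators under a substitution are read off
-- from this point. Exchanging α with αx + βy, or with αq + βs, needs an inverse of x, or of q. It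
-- exists if the new point or line misses the curve: x satisfies a cubic, and q (after
-- normalisation) a quartic, with invertible constant term. Equality in K need not be decidable,
-- while the isomorphism is data. So vectors are not chosen by cases: candidates are combined with
-- the idempotents x x⁻¹, and cases occur only in proofs of negated statements. That a polynomial of
-- degree at most 4 in τ does not vanish at all of τ = 0, ..., 4 is shown by finite differences or
-- interpolation; this is where 6 and 24 must be nonzero. The large identities are verified over
-- syntax trees, by a normalisation that the type checker runs, and then evaluated in K.

open import Defs
open import Level using (Level; _⊔_; Lift; lift)
open import Agda.Builtin.String using (String)
open import Algebra.Bundles using (Ring)
import Algebra.Properties.Ring as RingProps
open import Data.Bool.Base using (Bool; true; false; _∧_; T; if_then_else_)
open import Data.Fin using (#_; splitAt; _↑ˡ_; _↑ʳ_)
open import Data.Fin.Base using (Fin; zero; suc; toℕ)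
open import Data.List.Base as List using (List; []; _∷_; length; foldr; tabulate) renaming (map to mapL; _++_ to _++ᴸ_)
open import Data.Nat.Base as ℕ using (ℕ; zero; suc; _≡ᵇ_; _<ᵇ_)
open import Data.Product.Base using (Σ; _×_; _,_; proj₁; proj₂)
open import Data.Sum.Base using (inj₁; inj₂; [_,_]′)
open import Data.Unit.Base using (⊤; tt)
open import Data.Vec.Base using (Vec; lookup; []; _∷_)
open import Function.Base using (_∘_; _$_)
open import Relation.Binary.PropositionalEquality.Core as ≡ using (_≡_; refl)
open import Relation.Nullary using (¬_)

-- Normal forms of scalar expressions

module ScalarSolver where
  open import Level using () renaming (zero to 0ℓ)
  open import Algebra.Bundles using (CommutativeRing; RawRing)
  import Algebra.Morphism.RingMonomorphism as Mono
  open import Algebra.Morphism.Structures using (IsRingMonomorphism)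
  open import Data.Bool.Base using (_xor_)
  open import Data.Bool.Properties using (xor-∧-commutativeRing; ¬-not; ∧-idem)
  open import Data.Nat.Properties using (≡ᵇ⇒≡)
  open import Function.Base using (id)

  data SE : Set where
    var       : ℕ → SE
    𝟘 𝟙       : SE
    _:+_ _:*_ : SE → SE → SE
    :-_ inv   : SE → SE

  infixl 6 _:+_
  infixl 7 _:*_

  -- A field structure on syntax trees needs an equality for which the axioms hold. The value in 𝔽₂
  -- provides one: inversion is the identity there, and the laws are pulled back from 𝔽₂.
  parity : SE → Bool
  parity (var _)  = false
  parity 𝟘        = false
  parity 𝟙        = true
  parity (x :+ y) = parity x xor parity y
  parity (x :* y) = parity x ∧ parity y
  parity (:- x)   = parity x
  parity (inv x)  = parity x

  private
    module 𝔽₂ = CommutativeRing xor-∧-commutativeRing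

  seRaw : RawRing 0ℓ 0ℓ
  seRaw = record
    { Carrier = SE ; _≈_ = λ x y → parity x ≡ parity y
    ; _+_ = _:+_ ; _*_ = _:*_ ; -_ = :-_ ; 0# = 𝟘 ; 1# = 𝟙 }

  seCommutativeRing : CommutativeRing 0ℓ 0ℓ
  seCommutativeRing = record
    { Carrier = SE ; _≈_ = λ x y → parity x ≡ parity y
    ; _+_ = _:+_ ; _*_ = _:*_ ; -_ = :-_ ; 0# = 𝟘 ; 1# = 𝟙
    ; isCommutativeRing = Mono.isCommutativeRing {R₁ = seRaw} {R₂ = 𝔽₂.rawRing} {⟦_⟧ = parity} parityMono 𝔽₂.isCommutativeRing }
    where
    parityMono : IsRingMonomorphism seRaw 𝔽₂.rawRing parity
    parityMono = record
      { isRingHomomorphism = record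
        { isSemiringHomomorphism = record
          { isNearSemiringHomomorphism = record
            { +-isMonoidHomomorphism = record
              { isMagmaHomomorphism = record
                { isRelHomomorphism = record { cong = id } ; homo = λ _ _ → refl }
              ; ε-homo = refl }
            ; *-homo = λ _ _ → refl }
          ; 1#-homo = refl }
        ; -‿homo = λ _ → refl }
      ; injective = id }

  -- Instantiating the definitions of Defs at this field turns its formulas into
  -- syntax trees, whose values in a field F are definitionally the formulas over F.
  -- The equality of the field (equality modulo 2) plays no role.
  𝕊 : Field 0ℓ 0ℓ
  𝕊 = record
    { commutativeRing = seCommutativeRing ; _⁻¹ = inv ; 0≉1 = λ ()
    ; inverse = λ x x≉0 → ≡.trans (∧-idem (parity x)) (¬-not x≉0) }

  -- Integer coefficients are differences of two naturals.  The letters of a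
  -- monomial are sorted; letter 0 stands for 1/2, and the letters 1 and 2 are
  -- inverse to each other.
  Mon : Set
  Mon = List ℕ

  CP : Set
  CP = List ((ℕ × ℕ) × Mon)

  -- Merging is sound in whatever order the terms come out; so evidence is carried only by equality,
  -- where two terms are combined.
  data Cmp (u v : List ℕ) : Set where
    lt gt : Cmp u v
    eq    : u ≡ v → Cmp u v

  cmp : ∀ u v → Cmp u v
  cmp []      []      = eq refl
  cmp []      (_ ∷ _) = lt
  cmp (_ ∷ _) []      = gt
  cmp (x ∷ u) (y ∷ v) with x ≡ᵇ y in e
  ... | false = if x <ᵇ y then lt else gt
  ... | true with cmp u v
  ...   | lt   = lt
  ...   | gt   = gt
  ...   | eq p = eq (≡.cong₂ _∷_ (≡ᵇ⇒≡ x y (≡.subst T (≡.sym e) tt)) p)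

  -- Merging of sorted lists. `addCP₁` keeps the head of the first list apart, so that every call
  -- shortens one of the two lists.
  addCP : CP → CP → CP
  addCP₁ : (ℕ × ℕ) × Mon → CP → CP → CP
  addCP []      bs = bs
  addCP (a ∷ as) bs = addCP₁ a as bs
  addCP₁ a as [] = a ∷ as
  addCP₁ a as (b ∷ bs) with cmp (proj₂ a) (proj₂ b)
  ... | lt   = a ∷ addCP as (b ∷ bs)
  ... | gt   = b ∷ addCP₁ a as bs
  ... | eq _ with (proj₁ (proj₁ a) ℕ.+ proj₁ (proj₁ b)) ≡ᵇ (proj₂ (proj₁ a) ℕ.+ proj₂ (proj₁ b))
  ...   | true  = addCP as bs
  ...   | false = ((proj₁ (proj₁ a) ℕ.+ proj₁ (proj₁ b) , proj₂ (proj₁ a) ℕ.+ proj₂ (proj₁ b)) , proj₂ a) ∷ addCP as bs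

  mergePairs : ∀ {A : Set} → (A → A → A) → List A → List A
  mergePairs _∙_ (a ∷ b ∷ l) = (a ∙ b) ∷ mergePairs _∙_ l
  mergePairs _∙_ l           = l

  -- Merging pairwise in rounds keeps long sums balanced. The number bounds the rounds, and the
  -- length of the list is always enough.
  mergeAll : ∀ {A : Set} → (A → A → A) → A → ℕ → List A → A
  mergeAll _∙_ ε n       []      = ε
  mergeAll _∙_ ε n       (a ∷ []) = a
  mergeAll _∙_ ε zero    l       = foldr _∙_ ε l
  mergeAll _∙_ ε (suc n) l       = mergeAll _∙_ ε n (mergePairs _∙_ l)

  sumCP : List CP → CP
  sumCP l = mergeAll addCP [] (length l) l

  -- Since letters are sorted, a new letter 1 meets a letter 2, or conversely, exactly where it
  -- would be inserted. Cancelling there keeps the two from occurring together.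
  insM : ℕ → Mon → Mon
  insM x []       = x ∷ []
  insM 1 (2 ∷ m)  = m
  insM 2 (1 ∷ m)  = m
  insM x (y ∷ m)  = if y <ᵇ x then y ∷ insM x m else x ∷ y ∷ m

  mulM : Mon → Mon → Mon
  mulM u v = foldr insM v u

  mulT : (ℕ × ℕ) × Mon → (ℕ × ℕ) × Mon → (ℕ × ℕ) × Mon
  mulT ((p , n) , u) ((p′ , n′) , v) = (p ℕ.* p′ ℕ.+ n ℕ.* n′ , p ℕ.* n′ ℕ.+ n ℕ.* p′) , mulM u v

  mulTC : (ℕ × ℕ) × Mon → CP → List CP
  mulTC a = mapL (λ b → mulT a b ∷ [])

  mulCP : CP → CP → CP
  mulCP []       bs = []
  mulCP (a ∷ []) bs = sumCP (mulTC a bs)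
  mulCP (a ∷ as) bs = addCP (sumCP (mulTC a bs)) (mulCP as bs)

  negCP : CP → CP
  negCP = mapL (λ { ((p , n) , u) → (n , p) , u })

  oneCP : CP
  oneCP = ((1 , 0) , []) ∷ []

  -- Every inverse becomes letter 0, which is ½ because `okS` admits no other inverse. That letter
  -- is not cancelled against 2, so an identity that contains ½ must hold with ½ as an
  -- indeterminate.
  nS : SE → CP
  nS (var k)  = ((1 , 0) , suc k ∷ []) ∷ []
  nS 𝟘        = []
  nS 𝟙        = oneCP
  nS (x :+ y) = addCP (nS x) (nS y)
  nS (x :* y) = mulCP (nS x) (nS y)
  nS (:- x)   = negCP (nS x)
  nS (inv _)  = ((1 , 0) , 0 ∷ []) ∷ []

  isHalf : SE → Bool
  isHalf (𝟙 :+ 𝟙) = true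
  isHalf _        = false

  okS : SE → Bool
  okS (var k)  = true
  okS 𝟘        = true
  okS 𝟙        = true
  okS (x :+ y) = okS x ∧ okS y
  okS (x :* y) = okS x ∧ okS y
  okS (:- x)   = okS x
  okS (inv x)  = isHalf x

  module _ {c ℓ : Level} (F : Field c ℓ) where
    open Field F using (Carrier)

    evS : (ℕ → Carrier) → SE → Carrier
    evS ρ (var k)  = ρ k
    evS ρ 𝟘        = Field.0# F
    evS ρ 𝟙        = Field.1# F
    evS ρ (x :+ y) = Field._+_ F (evS ρ x) (evS ρ y)
    evS ρ (x :* y) = Field._*_ F (evS ρ x) (evS ρ y)
    evS ρ (:- x)   = Field.-_ F (evS ρ x)
    evS ρ (inv x)  = Field._⁻¹ F (evS ρ x)

  zeroCP : CP → Bool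
  zeroCP []      = true
  zeroCP (_ ∷ _) = false

  checkS : SE → SE → Bool
  checkS x y = okS x ∧ okS y ∧ zeroCP (addCP (nS x) (negCP (nS y)))

  T-∧ : ∀ {x y} → T (x ∧ y) → T x × T y
  T-∧ {true} {true} _ = tt , tt

  module CommSound {c ℓ : Level} (F : Field c ℓ) (ρ : ℕ → Field.Carrier F)
    (inv01 : Field._≈_ F (Field._*_ F (ρ 0) (ρ 1)) (Field.1# F)) where

    open Field F renaming (zero to zeroAnn)
    private module R = RingProps ring
    open import Relation.Binary.Reasoning.Setoid setoid
    open import Algebra.Properties.CommutativeSemigroup *-commutativeSemigroup using () renaming (interchange to *-interchange; x∙yz≈y∙xz to *-left)
    open import Algebra.Properties.CommutativeSemigroup +-commutativeSemigroup using () renaming (interchange to +-interchange)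

    letter : ℕ → Carrier
    letter zero    = half F
    letter (suc k) = ρ k

    ⟦_⟧m : Mon → Carrier
    ⟦ [] ⟧m    = 1#
    ⟦ x ∷ m ⟧m = letter x * ⟦ m ⟧m

    ⟦_⟧z : ℕ × ℕ → Carrier
    ⟦ p , n ⟧z = nat F p - nat F n

    ⟦_⟧t : (ℕ × ℕ) × Mon → Carrier
    ⟦ z , m ⟧t = ⟦ z ⟧z * ⟦ m ⟧m

    ⟦_⟧ : CP → Carrier
    ⟦ [] ⟧     = 0#
    ⟦ t ∷ ts ⟧ = ⟦ t ⟧t + ⟦ ts ⟧

    nat-+ : ∀ m n → nat F (m ℕ.+ n) ≈ nat F m + nat F n
    nat-+ zero    n = sym (+-identityˡ _)
    nat-+ (suc m) n = trans (+-congˡ (nat-+ m n)) (sym (+-assoc _ _ _))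

    nat-* : ∀ m n → nat F (m ℕ.* n) ≈ nat F m * nat F n
    nat-* zero    n = sym (zeroˡ _)
    nat-* (suc m) n = begin
      nat F (n ℕ.+ m ℕ.* n)                ≈⟨ nat-+ n (m ℕ.* n) ⟩
      nat F n + nat F (m ℕ.* n)            ≈⟨ +-cong (sym (*-identityˡ _)) (nat-* m n) ⟩
      1# * nat F n + nat F m * nat F n     ≈⟨ distribʳ _ _ _ ⟨
      (1# + nat F m) * nat F n             ∎

    -distrib : ∀ x y → - (x + y) ≈ - x + - y
    -distrib x y = trans (R.-‿anti-homo-+ x y) (+-comm _ _)

    z-+ : ∀ a b → ⟦ proj₁ a ℕ.+ proj₁ b , proj₂ a ℕ.+ proj₂ b ⟧z ≈ ⟦ a ⟧z + ⟦ b ⟧z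
    z-+ (p , n) (p′ , n′) = begin
      nat F (p ℕ.+ p′) - nat F (n ℕ.+ n′)                  ≈⟨ +-cong (nat-+ p p′) (-‿cong (nat-+ n n′)) ⟩
      (nat F p + nat F p′) - (nat F n + nat F n′)          ≈⟨ +-congˡ (-distrib _ _) ⟩
      (nat F p + nat F p′) + (- nat F n + - nat F n′)      ≈⟨ +-interchange _ _ _ _ ⟩
      (nat F p - nat F n) + (nat F p′ - nat F n′)          ∎

    z-neg : ∀ p n → ⟦ n , p ⟧z ≈ - ⟦ p , n ⟧z
    z-neg p n = sym (trans (-distrib _ _) (trans (+-congˡ (R.-‿involutive _)) (+-comm _ _)))

    z-* : ∀ p n p′ n′ → ⟦ p ℕ.* p′ ℕ.+ n ℕ.* n′ , p ℕ.* n′ ℕ.+ n ℕ.* p′ ⟧z ≈ ⟦ p , n ⟧z * ⟦ p′ , n′ ⟧z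
    z-* p n p′ n′ = begin
      nat F (p ℕ.* p′ ℕ.+ n ℕ.* n′) - nat F (p ℕ.* n′ ℕ.+ n ℕ.* p′)
        ≈⟨ z-+ (p ℕ.* p′ , p ℕ.* n′) (n ℕ.* n′ , n ℕ.* p′) ⟩
      (nat F (p ℕ.* p′) - nat F (p ℕ.* n′)) + (nat F (n ℕ.* n′) - nat F (n ℕ.* p′))
        ≈⟨ +-cong (+-cong (nat-* p p′) (-‿cong (nat-* p n′))) (+-cong (nat-* n n′) (-‿cong (nat-* n p′))) ⟩
      (a * a′ - a * b′) + (b * b′ - b * a′)
        ≈⟨ +-cong (+-congˡ (R.-‿distribʳ-* a b′)) (trans (+-comm _ _) (+-cong (R.-‿distribˡ-* b a′)
             (sym (trans (sym (R.-‿distribʳ-* (- b) b′)) (trans (-‿cong (sym (R.-‿distribˡ-* b b′))) (R.-‿involutive _)))))) ⟩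
      (a * a′ + a * (- b′)) + ((- b) * a′ + (- b) * (- b′))
        ≈⟨ +-cong (distribˡ _ _ _) (distribˡ _ _ _) ⟨
      a * (a′ - b′) + (- b) * (a′ - b′)
        ≈⟨ distribʳ _ _ _ ⟨
      (a - b) * (a′ - b′) ∎
      where a = nat F p
            b = nat F n
            a′ = nat F p′
            b′ = nat F n′

    add-sound  : ∀ as bs → ⟦ addCP as bs ⟧ ≈ ⟦ as ⟧ + ⟦ bs ⟧
    add₁-sound : ∀ a as bs → ⟦ addCP₁ a as bs ⟧ ≈ (⟦ a ⟧t + ⟦ as ⟧) + ⟦ bs ⟧
    add-sound [] bs       = sym (+-identityˡ _)
    add-sound (a ∷ as) bs = add₁-sound a as bs
    add₁-sound a as []    = sym (+-identityʳ _)
    add₁-sound a@((p , n) , u) as bs@(b@((p′ , n′) , v) ∷ bs′) with cmp u v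
    ... | lt   = trans (+-congˡ (add-sound as bs)) (sym (+-assoc _ _ _))
    ... | gt   = begin
      ⟦ b ⟧t + ⟦ addCP₁ a as bs′ ⟧            ≈⟨ +-congˡ (add₁-sound a as bs′) ⟩
      ⟦ b ⟧t + ((⟦ a ⟧t + ⟦ as ⟧) + ⟦ bs′ ⟧)  ≈⟨ +-assoc _ _ _ ⟨
      (⟦ b ⟧t + (⟦ a ⟧t + ⟦ as ⟧)) + ⟦ bs′ ⟧  ≈⟨ +-congʳ (+-comm _ _) ⟩
      ((⟦ a ⟧t + ⟦ as ⟧) + ⟦ b ⟧t) + ⟦ bs′ ⟧  ≈⟨ +-assoc _ _ _ ⟩
      (⟦ a ⟧t + ⟦ as ⟧) + (⟦ b ⟧t + ⟦ bs′ ⟧)  ∎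
    ... | eq refl with (p ℕ.+ p′) ≡ᵇ (n ℕ.+ n′) in e
    ...   | false = begin
      ⟦ p ℕ.+ p′ , n ℕ.+ n′ ⟧z * ⟦ u ⟧m + ⟦ addCP as bs′ ⟧
        ≈⟨ +-cong (trans (*-congʳ (z-+ (p , n) (p′ , n′))) (distribʳ _ _ _)) (add-sound as bs′) ⟩
      (⟦ a ⟧t + ⟦ b ⟧t) + (⟦ as ⟧ + ⟦ bs′ ⟧)  ≈⟨ +-interchange _ _ _ _ ⟩
      (⟦ a ⟧t + ⟦ as ⟧) + (⟦ b ⟧t + ⟦ bs′ ⟧)  ∎
    ...   | true = begin
      ⟦ addCP as bs′ ⟧                        ≈⟨ add-sound as bs′ ⟩
      ⟦ as ⟧ + ⟦ bs′ ⟧                        ≈⟨ +-identityˡ _ ⟨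
      0# + (⟦ as ⟧ + ⟦ bs′ ⟧)                 ≈⟨ +-congʳ zero-sum ⟨
      (⟦ a ⟧t + ⟦ b ⟧t) + (⟦ as ⟧ + ⟦ bs′ ⟧)  ≈⟨ +-interchange _ _ _ _ ⟩
      (⟦ a ⟧t + ⟦ as ⟧) + (⟦ b ⟧t + ⟦ bs′ ⟧)  ∎
      where
      zero-sum : ⟦ a ⟧t + ⟦ b ⟧t ≈ 0#
      zero-sum = begin
        ⟦ a ⟧t + ⟦ b ⟧t                        ≈⟨ trans (*-congʳ (z-+ (p , n) (p′ , n′))) (distribʳ _ _ _) ⟨
        ⟦ p ℕ.+ p′ , n ℕ.+ n′ ⟧z * ⟦ u ⟧m
          ≡⟨ ≡.cong (λ k → (nat F k - nat F (n ℕ.+ n′)) * ⟦ u ⟧m) (≡ᵇ⇒≡ (p ℕ.+ p′) _ (≡.subst T (≡.sym e) tt)) ⟩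
        ⟦ n ℕ.+ n′ , n ℕ.+ n′ ⟧z * ⟦ u ⟧m      ≈⟨ *-congʳ (-‿inverseʳ _) ⟩
        0# * ⟦ u ⟧m                            ≈⟨ zeroˡ _ ⟩
        0#                                     ∎

    total : List CP → Carrier
    total []      = 0#
    total (a ∷ l) = ⟦ a ⟧ + total l

    foldr-sound : ∀ l → ⟦ foldr addCP [] l ⟧ ≈ total l
    foldr-sound []      = Field.refl F
    foldr-sound (a ∷ l) = trans (add-sound a (foldr addCP [] l)) (+-congˡ (foldr-sound l))

    pairs-sound : ∀ l → total (mergePairs addCP l) ≈ total l
    pairs-sound []          = Field.refl F
    pairs-sound (a ∷ [])    = Field.refl F
    pairs-sound (a ∷ b ∷ l) = trans (+-cong (add-sound a b) (pairs-sound l)) (+-assoc _ _ _)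

    all-sound : ∀ n l → ⟦ mergeAll addCP [] n l ⟧ ≈ total l
    all-sound n       []          = Field.refl F
    all-sound n       (a ∷ [])    = sym (+-identityʳ _)
    all-sound zero    (a ∷ b ∷ l) = foldr-sound (a ∷ b ∷ l)
    all-sound (suc n) (a ∷ b ∷ l) = trans (all-sound n (mergePairs addCP (a ∷ b ∷ l))) (pairs-sound (a ∷ b ∷ l))

    ins-sound : ∀ x m → ⟦ insM x m ⟧m ≈ letter x * ⟦ m ⟧m
    ins-sound 0 []      = Field.refl F
    ins-sound 1 []      = Field.refl F
    ins-sound 2 []      = Field.refl F
    ins-sound (suc (suc (suc x))) [] = Field.refl F
    ins-sound 0 (y ∷ m) = Field.refl F
    ins-sound 1 (0 ∷ m) = trans (*-congˡ (ins-sound 1 m)) (*-left _ _ _)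
    ins-sound 1 (1 ∷ m) = Field.refl F
    ins-sound 1 (2 ∷ m) = sym (trans (sym (*-assoc _ _ _)) (trans (*-congʳ inv01) (*-identityˡ _)))
    ins-sound 1 (suc (suc (suc y)) ∷ m) = Field.refl F
    ins-sound 2 (0 ∷ m) = trans (*-congˡ (ins-sound 2 m)) (*-left _ _ _)
    ins-sound 2 (1 ∷ m) = sym (trans (sym (*-assoc _ _ _)) (trans (*-congʳ (trans (*-comm _ _) inv01)) (*-identityˡ _)))
    ins-sound 2 (2 ∷ m) = Field.refl F
    ins-sound 2 (suc (suc (suc y)) ∷ m) = Field.refl F
    ins-sound (suc (suc (suc x))) (y ∷ m) with y <ᵇ suc (suc (suc x))
    ... | true  = trans (*-congˡ (ins-sound (suc (suc (suc x))) m)) (*-left _ _ _)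
    ... | false = Field.refl F

    mulM-sound : ∀ u v → ⟦ mulM u v ⟧m ≈ ⟦ u ⟧m * ⟦ v ⟧m
    mulM-sound []      v = sym (*-identityˡ _)
    mulM-sound (x ∷ u) v = trans (ins-sound x (mulM u v)) (trans (*-congˡ (mulM-sound u v)) (sym (*-assoc _ _ _)))

    mulT-sound : ∀ a b → ⟦ mulT a b ⟧t ≈ ⟦ a ⟧t * ⟦ b ⟧t
    mulT-sound ((p , n) , u) ((p′ , n′) , v) =
      trans (*-cong (z-* p n p′ n′) (mulM-sound u v)) (*-interchange _ _ _ _)

    mulTC-sound : ∀ a bs → total (mulTC a bs) ≈ ⟦ a ⟧t * ⟦ bs ⟧
    mulTC-sound a []       = sym (zeroʳ _)
    mulTC-sound a (b ∷ bs) =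
      trans (+-cong (trans (+-identityʳ _) (mulT-sound a b)) (mulTC-sound a bs)) (sym (distribˡ _ _ _))

    mul₁-sound : ∀ a bs → ⟦ sumCP (mulTC a bs) ⟧ ≈ ⟦ a ⟧t * ⟦ bs ⟧
    mul₁-sound a bs = trans (all-sound (length (mulTC a bs)) (mulTC a bs)) (mulTC-sound a bs)

    mul-sound : ∀ as bs → ⟦ mulCP as bs ⟧ ≈ ⟦ as ⟧ * ⟦ bs ⟧
    mul-sound []            bs = sym (zeroˡ _)
    mul-sound (a ∷ [])      bs = trans (mul₁-sound a bs) (*-congʳ (sym (+-identityʳ _)))
    mul-sound (a ∷ a′ ∷ as) bs = trans (add-sound (sumCP (mulTC a bs)) (mulCP (a′ ∷ as) bs))
      (trans (+-cong (mul₁-sound a bs) (mul-sound (a′ ∷ as) bs)) (sym (distribʳ _ _ _)))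

    neg-sound : ∀ as → ⟦ negCP as ⟧ ≈ - ⟦ as ⟧
    neg-sound []                   = sym R.-0#≈0#
    neg-sound (((p , n) , u) ∷ as) =
      trans (+-cong (trans (*-congʳ (z-neg p n)) (sym (R.-‿distribˡ-* _ _))) (neg-sound as)) (sym (-distrib _ _))

    ⟦1,0⟧ : ⟦ 1 , 0 ⟧z ≈ 1#
    ⟦1,0⟧ = trans (+-cong (+-identityʳ _) R.-0#≈0#) (+-identityʳ _)

    ⟦letter⟧ : ∀ x → ⟦ ((1 , 0) , x ∷ []) ∷ [] ⟧ ≈ letter x
    ⟦letter⟧ x = trans (+-identityʳ _) (trans (*-cong ⟦1,0⟧ (*-identityʳ _)) (*-identityˡ _))

    ⟦one⟧ : ⟦ oneCP ⟧ ≈ 1#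
    ⟦one⟧ = trans (+-identityʳ _) (trans (*-identityʳ _) ⟦1,0⟧)

    nS-sound : ∀ x → T (okS x) → ⟦ nS x ⟧ ≈ evS F ρ x
    nS-sound (var k)  _ = ⟦letter⟧ (suc k)
    nS-sound 𝟘        _ = Field.refl F
    nS-sound 𝟙        _ = ⟦one⟧
    nS-sound (x :+ y) h = let hx , hy = T-∧ {okS x} h in
      trans (add-sound (nS x) (nS y)) (+-cong (nS-sound x hx) (nS-sound y hy))
    nS-sound (x :* y) h = let hx , hy = T-∧ {okS x} h in
      trans (mul-sound (nS x) (nS y)) (*-cong (nS-sound x hx) (nS-sound y hy))
    nS-sound (:- x)   h = trans (neg-sound (nS x)) (-‿cong (nS-sound x h))
    nS-sound (inv (𝟙 :+ 𝟙)) _ = ⟦letter⟧ 0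

    zero-sound : ∀ p → T (zeroCP p) → ⟦ p ⟧ ≈ 0#
    zero-sound [] _ = Field.refl F

    solveS : ∀ x y → T (checkS x y) → evS F ρ x ≈ evS F ρ y
    solveS x y h =
      let hx , h′ = T-∧ {okS x} h
          hy , hz = T-∧ {okS y} h′
          e = zero-sound (addCP (nS x) (negCP (nS y))) hz
          d = trans (sym (trans (add-sound (nS x) _) (+-congˡ (neg-sound (nS y))))) e
      in trans (sym (nS-sound x hx)) (trans (R.x∙y⁻¹≈ε⇒x≈y _ _ d) (nS-sound y hy))

open ScalarSolver public

-- Normal forms in a quotient of a free algebra

module AlgebraSolver where
  open import Algebra.Bundles using (CommutativeMonoid)
  open import Data.Maybe.Base using (Maybe; just; nothing)
  open import Data.Nat.Properties using (≡ᵇ⇒≡)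

  Word : Set
  Word = List ℕ

  NCP : Set
  NCP = List (Word × CP)

  addN  : NCP → NCP → NCP
  addN₁ : Word × CP → NCP → NCP → NCP
  addN []       bs = bs
  addN (a ∷ as) bs = addN₁ a as bs
  addN₁ a as [] = a ∷ as
  addN₁ a as (b ∷ bs) with cmp (proj₁ a) (proj₁ b)
  ... | lt   = a ∷ addN as (b ∷ bs)
  ... | gt   = b ∷ addN₁ a as bs
  ... | eq _ with addCP (proj₂ a) (proj₂ b)
  ...   | []      = addN as bs
  ...   | q@(_ ∷ _) = (proj₁ a , q) ∷ addN as bs

  sumN : List NCP → NCP
  sumN l = mergeAll addN [] (length l) l

  scaleN : CP → NCP → NCP
  scaleN q = mapL (λ { (w , r) → w , mulCP q r })

  Rules : Set
  Rules = List (Word × NCP)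

  strip : Word → Word → Maybe Word
  strip []      w       = just w
  strip (x ∷ u) []      = nothing
  strip (x ∷ u) (y ∷ w) = if x ≡ᵇ y then strip u w else nothing

  match : Rules → Word → Maybe (NCP × Word)
  match []            w = nothing
  match ((u , P) ∷ R) w with strip u w
  ... | just v  = just (P , v)
  ... | nothing = match R w

  -- The first argument bounds the depth of the rewriting; when it is exhausted the
  -- product is left as it stands.
  letterW : ℕ → Rules → ℕ → Word → NCP
  letterN : ℕ → Rules → ℕ → NCP → NCP
  wordW   : ℕ → Rules → Word → Word → NCP
  wordN   : ℕ → Rules → NCP → Word → NCP
  letterW zero    R x w = (x ∷ w , oneCP) ∷ []
  letterW (suc n) R x w with match R (x ∷ w)
  ... | nothing      = (x ∷ w , oneCP) ∷ []
  ... | just (P , v) = wordN n R P v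
  letterN n R x P = sumN (mapL (λ { (w , q) → scaleN q (letterW n R x w) }) P)
  wordW n R []      w = (w , oneCP) ∷ []
  wordW n R (x ∷ u) w = letterN n R x (wordW n R u w)
  wordN n R P v = sumN (mapL (λ { (u , q) → scaleN q (wordW n R u v) }) P)

  mulN : ℕ → Rules → NCP → NCP → NCP
  mulN n R []             Q = []
  mulN n R ((u , q) ∷ P) Q = addN (scaleN q (foldr (letterN n R) Q u)) (mulN n R P Q)

  nN : ∀ {g} → ℕ → Rules → NC 𝕊 g → NCP
  nN n R (con a) with nS a
  ... | []        = []
  ... | q@(_ ∷ _) = ([] , q) ∷ []
  -- A single generator may be the left-hand side of a rule, as when a letter abbreviates an
  -- expression.
  nN n R (gen i) = letterW n R (toℕ i) []
  nN n R (x ⊕ y) = addN (nN n R x) (nN n R y)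
  nN n R (x ⊗ y) = mulN n R (nN n R x) (nN n R y)

  okN : ∀ {g} → NC 𝕊 g → Bool
  okN (con a) = okS a
  okN (gen i) = true
  okN (x ⊕ y) = okN x ∧ okN y
  okN (x ⊗ y) = okN x ∧ okN y

  zeroN : NCP → Bool
  zeroN []            = true
  zeroN ((_ , q) ∷ P) = zeroCP q ∧ zeroN P

  evN : ∀ {c ℓ} (F : Field c ℓ) {g h} → (ℕ → Field.Carrier F) → (ℕ → NC F h) → NC 𝕊 g → NC F h
  evN F ρ θ (con a) = con (evS F ρ a)
  evN F ρ θ (gen i) = θ (toℕ i)
  evN F ρ θ (x ⊕ y) = evN F ρ θ x ⊕ evN F ρ θ y
  evN F ρ θ (x ⊗ y) = evN F ρ θ x ⊗ evN F ρ θ y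

  ncRing : ∀ {c ℓ} (F : Field c ℓ) {g k} → (Fin k → NC F g) → Ring c (c ⊔ ℓ)
  ncRing F R = record
    { Carrier = NC F _ ; _≈_ = Eqv F R ; _+_ = _⊕_ ; _*_ = _⊗_
    ; -_ = λ x → con (Field.-_ F (Field.1# F)) ⊗ x ; 0# = con (Field.0# F) ; 1# = con (Field.1# F)
    ; isRing = record
      { +-isAbelianGroup = record
        { isGroup = record
          { isMonoid = record
            { isSemigroup = record
              { isMagma = record
                { isEquivalence = record { refl = refl′ ; sym = sym′ ; trans = trans′ }
                ; ∙-cong = ⊕-cong }
              ; assoc = ⊕-assoc }
            ; identity = ⊕-idˡ , λ x → trans′ (⊕-comm _ _) (⊕-idˡ x) }
          ; inverse = ⊕-invˡ , λ x → trans′ (⊕-comm _ _) (⊕-invˡ x)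
          ; ⁻¹-cong = ⊗-cong refl′ }
        ; comm = ⊕-comm }
      ; *-cong = ⊗-cong
      ; *-assoc = ⊗-assoc
      ; *-identity = ⊗-idˡ , ⊗-idʳ
      ; distrib = ⊗-distribˡ , ⊗-distribʳ } }

  module NCSound {c ℓ : Level} (F : Field c ℓ) {g k : ℕ} (S : Fin k → NC F g)
    (ρ : ℕ → Field.Carrier F) (inv01 : Field._≈_ F (Field._*_ F (ρ 0) (ρ 1)) (Field.1# F))
    (θ : ℕ → NC F g) where

    private module F = Field F
    module C = CommSound F ρ inv01
    open Ring (ncRing F S) hiding (zero)
    private module R = RingProps (ncRing F S)
    open import Relation.Binary.Reasoning.Setoid setoid
    open import Algebra.Properties.CommutativeSemigroup (CommutativeMonoid.commutativeSemigroup +-commutativeMonoid)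
      using () renaming (interchange to +-interchange)

    infix 4 _~_
    _~_ : NC F g → NC F g → Set (c ⊔ ℓ)
    _~_ = Eqv F S

    ⟦_⟧w : Word → NC F g
    ⟦ [] ⟧w    = con F.1#
    ⟦ x ∷ w ⟧w = θ x ⊗ ⟦ w ⟧w

    ⟦_⟧n : NCP → NC F g
    ⟦ [] ⟧n          = con F.0#
    ⟦ (w , q) ∷ P ⟧n = con C.⟦ q ⟧ ⊗ ⟦ w ⟧w ⊕ ⟦ P ⟧n

    single : ∀ w → ⟦ (w , oneCP) ∷ [] ⟧n ~ ⟦ w ⟧w
    single w = trans (+-identityʳ _) (trans (*-congʳ (con-cong C.⟦one⟧)) (*-identityˡ _))

    addN-sound  : ∀ as bs → ⟦ addN as bs ⟧n ~ ⟦ as ⟧n ⊕ ⟦ bs ⟧n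
    addN₁-sound : ∀ a as bs → ⟦ addN₁ a as bs ⟧n ~ ⟦ a ∷ as ⟧n ⊕ ⟦ bs ⟧n
    addN-sound [] bs       = sym (+-identityˡ _)
    addN-sound (a ∷ as) bs = addN₁-sound a as bs
    addN₁-sound a as [] = sym (+-identityʳ _)
    addN₁-sound a@(u , p) as bs@(b@(v , q) ∷ bs′) with cmp u v
    ... | lt = trans (+-congˡ (addN-sound as bs)) (sym (+-assoc _ _ _))
    ... | gt = begin
      con C.⟦ q ⟧ ⊗ ⟦ v ⟧w ⊕ ⟦ addN₁ a as bs′ ⟧n               ≈⟨ +-congˡ (addN₁-sound a as bs′) ⟩
      con C.⟦ q ⟧ ⊗ ⟦ v ⟧w ⊕ (⟦ a ∷ as ⟧n ⊕ ⟦ bs′ ⟧n)           ≈⟨ +-assoc _ _ _ ⟨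
      (con C.⟦ q ⟧ ⊗ ⟦ v ⟧w ⊕ ⟦ a ∷ as ⟧n) ⊕ ⟦ bs′ ⟧n           ≈⟨ +-congʳ (+-comm _ _) ⟩
      (⟦ a ∷ as ⟧n ⊕ con C.⟦ q ⟧ ⊗ ⟦ v ⟧w) ⊕ ⟦ bs′ ⟧n           ≈⟨ +-assoc _ _ _ ⟩
      ⟦ a ∷ as ⟧n ⊕ (con C.⟦ q ⟧ ⊗ ⟦ v ⟧w ⊕ ⟦ bs′ ⟧n)           ∎
    ... | eq refl with addCP p q | C.add-sound p q
    ...   | [] | h = begin
      ⟦ addN as bs′ ⟧n                        ≈⟨ addN-sound as bs′ ⟩
      ⟦ as ⟧n ⊕ ⟦ bs′ ⟧n                      ≈⟨ +-identityˡ _ ⟨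
      con F.0# ⊕ (⟦ as ⟧n ⊕ ⟦ bs′ ⟧n)         ≈⟨ +-congʳ (trans (*-congʳ (con-cong (F.sym h))) (zeroˡ _)) ⟨
      _                                       ≈⟨ +-congʳ (trans (*-congʳ (con-+ _ _)) (⊗-distribʳ _ _ _)) ⟩
      (con C.⟦ p ⟧ ⊗ ⟦ u ⟧w ⊕ con C.⟦ q ⟧ ⊗ ⟦ u ⟧w) ⊕ (⟦ as ⟧n ⊕ ⟦ bs′ ⟧n)  ≈⟨ +-interchange _ _ _ _ ⟩
      ⟦ a ∷ as ⟧n ⊕ ⟦ bs ⟧n                   ∎
    ...   | _ ∷ _ | h = trans
      (+-cong (trans (*-congʳ (trans (con-cong h) (con-+ _ _))) (⊗-distribʳ _ _ _)) (addN-sound as bs′))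
      (+-interchange _ _ _ _)

    total : List NCP → NC F g
    total []      = con F.0#
    total (a ∷ l) = ⟦ a ⟧n ⊕ total l

    foldr-sound : ∀ l → ⟦ foldr addN [] l ⟧n ~ total l
    foldr-sound []      = refl′
    foldr-sound (a ∷ l) = trans (addN-sound a (foldr addN [] l)) (+-congˡ (foldr-sound l))

    pairs-sound : ∀ l → total (mergePairs addN l) ~ total l
    pairs-sound []          = refl′
    pairs-sound (a ∷ [])    = refl′
    pairs-sound (a ∷ b ∷ l) = trans (+-cong (addN-sound a b) (pairs-sound l)) (+-assoc _ _ _)

    all-sound : ∀ n l → ⟦ mergeAll addN [] n l ⟧n ~ total l
    all-sound n       []          = refl′
    all-sound n       (a ∷ [])    = sym (+-identityʳ _)
    all-sound zero    (a ∷ b ∷ l) = foldr-sound (a ∷ b ∷ l)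
    all-sound (suc n) (a ∷ b ∷ l) = trans (all-sound n (mergePairs addN (a ∷ b ∷ l))) (pairs-sound (a ∷ b ∷ l))

    scaleN-sound : ∀ q P → ⟦ scaleN q P ⟧n ~ con C.⟦ q ⟧ ⊗ ⟦ P ⟧n
    scaleN-sound q []            = sym (zeroʳ _)
    scaleN-sound q ((w , r) ∷ P) = trans
      (+-cong (trans (*-congʳ (trans (con-cong (C.mul-sound q r)) (con-* _ _))) (⊗-assoc _ _ _)) (scaleN-sound q P))
      (sym (⊗-distribˡ _ _ _))

    _·w_ : Word → Word → NC F g
    u ·w v = ⟦ u ⟧w ⊗ ⟦ v ⟧w

    strip-sound : ∀ u w v → strip u w ≡ just v → ⟦ w ⟧w ~ ⟦ u ⟧w ⊗ ⟦ v ⟧w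
    strip-sound []      w       .w refl = sym (*-identityˡ _)
    strip-sound (x ∷ u) (y ∷ w) v e with x ≡ᵇ y in xy
    strip-sound (x ∷ u) (y ∷ w) v e | true rewrite ≡ᵇ⇒≡ x y (≡.subst T (≡.sym xy) tt) =
      trans (*-congˡ (strip-sound u w v e)) (sym (⊗-assoc _ _ _))

    Valid-rules : Rules → Set (c ⊔ ℓ)
    Valid-rules []            = Lift _ ⊤
    Valid-rules ((u , P) ∷ R) = ⟦ u ⟧w ~ ⟦ P ⟧n × Valid-rules R

    match-sound : ∀ R → Valid-rules R → ∀ w P v → match R w ≡ just (P , v) → ⟦ w ⟧w ~ ⟦ P ⟧n ⊗ ⟦ v ⟧w
    match-sound ((u , Q) ∷ R) (h , hs) w P v e with strip u w in s
    match-sound ((u , Q) ∷ R) (h , hs) w P v refl | just .v = trans (strip-sound u w v s) (*-congʳ h)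
    match-sound ((u , Q) ∷ R) (h , hs) w P v e    | nothing = match-sound R hs w P v e

    module _ (R : Rules) (valid : Valid-rules R) where
      letterW-sound : ∀ n x w → ⟦ letterW n R x w ⟧n ~ θ x ⊗ ⟦ w ⟧w
      letterN-sound : ∀ n x P → ⟦ letterN n R x P ⟧n ~ θ x ⊗ ⟦ P ⟧n
      letterT-sound : ∀ n x P → total (mapL (λ { (w , q) → scaleN q (letterW n R x w) }) P) ~ θ x ⊗ ⟦ P ⟧n
      wordW-sound   : ∀ n u w → ⟦ wordW n R u w ⟧n ~ ⟦ u ⟧w ⊗ ⟦ w ⟧w
      wordN-sound   : ∀ n P v → ⟦ wordN n R P v ⟧n ~ ⟦ P ⟧n ⊗ ⟦ v ⟧w
      wordT-sound   : ∀ n P v → total (mapL (λ { (u , q) → scaleN q (wordW n R u v) }) P) ~ ⟦ P ⟧n ⊗ ⟦ v ⟧w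
      letterW-sound zero    x w = single (x ∷ w)
      letterW-sound (suc n) x w with match R (x ∷ w) in e
      ... | nothing      = single (x ∷ w)
      ... | just (P , v) = trans (wordN-sound n P v) (sym (match-sound R valid (x ∷ w) P v e))
      letterN-sound n x P = trans (all-sound (length l) l) (letterT-sound n x P)
        where l = mapL (λ { (w , q) → scaleN q (letterW n R x w) }) P
      letterT-sound n x []            = sym (zeroʳ _)
      letterT-sound n x ((w , q) ∷ P) = trans
        (+-cong (begin
          ⟦ scaleN q (letterW n R x w) ⟧n       ≈⟨ scaleN-sound q (letterW n R x w) ⟩
          con C.⟦ q ⟧ ⊗ ⟦ letterW n R x w ⟧n    ≈⟨ *-congˡ (letterW-sound n x w) ⟩
          con C.⟦ q ⟧ ⊗ (θ x ⊗ ⟦ w ⟧w)          ≈⟨ ⊗-assoc _ _ _ ⟨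
          (con C.⟦ q ⟧ ⊗ θ x) ⊗ ⟦ w ⟧w          ≈⟨ *-congʳ (central _ _) ⟩
          (θ x ⊗ con C.⟦ q ⟧) ⊗ ⟦ w ⟧w          ≈⟨ ⊗-assoc _ _ _ ⟩
          θ x ⊗ (con C.⟦ q ⟧ ⊗ ⟦ w ⟧w)          ∎)
          (letterT-sound n x P))
        (sym (⊗-distribˡ _ _ _))
      wordW-sound n []      w = trans (single w) (sym (*-identityˡ _))
      wordW-sound n (x ∷ u) w = trans (letterN-sound n x (wordW n R u w))
        (trans (*-congˡ (wordW-sound n u w)) (sym (⊗-assoc _ _ _)))
      wordN-sound n P v = trans (all-sound (length l) l) (wordT-sound n P v)
        where l = mapL (λ { (u , q) → scaleN q (wordW n R u v) }) P
      wordT-sound n []            v = sym (zeroˡ _)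
      wordT-sound n ((u , q) ∷ P) v = trans
        (+-cong (trans (scaleN-sound q (wordW n R u v)) (trans (*-congˡ (wordW-sound n u v)) (sym (⊗-assoc _ _ _))))
          (wordT-sound n P v))
        (sym (⊗-distribʳ _ _ _))

      letters-sound : ∀ n u P → ⟦ foldr (letterN n R) P u ⟧n ~ ⟦ u ⟧w ⊗ ⟦ P ⟧n
      letters-sound n []      P = sym (*-identityˡ _)
      letters-sound n (x ∷ u) P = trans (letterN-sound n x (foldr (letterN n R) P u))
        (trans (*-congˡ (letters-sound n u P)) (sym (⊗-assoc _ _ _)))

      mulN-sound : ∀ n P Q → ⟦ mulN n R P Q ⟧n ~ ⟦ P ⟧n ⊗ ⟦ Q ⟧n
      mulN-sound n []            Q = sym (zeroˡ _)
      mulN-sound n ((u , q) ∷ P) Q = trans (addN-sound (scaleN q (foldr (letterN n R) Q u)) (mulN n R P Q))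
        (trans (+-cong (trans (scaleN-sound q (foldr (letterN n R) Q u))
                              (trans (*-congˡ (letters-sound n u Q)) (sym (⊗-assoc _ _ _))))
                       (mulN-sound n P Q))
               (sym (⊗-distribʳ _ _ _)))

      nN-sound : ∀ {g′} n (x : NC 𝕊 g′) → T (okN x) → ⟦ nN n R x ⟧n ~ evN F ρ θ x
      nN-sound n (con a) h with nS a | C.nS-sound a h
      ... | []    | e = con-cong e
      ... | _ ∷ _ | e = trans (+-identityʳ _) (trans (*-identityʳ _) (con-cong e))
      nN-sound n (gen i) h = trans (letterW-sound n (toℕ i) []) (*-identityʳ _)
      nN-sound n (x ⊕ y) h = let hx , hy = T-∧ {okN x} h in
        trans (addN-sound (nN n R x) (nN n R y)) (+-cong (nN-sound n x hx) (nN-sound n y hy))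
      nN-sound n (x ⊗ y) h = let hx , hy = T-∧ {okN x} h in
        trans (mulN-sound n (nN n R x) (nN n R y)) (*-cong (nN-sound n x hx) (nN-sound n y hy))

      zeroN-sound : ∀ P → T (zeroN P) → ⟦ P ⟧n ~ con F.0#
      zeroN-sound []            h = refl′
      zeroN-sound ((w , q) ∷ P) h = let hq , hP = T-∧ {zeroCP q} h in
        trans (+-cong (trans (*-congʳ (con-cong (C.zero-sound q hq))) (zeroˡ _)) (zeroN-sound P hP)) (+-identityˡ _)

open AlgebraSolver public

-- Certificates of ideal membership

module Identities where
  open import Agda.Builtin.Char using (primCharToNat)
  open import Agda.Builtin.String using (primStringToList)

  nth : ∀ {a} {A : Set a} → A → List A → ℕ → A
  nth d []       _       = d
  nth d (x ∷ _)  zero    = x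
  nth d (_ ∷ xs) (suc k) = nth d xs k

  -- A certificate lists terms c · U · Rᵢ · V of the two-sided ideal generated by
  -- relations R₀, R₁, …
  Cert : Set
  Cert = List (SE × Word × ℕ × Word)

  -- (w , s , i) is the rewriting rule w → w + s Rᵢ; the leading term of − s Rᵢ is
  -- supposed to be w.
  Monic : Set
  Monic = Word × SE × ℕ

  negOne : CP
  negOne = ((0 , 1) , []) ∷ []

  rulesOf : ∀ {g} → List (NC 𝕊 g) → List Monic → Rules
  rulesOf Rs = mapL λ { (w , s , i) →
    w , addN ((w , oneCP) ∷ []) (scaleN (nS s) (nN 0 [] (nth (con 𝟘) Rs i))) }

  certT : ℕ → Rules → List NCP → SE × Word × ℕ × Word → NCP
  certT n R Ns (c , u , i , v) = scaleN (nS c) (foldr (letterN n R) (wordN n R (nth [] Ns i) v) u)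

  okC : Cert → Bool
  okC []            = true
  okC ((c , _) ∷ C) = okS c ∧ okC C

  okL : ∀ {g} → List (NC 𝕊 g) → Bool
  okL []       = true
  okL (x ∷ xs) = okN x ∧ okL xs

  -- The rules need not be confluent: the certificate supplies the elements of the ideal that
  -- rewriting does not reach. A negative answer proves nothing, a positive one proves x = y in the
  -- quotient.
  identity? : ∀ {g} → ℕ → List (NC 𝕊 g) → List Monic → NC 𝕊 g → NC 𝕊 g → Cert → Bool
  identity? n Rs M x y C =
    okN x ∧ okN y ∧ okC C ∧
    zeroN (addN (nN n R x) (scaleN negOne (addN (nN n R y) (sumN (mapL (certT n R (mapL (nN n R) Rs)) C)))))
    where R = rulesOf Rs M

  module Identity {c ℓ : Level} (F : Field c ℓ) {g k : ℕ} (S : Fin k → NC F g)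
    (ρ : ℕ → Field.Carrier F) (inv01 : Field._≈_ F (Field._*_ F (ρ 0) (ρ 1)) (Field.1# F))
    (θ : ℕ → NC F g) where

    open NCSound F S ρ inv01 θ public
    private module F = Field F
    open Ring (ncRing F S) hiding (zero)
    private module R = RingProps (ncRing F S)
    open import Relation.Binary.Reasoning.Setoid setoid

    Vanish : ∀ {h} → List (NC 𝕊 h) → Set (c ⊔ ℓ)
    Vanish []       = Lift _ ⊤
    Vanish (x ∷ xs) = evN F ρ θ x ~ con F.0# × Vanish xs

    nth-vanish : ∀ {h} (Rs : List (NC 𝕊 h)) → T (okL Rs) → Vanish Rs → ∀ i →
      T (okN (nth (con 𝟘) Rs i)) × evN F ρ θ (nth (con 𝟘) Rs i) ~ con F.0#
    nth-vanish []       _ _        i       = tt , refl′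
    nth-vanish (x ∷ Rs) h (v , vs) zero    = proj₁ (T-∧ {okN x} h) , v
    nth-vanish (x ∷ Rs) h (v , vs) (suc i) = nth-vanish Rs (proj₂ (T-∧ {okN x} h)) vs i

    negOne-sound : con C.⟦ negOne ⟧ ~ con (F.- F.1#)
    negOne-sound = con-cong (F.trans (F.+-identityʳ _) (F.trans (F.*-identityʳ _)
      (F.trans (F.+-identityˡ _) (F.-‿cong (F.+-identityʳ _)))))

    rules-valid : ∀ {h} (Rs : List (NC 𝕊 h)) → T (okL Rs) → Vanish Rs → ∀ M → Valid-rules (rulesOf Rs M)
    rules-valid Rs h v []                = lift tt
    rules-valid Rs h v ((w , s , i) ∷ M) = eq′ , rules-valid Rs h v M
      where
      q = nS s
      P = nN 0 [] (nth (con 𝟘) Rs i)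
      P~0 : ⟦ P ⟧n ~ con F.0#
      P~0 = trans (nN-sound [] (lift tt) 0 (nth (con 𝟘) Rs i) (proj₁ (nth-vanish Rs h v i))) (proj₂ (nth-vanish Rs h v i))
      eq′ : ⟦ w ⟧w ~ ⟦ addN ((w , oneCP) ∷ []) (scaleN q P) ⟧n
      eq′ = sym (trans (addN-sound ((w , oneCP) ∷ []) (scaleN q P)) (trans (+-cong (single w)
        (trans (scaleN-sound q P) (trans (*-congˡ P~0) (zeroʳ _)))) (+-identityʳ _)))

    module _ {h} (Rs : List (NC 𝕊 h)) (okRs : T (okL Rs)) (van : Vanish Rs) (M : List Monic) (n : ℕ) where
      private
        Ru = rulesOf Rs M
        va = rules-valid Rs okRs van M

      nthN-zero : ∀ (Qs : List (NC 𝕊 h)) → T (okL Qs) → Vanish Qs → ∀ i → ⟦ nth [] (mapL (nN n Ru) Qs) i ⟧n ~ con F.0#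
      nthN-zero []       _ _        i       = refl′
      nthN-zero (x ∷ Qs) o (v , vs) zero    = trans (nN-sound Ru va n x (proj₁ (T-∧ {okN x} o))) v
      nthN-zero (x ∷ Qs) o (v , vs) (suc i) = nthN-zero Qs (proj₂ (T-∧ {okN x} o)) vs i

      cert-zero : ∀ C → total (mapL (certT n Ru (mapL (nN n Ru) Rs)) C) ~ con F.0#
      cert-zero []                    = refl′
      cert-zero ((a , u , i , v) ∷ C) = trans (+-cong
        (trans (scaleN-sound (nS a) (foldr (letterN n Ru) (wordN n Ru Q v) u)) (trans (*-congˡ
          (trans (letters-sound Ru va n u (wordN n Ru Q v)) (trans (*-congˡ (trans (wordN-sound Ru va n Q v)
            (trans (*-congʳ (nthN-zero Rs okRs van i)) (zeroˡ _)))) (zeroʳ _)))) (zeroʳ _)))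
        (cert-zero C)) (+-identityˡ _)
        where Q = nth [] (mapL (nN n Ru) Rs) i

      identity : ∀ x y C → T (identity? n Rs M x y C) → evN F ρ θ x ~ evN F ρ θ y
      identity x y C t =
        let ox , t₁ = T-∧ {okN x} t
            oy , t₂ = T-∧ {okN y} t₁
            _  , t₃ = T-∧ {okC C} t₂
            l = mapL (certT n Ru (mapL (nN n Ru) Rs)) C
            Y = addN (nN n Ru y) (sumN l)
            Y~ : ⟦ Y ⟧n ~ evN F ρ θ y
            Y~ = trans (addN-sound (nN n Ru y) (sumN l)) (trans (+-cong (nN-sound Ru va n y oy)
                   (trans (all-sound (length l) l) (cert-zero C))) (+-identityʳ _))
            e : evN F ρ θ x ⊕ con (F.- F.1#) ⊗ evN F ρ θ y ~ con F.0#
            e = trans (sym (trans (addN-sound (nN n Ru x) (scaleN negOne Y)) (+-cong (nN-sound Ru va n x ox)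
                  (trans (scaleN-sound negOne Y) (*-cong negOne-sound Y~)))))
                  (zeroN-sound Ru va (addN (nN n Ru x) (scaleN negOne Y)) t₃)
        in R.x∙y⁻¹≈ε⇒x≈y _ _ e

  -- The text format of certificates: terms are separated by commas and have the
  -- form ±k⟨coefficient⟩ U R V, with a digit k, and two characters for every
  -- factor of the coefficient and for the relation R.
  module Parse (factor : ℕ → ℕ → SE) (letterOf : ℕ → ℕ) (relOf : ℕ → ℕ → ℕ) where
    split : ℕ → List ℕ → List (List ℕ)
    split s []       = [] ∷ []
    split s (x ∷ xs) with x ≡ᵇ s | split s xs
    ... | true  | r       = [] ∷ r
    ... | false | []      = (x ∷ []) ∷ []
    ... | false | (w ∷ r) = (x ∷ w) ∷ r

    lit : ℕ → SE
    lit zero          = 𝟘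
    lit (suc zero)    = 𝟙
    lit (suc (suc n)) = 𝟙 :+ lit (suc n)

    product : SE → List ℕ → SE
    product a (x ∷ y ∷ r) = product (a :* factor x y) r
    product a _           = a

    coefficient : List ℕ → SE
    coefficient (s ∷ d ∷ r) = product (if s ≡ᵇ 45 then :- lit (d ℕ.∸ 48) else lit (d ℕ.∸ 48)) r
    coefficient _           = 𝟘

    term : List (List ℕ) → SE × Word × ℕ × Word
    term (c ∷ u ∷ (x ∷ y ∷ []) ∷ v ∷ []) = coefficient c , mapL letterOf u , relOf x y , mapL letterOf v
    term _                               = 𝟘 , [] , 0 , []

    codes : String → List ℕ
    codes s = mapL primCharToNat (primStringToList s)

    parse : String → Cert
    parse s = mapL (λ w → term (split 32 w)) (split 44 (codes s))

  -- If P i and Q i agree by computation only once i is a numeral, because of `lookup` or `splitAt`,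
  -- then `gather (spread h)` turns a proof of ∀ i → P i into one of ∀ i → Q i: the components of
  -- this product are taken at numerals.
  AllF : ∀ {a} n → (Fin n → Set a) → Set a
  AllF zero    P = Lift _ ⊤
  AllF (suc n) P = P zero × AllF n (P ∘ suc)

  spread : ∀ {a n} {P : Fin n → Set a} → (∀ i → P i) → AllF n P
  spread {n = zero}  h = lift tt
  spread {n = suc n} h = h zero , spread (h ∘ suc)

  gather : ∀ {a n} {P : Fin n → Set a} → AllF n P → ∀ i → P i
  gather (p , ps) zero    = p
  gather (p , ps) (suc i) = gather ps i

  module _ {c ℓ : Level} (F : Field c ℓ) where
    sub : ∀ {g h} → (Fin g → NC F h) → NC F g → NC F h
    sub ψ (con a) = con a
    sub ψ (gen i) = ψ i
    sub ψ (x ⊕ y) = sub ψ x ⊕ sub ψ y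
    sub ψ (x ⊗ y) = sub ψ x ⊗ sub ψ y

    letters : ∀ {g} → List (NC F g) → ℕ → NC F g
    letters {g} xs = nth (con (Field.0# F)) (tabulate {n = g} gen ++ᴸ xs)

    -- the first two scalars are inverse to each other
    env : Field.Carrier F → Field.Carrier F → List (Field.Carrier F) → ℕ → Field.Carrier F
    env a b xs = nth (Field.0# F) (a ∷ b ∷ xs)

  module _ {c ℓ : Level} (F : Field c ℓ) where
    private module F = Field F

    subHom : ∀ {g k h l} {R : Fin k → NC F g} {S : Fin l → NC F h} (ψ : Fin g → NC F h) →
      (∀ i → Eqv F S (sub F ψ (R i)) (con F.0#)) → ∀ {x y} → Eqv F R x y → Eqv F S (sub F ψ x) (sub F ψ y)
    subHom ψ ok refl′ = refl′
    subHom ψ ok (sym′ p) = sym′ (subHom ψ ok p)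
    subHom ψ ok (trans′ p q) = trans′ (subHom ψ ok p) (subHom ψ ok q)
    subHom ψ ok (⊕-cong p q) = ⊕-cong (subHom ψ ok p) (subHom ψ ok q)
    subHom ψ ok (⊗-cong p q) = ⊗-cong (subHom ψ ok p) (subHom ψ ok q)
    subHom ψ ok (⊕-assoc x y z) = ⊕-assoc _ _ _
    subHom ψ ok (⊕-comm x y) = ⊕-comm _ _
    subHom ψ ok (⊕-idˡ x) = ⊕-idˡ _
    subHom ψ ok (⊕-invˡ x) = ⊕-invˡ _
    subHom ψ ok (⊗-assoc x y z) = ⊗-assoc _ _ _
    subHom ψ ok (⊗-idˡ x) = ⊗-idˡ _
    subHom ψ ok (⊗-idʳ x) = ⊗-idʳ _
    subHom ψ ok (⊗-distribˡ x y z) = ⊗-distribˡ _ _ _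
    subHom ψ ok (⊗-distribʳ x y z) = ⊗-distribʳ _ _ _
    subHom ψ ok (con-cong p) = con-cong p
    subHom ψ ok (con-+ a b) = con-+ a b
    subHom ψ ok (con-* a b) = con-* a b
    subHom ψ ok (central a x) = central a _
    subHom ψ ok (rel i) = ok i

open Identities public

-- Isomorphisms that transport ξ and D

module Connections where
  module _ {c ℓ : Level} (F : Field c ℓ) where
    private module F = Field F

    Subst : Deg → Set c
    Subst n = Fin (ngen F n) → NC F (ngen F n)

    -- For n = 2 the element η has a formula of its own, so its behaviour is recorded along the way:
    -- it is multiplied by δ³ without correction. For n = 3, 4 it is defined from Dξ, and its
    -- behaviour follows at the end.
    EtaClause : (n : Deg) → F.Carrier → Model F n → Model F n → (NC F (ngen F n) → NC F (ngen F n)) → Set (c ⊔ ℓ)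
    EtaClause two δ f f′ ψ = Eqv F (relsA F two f) (ψ (ηA F two f′)) (_·_ F (δ F.* δ F.* δ) (ηA F two f))
    EtaClause _   δ f f′ ψ = Lift _ ⊤

    -- ψ : A_{f′} → A_f multiplies D by δ up to inner derivations, and ξ by δ² up to
    -- constants.
    record Conn (n : Deg) (δ : F.Carrier) (f f′ : Model F n) : Set (c ⊔ ℓ) where
      field
        iso : AlgIso F (relsA F n f′) (relsA F n f)
      open AlgIso iso public
      field
        ρ   : F.Carrier
        ξ-eq : Eqv F (relsA F n f) (ψ (ξA F n f′)) (_·_ F (δ F.* δ) (ξA F n f) ⊕ con ρ)
        κ   : NC F (ngen F n)
        D-eq : ∀ x → Eqv F (relsA F n f) (ψ (DA F n f′ x)) (_·_ F δ (DA F n f (ψ x)) ⊕ ⟦_,_⟧ F κ (ψ x))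
        η-eq : EtaClause n δ f f′ ψ

    -- The part of a connection that is checked on generators: a homomorphism without its inverse,
    -- and the identity for D at each generator.
    record Step (n : Deg) (δ : F.Carrier) (f f′ : Model F n) : Set (c ⊔ ℓ) where
      field
        ψ   : Subst n
        ok  : ∀ i → Eqv F (relsA F n f) (sub F ψ (relsA F n f′ i)) (con F.0#)
        ρ   : F.Carrier
        ξ-eq : Eqv F (relsA F n f) (sub F ψ (ξA F n f′)) (_·_ F (δ F.* δ) (ξA F n f) ⊕ con ρ)
        κ   : NC F (ngen F n)
        D-eq : ∀ i → Eqv F (relsA F n f) (sub F ψ (DA F n f′ (gen i))) (_·_ F δ (DA F n f (ψ i)) ⊕ ⟦_,_⟧ F κ (ψ i))
        η-eq : EtaClause n δ f f′ (sub F ψ)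

    module _ {g k : ℕ} (S : Fin k → NC F g) where
      open Ring (ncRing F S) hiding (zero)
      open import Relation.Binary.Reasoning.Setoid setoid
      private
        module R = RingProps (ncRing F S)
        infix 4 _~_
        _~_ = Eqv F S

      open Identity F S (env F F.1# F.1# []) (F.*-identityˡ _) (letters F []) using () renaming (identity to id₀) public

      -- [κ,−] and δ·E are derivations
      leibniz : ∀ (δ κ E₁ E₂ x y X Y : NC F g) → (∀ z → δ ⊗ z ~ z ⊗ δ) →
        X ~ δ ⊗ E₁ ⊕ ⟦_,_⟧ F κ x → Y ~ δ ⊗ E₂ ⊕ ⟦_,_⟧ F κ y →
        X ⊗ y ⊕ x ⊗ Y ~ δ ⊗ (E₁ ⊗ y ⊕ x ⊗ E₂) ⊕ ⟦_,_⟧ F κ (x ⊗ y)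
      leibniz δ κ E₁ E₂ x y X Y cδ hX hY = trans (+-cong (*-congʳ hX) (*-congˡ hY)) (
        N.identity Rs tt (ze , lift tt) ((3 ∷ 0 ∷ [] , :- 𝟙 , 0) ∷ []) 9
          ((d ⊗ e₁ ⊕ br k′ x′) ⊗ y′ ⊕ x′ ⊗ (d ⊗ e₂ ⊕ br k′ y′))
          (d ⊗ (e₁ ⊗ y′ ⊕ x′ ⊗ e₂) ⊕ br k′ (x′ ⊗ y′)) [] tt)
        where
        θ : ℕ → NC F g
        θ = nth (con F.0#) (δ ∷ κ ∷ E₁ ∷ x ∷ E₂ ∷ y ∷ [])
        module N = Identity F S (env F F.1# F.1# []) (F.*-identityˡ _) θ
        d k′ e₁ x′ e₂ y′ : NC 𝕊 6
        d = gen (# 0)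
        k′ = gen (# 1)
        e₁ = gen (# 2)
        x′ = gen (# 3)
        e₂ = gen (# 4)
        y′ = gen (# 5)
        br : NC 𝕊 6 → NC 𝕊 6 → NC 𝕊 6
        br = ⟦_,_⟧ 𝕊
        Rs = _⊖_ 𝕊 (x′ ⊗ d) (d ⊗ x′) ∷ []
        ze : x ⊗ δ ⊕ (con (F.- F.1#)) ⊗ (δ ⊗ x) ~ con F.0#
        ze = trans (+-congʳ (sym (cδ x))) (-‿inverseʳ _)

      br-con : ∀ a (x : NC F g) → ⟦_,_⟧ F x (con a) ~ con F.0#
      br-con a x = trans (+-congˡ (*-congˡ (central a x))) (-‿inverseʳ _)

      -- Both x ↦ ψ(D′x) and x ↦ δD(ψx) + [κ, ψx] are derivations along ψ, so agreement on
      -- generators is enough.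
      sub-extDer : ∀ {h} (d′ : Fin h → NC F h) (d : Fin g → NC F g) (ψ : Fin h → NC F g) (δ : F.Carrier) (κ : NC F g) →
        (∀ i → sub F ψ (d′ i) ~ _·_ F δ (extDer F d (ψ i)) ⊕ ⟦_,_⟧ F κ (ψ i)) →
        ∀ x → sub F ψ (extDer F d′ x) ~ _·_ F δ (extDer F d (sub F ψ x)) ⊕ ⟦_,_⟧ F κ (sub F ψ x)
      sub-extDer d′ d ψ δ κ h (con a) = sym (trans (+-cong (zeroʳ _) (br-con a κ)) (+-identityˡ _))
      sub-extDer d′ d ψ δ κ h (gen i) = h i
      sub-extDer d′ d ψ δ κ h (x ⊕ y) = trans (+-cong (sub-extDer d′ d ψ δ κ h x) (sub-extDer d′ d ψ δ κ h y))
        (id₆ (con δ) κ (extDer F d (sub F ψ x)) (sub F ψ x) (extDer F d (sub F ψ y)) (sub F ψ y))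
        where
        id₆ : ∀ δ κ E₁ x E₂ y → (δ ⊗ E₁ ⊕ ⟦_,_⟧ F κ x) ⊕ (δ ⊗ E₂ ⊕ ⟦_,_⟧ F κ y) ~ δ ⊗ (E₁ ⊕ E₂) ⊕ ⟦_,_⟧ F κ (x ⊕ y)
        id₆ δ κ E₁ x E₂ y = N.identity {h = 6} [] tt (lift tt) [] 0
          ((v₀ ⊗ v₂ ⊕ ⟦_,_⟧ 𝕊 v₁ v₃) ⊕ (v₀ ⊗ v₄ ⊕ ⟦_,_⟧ 𝕊 v₁ v₅)) (v₀ ⊗ (v₂ ⊕ v₄) ⊕ ⟦_,_⟧ 𝕊 v₁ (v₃ ⊕ v₅)) [] tt
          where
          module N = Identity F S (env F F.1# F.1# []) (F.*-identityˡ _) (nth (con F.0#) (δ ∷ κ ∷ E₁ ∷ x ∷ E₂ ∷ y ∷ []))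
          v₀ v₁ v₂ v₃ v₄ v₅ : NC 𝕊 6
          v₀ = gen (# 0)
          v₁ = gen (# 1)
          v₂ = gen (# 2)
          v₃ = gen (# 3)
          v₄ = gen (# 4)
          v₅ = gen (# 5)
      sub-extDer d′ d ψ δ κ h (x ⊗ y) = leibniz (con δ) κ _ _ _ _ _ _ (central δ)
        (sub-extDer d′ d ψ δ κ h x) (sub-extDer d′ d ψ δ κ h y)

    step-D : ∀ n {δ} {f f′ : Model F n} (s : Step n δ f f′) → ∀ x →
      Eqv F (relsA F n f) (sub F (Step.ψ s) (DA F n f′ x)) (_·_ F δ (DA F n f (sub F (Step.ψ s) x)) ⊕ ⟦_,_⟧ F (Step.κ s) (sub F (Step.ψ s) x))
    step-D two   {f = f} {f′} s = sub-extDer _ (Two.Dgen F f′) (Two.Dgen F f) (Step.ψ s) _ (Step.κ s) (Step.D-eq s)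
    step-D three {f = f} {f′} s = sub-extDer _ (Three.Dgen F f′) (Three.Dgen F f) (Step.ψ s) _ (Step.κ s) (Step.D-eq s)
    step-D four  {f = f} {f′} s = sub-extDer _ (Four.Dgen F f′) (Four.Dgen F f) (Step.ψ s) _ (Step.κ s) (Step.D-eq s)

    sub-sub : ∀ {g k} {S : Fin k → NC F g} {h} (φ : Fin h → NC F g) (ψ : Fin g → NC F h) →
      (∀ i → Eqv F S (sub F φ (ψ i)) (gen i)) → ∀ x → Eqv F S (sub F φ (sub F ψ x)) x
    sub-sub φ ψ h (con a) = refl′
    sub-sub φ ψ h (gen i) = h i
    sub-sub φ ψ h (x ⊕ y) = ⊕-cong (sub-sub φ ψ h x) (sub-sub φ ψ h y)
    sub-sub φ ψ h (x ⊗ y) = ⊗-cong (sub-sub φ ψ h x) (sub-sub φ ψ h y)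

    connect : ∀ {n δ} {f f′ : Model F n} (s : Step n δ f f′) (φ : Subst n) →
      (∀ i → Eqv F (relsA F n f′) (sub F φ (relsA F n f i)) (con F.0#)) →
      (∀ i → Eqv F (relsA F n f′) (sub F φ (Step.ψ s i)) (gen i)) →
      (∀ i → Eqv F (relsA F n f) (sub F (Step.ψ s) (φ i)) (gen i)) → Conn n δ f f′
    connect {n} {δ} {f} {f′} s φ ok′ φψ ψφ = record
      { iso = record
        { to = record { fun = sub F ψ ; fun-cong = subHom F ψ ok ; ⊕-hom = λ _ _ → refl′ ; ⊗-hom = λ _ _ → refl′ ; con-hom = λ _ → refl′ }
        ; from = record { fun = sub F φ ; fun-cong = subHom F φ ok′ ; ⊕-hom = λ _ _ → refl′ ; ⊗-hom = λ _ _ → refl′ ; con-hom = λ _ → refl′ }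
        ; from∘to = sub-sub φ ψ φψ ; to∘from = sub-sub ψ φ ψφ }
      ; ρ = ρ ; ξ-eq = ξ-eq ; κ = κ ; D-eq = step-D n s ; η-eq = η-eq }
      where open Step s

    connect₂ : ∀ {n δ δ′} {f f′ : Model F n} (s : Step n δ f f′) (s′ : Step n δ′ f′ f) →
      (∀ i → Eqv F (relsA F n f′) (sub F (Step.ψ s′) (Step.ψ s i)) (gen i)) →
      (∀ i → Eqv F (relsA F n f) (sub F (Step.ψ s) (Step.ψ s′ i)) (gen i)) → Conn n δ f f′
    connect₂ s s′ = connect s (Step.ψ s′) (Step.ok s′)

    module _ {n : Deg} where
      private
        infix 4 _⊢_~_
        _⊢_~_ : Model F n → NC F (ngen F n) → NC F (ngen F n) → Set (c ⊔ ℓ)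
        f ⊢ x ~ y = Eqv F (relsA F n f) x y

      hom-· : ∀ {f f′ : Model F n} (h : AlgHom F (relsA F n f′) (relsA F n f)) a x →
        f ⊢ (AlgHom.fun h) (_·_ F a x) ~ _·_ F a ((AlgHom.fun h) x)
      hom-· h a x = trans′ (⊗-hom _ _) (⊗-cong (con-hom _) refl′)
        where open AlgHom h

      hom-⟦⟧ : ∀ {f f′ : Model F n} (h : AlgHom F (relsA F n f′) (relsA F n f)) x y →
        f ⊢ (AlgHom.fun h) (⟦_,_⟧ F x y) ~ ⟦_,_⟧ F ((AlgHom.fun h) x) ((AlgHom.fun h) y)
      hom-⟦⟧ h x y = trans′ (⊕-hom _ _) (⊕-cong (⊗-hom _ _) (trans′ (hom-· h _ _) (⊗-cong refl′ (⊗-hom _ _))))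
        where open AlgHom h

      conn-trans : ∀ {δ₁ δ₂} {f f′ f″ : Model F n} → Conn n δ₁ f f′ → Conn n δ₂ f′ f″ → Conn n (δ₂ F.* δ₁) f f″
      conn-trans {δ₁} {δ₂} {f} {f′} {f″} C₁ C₂ = record
        { iso = record
          { to = comp K₁.to K₂.to ; from = comp K₂.from K₁.from
          ; from∘to = λ x → trans′ (AlgHom.fun-cong K₂.from (K₁.from∘to _)) (K₂.from∘to x)
          ; to∘from = λ y → trans′ (AlgHom.fun-cong K₁.to (K₂.to∘from _)) (K₁.to∘from y) }
        ; ρ = δ₂ F.* δ₂ F.* K₁.ρ F.+ K₂.ρ
        ; ξ-eq = trans′ (h.fun-cong K₂.ξ-eq) (trans′ (trans′ (h.⊕-hom _ _) (⊕-cong (trans′ (hom-· K₁.to _ _)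
            (⊗-cong refl′ K₁.ξ-eq)) (h.con-hom _)))
            (N.identity {h = 1} [] tt (lift tt) [] 0
              (con (b :* b) ⊗ (con (a :* a) ⊗ z ⊕ con u) ⊕ con v)
              (con ((b :* a) :* (b :* a)) ⊗ z ⊕ con (b :* b :* u :+ v)) [] tt))
        -- ψ₁ carries δ₂D′ + [κ₂, -] to δ₂(δ₁D + [κ₁, -]) + [ψ₁κ₂, -].
        ; κ = _·_ F δ₂ K₁.κ ⊕ h.fun K₂.κ
        ; D-eq = λ x → trans′ (h.fun-cong (K₂.D-eq x)) (trans′ (trans′ (h.⊕-hom _ _) (⊕-cong
            (trans′ (hom-· K₁.to _ _) (⊗-cong refl′ (K₁.D-eq (K₂.ψ x)))) (hom-⟦⟧ K₁.to _ _)))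
            (dist (DA F n f (K₁.ψ (K₂.ψ x))) (K₁.ψ (K₂.ψ x)) K₁.κ (h.fun K₂.κ)))
        ; η-eq = eta n {f} {f′} {f″} K₁.to K₂.ψ K₁.η-eq K₂.η-eq }
        where
        module K₁ = Conn C₁
        module K₂ = Conn C₂
        module h = AlgHom K₁.to
        comp : ∀ {f f′ f″ : Model F n} → AlgHom F (relsA F n f′) (relsA F n f) → AlgHom F (relsA F n f″) (relsA F n f′) →
          AlgHom F (relsA F n f″) (relsA F n f)
        comp h k = record
          { fun = λ x → h′.fun (k′.fun x) ; fun-cong = λ p → h′.fun-cong (k′.fun-cong p)
          ; ⊕-hom = λ x y → trans′ (h′.fun-cong (k′.⊕-hom x y)) (h′.⊕-hom _ _)
          ; ⊗-hom = λ x y → trans′ (h′.fun-cong (k′.⊗-hom x y)) (h′.⊗-hom _ _)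
          ; con-hom = λ a → trans′ (h′.fun-cong (k′.con-hom a)) (h′.con-hom a) }
          where
          module h′ = AlgHom h
          module k′ = AlgHom k
        a b u v : SE
        a = var 2
        b = var 3
        u = var 4
        v = var 5
        z : NC 𝕊 1
        z = gen (# 0)
        ev = env F F.1# F.1# (δ₁ ∷ δ₂ ∷ K₁.ρ ∷ K₂.ρ ∷ [])
        module N = Identity F (relsA F n f) ev (F.*-identityˡ _) (nth (con F.0#) (ξA F n f ∷ []))
        dist : ∀ X x κ₁ κ₂ → f ⊢ _·_ F δ₂ (_·_ F δ₁ X ⊕ ⟦_,_⟧ F κ₁ x) ⊕ ⟦_,_⟧ F κ₂ x ~
                                 _·_ F (δ₂ F.* δ₁) X ⊕ ⟦_,_⟧ F (_·_ F δ₂ κ₁ ⊕ κ₂) x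
        dist X x κ₁ κ₂ = N′.identity {h = 4} [] tt (lift tt) [] 0
              (con b ⊗ (con a ⊗ x₀ ⊕ ⟦_,_⟧ 𝕊 x₂ x₁) ⊕ ⟦_,_⟧ 𝕊 x₃ x₁)
              (con (b :* a) ⊗ x₀ ⊕ ⟦_,_⟧ 𝕊 (con b ⊗ x₂ ⊕ x₃) x₁) [] tt
          where
          module N′ = Identity F (relsA F n f) ev (F.*-identityˡ _) (nth (con F.0#) (X ∷ x ∷ κ₁ ∷ κ₂ ∷ []))
          x₀ x₁ x₂ x₃ : NC 𝕊 4
          x₀ = gen (# 0)
          x₁ = gen (# 1)
          x₂ = gen (# 2)
          x₃ = gen (# 3)
        eta : ∀ n {f f′ f″ : Model F n} (h : AlgHom F (relsA F n f′) (relsA F n f)) (ψ₂ : NC F (ngen F n) → NC F (ngen F n)) →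
          EtaClause n δ₁ f f′ (AlgHom.fun h) → EtaClause n δ₂ f′ f″ ψ₂ →
          EtaClause n (δ₂ F.* δ₁) f f″ (λ x → AlgHom.fun h (ψ₂ x))
        eta two {f} h ψ₂ e₁ e₂ = trans′ (AlgHom.fun-cong h e₂) (trans′ (trans′ (AlgHom.⊗-hom h _ _) (⊗-cong (AlgHom.con-hom h _) e₁))
            (N₂.identity {h = 1} [] tt (lift tt) [] 0 (con (b :* b :* b) ⊗ (con (a :* a :* a) ⊗ z))
              (con ((b :* a) :* (b :* a) :* (b :* a)) ⊗ z) [] tt))
          where
          module N₂ = Identity F (relsA F two f) ev (F.*-identityˡ _) (nth (con F.0#) (ηA F two f ∷ []))
        eta three h ψ₂ e₁ e₂ = lift _
        eta four  h ψ₂ e₁ e₂ = lift _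

open Connections public

-- Elementary substitutions verified on generic models

module Steps where
  allB : ∀ {n} → (Fin n → Bool) → Bool
  allB {zero}  h = true
  allB {suc n} h = h zero ∧ allB (h ∘ suc)

  allB-sound : ∀ {n} (h : Fin n → Bool) → T (allB h) → ∀ i → T (h i)
  allB-sound h t zero    = proj₁ (T-∧ {h zero} t)
  allB-sound h t (suc i) = allB-sound (h ∘ suc) (proj₂ (T-∧ {h zero} t)) i

  nth-tabulate : ∀ {a} {A : Set a} {d : A} {n} (h : Fin n → A) xs i → nth d (tabulate h ++ᴸ xs) (toℕ i) ≡ h i
  nth-tabulate h xs zero    = refl
  nth-tabulate h xs (suc i) = nth-tabulate (h ∘ suc) xs i

  -- Variables 0 and 1 are reserved for a pair of mutually inverse scalars, whence the shift by 2.
  varModel : ∀ n → Model 𝕊 n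
  varModel n i = var (2 ℕ.+ toℕ i)

  DgenA : ∀ {c ℓ} (F : Field c ℓ) n → Model F n → Fin (ngen F n) → NC F (ngen F n)
  DgenA F two   f = Two.Dgen F f
  DgenA F three f = Three.Dgen F f
  DgenA F four  f = Four.Dgen F f

  relList : ∀ n → Model 𝕊 n → List (NC 𝕊 (ngen 𝕊 n))
  relList n f = tabulate (relsA 𝕊 n f)

  -- A substitution given over syntax trees. `ok?` is a closed Boolean that the type checker
  -- evaluates for the generic model; `step` then instantiates it in every field and for all values
  -- of the variables.
  record StepData (n : Deg) : Set where
    field
      source target : Model 𝕊 n
      image         : Fin (ngen 𝕊 n) → NC 𝕊 (ngen 𝕊 n)
      factor const  : SE
      inner         : NC 𝕊 (ngen 𝕊 n)
      depth         : ℕ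
      monic         : List Monic
      ok-cert       : Fin (nrel 𝕊 n) → Cert
      ξ-cert        : Cert
      D-cert        : Fin (ngen 𝕊 n) → Cert

    Rs : List (NC 𝕊 (ngen 𝕊 n))
    Rs = relList n source

    okCheck : Fin (nrel 𝕊 n) → Bool
    okCheck i = identity? depth Rs monic (sub 𝕊 image (relsA 𝕊 n target i)) (con 𝟘) (ok-cert i)
    ξ-lhs ξ-rhs : NC 𝕊 (ngen 𝕊 n)
    ξ-lhs = sub 𝕊 image (ξA 𝕊 n target)
    ξ-rhs = _·_ 𝕊 (factor :* factor) (ξA 𝕊 n source) ⊕ con const
    D-lhs D-rhs : Fin (ngen 𝕊 n) → NC 𝕊 (ngen 𝕊 n)
    D-lhs i = sub 𝕊 image (DA 𝕊 n target (gen i))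
    D-rhs i = _·_ 𝕊 factor (DA 𝕊 n source (image i)) ⊕ ⟦_,_⟧ 𝕊 inner (image i)
    D-check : Fin (ngen 𝕊 n) → Bool
    D-check i = identity? depth Rs monic (D-lhs i) (D-rhs i) (D-cert i)
    ηCheck : (n : Deg) (f f′ : Model 𝕊 n) (ψ : Fin (ngen 𝕊 n) → NC 𝕊 (ngen 𝕊 n)) → Bool
    ηCheck two f f′ ψ = identity? depth (relList two f) monic (sub 𝕊 ψ (ηA 𝕊 two f′)) (_·_ 𝕊 (factor :* factor :* factor) (ηA 𝕊 two f)) []
    ηCheck _   f f′ ψ = true

    ok? : Bool
    ok? = okL Rs ∧ allB okCheck ∧ identity? depth Rs monic ξ-lhs ξ-rhs ξ-cert ∧ allB D-check ∧ ηCheck n source target image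

  module _ {c ℓ : Level} (F : Field c ℓ) where
    private module F = Field F

    module _ (ρ : ℕ → F.Carrier) where
      ev₀ : ∀ {g} → NC 𝕊 g → NC F g
      ev₀ = evN F ρ (letters F [])

      -- Evaluation follows the constructors literally, so this and the next commutations are
      -- identities of expressions, not merely congruences in the algebra.
      ev-sub : ∀ {g h} (θ : ℕ → NC F h) {g′} (ψ : Fin g → NC 𝕊 g′) x →
        evN F ρ θ (sub 𝕊 ψ x) ≡ sub F (λ i → evN F ρ θ (ψ i)) (ev₀ x)
      ev-sub θ ψ (con a) = refl
      ev-sub θ ψ (gen i) rewrite nth-tabulate {d = con F.0#} (gen {F = F}) [] i = refl
      ev-sub θ ψ (x ⊕ y) = ≡.cong₂ _⊕_ (ev-sub θ ψ x) (ev-sub θ ψ y)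
      ev-sub θ ψ (x ⊗ y) = ≡.cong₂ _⊗_ (ev-sub θ ψ x) (ev-sub θ ψ y)

      ev-extDer : ∀ {g} (d : Fin g → NC 𝕊 g) (d′ : Fin g → NC F g) → (∀ i → ev₀ (d i) ≡ d′ i) → ∀ x →
        ev₀ (extDer 𝕊 d x) ≡ extDer F d′ (ev₀ x)
      ev-extDer d d′ h (con a) = refl
      ev-extDer d d′ h (gen i) rewrite nth-tabulate {d = con F.0#} (gen {F = F}) [] i = h i
      ev-extDer d d′ h (x ⊕ y) = ≡.cong₂ _⊕_ (ev-extDer d d′ h x) (ev-extDer d d′ h y)
      ev-extDer d d′ h (x ⊗ y) =
        ≡.cong₂ _⊕_ (≡.cong (_⊗ ev₀ y) (ev-extDer d d′ h x)) (≡.cong (ev₀ x ⊗_) (ev-extDer d d′ h y))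

      evM : ∀ {m} → (Fin m → SE) → Fin m → F.Carrier
      evM f i = evS F ρ (f i)

      ev-rels : ∀ n (f : Model 𝕊 n) i → ev₀ (relsA 𝕊 n f i) ≡ relsA F n (evM f) i
      ev-rels two   f = gather {n = 5} (spread {n = 5} {P = λ i → relsA F two (evM f) i ≡ relsA F two (evM f) i} λ _ → refl)
      ev-rels three f = gather {n = 4} (spread {n = 4} {P = λ i → relsA F three (evM f) i ≡ relsA F three (evM f) i} λ _ → refl)
      ev-rels four  f = gather {n = 9} (spread {n = 9} {P = λ i → relsA F four (evM f) i ≡ relsA F four (evM f) i} λ _ → refl)

      ev-ξ : ∀ n (f : Model 𝕊 n) → ev₀ (ξA 𝕊 n f) ≡ ξA F n (evM f)
      ev-ξ two   f = refl
      ev-ξ three f = refl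
      ev-ξ four  f = refl

      ev-Dgen : ∀ n (f : Model 𝕊 n) i → ev₀ (DgenA 𝕊 n f i) ≡ DgenA F n (evM f) i
      ev-Dgen two   f = gather {n = 3} (spread {n = 3} {P = λ i → DgenA F two (evM f) i ≡ DgenA F two (evM f) i} λ _ → refl)
      ev-Dgen three f = gather {n = 2} (spread {n = 2} {P = λ i → DgenA F three (evM f) i ≡ DgenA F three (evM f) i} λ _ → refl)
      ev-Dgen four  f = gather {n = 4} (spread {n = 4} {P = λ i → DgenA F four (evM f) i ≡ DgenA F four (evM f) i} λ _ → refl)

      ev-DA : ∀ n (f : Model 𝕊 n) x → ev₀ (DA 𝕊 n f x) ≡ DA F n (evM f) (ev₀ x)
      ev-DA two   f = ev-extDer _ _ (ev-Dgen two f)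
      ev-DA three f = ev-extDer _ _ (ev-Dgen three f)
      ev-DA four  f = ev-extDer _ _ (ev-Dgen four f)

    module _ (a b : F.Carrier) (ab : a F.* b F.≈ F.1#) (xs : List F.Carrier) where
      private
        ρ = env F a b xs

      vanish-rels : ∀ n (f : Model 𝕊 n) {g k} (S : Fin k → NC F g) (θ : ℕ → NC F g) →
        (∀ i → Eqv F S (evN F ρ θ (relsA 𝕊 n f i)) (con F.0#)) → Identity.Vanish F S ρ ab θ (relList n f)
      vanish-rels n f S θ h = go (relsA 𝕊 n f) h
        where
        go : ∀ {m} (r : Fin m → NC 𝕊 (ngen 𝕊 n)) → (∀ i → Eqv F S (evN F ρ θ (r i)) (con F.0#)) →
          Identity.Vanish F S ρ ab θ (tabulate r)
        go {zero}  r h = lift tt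
        go {suc m} r h = h zero , go (r ∘ suc) (h ∘ suc)

      step-η : ∀ n (s : StepData n) → T (okL (StepData.Rs s)) → T ((StepData.ηCheck s) n (StepData.source s) (StepData.target s) (StepData.image s)) →
        EtaClause F n (evS F ρ (StepData.factor s)) (evM ρ (StepData.source s)) (evM ρ (StepData.target s)) (sub F (λ i → ev₀ ρ ((StepData.image s) i)))
      step-η three s _ _ = lift _
      step-η four  s _ _ = lift _
      step-η two   s o t = trans′ (reflexive (≡.sym (ev-sub ρ θ image (ηA 𝕊 two target))))
        (I.identity Rs o van monic depth (sub 𝕊 image (ηA 𝕊 two target)) (_·_ 𝕊 (factor :* factor :* factor) (ηA 𝕊 two source)) [] t)
        where
        open StepData s
        θ : ℕ → NC F 3
        θ = letters F []
        S = relsA F two (evM ρ source)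
        module I = Identity F S ρ ab θ
        reflexive : ∀ {x y} → x ≡ y → Eqv F S x y
        reflexive refl = refl′
        van = vanish-rels two source S θ (λ i → trans′ (reflexive (ev-rels ρ two source i)) (rel i))

      step : ∀ n (s : StepData n) → T (StepData.ok? s) → Step F n (evS F ρ (StepData.factor s)) (evM ρ (StepData.source s)) (evM ρ (StepData.target s))
      step n s t = record
        { ψ    = Ψ
        ; ok   = λ i → trans′ (reflexive (≡.sym (≡.trans (ev-sub ρ θ image (relsA 𝕊 n target i)) (≡.cong (sub F Ψ) (ev-rels ρ n target i)))))
                   (I.identity Rs okRs van monic depth (sub 𝕊 image (relsA 𝕊 n target i)) (con 𝟘) (ok-cert i) (allB-sound okCheck t₂ i))
        ; ρ    = evS F ρ const
        ; ξ-eq = trans′ (reflexive (≡.sym (≡.trans (ev-sub ρ θ image (ξA 𝕊 n target)) (≡.cong (sub F Ψ) (ev-ξ ρ n target)))))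
                   (trans′ (I.identity Rs okRs van monic depth ξ-lhs ξ-rhs ξ-cert t₄)
                     (reflexive (≡.cong (λ z → _·_ F (evS F ρ factor F.* evS F ρ factor) z ⊕ con (evS F ρ const)) (ev-ξ ρ n source))))
        ; κ    = ev₀ ρ inner
        ; D-eq = λ i → trans′ (reflexive (≡.sym (≡.trans (ev-sub ρ θ image (DA 𝕊 n target (gen i))) (≡.cong (sub F Ψ)
                     (≡.trans (ev-DA ρ n target (gen i)) (≡.cong (DA F n _) (nth-tabulate gen [] i)))))))
                   (trans′ (I.identity Rs okRs van monic depth (D-lhs i) (D-rhs i) (D-cert i) (allB-sound D-check t₆ i))
                     (reflexive (≡.cong (λ z → _·_ F (evS F ρ factor) z ⊕ ⟦_,_⟧ F (ev₀ ρ inner) (Ψ i)) (ev-DA ρ n source (image i)))))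
        ; η-eq = step-η n s okRs t₇ }
        where
        open StepData s
        θ : ℕ → NC F (ngen F n)
        θ = letters F []
        Ψ : Subst F n
        Ψ i = ev₀ ρ (image i)
        S = relsA F n (evM ρ source)
        module I = Identity F S ρ ab θ
        reflexive : ∀ {x y} → x ≡ y → Eqv F S x y
        reflexive refl = refl′
        van = vanish-rels n source S θ (λ i → trans′ (reflexive (ev-rels ρ n source i)) (rel i))
        okRs = proj₁ (T-∧ {okL Rs} t)
        t₁ = proj₂ (T-∧ {okL Rs} t)
        t₂ = proj₁ (T-∧ {allB okCheck} t₁)
        t₃ = proj₂ (T-∧ {allB okCheck} t₁)
        t₄ = proj₁ (T-∧ {identity? depth Rs monic ξ-lhs ξ-rhs ξ-cert} t₃)
        t₅ = proj₂ (T-∧ {identity? depth Rs monic ξ-lhs ξ-rhs ξ-cert} t₃)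
        t₆ = proj₁ (T-∧ {allB D-check} t₅)
        t₇ = proj₂ (T-∧ {allB D-check} t₅)

    module _ {g k : ℕ} (S : Fin k → NC F g) where
      evS-cong : ∀ {ρ ρ′ : ℕ → F.Carrier} → (∀ k → ρ k F.≈ ρ′ k) → ∀ x → T (okS x) → evS F ρ x F.≈ evS F ρ′ x
      evS-cong h (var k)  e = h k
      evS-cong h 𝟘        e = F.refl
      evS-cong h 𝟙        e = F.refl
      evS-cong h (x :+ y) t = let p , q = T-∧ {okS x} t in F.+-cong (evS-cong h x p) (evS-cong h y q)
      evS-cong h (x :* y) t = let p , q = T-∧ {okS x} t in F.*-cong (evS-cong h x p) (evS-cong h y q)
      evS-cong h (:- x)   t = F.-‿cong (evS-cong h x t)
      evS-cong h (inv (𝟙 :+ 𝟙)) t = F.refl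

      evN-cong : ∀ {ρ ρ′ : ℕ → F.Carrier} {θ : ℕ → NC F g} → (∀ k → ρ k F.≈ ρ′ k) → ∀ {h} (x : NC 𝕊 h) → T (okN x) →
        Eqv F S (evN F ρ θ x) (evN F ρ′ θ x)
      evN-cong h (con a) t = con-cong (evS-cong h a t)
      evN-cong h (gen i) t = refl′
      evN-cong h (x ⊕ y) t = let p , q = T-∧ {okN x} t in ⊕-cong (evN-cong h x p) (evN-cong h y q)
      evN-cong h (x ⊗ y) t = let p , q = T-∧ {okN x} t in ⊗-cong (evN-cong h x p) (evN-cong h y q)

    module _ {n : Deg} where
      modelEnv : Model F n → ℕ → F.Carrier
      modelEnv f = env F F.1# F.1# (tabulate f)

      nth-cong : ∀ {m} (f f′ : Fin m → F.Carrier) → (∀ i → f i F.≈ f′ i) → ∀ k →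
        nth F.0# (tabulate f) k F.≈ nth F.0# (tabulate f′) k
      nth-cong {zero}  f f′ h k       = F.refl
      nth-cong {suc m} f f′ h zero    = h zero
      nth-cong {suc m} f f′ h (suc k) = nth-cong (f ∘ suc) (f′ ∘ suc) (h ∘ suc) k

      modelEnv-cong : ∀ {f f′ : Model F n} → (∀ i → f i F.≈ f′ i) → ∀ k → modelEnv f k F.≈ modelEnv f′ k
      modelEnv-cong h zero          = F.refl
      modelEnv-cong h (suc zero)    = F.refl
      modelEnv-cong {f} {f′} h (suc (suc k)) = nth-cong f f′ h k

    -- Both sides are values of one generic expression at two vectors of coefficients.
    rels-cong : ∀ n {f f′ : Model F n} → (∀ i → f i F.≈ f′ i) → ∀ {k} (S : Fin k → NC F (ngen F n)) i →
      Eqv F S (relsA F n f i) (relsA F n f′ i)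
    rels-cong two {f} {f′} h S = gather {n = 5} (spread {n = 5}
      {P = λ i → Eqv F S (ev₀ (modelEnv {two} f) (relsA 𝕊 two (varModel two) i)) (ev₀ (modelEnv {two} f′) (relsA 𝕊 two (varModel two) i))}
      λ i → evN-cong S (modelEnv-cong {two} h) (relsA 𝕊 two (varModel two) i) (allB-sound (λ i → okN (relsA 𝕊 two (varModel two) i)) tt i))
    rels-cong three {f} {f′} h S = gather {n = 4} (spread {n = 4}
      {P = λ i → Eqv F S (ev₀ (modelEnv {three} f) (relsA 𝕊 three (varModel three) i)) (ev₀ (modelEnv {three} f′) (relsA 𝕊 three (varModel three) i))}
      λ i → evN-cong S (modelEnv-cong {three} h) (relsA 𝕊 three (varModel three) i) (allB-sound (λ i → okN (relsA 𝕊 three (varModel three) i)) tt i))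
    rels-cong four {f} {f′} h S = gather {n = 9} (spread {n = 9}
      {P = λ i → Eqv F S (ev₀ (modelEnv {four} f) (relsA 𝕊 four (varModel four) i)) (ev₀ (modelEnv {four} f′) (relsA 𝕊 four (varModel four) i))}
      λ i → evN-cong S (modelEnv-cong {four} h) (relsA 𝕊 four (varModel four) i) (allB-sound (λ i → okN (relsA 𝕊 four (varModel four) i)) tt i))

    ξ-cong : ∀ n {f f′ : Model F n} → (∀ i → f i F.≈ f′ i) → ∀ {k} (S : Fin k → NC F (ngen F n)) →
      Eqv F S (ξA F n f) (ξA F n f′)
    ξ-cong two   h S = evN-cong S {θ = letters F []} (modelEnv-cong {two} h) (ξA 𝕊 two (varModel two)) tt
    ξ-cong three h S = evN-cong S {θ = letters F []} (modelEnv-cong {three} h) (ξA 𝕊 three (varModel three)) tt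
    ξ-cong four  h S = evN-cong S {θ = letters F []} (modelEnv-cong {four} h) (ξA 𝕊 four (varModel four)) tt

    Dgen-cong : ∀ n {f f′ : Model F n} → (∀ i → f i F.≈ f′ i) → ∀ {k} (S : Fin k → NC F (ngen F n)) i →
      Eqv F S (DA F n f (gen i)) (DA F n f′ (gen i))
    Dgen-cong two {f} {f′} h S = gather {n = 3} (spread {n = 3}
      {P = λ i → Eqv F S (ev₀ (modelEnv {two} f) (DgenA 𝕊 two (varModel two) i)) (ev₀ (modelEnv {two} f′) (DgenA 𝕊 two (varModel two) i))}
      λ i → evN-cong S (modelEnv-cong {two} h) (DgenA 𝕊 two (varModel two) i) (allB-sound (λ i → okN (DgenA 𝕊 two (varModel two) i)) tt i))
    Dgen-cong three {f} {f′} h S = gather {n = 2} (spread {n = 2}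
      {P = λ i → Eqv F S (ev₀ (modelEnv {three} f) (DgenA 𝕊 three (varModel three) i)) (ev₀ (modelEnv {three} f′) (DgenA 𝕊 three (varModel three) i))}
      λ i → evN-cong S (modelEnv-cong {three} h) (DgenA 𝕊 three (varModel three) i) (allB-sound (λ i → okN (DgenA 𝕊 three (varModel three) i)) tt i))
    Dgen-cong four {f} {f′} h S = gather {n = 4} (spread {n = 4}
      {P = λ i → Eqv F S (ev₀ (modelEnv {four} f) (DgenA 𝕊 four (varModel four) i)) (ev₀ (modelEnv {four} f′) (DgenA 𝕊 four (varModel four) i))}
      λ i → evN-cong S (modelEnv-cong {four} h) (DgenA 𝕊 four (varModel four) i) (allB-sound (λ i → okN (DgenA 𝕊 four (varModel four) i)) tt i))

    sub-gen : ∀ {g} (x : NC F g) → sub F gen x ≡ x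
    sub-gen (con a) = refl
    sub-gen (gen i) = refl
    sub-gen (x ⊕ y) = ≡.cong₂ _⊕_ (sub-gen x) (sub-gen y)
    sub-gen (x ⊗ y) = ≡.cong₂ _⊗_ (sub-gen x) (sub-gen y)

    -- Coefficients are compared by ≈, so models with equal coefficients may still have different
    -- relations as expressions; this step with δ = 1 passes between them.
    equalStep : ∀ {n} {f f′ : Model F n} → (∀ i → f i F.≈ f′ i) → Step F n F.1# f f′
    equalStep {n} {f} {f′} h = record
      { ψ = gen
      ; ok = λ i → ⟪ sub-gen _ ⟫ (trans′ (rels-cong n (λ i → F.sym (h i)) S i) (rel i))
      ; ρ = F.0#
      ; ξ-eq = ⟪ sub-gen _ ⟫ (trans (ξ-cong n (λ i → F.sym (h i)) S) (sym (trans (+-identityʳ _)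
          (trans (*-congʳ (con-cong (F.*-identityˡ _))) (*-identityˡ _)))))
      ; κ = con F.0#
      ; D-eq = λ i → ⟪ sub-gen _ ⟫ (trans (Dgen-cong n (λ i → F.sym (h i)) S i) (sym (trans (+-cong (*-identityˡ _)
          (trans (+-cong (zeroˡ _) (trans (*-congˡ (zeroʳ _)) (zeroʳ _))) (+-identityˡ _))) (+-identityʳ _))))
      ; η-eq = eta n h }
      where
      S = relsA F n f
      open Ring (ncRing F S) hiding (zero)
      ⟪_⟫ : ∀ {x x′ y} → x ≡ x′ → Eqv F S x′ y → Eqv F S x y
      ⟪ refl ⟫ p = p
      eta : ∀ n {f f′ : Model F n} → (∀ i → f i F.≈ f′ i) → EtaClause F n F.1# f f′ (sub F gen)
      eta two h = trans′ (sym′ (⊗-idˡ _)) (⊗-cong (con-cong (F.sym (F.trans (F.*-congʳ (F.*-identityˡ _)) (F.*-identityˡ _)))) refl′)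
      eta three h = lift _
      eta four  h = lift _

    conn-≈ : ∀ {n} {f f′ : Model F n} → (∀ i → f i F.≈ f′ i) → Conn F n F.1# f f′
    conn-≈ h = connect₂ F (equalStep h) (equalStep (λ i → F.sym (h i))) (λ _ → refl′) (λ _ → refl′)

    conn-δ : ∀ {n δ δ′} {f f′ : Model F n} → δ F.≈ δ′ → Conn F n δ f f′ → Conn F n δ′ f f′
    conn-δ {n} {δ} {δ′} {f} {f′} e C = record
      { iso = iso ; ρ = ρ ; κ = κ
      ; ξ-eq = trans′ ξ-eq (⊕-cong (⊗-cong (con-cong (F.*-cong e e)) refl′) refl′)
      ; D-eq = λ x → trans′ (D-eq x) (⊕-cong (⊗-cong (con-cong e) refl′) refl′)
      ; η-eq = eta n η-eq }
      where
      open Conn C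
      eta : ∀ n {f f′ : Model F n} {ψ} → EtaClause F n δ f f′ ψ → EtaClause F n δ′ f f′ ψ
      eta two h = trans′ h (⊗-cong (con-cong (F.*-cong (F.*-cong e e) e)) refl′)
      eta three h = lift _
      eta four  h = lift _

    conn-resp : ∀ {n δ} {f f₁ f′ f₁′ : Model F n} → (∀ i → f i F.≈ f₁ i) → (∀ i → f₁′ i F.≈ f′ i) →
      Conn F n δ f₁ f₁′ → Conn F n δ f f′
    conn-resp {δ = δ} h h′ C = conn-δ (F.trans (F.*-identityˡ _) (F.*-identityʳ _))
      (conn-trans F (conn-trans F (conn-≈ h) C) (conn-≈ h′))

open Steps public

-- Substitutions in degree 2

module Degree2 where
  record MoveData (n : Deg) : Set where
    field
      stepData  : StepData n
    open StepData stepData public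
    field
      back       : Fin (ngen 𝕊 n) → NC 𝕊 (ngen 𝕊 n)
      back-monic : List Monic
      back-cert  : Fin (nrel 𝕊 n) → Cert

    back? : Fin (nrel 𝕊 n) → Bool
    back? i = identity? depth (relList n target) back-monic (sub 𝕊 back (relsA 𝕊 n source i)) (con 𝟘) (back-cert i)

    inverse₁? inverse₂? : Fin (ngen 𝕊 n) → Bool
    inverse₁? i = identity? depth (relList n target) back-monic (sub 𝕊 back (image i)) (gen i) []
    inverse₂? i = identity? depth (relList n source) monic (sub 𝕊 image (back i)) (gen i) []

    move? : Bool
    move? = ok? ∧ okL (relList n target) ∧ allB back? ∧ allB inverse₁? ∧ allB inverse₂?

  module _ {c ℓ : Level} (F : Field c ℓ) where
    private module F = Field F

    module _ (a b : F.Carrier) (ab : a F.* b F.≈ F.1#) (xs : List F.Carrier) where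
      private
        ρ = env F a b xs

      move : ∀ {n} (m : MoveData n) → T (MoveData.move? m) → Conn F n (evS F ρ (MoveData.factor m)) (evM F ρ (MoveData.source m)) (evM F ρ (MoveData.target m))
      move {n} m t = connect F (step F a b ab xs n stepData (proj₁ (T-∧ {ok?} t))) Φ
        (λ i → trans′ (reflexive (≡.sym (≡.trans (ev-sub F ρ θ back (relsA 𝕊 n source i)) (≡.cong (sub F Φ) (ev-rels F ρ n source i)))))
          (I′.identity (relList n target) okT van back-monic depth (sub 𝕊 back (relsA 𝕊 n source i)) (con 𝟘) (back-cert i)
            (allB-sound back? (proj₁ (T-∧ {allB back?} t₂)) i)))
        (λ i → trans′ (reflexive (≡.sym (ev-sub F ρ θ back (image i)))) (trans′
          (I′.identity (relList n target) okT van back-monic depth (sub 𝕊 back (image i)) (gen i) [] (allB-sound inverse₁? (proj₁ (T-∧ {allB inverse₁?} t₃)) i))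
          (reflexive (nth-tabulate gen [] i))))
        (λ i → trans′ (reflexive (≡.sym (ev-sub F ρ θ image (back i)))) (trans′
          (I.identity (relList n source) (proj₁ (T-∧ {okL Rs} (proj₁ (T-∧ {ok?} t)))) vanS monic depth (sub 𝕊 image (back i)) (gen i) []
            (allB-sound inverse₂? (proj₂ (T-∧ {allB inverse₁?} t₃)) i))
          (reflexive (nth-tabulate gen [] i))))
        where
        open MoveData m
        t₁ = proj₂ (T-∧ {ok?} t)
        okT = proj₁ (T-∧ {okL (relList n target)} t₁)
        t₂ = proj₂ (T-∧ {okL (relList n target)} t₁)
        t₃ = proj₂ (T-∧ {allB back?} t₂)
        θ : ℕ → NC F (ngen F n)
        θ = letters F []
        Φ : Subst F n
        Φ i = ev₀ F ρ (back i)
        S = relsA F n (evM F ρ source)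
        S′ = relsA F n (evM F ρ target)
        module I = Identity F S ρ ab θ
        module I′ = Identity F S′ ρ ab θ
        reflexive : ∀ {g k} {S : Fin k → NC F g} {x y} → x ≡ y → Eqv F S x y
        reflexive refl = refl′
        van = vanish-rels F a b ab xs n target S′ θ (λ i → trans′ (reflexive (ev-rels F ρ n target i)) (rel i))
        vanS = vanish-rels F a b ab xs n source S θ (λ i → trans′ (reflexive (ev-rels F ρ n source i)) (rel i))

    evVar : ∀ n a b (f : Model F n) xs i → f i F.≈ evM F (env F a b (tabulate f ++ᴸ xs)) (varModel n) i
    evVar n a b f xs i = F.reflexive (≡.sym (nth-tabulate f xs i))

  module Moves2 {c ℓ : Level} (F : Field c ℓ) where
    open Field F using (Carrier; _+_; _*_)
    private
      n₂ n₃ n₄ n₆ : Carrier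
      n₂ = nat F 2
      n₃ = nat F 3
      n₄ = nat F 4
      n₆ = nat F 6

    -- Coefficients of f(x, z + wx). In the same way `flip₂`, `scale₂` and `twist₂` are f(z, x),
    -- f(gx, z) and g² f(x, z).
    shear₂ : Carrier → Model F two → Model F two
    shear₂ w f = lookup
      ( a + w * b + w * w * c₀ + w * w * w * d + w * w * w * w * e
      ∷ b + n₂ * w * c₀ + n₃ * w * w * d + n₄ * w * w * w * e
      ∷ c₀ + n₃ * w * d + n₆ * w * w * e ∷ d + n₄ * w * e ∷ e ∷ [])
      where open Two F f using (a; b; d; e) renaming (c′ to c₀)

    flip₂ : Model F two → Model F two
    flip₂ f = lookup (e ∷ d ∷ c₀ ∷ b ∷ a ∷ [])
      where open Two F f using (a; b; d; e) renaming (c′ to c₀)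

    scale₂ : Carrier → Model F two → Model F two
    scale₂ g f = lookup (g * g * g * g * a ∷ g * g * g * b ∷ g * g * c₀ ∷ g * d ∷ e ∷ [])
      where open Two F f using (a; b; d; e) renaming (c′ to c₀)

    twist₂ : Carrier → Model F two → Model F two
    twist₂ g f = lookup (g * g * a ∷ g * g * b ∷ g * g * c₀ ∷ g * g * d ∷ g * g * e ∷ [])
      where open Two F f using (a; b; d; e) renaming (c′ to c₀)

  private
    R S T′ : NC 𝕊 3
    R = gen (# 0)
    S = gen (# 1)
    T′ = gen (# 2)
    infixr 7 _⋆_
    _⋆_ : ∀ {g} → SE → NC 𝕊 g → NC 𝕊 g
    _⋆_ = _·_ 𝕊
    monic₂ : List Monic
    monic₂ = (0 ∷ 0 ∷ [] , :- 𝟙 , 0) ∷ (1 ∷ 0 ∷ [] , :- 𝟙 , 1) ∷ (2 ∷ 0 ∷ [] , :- 𝟙 , 2)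
           ∷ (2 ∷ 1 ∷ [] , :- 𝟙 , 3) ∷ (2 ∷ 2 ∷ [] , :- 𝟙 , 4) ∷ []
    w : SE
    w = var 7
    module M₂ = Moves2 𝕊

    data₂ : Model 𝕊 two → SE → SE → NC 𝕊 3 → (image back : Fin 3 → NC 𝕊 3) → MoveData two
    data₂ target factor const inner image back = record
      { stepData = record
        { source = varModel two ; target = target ; image = image ; factor = factor ; const = const ; inner = inner
        ; depth = 12 ; monic = monic₂ ; ok-cert = λ _ → [] ; ξ-cert = [] ; D-cert = λ _ → [] }
      ; back = back ; back-monic = monic₂ ; back-cert = λ _ → [] }

    -- Since (rx² + sxz + tz²)² = f(x, z) with x, z central, substituting z + wx for z turns (r, s,
    -- t) into (r + ws + w²t, s + 2wt, t); the others are read off likewise. The constant of the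
    -- shear is the difference between (s + 2wt)² - s² = 2wd + 4w²e and the change 3wd + 6w²e of c.
    shearData₂ flipData₂ scaleData₂ twistData₂ : MoveData two
    shearData₂ = data₂ (M₂.shear₂ w (varModel two)) 𝟙 (:- (w :* var 5 :+ nat 𝕊 2 :* w :* w :* var 6)) (w ⋆ T′)
      (lookup (R ⊕ w ⋆ S ⊕ (w :* w) ⋆ T′ ∷ S ⊕ (nat 𝕊 2 :* w) ⋆ T′ ∷ T′ ∷ []))
      (lookup (R ⊕ (:- w) ⋆ S ⊕ (w :* w) ⋆ T′ ∷ S ⊕ (:- (nat 𝕊 2 :* w)) ⋆ T′ ∷ T′ ∷ []))
    flipData₂ = data₂ (M₂.flip₂ (varModel two)) (:- 𝟙) 𝟘 S (lookup (T′ ∷ S ∷ R ∷ [])) (lookup (T′ ∷ S ∷ R ∷ []))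
    scaleData₂ = data₂ (M₂.scale₂ (var 0) (varModel two)) (var 0) 𝟘 (con 𝟘)
      (lookup ((var 0 :* var 0) ⋆ R ∷ var 0 ⋆ S ∷ T′ ∷ [])) (lookup ((var 1 :* var 1) ⋆ R ∷ var 1 ⋆ S ∷ T′ ∷ []))
    twistData₂ = data₂ (M₂.twist₂ (var 0) (varModel two)) (var 0) 𝟘 (con 𝟘)
      (lookup (var 0 ⋆ R ∷ var 0 ⋆ S ∷ var 0 ⋆ T′ ∷ [])) (lookup (var 1 ⋆ R ∷ var 1 ⋆ S ∷ var 1 ⋆ T′ ∷ []))

  module Conn2 {c ℓ : Level} (F : Field c ℓ) where
    private module F = Field F
    open Moves2 F public

    private
      ⟨_⟩ : ∀ {f : Model F two} (h : Model F two) → AllF 5 (λ i → f i F.≈ h i) → ∀ i → f i F.≈ h i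
      ⟨ h ⟩ = gather

      refls : ∀ (h : Model F two) → AllF 5 (λ i → h i F.≈ h i)
      refls h = spread {P = λ i → h i F.≈ h i} λ _ → F.refl

    conn-shear₂ : ∀ w f → Conn F two F.1# f (shear₂ w f)
    conn-shear₂ w f = conn-resp F (evVar F two F.1# F.1# f (w ∷ [])) (gather (refls (shear₂ w f)))
      (move F F.1# F.1# (F.*-identityˡ _) (tabulate f ++ᴸ w ∷ []) shearData₂ tt)

    conn-flip₂ : ∀ f → Conn F two (F.- F.1#) f (flip₂ f)
    conn-flip₂ f = conn-resp F (evVar F two F.1# F.1# f []) (gather (refls (flip₂ f)))
      (move F F.1# F.1# (F.*-identityˡ _) (tabulate f ++ᴸ []) flipData₂ tt)

    conn-scale₂ : ∀ {g h} → g F.* h F.≈ F.1# → ∀ f → Conn F two g f (scale₂ g f)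
    conn-scale₂ {g} {h} e f = conn-resp F (evVar F two g h f []) (gather (refls (scale₂ g f)))
      (move F g h e (tabulate f ++ᴸ []) scaleData₂ tt)

    conn-twist₂ : ∀ {g h} → g F.* h F.≈ F.1# → ∀ f → Conn F two g f (twist₂ g f)
    conn-twist₂ {g} {h} e f = conn-resp F (evVar F two g h f []) (gather (refls (twist₂ g f)))
      (move F g h e (tabulate f ++ᴸ []) twistData₂ tt)

open Degree2 public

-- Substitutions in degree 3

module Degree3 where
  module Moves3 {c ℓ : Level} (F : Field c ℓ) where
    open Field F using (Carrier; _+_; _*_)

    -- Coefficients of f(x, y + tx, z). The models after it are f(x, y, z + tx), f(y, x, z), f(gx,
    -- y, z), g f and f(z, y, x).
    shear₃ : Carrier → Model F three → Model F three
    shear₃ t f = lookup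
      ( a + t * a2 + t * t * b1 + t * t * t * b ∷ b ∷ c₀ ∷ a2 + nat F 2 * t * b1 + nat F 3 * t * t * b
      ∷ a3 + t * m + t * t * b3 ∷ b1 + nat F 3 * t * b ∷ b3 ∷ c1 + t * c2 ∷ c2 ∷ m + nat F 2 * t * b3 ∷ [])
      where open Three F f using (a; b; a2; a3; b1; b3; c1; c2; m) renaming (c′ to c₀)

    lift₃ : Carrier → Model F three → Model F three
    lift₃ t f = lookup
      ( a + t * a3 + t * t * c1 + t * t * t * c₀ ∷ b ∷ c₀ ∷ a2 + t * m + t * t * c2
      ∷ a3 + nat F 2 * t * c1 + nat F 3 * t * t * c₀ ∷ b1 + t * b3 ∷ b3 ∷ c1 + nat F 3 * t * c₀ ∷ c2
      ∷ m + nat F 2 * t * c2 ∷ [])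
      where open Three F f using (a; b; a2; a3; b1; b3; c1; c2; m) renaming (c′ to c₀)

    flip₃ : Model F three → Model F three
    flip₃ f = lookup (b ∷ a ∷ c₀ ∷ b1 ∷ b3 ∷ a2 ∷ a3 ∷ c2 ∷ c1 ∷ m ∷ [])
      where open Three F f using (a; b; a2; a3; b1; b3; c1; c2; m) renaming (c′ to c₀)

    scale₃ : Carrier → Model F three → Model F three
    scale₃ g f = lookup
      (g * g * g * a ∷ b ∷ c₀ ∷ g * g * a2 ∷ g * g * a3 ∷ g * b1 ∷ b3 ∷ g * c1 ∷ c2 ∷ g * m ∷ [])
      where open Three F f using (a; b; a2; a3; b1; b3; c1; c2; m) renaming (c′ to c₀)

    twist₃ : Carrier → Model F three → Model F three
    twist₃ g f = lookup
      (g * a ∷ g * b ∷ g * c₀ ∷ g * a2 ∷ g * a3 ∷ g * b1 ∷ g * b3 ∷ g * c1 ∷ g * c2 ∷ g * m ∷ [])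
      where open Three F f using (a; b; a2; a3; b1; b3; c1; c2; m) renaming (c′ to c₀)

    swap₃ : Model F three → Model F three
    swap₃ f = lookup (c₀ ∷ b ∷ a ∷ c2 ∷ c1 ∷ b3 ∷ b1 ∷ a3 ∷ a2 ∷ m ∷ [])
      where open Three F f using (a; b; a2; a3; b1; b3; c1; c2; m) renaming (c′ to c₀)

  module Data₃ where
    X Y : NC 𝕊 2
    X = gen (# 0)
    Y = gen (# 1)
    infixr 7 _⋆_
    _⋆_ : ∀ {g} → SE → NC 𝕊 g → NC 𝕊 g
    _⋆_ = _·_ 𝕊
    module M₃ = Moves3 𝕊

    monic₃ : SE → List Monic
    monic₃ s = (0 ∷ 0 ∷ 0 ∷ [] , s , 0) ∷ (1 ∷ 0 ∷ 0 ∷ [] , s , 1) ∷ (1 ∷ 1 ∷ 0 ∷ [] , s , 2) ∷ (1 ∷ 1 ∷ 1 ∷ [] , s , 3) ∷ []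

    -- With c = 1 the relations are rewriting rules without division. The coefficient a is an
    -- argument, since the swap needs it to be the invertible variable `var 0`.
    unitary₃ : SE → Model 𝕊 three
    unitary₃ a = lookup (a ∷ var 3 ∷ 𝟙 ∷ var 5 ∷ var 6 ∷ var 7 ∷ var 8 ∷ var 9 ∷ var 10 ∷ var 11 ∷ [])

    data₃ : (source target : Model 𝕊 three) → SE → SE → NC 𝕊 2 → (image back : Fin 2 → NC 𝕊 2) → (s s′ : List Monic) →
      (okc backc : Fin 4 → Cert) → MoveData three
    data₃ source target factor const inner image back s s′ okc backc = record
      { stepData = record
        { source = source ; target = target ; image = image ; factor = factor ; const = const ; inner = inner
        ; depth = 20 ; monic = s ; ok-cert = okc ; ξ-cert = [] ; D-cert = λ _ → [] }
      ; back = back ; back-monic = s′ ; back-cert = backc }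

    m₁ : List Monic
    m₁ = monic₃ (:- 𝟙)

    scalar : (Fin 4 → SE) → Fin 4 → Cert
    scalar h i = (h i , [] , toℕ i , []) ∷ []

    none : Fin 4 → Cert
    none _ = []

    t : SE
    t = var 12

    -- The images make αx′ + βy′ equal to αX + (β + tα)Y for the shear and to αX + βY - tα for the
    -- lift. In `scaleData₃` and `twistData₃` the coefficient c is arbitrary and nothing is
    -- rewritten; each new relation is a multiple of the old one.
    shearData₃ liftData₃ flipData₃ scaleData₃ twistData₃ swapData₃ : MoveData three
    shearData₃ = data₃ (unitary₃ (var 2)) (M₃.shear₃ t (unitary₃ (var 2))) 𝟙
      (var 3 :* var 9 :* t :+ nat 𝕊 2 :* var 3 :* var 10 :* t :* t :+ var 7 :* var 10 :* t) (con 𝟘)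
      (lookup (X ⊕ t ⋆ Y ∷ Y ∷ [])) (lookup (X ⊕ (:- t) ⋆ Y ∷ Y ∷ [])) m₁ m₁ none none
    liftData₃ = data₃ (unitary₃ (var 2)) (M₃.lift₃ t (unitary₃ (var 2))) 𝟙
      (var 7 :* t :+ var 8 :* var 9 :* t :+ nat 𝕊 2 :* var 8 :* t :* t) ((:- t) ⋆ Y)
      (lookup (X ⊕ con (:- t) ∷ Y ∷ [])) (lookup (X ⊕ con t ∷ Y ∷ [])) m₁ m₁ none none
    flipData₃ = data₃ (unitary₃ (var 2)) (M₃.flip₃ (unitary₃ (var 2))) (:- 𝟙) 𝟘 (con 𝟘)
      (lookup (Y ∷ X ∷ [])) (lookup (Y ∷ X ∷ [])) m₁ m₁ none none
    scaleData₃ = data₃ (varModel three) (M₃.scale₃ (var 0) (varModel three)) (var 0) 𝟘 (con 𝟘)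
      (lookup (var 0 ⋆ X ∷ Y ∷ [])) (lookup (var 1 ⋆ X ∷ Y ∷ [])) [] []
      (scalar (lookup (g :* g :* g ∷ g :* g ∷ g ∷ 𝟙 ∷ []))) (scalar (lookup (h :* h :* h ∷ h :* h ∷ h ∷ 𝟙 ∷ [])))
      where
      g = var 0
      h = var 1
    twistData₃ = data₃ (varModel three) (M₃.twist₃ (var 0) (varModel three)) (var 0) 𝟘 (con 𝟘)
      (lookup (X ∷ Y ∷ [])) (lookup (X ∷ Y ∷ [])) [] [] (scalar (λ _ → var 0)) (scalar (λ _ → var 1))
    swapData₃ = data₃ (unitary₃ (var 0)) (M₃.swap₃ (unitary₃ (var 0))) (:- 𝟙) 𝟘 ((:- 𝟙) ⋆ (Y ⊗ X ⊕ var 9 ⋆ Y))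
      (lookup (u ∷ (:- 𝟙) ⋆ (Y ⊗ u) ∷ [])) (lookup (v ∷ (:- 𝟙) ⋆ (Y ⊗ v) ∷ [])) m₁ (monic₃ (:- (var 1))) none none
      where
      u v : NC 𝕊 2
      -- u is x⁻¹ by the cubic x³ + c₁x² + a₃x + a = 0, and v is x⁻¹ in the swapped algebra, where a
      -- is the leading coefficient. The images x⁻¹ and -yx⁻¹ come from solving (αx′ + βy′)x + βy =
      -- α.
      u = (:- (var 1)) ⋆ (X ⊗ X ⊕ var 9 ⋆ X ⊕ con (var 6))
      v = (:- 𝟙) ⋆ (var 0 ⋆ (X ⊗ X) ⊕ var 6 ⋆ X ⊕ con (var 9))

  open Data₃ using (shearData₃; liftData₃; flipData₃; scaleData₃; twistData₃; swapData₃) public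

  module Conn3 {c ℓ : Level} (F : Field c ℓ) where
    private module F = Field F
    open Moves3 F public

    private
      refls : ∀ (h : Model F three) → AllF 10 (λ i → h i F.≈ h i)
      refls h = spread {P = λ i → h i F.≈ h i} λ _ → F.refl

    conn-scale₃ : ∀ {g h} → g F.* h F.≈ F.1# → ∀ f → Conn F three g f (scale₃ g f)
    conn-scale₃ {g} {h} e f = conn-resp F (evVar F three g h f []) (gather (refls (scale₃ g f)))
      (move F g h e (tabulate f ++ᴸ []) scaleData₃ tt)

    conn-twist₃ : ∀ {g h} → g F.* h F.≈ F.1# → ∀ f → Conn F three g f (twist₃ g f)
    conn-twist₃ {g} {h} e f = conn-resp F (evVar F three g h f []) (gather (refls (twist₃ g f)))
      (move F g h e (tabulate f ++ᴸ []) twistData₃ tt)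

open Degree3 public

-- Substitutions in degree 4 that preserve the line {x₃ = x₄ = 0}

module Degree4 where
  module Moves4 {c ℓ : Level} (F : Field c ℓ) where
    open Field F using (Carrier; _+_; _*_)

    Form : Set c
    Form = Fin 10 → Carrier

    each : (Form → Form) → Model F four → Model F four
    each T f = [ T (fst4 F f) , T (snd4 F f) ]′ ∘ splitAt 10

    private
      module Coeffs (g : Form) where
        g1 g2 g3 g4 g5 g6 g7 g8 g9 g10 : Carrier
        g1 = g (# 0)
        g2 = g (# 1)
        g3 = g (# 2)
        g4 = g (# 3)
        g5 = g (# 4)
        g6 = g (# 5)
        g7 = g (# 6)
        g8 = g (# 7)
        g9 = g (# 8)
        g10 = g (# 9)
      2# = nat F 2

    -- The substitutions of x₂ + tx₁ for x₂, x₄ + tx₃ for x₄, x₁ + tx₃ for x₁, and hx₃ for x₃.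
    shearForm₁₂ shearForm₃₄ liftForm scaleForm : Carrier → Form → Form
    shearForm₁₂ t g = lookup
      (g1 + t * g2 + t * t * g5 ∷ g2 + 2# * t * g5 ∷ g3 + t * g6 ∷ g4 + t * g7 ∷ g5 ∷ g6 ∷ g7 ∷ g8 ∷ g9 ∷ g10 ∷ [])
      where open Coeffs g
    shearForm₃₄ t g = lookup
      (g1 ∷ g2 ∷ g3 + t * g4 ∷ g4 ∷ g5 ∷ g6 + t * g7 ∷ g7 ∷ g8 + t * g9 + t * t * g10 ∷ g9 + 2# * t * g10 ∷ g10 ∷ [])
      where open Coeffs g
    liftForm t g = lookup
      (g1 ∷ g2 ∷ g3 + 2# * t * g1 ∷ g4 ∷ g5 ∷ g6 + t * g2 ∷ g7 ∷ g8 + t * g3 + t * t * g1 ∷ g9 + t * g4 ∷ g10 ∷ [])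
      where open Coeffs g
    scaleForm h g = lookup (g1 ∷ g2 ∷ h * g3 ∷ g4 ∷ g5 ∷ h * g6 ∷ g7 ∷ h * h * g8 ∷ h * g9 ∷ g10 ∷ [])
      where open Coeffs g

    flipForm₁₂ flipForm₃₄ swapForm : Form → Form
    flipForm₁₂ g = lookup (g5 ∷ g2 ∷ g6 ∷ g7 ∷ g1 ∷ g3 ∷ g4 ∷ g8 ∷ g9 ∷ g10 ∷ [])
      where open Coeffs g
    flipForm₃₄ g = lookup (g1 ∷ g2 ∷ g4 ∷ g3 ∷ g5 ∷ g7 ∷ g6 ∷ g10 ∷ g9 ∷ g8 ∷ [])
      where open Coeffs g
    swapForm g = lookup (g1 ∷ g3 ∷ g2 ∷ g4 ∷ g8 ∷ g6 ∷ g9 ∷ g5 ∷ g7 ∷ g10 ∷ [])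
      where open Coeffs g

    shear₁₂ shear₃₄ lift₃₁ scale₄ : Carrier → Model F four → Model F four
    shear₁₂ t = each (shearForm₁₂ t)
    shear₃₄ t = each (shearForm₃₄ t)
    lift₃₁ t  = each (liftForm t)
    scale₄ h  = each (scaleForm h)

    flip₁₂ flip₃₄ swap₂₃ : Model F four → Model F four
    flip₁₂ = each flipForm₁₂
    flip₃₄ = each flipForm₃₄
    swap₂₃ = each swapForm

    mix : Mat F 2 → Model F four → Model F four
    mix N f = [ row (# 0) , row (# 1) ]′ ∘ splitAt 10
      where
      row : Fin 2 → Form
      row i k = N i (# 0) * fst4 F f k + N i (# 1) * snd4 F f k

  private
    p q r s : NC 𝕊 4
    p = gen (# 0)
    q = gen (# 1)
    r = gen (# 2)
    s = gen (# 3)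
    infixr 7 _⋆_
    _⋆_ : ∀ {g} → SE → NC 𝕊 g → NC 𝕊 g
    _⋆_ = _·_ 𝕊
    module M₄ = Moves4 𝕊

    f₄ : Model 𝕊 four
    f₄ = varModel four
    module V₄ = Four 𝕊 f₄

    -- digits of a coefficient: 0 stands for the index 10; ij is the minor dᵢⱼ
    digit : ℕ → ℕ
    digit c = if c ≡ᵇ 48 then 10 else c ℕ.∸ 48

    minor : ℕ → ℕ → SE
    minor x y = if x ≡ᵇ 116 then var 22 else V₄.d (digit x) (digit y)

    letterOf : ℕ → ℕ
    letterOf c = c ℕ.∸ 112

    -- The relation Ak in a certificate is the combination aₖ A(f₂) − bₖ A(f₁) of
    -- the relations A of f₁ and f₂, with coefficients dₖⱼ; likewise for B and C.
    eliminate : Cert → Cert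
    eliminate []                    = []
    eliminate ((c , u , i , v) ∷ C) =
      (c :* at 𝕊 V₄.f1 (i ℕ.∸ 10 ℕ.* k) , u , 3 ℕ.+ k , v) ∷ (:- (c :* at 𝕊 V₄.f2 (i ℕ.∸ 10 ℕ.* k)) , u , k , v) ∷ eliminate C
      where k = if i <ᵇ 11 then 0 else if i <ᵇ 21 then 1 else 2

    module P₄ = Parse minor letterOf (λ x y → 10 ℕ.* (x ℕ.∸ 65) ℕ.+ digit y)

    certificate : List String → Cert
    certificate []       = []
    certificate (x ∷ xs) = eliminate (P₄.parse x) ++ᴸ certificate xs

    constant : List String → SE
    constant []       = 𝟘
    constant (x ∷ xs) = foldr (λ w e → P₄.coefficient w :+ e) (constant xs) (P₄.split 44 (P₄.codes x))

    shear₁₂-const : SE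
    shear₁₂-const = constant
      ( "+22580t1,+12769t1,+12778t1,-22850t1,-12959t1,-23560t1,-13579t1,+23650t1,-14569t1,+14659t1,-14758t1"
      ∷ "-25058t1t1,+15660t1t1,+15679t1t1,+15769t1t1,+15778t1t1,-15959t1t1" ∷ [])

    -- Membership of ψ(ξ′) - δ²ξ - ρ in the ideal. The minors dᵢⱼ appear because the relations of f₁
    -- and f₂ are combined in pairs so as to eliminate one coefficient.
    shear₁₂-cert : Cert
    shear₁₂-cert = certificate
      ( "+125t1  A0 ,-125t1  C8 ,-127t1  A7 ,-127t1  B6 ,+228t1  C5 ,+129t1  B5 ,+135t1  B7 ,+235t1  C6 "
      ∷ "-236t1  C5 ,+145t1  B6 ,-146t1  B5 ,+147t1  A5 ,+150t1t1  A5 ,-156t1t1  B7 ,-156t1t1  C6 "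
      ∷ "-157t1t1  A7 ,-157t1t1  B6 ,+158t1t1  C5 ,+159t1t1  B5 ,+115t1  B6 r,-115t1  B7 p,-115t1  C6 p"
      ∷ "+115t1 p B7 ,+115t1 p C6 ,-116t1  B5 r,+116t1  C5 p,-116t1 p C5 ,-117t1  A5 r,-117t1  B5 p"
      ∷ "+117t1 r A5 ,-123t1  C5 p,+123t1 p C5 ,-224t1  A5 r,-124t1  B5 p,+124t1 p B5 ,+125t1  A4 r"
      ∷ "+125t1  A7 s,+125t1  B4 p,+125t1  B6 s,+125t1  C3 p,+125t1 q B7 ,+125t1 q C6 ,-126t1  B5 s"
      ∷ "-227t1  A5 s,-127t1  B2 p,-127t1  B5 q,+235t1  B5 s,+135t1  C5 q,-135t1 q C5 ,-145t1  A5 s"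
      ∷ "+145t1 s A5 ,+125t1t1  B7 p,-227t1t1  B5 p,-135t1t1  B5 r,+135t1t1  C5 p,+145t1t1  A5 r"
      ∷ "-256t1t1  B5 s,-156t1t1  C5 q,-157t1t1 q B5 ,-157t1t1 s A5 ,+156t1t1t1  B5 r,-157t1t1t1  B5 p"
      ∷ "-112t1  B5 rp,-112t1 pp C5 ,+112t1 r A5 r,-112t1 rp B5 ,+115t1  A2 rr,-115t1  A5 sr,-115t1  B5 sp"
      ∷ "+215t1 p B5 s,+115t1 p C2 p,+115t1 p C5 q,-115t1 pq C5 ,+115t1 s A5 r,-115t1 sp B5 ,+125t1  A2 sr"
      ∷ "-125t1  A5 ss,+225t1 q B5 s,+125t1 q C2 p,+125t1 q C5 q,+115t1t1  A5 rr,-115t1t1  B5 rp"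
      ∷ "-115t1t1 p B5 r,+115t1t1 p C5 p,+125t1t1  A5 sr,-125t1t1  B5 sp,-125t1t1 q B5 r,+125t1t1 q C5 p" ∷ [])

    shear₃₄-const : SE
    shear₃₄-const = constant
      ( "-21050t1t1,-21059t1,-11670t1,+11760t1,+11770t1t1,+11779t1,-12020t1t1,-12029t1,+12470t1t1,+12479t1"
      ∷ "+12640t1,+12730t1,+12740t1t1,-23540t1,-14045t1t1" ∷ [])

    shear₃₄-cert : Cert
    shear₃₄-cert = certificate
      ( "+210t1  B5 ,+116t1  C7 ,-117t1  B7 ,-117t1  C6 ,-124t1  B7 ,-126t1  C4 ,-127t1  C3 ,+129t1  C2 "
      ∷ "+235t1  C4 ,+210t1t1  C5 ,-117t1t1  C7 ,+120t1t1  C2 ,-124t1t1  C7 ,-127t1t1  C4 ,+145t1t1  C4 "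
      ∷ "-112t1  C7 p,+112t1 p C7 ,-213t1  C5 r,+114t1  B5 r,+114t1  C5 p,-114t1 p C5 ,-115t1  B7 s"
      ∷ "+215t1  C3 r,+215t1 p C4 ,+215t1 q C7 ,-117t1  B2 r,+117t1  B5 s,-117t1  C2 p,-117t1  C5 q"
      ∷ "-117t1 p C2 ,-117t1 q C5 ,-223t1  C5 s,-124t1  B2 r,-124t1  B5 s,-124t1  C2 p,-124t1  C5 q"
      ∷ "+124t1 p C2 ,+124t1 q C5 ,+125t1  B4 s,+225t1  C3 s,-127t1  B2 s,+215t1t1  C4 r,-217t1t1  C2 r"
      ∷ "-124t1t1  C2 r,-224t1t1  C5 s,+225t1t1  C4 s,-127t1t1  C2 s,-112t1  C2 rp,-112t1  C5 ps,-112t1  C5 sp"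
      ∷ "+112t1 p C5 s,-212t1 q C5 r,-112t1 rp C2 ,-112t1 sp C5 ,+115t1  C1 rp,+115t1  C2 ps,-115t1  C5 qs"
      ∷ "+215t1 p C1 r,+115t1 p C2 s,+215t1 q C2 r,+115t1 q C5 s,+115t1 rp C1 ,+125t1  C2 qs,+125t1 q C2 s"
      ∷ "-112t1t1  C2 rr,-212t1t1  C5 sr,+215t1t1  C1 rr,+215t1t1  C2 sr,+125t1t1  C2 ss" ∷ [])

    lift₃₁-const : SE
    lift₃₁-const = constant
      ( "-21015t1t1,+11220t1t1,+21247t1t1,-11260t1,-11279t1,+21350t1,+11445t1t1,-21459t1,+11467t1,-21530t1"
      ∷ "+11620t1,-11717t1t1,+11724t1t1,+11729t1,-11737t1,-12023t1,-12347t1" ∷ [])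

    lift₃₁-cert : Cert
    lift₃₁-cert = certificate
      ( "+112t1  B7 ,+112t1  C6 ,-213t1  C5 ,+114t1  B5 ,+215t1  C3 ,-116t1  C2 ,+123t1  C2 ,-112t1t1  C2 "
      ∷ "+215t1t1  C1 ,+112t1  B2 r,+112t1  B5 s,+112t1  C2 p,+112t1  C5 q,-112t1 p C2 ,-112t1 q C5 "
      ∷ "+115t1  B2 s,-115t1  C1 p,+115t1 p C1 " ∷ [])

    flip₁₂-const : SE
    flip₁₂-const = constant
      ( "+21058,+11660,+11679,-11769,-11778,-21850,+12360,-12478,-12630,+12748,+13035,+13459,-14548" ∷ [])

    flip₁₂-cert : Cert
    flip₁₂-cert = certificate
      ( "-210  A5 ,-115  A0 ,-115  B9 ,-115  C8 ,-116  B7 ,-116  C6 ,+117  A7 ,+117  B6 ,+218  C5 ,+120  A2 "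
      ∷ "-123  C6 ,+124  A7 ,+126  C3 ,-127  A4 ,-128  C2 ,-134  B5 ,-135  C3 ,+145  A4 ,-112  A7 r,+112  C6 p"
      ∷ "-112 p C6 ,+112 r A7 ,+113  B5 r,+113  C5 p,+113 p C5 ,-114  A5 r,-114  B5 p,-114 r A5 ,+115  A4 r"
      ∷ "-115  B3 r,+115  B4 p,-115  B7 q,-115  C3 p,-115  C6 q,-215 p B4 ,-215 p C3 ,-115 q B7 ,-215 q C6 "
      ∷ "+115 s A7 ,-116  B2 r,-116  B5 s,-116  C2 p,+116  C5 q,+116 p C2 ,+116 q C5 ,-217  A5 s,+117 p B2 "
      ∷ "+117 q B5 ,+123  B5 s,+123  C5 q,-123 p C2 ,-123 q C5 ,+124  A2 r,+124  B2 p,-124 p B2 ,-124 q B5 "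
      ∷ "-125  B3 s,+125  B4 q,-126  C2 q,+127  A2 s,-112  A2 rr,-312  A5 sr,-112  B2 pr,-212  B5 qr"
      ∷ "-112  B5 sp,-112 p C5 q,+112 pp C2 ,+112 pq C5 ,+212 q B5 r,+212 q C5 p,+112 r A5 s,+112 rp B2 "
      ∷ "+112 sp B5 ,+115  A1 rr,+115  A2 sr,-215  A5 ss,+115  B1 pr,-115  B2 ps,+115  B2 qr,+115  B2 sp"
      ∷ "-115  B5 qs,-115  B5 sq,-215 p B1 r,-115 p B2 s,-215 p C1 p,-115 p C2 q,-115 pp C1 ,-215 q B2 r"
      ∷ "-215 q C2 p,-115 q C5 q,-115 rp B1 ,+115 s A5 s,+125  A2 ss,+125  B2 sq,-125 q B2 s,-125 q C2 q" ∷ [])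

    flip₃₄-const : SE
    flip₃₄-const = constant
      ( "+21058,+11660,+11679,-11769,-11778,-21850,+12360,-12478,-12630,+12748,+13035,+13459,-14548" ∷ [])

    flip₃₄-cert : Cert
    flip₃₄-cert = certificate
      ( "-210  A5 ,-115  A0 ,-115  B9 ,-115  C8 ,-116  B7 ,-116  C6 ,+117  A7 ,+117  B6 ,+218  C5 ,+120  A2 "
      ∷ "-123  C6 ,+124  A7 ,+126  C3 ,-127  A4 ,-128  C2 ,-134  B5 ,-135  C3 ,+145  A4 ,-112  A7 r,+112  C6 p"
      ∷ "-112 p C6 ,+112 r A7 ,+113  B5 r,+113  C5 p,+113 p C5 ,-114  A5 r,-114  B5 p,-114 r A5 ,+115  A4 r"
      ∷ "-115  B3 r,+115  B4 p,-115  B7 q,-115  C3 p,-115  C6 q,-215 p B4 ,-215 p C3 ,-115 q B7 ,-215 q C6 "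
      ∷ "+115 s A7 ,-116  B2 r,-116  B5 s,-116  C2 p,+116  C5 q,+116 p C2 ,+116 q C5 ,-217  A5 s,+117 p B2 "
      ∷ "+117 q B5 ,+123  B5 s,+123  C5 q,-123 p C2 ,-123 q C5 ,+124  A2 r,+124  B2 p,-124 p B2 ,-124 q B5 "
      ∷ "-125  B3 s,+125  B4 q,-126  C2 q,+127  A2 s,-112  A2 rr,-312  A5 sr,-112  B2 pr,-212  B5 qr"
      ∷ "-112  B5 sp,-112 p C5 q,+112 pp C2 ,+112 pq C5 ,+212 q B5 r,+212 q C5 p,+112 r A5 s,+112 rp B2 "
      ∷ "+112 sp B5 ,+115  A1 rr,+115  A2 sr,-215  A5 ss,+115  B1 pr,-115  B2 ps,+115  B2 qr,+115  B2 sp"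
      ∷ "-115  B5 qs,-115  B5 sq,-215 p B1 r,-115 p B2 s,-215 p C1 p,-115 p C2 q,-115 pp C1 ,-215 q B2 r"
      ∷ "-215 q C2 p,-115 q C5 q,-115 rp B1 ,+115 s A5 s,+125  A2 ss,+125  B2 sq,-125 q B2 s,-125 q C2 q" ∷ [])

    -- The three relations that are free of coefficients serve as rules; those of f₁ and f₂ have no
    -- invertible leading coefficient for a generic model. The rules suffice for D, which is defined
    -- by commutators with ε.
    commuting : List Monic
    commuting = (1 ∷ 0 ∷ [] , 𝟙 , 6) ∷ (2 ∷ 1 ∷ [] , :- 𝟙 , 7) ∷ (2 ∷ 3 ∷ [] , :- 𝟙 , 8) ∷ []

    data₄ : (target : Model 𝕊 four) → SE → SE → NC 𝕊 4 → (image back : Fin 4 → NC 𝕊 4) →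
      (okc backc : Fin 9 → Cert) → Cert → MoveData four
    data₄ target factor const inner image back okc backc ξc = record
      { stepData = record
        { source = f₄ ; target = target ; image = image ; factor = factor ; const = const ; inner = inner
        ; depth = 12 ; monic = commuting ; ok-cert = okc ; ξ-cert = ξc ; D-cert = λ _ → [] }
      ; back = back ; back-monic = commuting ; back-cert = backc }

    combine : List (SE × ℕ) → Cert
    combine = mapL λ { (c , i) → c , [] , i , [] }

    ok₁ : List (SE × ℕ) → List (SE × ℕ) → List (SE × ℕ) → (ℕ → List (SE × ℕ)) → Fin 9 → Cert
    ok₁ a b c h = lookup (combine a ∷ combine b ∷ combine c ∷ shift a ∷ shift b ∷ shift c ∷ [] ∷ [] ∷ [] ∷ [])
      where
      shift : List (SE × ℕ) → Cert
      shift l = combine (mapL (λ { (c , i) → c , 3 ℕ.+ i }) l)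

    each₁ : List (SE × ℕ) → List (SE × ℕ) → List (SE × ℕ) → Fin 9 → Cert
    each₁ a b c = ok₁ a b c (λ _ → [])

    same : Fin 9 → Cert
    same = each₁ ((𝟙 , 0) ∷ []) ((𝟙 , 1) ∷ []) ((𝟙 , 2) ∷ [])

    t : SE
    t = var 22

    -- Read off from the generic point (αp + βr, αq + βs, α, β): for instance x₂ + tx₁ requires q′ =
    -- q - tp and s′ = s - tr, while x₄ + tx₃ adds t times (r, s) to (p, q).
    shearData₁₂ shearData₃₄ liftData₃₁ flipData₁₂ flipData₃₄ scaleData₄ : MoveData four
    shearData₁₂ = data₄ (M₄.shear₁₂ t f₄) 𝟙 shear₁₂-const (con 𝟘)
      (lookup (p ∷ q ⊕ (:- t) ⋆ p ∷ r ∷ s ⊕ (:- t) ⋆ r ∷ [])) (lookup (p ∷ q ⊕ t ⋆ p ∷ r ∷ s ⊕ t ⋆ r ∷ []))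
      same same shear₁₂-cert
    shearData₃₄ = data₄ (M₄.shear₃₄ t f₄) 𝟙 shear₃₄-const
      -- With W = d₁₂r² + 2d₁₅sr + d₂₅s², ε becomes ε + 2tW, and [r, ε] = -[p, W], [s, ε] = -[q, W]
      -- by the commutation relations. So the correction at p is ½t[r, ε] + t[p, W] = ½t[p, W] =
      -- [κ, p].
      ((half 𝕊 :* (:- t)) ⋆ (V₄.d 1 2 ⋆ (r ⊗ r) ⊕ (nat 𝕊 2 :* V₄.d 1 5) ⋆ (s ⊗ r) ⊕ V₄.d 2 5 ⋆ (s ⊗ s)))
      (lookup (p ⊕ t ⋆ r ∷ q ⊕ t ⋆ s ∷ r ∷ s ∷ [])) (lookup (p ⊕ (:- t) ⋆ r ∷ q ⊕ (:- t) ⋆ s ∷ r ∷ s ∷ []))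
      (each₁ ((𝟙 , 0) ∷ (t , 1) ∷ (t :* t , 2) ∷ []) ((𝟙 , 1) ∷ (nat 𝕊 2 :* t , 2) ∷ []) ((𝟙 , 2) ∷ []))
      (each₁ ((𝟙 , 0) ∷ (:- t , 1) ∷ (t :* t , 2) ∷ []) ((𝟙 , 1) ∷ (:- (nat 𝕊 2 :* t) , 2) ∷ []) ((𝟙 , 2) ∷ []))
      shear₃₄-cert
    -- ε changes by -2t(d₁₂r + d₁₅s), and κ is minus half of this. The product of ½ and 2 is left
    -- standing so that both sides contain ½ once.
    liftData₃₁ = data₄ (M₄.lift₃₁ t f₄) 𝟙 lift₃₁-const ((half 𝕊 :* nat 𝕊 2 :* t) ⋆ (V₄.d 1 2 ⋆ r ⊕ V₄.d 1 5 ⋆ s))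
      (lookup (p ⊕ con (:- t) ∷ q ∷ r ∷ s ∷ [])) (lookup (p ⊕ con t ∷ q ∷ r ∷ s ∷ [])) same same lift₃₁-cert
    flipData₁₂ = data₄ (M₄.flip₁₂ f₄) (:- 𝟙) flip₁₂-const (con 𝟘)
      (lookup (q ∷ p ∷ s ∷ r ∷ [])) (lookup (q ∷ p ∷ s ∷ r ∷ [])) same same flip₁₂-cert
    -- ε is invariant under this exchange, but D kills r and s rather than p and q. The derivation
    -- -D - ½[ε, -] kills p and q and equals ½[-, ε] on r and s.
    flipData₃₄ = data₄ (M₄.flip₃₄ f₄) (:- 𝟙) flip₃₄-const ((:- half 𝕊) ⋆ V₄.ε)
      (lookup (r ∷ s ∷ p ∷ q ∷ [])) (lookup (r ∷ s ∷ p ∷ q ∷ []))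
      (each₁ ((𝟙 , 2) ∷ []) ((𝟙 , 1) ∷ []) ((𝟙 , 0) ∷ [])) (each₁ ((𝟙 , 2) ∷ []) ((𝟙 , 1) ∷ []) ((𝟙 , 0) ∷ []))
      flip₃₄-cert
    scaleData₄ = data₄ (M₄.scale₄ (var 0) f₄) (var 0) 𝟘 (con 𝟘)
      (lookup (var 0 ⋆ p ∷ var 0 ⋆ q ∷ r ∷ s ∷ [])) (lookup (var 1 ⋆ p ∷ var 1 ⋆ q ∷ r ∷ s ∷ []))
      (each₁ ((var 0 :* var 0 , 0) ∷ []) ((var 0 , 1) ∷ []) ((𝟙 , 2) ∷ []))
      (each₁ ((var 1 :* var 1 , 0) ∷ []) ((var 1 , 1) ∷ []) ((𝟙 , 2) ∷ [])) []

  module Conn4 {c ℓ : Level} (F : Field c ℓ) where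
    private module F = Field F
    open Moves4 F public

    private
      refls : ∀ (h : Model F four) → AllF 20 (λ i → h i F.≈ h i)
      refls h = spread {P = λ i → h i F.≈ h i} λ _ → F.refl

    conn-shear₁₂ : ∀ t f → Conn F four F.1# f (shear₁₂ t f)
    conn-shear₁₂ t f = conn-resp F (evVar F four F.1# F.1# f (t ∷ [])) (gather (refls (shear₁₂ t f)))
      (move F F.1# F.1# (F.*-identityˡ _) (tabulate f ++ᴸ t ∷ []) shearData₁₂ tt)

    conn-shear₃₄ : ∀ t f → Conn F four F.1# f (shear₃₄ t f)
    conn-shear₃₄ t f = conn-resp F (evVar F four F.1# F.1# f (t ∷ [])) (gather (refls (shear₃₄ t f)))
      (move F F.1# F.1# (F.*-identityˡ _) (tabulate f ++ᴸ t ∷ []) shearData₃₄ tt)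

    conn-lift₃₁ : ∀ t f → Conn F four F.1# f (lift₃₁ t f)
    conn-lift₃₁ t f = conn-resp F (evVar F four F.1# F.1# f (t ∷ [])) (gather (refls (lift₃₁ t f)))
      (move F F.1# F.1# (F.*-identityˡ _) (tabulate f ++ᴸ t ∷ []) liftData₃₁ tt)

    conn-flip₁₂ : ∀ f → Conn F four (F.- F.1#) f (flip₁₂ f)
    conn-flip₁₂ f = conn-resp F (evVar F four F.1# F.1# f []) (gather (refls (flip₁₂ f)))
      (move F F.1# F.1# (F.*-identityˡ _) (tabulate f ++ᴸ []) flipData₁₂ tt)

    conn-flip₃₄ : ∀ f → Conn F four (F.- F.1#) f (flip₃₄ f)
    conn-flip₃₄ f = conn-resp F (evVar F four F.1# F.1# f []) (gather (refls (flip₃₄ f)))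
      (move F F.1# F.1# (F.*-identityˡ _) (tabulate f ++ᴸ []) flipData₃₄ tt)

    conn-scale₄ : ∀ {g h} → g F.* h F.≈ F.1# → ∀ f → Conn F four g f (scale₄ g f)
    conn-scale₄ {g} {h} e f = conn-resp F (evVar F four g h f []) (gather (refls (scale₄ g f)))
      (move F g h e (tabulate f ++ᴸ []) scaleData₄ tt)

open Degree4 public

-- The swap in degree 4 for models in normal form

module Normal4 where
  -- Models with f₁(e₁) = 0 and f₂ = x₁² + (a form in x₂, x₃, x₄).
  normal₄ : ∀ {c ℓ} (F : Field c ℓ) → Model F four → Model F four
  normal₄ F f = lookup
    ( 0# ∷ f (# 1) ∷ f (# 2) ∷ f (# 3) ∷ f (# 4) ∷ f (# 5) ∷ f (# 6) ∷ f (# 7) ∷ f (# 8) ∷ f (# 9)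
    ∷ 1# ∷ 0# ∷ 0# ∷ 0# ∷ f (# 14) ∷ f (# 15) ∷ f (# 16) ∷ f (# 17) ∷ f (# 18) ∷ f (# 19) ∷ [])
    where open Field F using (0#; 1#)

  private
    infixr 7 _⋆_
    _⋆_ : ∀ {g} → SE → NC 𝕊 g → NC 𝕊 g
    _⋆_ = _·_ 𝕊

    f₄ f₄′ : Model 𝕊 four
    f₄ = normal₄ 𝕊 (varModel four)
    f₄′ = Moves4.swap₂₃ 𝕊 f₄

    -- The letters are p, q, r, s, u = q⁻¹ and u̇ = Du.
    p q r s u u̇ : NC 𝕊 6
    p = gen (# 0)
    q = gen (# 1)
    r = gen (# 2)
    s = gen (# 3)
    u = gen (# 4)
    u̇ = gen (# 5)

    infixl 6 _⊝_
    _⊝_ : ∀ {g} → NC 𝕊 g → NC 𝕊 g → NC 𝕊 g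
    _⊝_ = _⊖_ 𝕊

    incl : NC 𝕊 4 → NC 𝕊 6
    incl = sub 𝕊 (lookup (p ∷ q ∷ r ∷ s ∷ []))

    a b : ℕ → SE
    a = at 𝕊 (fst4 𝕊 f₄)
    b = at 𝕊 (snd4 𝕊 f₄)

    digit : ℕ → ℕ
    digit c = if c ≡ᵇ 48 then 10 else c ℕ.∸ 48

    -- the characters a, b and h stand for aᵢ, bᵢ and 1/2
    coefficientOf : ℕ → ℕ → SE
    coefficientOf x y = if x ≡ᵇ 97 then a (digit y) else if x ≡ᵇ 98 then b (digit y) else half 𝕊

    -- p, q, r, s, u
    letterOf : ℕ → ℕ
    letterOf c = if c ≡ᵇ 117 then 4 else c ℕ.∸ 112

    -- A, B, C are the relations of f₁, and X, Y, Z those of f₁′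
    relOf : ℕ → ℕ → ℕ
    relOf x _ = if x <ᵇ 70 then x ℕ.∸ 65 else x ℕ.∸ 74

    module P₉ = Parse coefficientOf letterOf relOf

    certificate : List String → Cert
    certificate []       = []
    certificate (x ∷ xs) = P₉.parse x ++ᴸ certificate xs

    central-p : Cert
    central-p = certificate
      ( "-1a2b6b9  B1 ,+1a2b7b8  B1 ,-1a3b5b8  C1 ,+1a2b5b8  B1 s,+1a2b5b8  C1 q,-1a2b5b8 q C1 ,-1a2b5b9 q B1 "
      ∷ "-1a2b6b6  B1 s,-1a2b6b7  B1 q,+1a2b6b7 q B1 ,-1a3b5b6  C1 q,+1a3b5b7  B1 q,-1a3b5b7 q B1 "
      ∷ "-1a2b6  B1 pr,-1a2b6 r B1 p,+1a2b7 p B1 p,-1a3b5 p C1 p,+1a5b6  B1 ps,-1a5b6 sp B1 ,-1a6b5  B1 ps"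
      ∷ "+1a6b5 sp B1 ,-1a7b5  B1 pq,+1a7b5 q B1 p,-2a2b5b6  B1 qs,-1a2b5b6  B1 sq,+1a2b5b6 sq B1 "
      ∷ "+1a3b5b5  B1 qs,+1a3b5b5  B1 sq,-1a3b5b5 q B1 s,-1a3b5b5 q C1 q,-1a3b5b5 sq B1 ,+1a2b5  A1 spr"
      ∷ "-1a2b5  B1 psp,+1a2b5 p B1 sp,+1a2b5 p C1 pq,-1a2b5 pq C1 p,-1a2b5 q B1 pr,-1a2b5 qr B1 p"
      ∷ "+1a2b5 sp B1 p,-1a2b5 spr A1 ,-1a5b5  B1 pqs,+1a5b5 q B1 ps,-1a5b5 sp B1 q,+1a5b5 spq B1 "
      ∷ "-1a2b5b5  B1 qsq,-1a2b5b5 q B1 qs,+1a2b5b5 sq B1 q" ∷ [])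

    central-q : Cert
    central-q = certificate
      ( "+1a6b0  A1 ,+1a7b8  B1 ,-1a0b5  A1 q,+1a2b0  A1 p,-1a2b8  B1 r,-1a2b8  C1 p,+1a2b8 p C1 ,+1a2b9 p B1 "
      ∷ "+1a5b0  A1 q,-1a5b8  B1 s,-1a5b8  C1 q,+1a5b9  A1 s,+1a6b7  A1 s,+1a7b6 q B1 ,+1a8b5  B1 s"
      ∷ "+1a8b5  C1 q,-1a9b5  A1 s,+1a9b5  B1 q,-1a9b5 q B1 ,-1a6  B1 pr,+1a6 p B1 r,+1a6 r A1 r,+1a7  A1 pr"
      ∷ "+1a7 p B1 p,-1a7 pr A1 ,-1a2b6  C1 pq,+1a2b6 p B1 s,+1a2b6 p C1 q,-1a2b6 q B1 r,+1a2b7  A1 ps"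
      ∷ "+2a2b7 p B1 q,-1a2b7 pq B1 ,-1a3b5  A1 sr,+1a3b5  B1 ps,-1a3b5  B1 qr,-1a3b5  B1 sp,+1a3b5 p B1 s"
      ∷ "+1a3b5 p C1 q,+1a3b5 q B1 r,-1a4b5  A1 qr,-1a4b5  A1 sp,+1a4b5  B1 pq,+1a4b5 p B1 q,-1a4b5 pq B1 "
      ∷ "-1a4b5 q B1 p,+1a5b6  A1 ss,-1a5b6 q B1 s,-1a5b6 q C1 q,+1a5b7  A1 qs,+1a5b7  A1 sq,+1a6b5 q B1 s"
      ∷ "+1a6b5 q C1 q,-1a7b5  A1 qs,-1a7b5  A1 sq,+1a7b5 q B1 q,+1a2 pr A1 r,+1a2 pr B1 p,-1a5  A1 psr"
      ∷ "+1a5  A1 spr,-2a5  B1 psp,-1a5 p B1 ps,-1a5 p B1 qr,-1a5 p C1 pq,+1a5 pq B1 r,+1a5 pr A1 s"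
      ∷ "+1a5 pr B1 q,+1a5 psp B1 ,-1a5 q B1 pr,+1a5 qr A1 r,+1a5 r A1 sp,+1a5 sp B1 p,+1a2b5  A1 pss"
      ∷ "-1a2b5  A1 qsr,-1a2b5  A1 sqr,-1a2b5  A1 ssp,+1a2b5  B1 qsp,+2a2b5 p B1 qs,+2a2b5 p B1 sq"
      ∷ "+2a2b5 p C1 qq,-1a2b5 psq B1 ,+1a2b5 q B1 ps,-1a2b5 q B1 qr,-1a2b5 q B1 sp,-1a2b5 q C1 pq"
      ∷ "-1a2b5 sq B1 p" ∷ [])

    central-r : Cert
    central-r = certificate
      ( "-1a2b0b6  B1 ,+2a2b7b8  C1 ,+1a2b7b9  B1 ,-1a3b5b9  C1 ,-1a0b5  A1 r,+1a5b0 p B1 ,-1a5b8  C1 r"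
      ∷ "+1a5b9  C1 p,-1a5b9 p C1 ,-1a6b7  C1 p,+1a6b7 p C1 ,+1a7b6  C1 p,-1a7b6 p C1 ,+1a7b7  B1 p"
      ∷ "-1a7b7 p B1 ,+1a8b5  C1 r,-1a9b5  C1 p,+1a9b5 p C1 ,-1a2b0b5 q B1 ,+2a2b5b8  C1 s,+1a2b5b9  B1 s"
      ∷ "-1a2b5b9 q C1 ,+1a2b6b7  C1 q,+1a2b6b7 q C1 ,+1a2b7b7 q B1 ,-1a3b5b6  C1 s,-1a3b5b7 q C1 "
      ∷ "-1a2b6 r B1 r,+2a2b7 p B1 r,+2a2b7 p C1 p,-1a2b7 pr B1 ,+1a2b7 r B1 p,-1a3b5 r C1 p,+1a4b5  B1 pr"
      ∷ "-1a4b5 p B1 r,-1a4b5 r A1 r,+1a5b6  C1 ps,+1a5b6  C1 sp,-1a5b6 p C1 s,-1a5b6 q C1 r,-1a5b6 sp C1 "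
      ∷ "+1a5b7  B1 ps,+1a5b7  B1 sp,+1a5b7 pq C1 ,-1a5b7 q C1 p,-1a5b7 sp B1 ,-1a6b5  C1 ps,-1a6b5  C1 sp"
      ∷ "+1a6b5 p C1 s,+1a6b5 q C1 r,+1a6b5 sp C1 ,-1a7b5  A1 sr,-1a7b5  B1 ps,+1a7b5  B1 sp,+1a7b5  C1 pq"
      ∷ "-1a7b5 p C1 q,+1a2b5b6 sq C1 ,+1a2b5b7 q B1 s,+1a2b5b7 q C1 q,+1a2b5b7 sq B1 ,-1a3b5b5 q C1 s"
      ∷ "-1a3b5b5 sq C1 ,-1a5 p C1 pr,+1a5 pr B1 r,+1a2b5  B1 psr,-1a2b5  C1 pqr,-1a2b5  C1 psp,+1a2b5 p C1 ps"
      ∷ "+1a2b5 p C1 qr,+1a2b5 p C1 sp,-1a2b5 pr B1 s,-1a2b5 qr B1 r,-1a2b5 qr C1 p,-1a2b5 r A1 sr"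
      ∷ "+1a2b5 r B1 ps,+1a2b5 r B1 sp,+1a2b5 sp B1 r,+1a2b5 sp C1 p,-1a2b5 spr B1 ,-1a5b5  A1 ssr"
      ∷ "+1a5b5  B1 sps,+1a5b5  B1 ssp,+1a5b5  C1 qsp,-1a5b5 p C1 qs,+1a5b5 pq C1 s,-1a5b5 q C1 sp"
      ∷ "-1a5b5 sp B1 s,-1a5b5 sp C1 q,+1a5b5 spq C1 ,-1a2b5b5  C1 qsq,+1a2b5b5 sq B1 s,+1a2b5b5 sq C1 q" ∷ [])

    central-s : Cert
    central-s = certificate
      ( "+1a7b0  A1 ,-1a7b9  B1 ,-1a0b5  A1 s,-1a2b0  B1 p,+1a2b0 p B1 ,+1a2b9  B1 r,+1a3b7  C1 p,-1a3b7 p C1 "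
      ∷ "-1a4b7  B1 p,+1a4b7 p B1 ,+1a5b0  A1 s,-1a5b8  C1 s,-1a7b6  B1 s,+1a7b7  A1 s,-1a7b7  B1 q"
      ∷ "+1a8b5  C1 s,-2a7  B1 pr,+2a7 p B1 r,-1a7 pr B1 ,+1a7 r A1 r,-1a7 r B1 p,+1a2b6  B1 sr,-2a2b7  B1 ps"
      ∷ "+1a2b7  B1 qr,+1a2b7  C1 pq,+2a2b7 p B1 s,-1a2b7 pq C1 ,+1a3b5  C1 ps,-1a4b5  A1 sr,-1a4b5  B1 sp"
      ∷ "+1a4b5 p B1 s,+1a4b5 p C1 q,-1a4b5 pq C1 ,-1a5b6 q C1 s,+1a5b7  A1 ss,+1a6b5 q C1 s,-2a7b5  B1 qs"
      ∷ "-1a7b5  B1 sq,+1a7b5 q B1 s,+1a2 pr B1 r,+1a2 r B1 pr,-1a5  B1 psr,-1a5  C1 psp,-1a5 p C1 ps"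
      ∷ "+1a5 pr B1 s,+1a5 psp C1 ,+1a5 r A1 sr,-1a2b5  A1 ssr,-2a2b5  B1 pss,+2a2b5  B1 qsr,+1a2b5  B1 sqr"
      ∷ "+1a2b5  C1 pqs,+1a2b5  C1 psq,+2a2b5 p B1 ss,+1a2b5 p C1 qs,-1a2b5 psq C1 ,-1a2b5 q B1 sr"
      ∷ "-1a2b5 q C1 ps" ∷ [])

    D-cert₀ : Cert
    D-cert₀ = certificate
      ( "+2a2b9  A1 ,+2a2b6  A1 s,+1a2b6  B1 q,-1a2b6 q B1 ,+2a2b7  A1 q,+2a2 pr A1 ,+2a2 r A1 p,+2a5  B1 pq"
      ∷ "-2a5 pq B1 ,+2a2b5  A1 qs,+2a2b5  A1 sq" ∷ [])

    D-cert₁ : Cert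
    D-cert₁ = certificate
      ( "+2a2b9  B1 ,+2a2b6  B1 s,+1a2b6  C1 q,-1a2b6 q C1 ,+2a2b7  B1 q,+2a2  B1 pr,-2a2 p B1 r,+2a2 pr B1 "
      ∷ "+2a2 r B1 p,+2a5  C1 pq,-2a5 pq C1 ,+2a2b5  B1 qs,+2a2b5  B1 sq" ∷ [])

    swap-ξ : Cert
    swap-ξ = certificate
      ( "-4a0b5  A1 ,-2a0b8  X1 ,-1a5b8  C1 ,+1a6b6  Z1 ,+1a6b7  B1 ,+1a6b9  Y1 ,-1a7b7  A1 ,+1a8b0  X1 "
      ∷ "+4a8b5  C1 ,+1a8b7  Y1 ,-1a9b6  Y1 ,-1a0b6  A1 u,+1a2b6  C1 p,-1a2b7  A1 r,+1a2b8  Y1 r,+2a3b5  B1 r"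
      ∷ "+1a3b5  C1 p,+3a3b5 p C1 ,+1a3b6  Y1 r,+1a3b7 p Y1 ,-3a4b5  A1 r,-1a4b5  B1 p,-1a4b8  X1 r"
      ∷ "-2a5b6 q C1 ,+1a5b7  A1 s,-1a5b7 q B1 ,-1a5b9  Y1 q,+1a6b5  B1 s,+4a6b5  Z1 q,+1a6b7  Y1 q"
      ∷ "+1a6b8  Z1 u,+1a6b8 u Z1 ,-2a7b5  A1 s,-1a8b6  Z1 u,+1a8b6 u Z1 ,-1a8b7  X1 s,+1a8b7 s X1 "
      ∷ "+1a8b7 u B1 ,+1a8b9 u Y1 ,-1a9b5  Y1 q,-1a9b7  A1 u,-1a9b8  Y1 u,-2a5 p B1 r,-3a5 p C1 p,+2a5 pr B1 "
      ∷ "+1a6  Y1 pr,-1a6 p Y1 r,+1a6 r Y1 p,-1a7 p Y1 p,+1a8 r X1 r,+1a9  X1 pr,-1a2b0  A1 pu,-1a2b5  A1 sr"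
      ∷ "+1a2b5  B1 sp,+2a2b5  Z1 pq,+1a2b5 p B1 s,-1a2b5 p C1 q,+3a2b5 p Z1 q,+1a2b6  Y1 qr,+1a2b7 p Y1 q"
      ∷ "+1a2b7 q Y1 p,+1a2b8  Z1 pu,+1a2b8 pu Z1 ,+1a2b8 s X1 r,-1a3b5 q Y1 r,+1a3b6 pu Z1 ,+1a3b6 s X1 r"
      ∷ "-1a3b7  A1 ur,+1a3b7 ps X1 ,+1a3b7 pu B1 ,+1a3b8  Y1 ur,-1a3b8 r Y1 u,-1a3b9  Y1 pu,+1a3b9 pu Y1 "
      ∷ "-1a4b5  Y1 pq,+1a4b5 p Y1 q,+1a4b5 q Y1 p,-3a4b7  A1 pu,+1a5b5  Z1 qq,-1a5b5 q B1 s,-1a5b5 q C1 q"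
      ∷ "+1a5b5 q Z1 q,+1a5b7  Y1 qq,-1a5b9  A1 us,+2a6b5  Y1 qs,-1a6b7  A1 us,-1a6b8  Y1 su,-1a7b5  Y1 qq"
      ∷ "+1a7b5 q Y1 q,+1a7b6  A1 us,-1a8b5  B1 us,-1a8b5  X1 ss,-1a8b5 q Z1 u,-1a8b5 su B1 ,+1a8b5 u B1 s"
      ∷ "+2a8b6  Y1 su,+1a8b8 uu Z1 ,-1a8b9  X1 su,+1a2 pr Y1 p,+1a3 pr X1 r,-1a5  Y1 pqr,-1a5 pr Y1 q"
      ∷ "-1a5 r Y1 pq,-1a6 ps X1 r,+1a7  A1 pur,+1a8 pr Y1 u,+1a8 ur Y1 p,+1a2b5  Y1 qqr,+1a2b5 p Y1 qs"
      ∷ "+1a2b5 ps Y1 q,+1a2b5 qs Y1 p,+1a2b5 s Y1 pq,+1a2b8  Y1 psu,-2a3b5  A1 usr,-1a3b5  B1 pus"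
      ∷ "+1a3b5 pu B1 s,+1a3b5 r A1 us,-1a3b5 spu B1 ,+1a3b6  Y1 psu,+1a3b8 puu Z1 ,+2a3b8 r X1 su"
      ∷ "-1a3b8 sr X1 u,+1a3b8 u B1 ur,+1a3b8 u Z1 pu,-1a3b9  X1 spu,+1a5b5  Y1 qqs,+2a8b5 q Y1 su"
      ∷ "+1a8b8 u Y1 su,+1a3 pur Y1 p,+1a5  A1 pusr,-1a5  A1 uspr,-1a5 pr A1 us,-1a5 r A1 usp,-1a6  Y1 pspu"
      ∷ "+1a8  X1 psur,-1a8  X1 spur,-2a8 pr X1 su,+1a8 psr X1 u,-1a8 pu B1 ur,-1a8 pu Z1 pu,-1a8 r X1 spu"
      ∷ "+1a3b5 q Y1 spu,+1a3b8  Y1 psuu,+1a3b8  Y1 pusu,-1a3b8  Y1 uspu,+1a3b8 pu Y1 su,-1a3 pr X1 spu"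
      ∷ "-1a8  Y1 pspuu" ∷ [])

    swap-Dp : Cert
    swap-Dp = certificate
      ( "-2h1b9  X1 ,-2h1b5  Y1 q,+2h1b5 q Y1 ,-2h1b7  A1 u,-2h1b8  Y1 u,+2h1b8 u Y1 ,-2h1  X1 pr,-2h1 pr X1 "
      ∷ "-2h1b5  A1 us,+2h1b8  X1 su,+2h1  X1 pspu" ∷ [])

    swap-Dq : Cert
    swap-Dq = certificate
      ( "+2h1  X1 r,-2h1 r X1 ,+2h1  Y1 pu,-2h1 pu Y1 ,+2h1  X1 psu,-2h1  X1 spu" ∷ [])

    -- From exchanging α with αq + βs in the generic point: q′ = q⁻¹ and s′ = -sq⁻¹, and p′, r′ are
    -- such that αp + βr keeps its value.
    image : Fin 4 → NC 𝕊 6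
    image = lookup (u ⊗ p ∷ u ∷ r ⊝ (s ⊗ u) ⊗ p ∷ (:- 𝟙) ⋆ (s ⊗ u) ∷ [])

    imageRel : Fin 9 → NC 𝕊 6
    imageRel i = sub 𝕊 image (relsA 𝕊 four f₄′ i)

    -- D with the inverse u of q adjoined as a letter and Du as another; `derivative` records what
    -- Du is.
    D₆ : Fin 6 → NC 𝕊 6
    D₆ = lookup (incl (Four.Dgen 𝕊 f₄ (# 0)) ∷ incl (Four.Dgen 𝕊 f₄ (# 1)) ∷ con 𝟘 ∷ con 𝟘 ∷ u̇ ∷ con 𝟘 ∷ [])

    κ₆ : NC 𝕊 6
    κ₆ = half 𝕊 ⋆ ((:- 𝟙) ⋆ ((nat 𝕊 2 :* a 2 :* b 5) ⋆ (s ⊗ q) ⊕ (a 2 :* b 6) ⋆ s ⊕ (nat 𝕊 2 :* a 2 :* b 8 :+ a 3 :* b 6) ⋆ (s ⊗ u))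
      ⊕ (nat 𝕊 2 :* a 5) ⋆ (s ⊗ p) ⊝ (nat 𝕊 2 :* a 6) ⋆ r ⊕ (nat 𝕊 2 :* a 6) ⋆ (s ⊗ p ⊗ u))

    base : List (NC 𝕊 6)
    base = tabulate (λ i → incl (relsA 𝕊 four f₄ i))

    inverses : List (NC 𝕊 6)
    inverses = u ⊗ q ⊝ con 𝟙 ∷ q ⊗ u ⊝ con 𝟙 ∷ []

    -- Obtained from pq = qp and ps + rq = qr + sp by multiplying with u = q⁻¹ on both sides; they
    -- let u be moved past p and r.
    commutations : List (NC 𝕊 6)
    commutations = u ⊗ p ⊝ p ⊗ u ∷ r ⊗ u ⊝ (u ⊗ r ⊝ u ⊗ s ⊗ p ⊗ u ⊕ p ⊗ u ⊗ s ⊗ u) ∷ []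

    derivative : List (NC 𝕊 6)
    derivative = u̇ ⊕ u ⊗ D₆ (# 1) ⊗ u ∷ []

    -- The relations of the swapped model vanish in A_f under the substitution. Once this is shown,
    -- they may be quoted as relations in the certificates for ξ and D.
    images : List (NC 𝕊 6)
    images = tabulate imageRel

    all₁ all₂ all₃ : List (NC 𝕊 6)
    all₁ = base ++ᴸ inverses
    all₂ = all₁ ++ᴸ commutations
    all₃ = all₂ ++ᴸ derivative ++ᴸ images

    -1ₛ : SE
    -1ₛ = :- 𝟙

    -- `mono₀` relies on the normal form: with f₂ = x₁² + ... the relations of f₂ start with p², pr
    -- + rp and r², and become rules for p², rp and r². `mono₁` cancels u against q.
    mono₁ mono₀ mono₂ : List Monic
    mono₀ = (0 ∷ 0 ∷ [] , -1ₛ , 3) ∷ (2 ∷ 2 ∷ [] , -1ₛ , 5) ∷ (2 ∷ 0 ∷ [] , -1ₛ , 4)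
          ∷ (1 ∷ 0 ∷ [] , 𝟙 , 6) ∷ (2 ∷ 3 ∷ [] , -1ₛ , 8) ∷ (2 ∷ 1 ∷ [] , -1ₛ , 7) ∷ []
    mono₁ = (4 ∷ 1 ∷ [] , -1ₛ , 9) ∷ (1 ∷ 4 ∷ [] , -1ₛ , 10) ∷ []
    mono₂ = mono₁ ++ᴸ (4 ∷ 0 ∷ [] , -1ₛ , 11) ∷ (2 ∷ 4 ∷ [] , -1ₛ , 12) ∷ mono₀
    mono₃ : List Monic
    mono₃ = (5 ∷ [] , -1ₛ , 13) ∷ mono₂

    imageCert : Fin 9 → Cert
    imageCert = lookup
      ( ((𝟙 , [] , 0 , 4 ∷ 4 ∷ []) ∷ [])
      ∷ ((-1ₛ , [] , 0 , 3 ∷ 4 ∷ 4 ∷ []) ∷ (-1ₛ , [] , 0 , 4 ∷ 3 ∷ 4 ∷ []) ∷ (𝟙 , 1 ∷ [] , 1 , 4 ∷ 4 ∷ []) ∷ [])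
      ∷ ((𝟙 , 1 ∷ [] , 2 , 4 ∷ []) ∷ (𝟙 , [] , 0 , 3 ∷ 4 ∷ 3 ∷ 4 ∷ []) ∷ (-1ₛ , 1 ∷ [] , 1 , 4 ∷ 3 ∷ 4 ∷ []) ∷ [])
      ∷ [] ∷ [] ∷ [] ∷ [] ∷ [] ∷ [] ∷ [])

    ξ₆ ξ₆′ : NC 𝕊 6
    ξ₆ = incl (Four.ξ 𝕊 f₄)
    ξ₆′ = sub 𝕊 image (Four.ξ 𝕊 f₄′)

    Dlhs Drhs : Fin 4 → NC 𝕊 6
    Dlhs i = sub 𝕊 image (Four.Dgen 𝕊 f₄′ i)
    Drhs i = (:- 𝟙) ⋆ extDer 𝕊 D₆ (image i) ⊕ ⟦_,_⟧ 𝕊 κ₆ (image i)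

    Dcert : Fin 4 → Cert
    Dcert = lookup (swap-Dp ∷ swap-Dq ∷ [] ∷ [] ∷ [])

    D-cert : Fin 9 → Cert
    D-cert = lookup (D-certh₀ ∷ D-certh₁ ∷ [] ∷ [] ∷ [] ∷ [] ∷ [] ∷ [] ∷ [] ∷ [])
      where
      -- D carries a factor ½; the listed certificates are those of 2D.
      hlf : Cert → Cert
      hlf = mapL λ { (c , x) → half 𝕊 :* c , x }
      D-certh₀ = hlf D-cert₀
      D-certh₁ = hlf D-cert₁

    -- The quotient (R(q) - R(0))/q for the quartic R that annihilates q, so that W₀q = -R(0) =
    -- -`res₀`.
    W₀ : NC 𝕊 6
    W₀ = (a 5 :* a 5 :+ a 2 :* a 2 :* b 5) ⋆ (q ⊗ q ⊗ q)
       ⊕ (nat 𝕊 2 :* a 5 :* a 6 :+ a 2 :* a 2 :* b 6 :+ nat 𝕊 2 :* a 2 :* a 3 :* b 5) ⋆ (q ⊗ q)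
       ⊕ (a 6 :* a 6 :+ nat 𝕊 2 :* a 5 :* a 8 :+ a 2 :* a 2 :* b 8 :+ nat 𝕊 2 :* a 2 :* a 3 :* b 6 :+ a 3 :* a 3 :* b 5) ⋆ q
       ⊕ con (nat 𝕊 2 :* a 6 :* a 8 :+ nat 𝕊 2 :* a 2 :* a 3 :* b 8 :+ a 3 :* a 3 :* b 6)

    res₀ : SE
    res₀ = a 8 :* a 8 :+ a 3 :* a 3 :* b 8

    -- With l = a₂q + a₃, the relations read pl + Q₁(q) = 0 and p² + Q₂(q) = 0,
    -- so that q is a root of the quartic Q₁² + Q₂l², whose constant term is res₀.
    quartic-cert : Cert
    quartic-cert =
      (a 5 , [] , 0 , 1 ∷ 1 ∷ []) ∷ (a 6 , [] , 0 , 1 ∷ []) ∷ (a 8 , [] , 0 , []) ∷ (:- a 2 , 0 ∷ 1 ∷ [] , 0 , []) ∷ (:- a 3 , 0 ∷ [] , 0 , [])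
      ∷ (a 2 :* a 2 , [] , 3 , 1 ∷ 1 ∷ []) ∷ (nat 𝕊 2 :* a 2 :* a 3 , [] , 3 , 1 ∷ []) ∷ (a 3 :* a 3 , [] , 3 , []) ∷ []

  module _ {c ℓ : Level} (F : Field c ℓ) where
    private module F = Field F

    module _ {g k : ℕ} (S : Fin k → NC F g) where
      private
        infix 4 _~_
        _~_ = Eqv F S
        module _ (xs : List (NC F g)) (ρ : List F.Carrier) where
          open Identity F S (env F F.1# F.1# ρ) (F.*-identityˡ _) (nth (con F.0#) xs) public using () renaming (identity to idn)
        x y z x˙ y˙ z˙ : NC 𝕊 6
        x = gen (# 0)
        y = gen (# 1)
        z = gen (# 2)
        x˙ = gen (# 3)
        y˙ = gen (# 4)
        z˙ = gen (# 5)
        nc! : ∀ (X Y Z X˙ Y˙ Z˙ : NC F g) (a : F.Carrier) (l r : NC 𝕊 6) → T (identity? 0 [] [] l r []) →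
          evN F (env F F.1# F.1# (a ∷ [])) (nth (con F.0#) (X ∷ Y ∷ Z ∷ X˙ ∷ Y˙ ∷ Z˙ ∷ [])) l ~
          evN F (env F F.1# F.1# (a ∷ [])) (nth (con F.0#) (X ∷ Y ∷ Z ∷ X˙ ∷ Y˙ ∷ Z˙ ∷ [])) r
        nc! X Y Z X˙ Y˙ Z˙ a l r t = idn (X ∷ Y ∷ Z ∷ X˙ ∷ Y˙ ∷ Z˙ ∷ []) (a ∷ []) [] tt (lift tt) [] 0 l r [] t
        open Ring (ncRing F S) hiding (zero)

      module _ (d : Fin g → NC F g) (h : ∀ i → extDer F d (S i) ~ con F.0#) where
        -- A derivation of the free algebra descends to the quotient as soon as it maps the defining
        -- relations into the ideal.
        extDer-cong : ∀ {x y} → x ~ y → extDer F d x ~ extDer F d y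
        extDer-cong refl′ = refl′
        extDer-cong (sym′ p) = sym′ (extDer-cong p)
        extDer-cong (trans′ p q) = trans′ (extDer-cong p) (extDer-cong q)
        extDer-cong (⊕-cong p q) = ⊕-cong (extDer-cong p) (extDer-cong q)
        extDer-cong (⊗-cong p q) = ⊕-cong (⊗-cong (extDer-cong p) q) (⊗-cong p (extDer-cong q))
        extDer-cong (⊕-assoc _ _ _) = ⊕-assoc _ _ _
        extDer-cong (⊕-comm _ _) = ⊕-comm _ _
        extDer-cong (⊕-idˡ _) = ⊕-idˡ _
        extDer-cong (⊕-invˡ X) = nc! X X X (extDer F d X) X X F.0# ((con 𝟘 ⊗ x ⊕ con (:- 𝟙) ⊗ x˙) ⊕ x˙) (con 𝟘) tt
        extDer-cong (⊗-assoc X Y Z) = nc! X Y Z (extDer F d X) (extDer F d Y) (extDer F d Z) F.0#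
          ((x˙ ⊗ y ⊕ x ⊗ y˙) ⊗ z ⊕ (x ⊗ y) ⊗ z˙) (x˙ ⊗ (y ⊗ z) ⊕ x ⊗ (y˙ ⊗ z ⊕ y ⊗ z˙)) tt
        extDer-cong (⊗-idˡ X) = nc! X X X (extDer F d X) X X F.0# (con 𝟘 ⊗ x ⊕ con 𝟙 ⊗ x˙) x˙ tt
        extDer-cong (⊗-idʳ X) = nc! X X X (extDer F d X) X X F.0# (x˙ ⊗ con 𝟙 ⊕ x ⊗ con 𝟘) x˙ tt
        extDer-cong (⊗-distribˡ X Y Z) = nc! X Y Z (extDer F d X) (extDer F d Y) (extDer F d Z) F.0#
          (x˙ ⊗ (y ⊕ z) ⊕ x ⊗ (y˙ ⊕ z˙)) ((x˙ ⊗ y ⊕ x ⊗ y˙) ⊕ (x˙ ⊗ z ⊕ x ⊗ z˙)) tt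
        extDer-cong (⊗-distribʳ X Y Z) = nc! X Y Z (extDer F d X) (extDer F d Y) (extDer F d Z) F.0#
          ((y˙ ⊕ z˙) ⊗ x ⊕ (y ⊕ z) ⊗ x˙) ((y˙ ⊗ x ⊕ y ⊗ x˙) ⊕ (z˙ ⊗ x ⊕ z ⊗ x˙)) tt
        extDer-cong (con-cong _) = refl′
        extDer-cong (con-+ _ _) = sym (+-identityʳ _)
        extDer-cong (con-* _ _) = sym (trans (+-cong (zeroˡ _) (zeroʳ _)) (+-identityʳ _))
        extDer-cong (central a X) = nc! X X X (extDer F d X) X X a (con 𝟘 ⊗ x ⊕ con (var 2) ⊗ x˙) (x˙ ⊗ con (var 2) ⊕ x ⊗ con 𝟘) tt
        extDer-cong (rel i) = h i

      -- z is central as soon as it commutes with the generators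
      Central : NC F g → Set (c ⊔ ℓ)
      Central z = ∀ x → ⟦_,_⟧ F z x ~ con F.0#

      central-gens : ∀ Z → (∀ i → ⟦_,_⟧ F Z (gen i) ~ con F.0#) → Central Z
      central-gens Z h (con a) = br-con F S a Z
      central-gens Z h (gen i) = h i
      central-gens Z h (X ⊕ Y) = trans (nc! Z X Y Z Z Z F.0# (⟦_,_⟧ 𝕊 x (y ⊕ z)) (⟦_,_⟧ 𝕊 x y ⊕ ⟦_,_⟧ 𝕊 x z) tt)
        (trans (+-cong (central-gens Z h X) (central-gens Z h Y)) (+-identityʳ _))
      central-gens Z h (X ⊗ Y) = trans (nc! Z X Y Z Z Z F.0# (⟦_,_⟧ 𝕊 x (y ⊗ z)) (⟦_,_⟧ 𝕊 x y ⊗ z ⊕ y ⊗ ⟦_,_⟧ 𝕊 x z) tt)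
        (trans (+-cong (trans (*-congʳ (central-gens Z h X)) (zeroˡ _)) (trans (*-congˡ (central-gens Z h Y)) (zeroʳ _))) (+-identityʳ _))

    module Inverted (g : Model F four) where
      ρ : ℕ → F.Carrier
      ρ = env F F.1# F.1# (tabulate g)
      f f′ : Model F four
      f = evM F ρ f₄
      f′ = evM F ρ f₄′
      S = relsA F four f
      open Ring (ncRing F S) hiding (zero; _-_)
      infix 4 _~_
      _~_ = Eqv F S
      θ₀ : ℕ → NC F 4
      θ₀ = letters F []
      module I₀ = Identity F S ρ (F.*-identityˡ _) θ₀

      van₀ : I₀.Vanish base
      van₀ = spreadVan
        where
        h : ∀ i → S i ~ con F.0#
        h i = rel i
        spreadVan = h (# 0) , h (# 1) , h (# 2) , h (# 3) , h (# 4) , h (# 5) , h (# 6) , h (# 7) , h (# 8) , lift tt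

      ξ-central : Central S (Four.ξ F f)
      ξ-central = central-gens S _ (gather (
        I₀.identity base tt van₀ mono₀ 40 (⟦_,_⟧ 𝕊 ξ₆ p) (con 𝟘) central-p tt ,
        I₀.identity base tt van₀ mono₀ 40 (⟦_,_⟧ 𝕊 ξ₆ q) (con 𝟘) central-q tt ,
        I₀.identity base tt van₀ mono₀ 40 (⟦_,_⟧ 𝕊 ξ₆ r) (con 𝟘) central-r tt ,
        I₀.identity base tt van₀ mono₀ 40 (⟦_,_⟧ 𝕊 ξ₆ s) (con 𝟘) central-s tt , lift tt))

      D-rels : ∀ i → extDer F (Four.Dgen F f) (S i) ~ con F.0#
      D-rels = gather (spread {n = 9} {P = λ i → evN F ρ θ₀ (extDer 𝕊 D₆ (incl (relsA 𝕊 four f₄ i))) ~ con F.0#} λ i →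
        I₀.identity base tt van₀ mono₀ 40 (extDer 𝕊 D₆ (incl (relsA 𝕊 four f₄ i))) (con 𝟘) (D-cert i)
          (allB-sound (λ i → identity? 40 base mono₀ (extDer 𝕊 D₆ (incl (relsA 𝕊 four f₄ i))) (con 𝟘) (D-cert i)) tt i))

      D-cong : ∀ {x y} → x ~ y → DA F four f x ~ DA F four f y
      D-cong = extDer-cong S (Four.Dgen F f) D-rels

      P Q R′ S′ : NC F 4
      P = gen (# 0)
      Q = gen (# 1)
      R′ = gen (# 2)
      S′ = gen (# 3)

      -- W₀q = -res₀, and W₀ is a polynomial in q, so -W₀/res₀ is an inverse of q on both sides.
      inverse-q : ∀ i → i F.* evS F ρ res₀ F.≈ F.1# → Σ (NC F 4) λ U → U ⊗ Q ~ con F.1# × Q ⊗ U ~ con F.1#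
      inverse-q i e = _·_ F (F.- i) W , left , right
        where
        W = evN F ρ θ₀ W₀
        WQ : con (evS F ρ res₀) ⊕ W ⊗ Q ~ con F.0#
        WQ = I₀.identity base tt van₀ mono₀ 40 (con res₀ ⊕ W₀ ⊗ q) (con 𝟘) quartic-cert tt
        θ₁ : ℕ → NC F 4
        θ₁ = nth (con F.0#) (W ∷ Q ∷ [])
        ρ₁ = env F i (evS F ρ res₀) []
        module I₁ = Identity F S ρ₁ e θ₁
        w q′ : NC 𝕊 2
        w = gen (# 0)
        q′ = gen (# 1)
        rs : List (NC 𝕊 2)
        rs = con (var 1) ⊕ w ⊗ q′ ∷ w ⊗ q′ ⊝ q′ ⊗ w ∷ []
        comm : W ⊗ Q ⊕ con (F.- F.1#) ⊗ (Q ⊗ W) ~ con F.0#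
        comm = I₀.identity base tt van₀ mono₀ 40 (W₀ ⊗ q ⊝ q ⊗ W₀) (con 𝟘) [] tt
        left : _·_ F (F.- i) W ⊗ Q ~ con F.1#
        left = I₁.identity rs tt (WQ , comm , lift tt) [] 0 (_·_ 𝕊 (:- var 0) w ⊗ q′) (con 𝟙) ((:- var 0 , [] , 0 , []) ∷ []) tt
        right : Q ⊗ _·_ F (F.- i) W ~ con F.1#
        right = I₁.identity rs tt (WQ , comm , lift tt) [] 0 (q′ ⊗ _·_ 𝕊 (:- var 0) w) (con 𝟙)
          ((:- var 0 , [] , 0 , []) ∷ (var 0 , [] , 1 , []) ∷ []) tt

      module _ (U : NC F 4) (UQ : U ⊗ Q ~ con F.1#) (QU : Q ⊗ U ~ con F.1#) where
        private
          θ : ℕ → NC F 4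
          θ = nth (con F.0#) (P ∷ Q ∷ R′ ∷ S′ ∷ U ∷ extDer F (Four.Dgen F f) U ∷ [])
          module I = Identity F S ρ (F.*-identityˡ _) θ
          ze : ∀ {x y} → x ~ y → x ⊕ con (F.- F.1#) ⊗ y ~ con F.0#
          ze e = trans (+-congʳ e) (-‿inverseʳ _)

          van₁ : I.Vanish all₁
          van₁ = let a0 , a1 , a2 , a3 , a4 , a5 , a6 , a7 , a8 , _ = van₀ in
            a0 , a1 , a2 , a3 , a4 , a5 , a6 , a7 , a8 , ze UQ , ze QU , lift tt

          up : evN F ρ θ (u ⊗ p ⊝ p ⊗ u) ~ con F.0#
          up = I.identity all₁ tt van₁ mono₁ 9 (u ⊗ p ⊝ p ⊗ u) (con 𝟘) ((𝟙 , 4 ∷ [] , 6 , 4 ∷ []) ∷ []) tt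

          ru : evN F ρ θ (r ⊗ u ⊝ (u ⊗ r ⊝ u ⊗ s ⊗ p ⊗ u ⊕ p ⊗ u ⊗ s ⊗ u)) ~ con F.0#
          ru = I.identity all₁ tt van₁ mono₁ 9 (r ⊗ u ⊝ (u ⊗ r ⊝ u ⊗ s ⊗ p ⊗ u ⊕ p ⊗ u ⊗ s ⊗ u)) (con 𝟘)
            ((:- 𝟙 , 4 ∷ [] , 7 , 4 ∷ []) ∷ (𝟙 , 4 ∷ [] , 6 , 4 ∷ 3 ∷ 4 ∷ []) ∷ []) tt

          van₂ : I.Vanish all₂
          van₂ = let a0 , a1 , a2 , a3 , a4 , a5 , a6 , a7 , a8 , a9 , a10 , _ = van₁ in
            a0 , a1 , a2 , a3 , a4 , a5 , a6 , a7 , a8 , a9 , a10 , up , ru , lift tt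

          image-zero : ∀ i → evN F ρ θ (imageRel i) ~ con F.0#
          image-zero i = I.identity all₂ tt van₂ mono₂ 40 (imageRel i) (con 𝟘) (imageCert i)
            (allB-sound (λ i → identity? 40 all₂ mono₂ (imageRel i) (con 𝟘) (imageCert i)) tt i)

          -- The equation D(uq) = D(1) = 0, multiplied by u on the right.
          DU : evN F ρ θ (u̇ ⊕ u ⊗ D₆ (# 1) ⊗ u) ~ con F.0#
          DU = I.identity {h = 6} (u̇ ⊗ q ⊕ u ⊗ D₆ (# 1) ∷ inverses) tt (D-cong UQ , ze UQ , ze QU , lift tt)
            ((1 ∷ 4 ∷ [] , :- 𝟙 , 2) ∷ []) 9 (u̇ ⊕ u ⊗ D₆ (# 1) ⊗ u) (con 𝟘) ((𝟙 , [] , 0 , 4 ∷ []) ∷ []) tt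

          van₃ : I.Vanish all₃
          van₃ = let a0 , a1 , a2 , a3 , a4 , a5 , a6 , a7 , a8 , a9 , a10 , a11 , a12 , _ = van₂ in
            a0 , a1 , a2 , a3 , a4 , a5 , a6 , a7 , a8 , a9 , a10 , a11 , a12 , DU ,
            image-zero (# 0) , image-zero (# 1) , image-zero (# 2) , image-zero (# 3) , image-zero (# 4) ,
            image-zero (# 5) , image-zero (# 6) , image-zero (# 7) , image-zero (# 8) , lift tt

        swapImage : Subst F four
        swapImage = lookup (U ⊗ P ∷ U ∷ _⊖_ F R′ ((S′ ⊗ U) ⊗ P) ∷ _·_ F (F.- F.1#) (S′ ⊗ U) ∷ [])

        swapStep : Step F four (F.- F.1#) f f′
        swapStep = record
          { ψ = swapImage
          ; ok = gather (spread {n = 9} {P = λ i → evN F ρ θ (imageRel i) ~ con F.0#} image-zero)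
          ; ρ = F.0#
          ; ξ-eq = trans (I.identity all₃ tt van₃ mono₃ 40 ξ₆′ ξ₆ swap-ξ tt) (sym (trans (+-identityʳ _)
              (trans (*-congʳ (con-cong (C.solveS (:- 𝟙 :* :- 𝟙) 𝟙 tt))) (*-identityˡ _))))
          ; κ = evN F ρ θ κ₆
          ; D-eq = gather (spread {n = 4} {P = λ i → evN F ρ θ (Dlhs i) ~ evN F ρ θ (Drhs i)} λ i →
              I.identity all₃ tt van₃ mono₃ 40 (Dlhs i) (Drhs i) (Dcert i)
                (allB-sound (λ i → identity? 40 all₃ mono₃ (Dlhs i) (Drhs i) (Dcert i)) tt i))
          ; η-eq = lift _ }
          where module C = CommSound F ρ (F.*-identityˡ _)

open Normal4 public

-- Inverse of the swap; change of basis of the pencil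

module Swapping where
  module Scalar {c ℓ : Level} (F : Field c ℓ) where
    private module F = Field F

    sc : ∀ (xs : List F.Carrier) l r → T (checkS l r) → evS F (env F F.1# F.1# xs) l F.≈ evS F (env F F.1# F.1# xs) r
    sc xs = CommSound.solveS F (env F F.1# F.1# xs) (F.*-identityˡ _)

    sc₁ : ∀ {a b} → a F.* b F.≈ F.1# → ∀ (xs : List F.Carrier) l r → T (checkS l r) → evS F (env F a b xs) l F.≈ evS F (env F a b xs) r
    sc₁ {a} {b} e xs = CommSound.solveS F (env F a b xs) e

    checkM : ∀ {n} → (Fin n → SE) → (Fin n → SE) → Bool
    checkM x y = allB λ i → checkS (x i) (y i)

    scM : ∀ {n} (xs : List F.Carrier) (x y : Fin n → SE) → T (checkM x y) →
      AllF n (λ i → evS F (env F F.1# F.1# xs) (x i) F.≈ evS F (env F F.1# F.1# xs) (y i))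
    scM xs x y t = spread λ i → sc xs (x i) (y i) (allB-sound (λ i → checkS (x i) (y i)) t i)

    unit : ∀ {x} → ¬ x F.≈ F.0# → x F.⁻¹ F.* x F.≈ F.1#
    unit h = F.trans (F.*-comm _ _) (F.inverse _ h)

  module Swap4 {c ℓ : Level} (F : Field c ℓ) where
    private module F = Field F
    open Conn4 F
    open Scalar F

    private
      x q p r s u : NC 𝕊 6
      p = gen (# 0)
      q = gen (# 1)
      r = gen (# 2)
      s = gen (# 3)
      u = gen (# 4)
      x = gen (# 5)
      infixl 6 _⊝_
      _⊝_ : ∀ {g} → NC 𝕊 g → NC 𝕊 g → NC 𝕊 g
      _⊝_ = _⊖_ 𝕊
      infixr 8 _⋆_
      _⋆_ : ∀ {g} → SE → NC 𝕊 g → NC 𝕊 g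
      _⋆_ = _·_ 𝕊

    -- The images of q under the two substitutions q ↦ U, q ↦ U′ are inverse to q
    -- on either side, whence the substitutions are inverse to each other.
    module _ {k : ℕ} (S : Fin k → NC F 4) (U′ X : NC F 4) where
      private
        Q : NC F 4
        Q = gen (# 1)
        infix 4 _~_
        _~_ = Eqv F S
        φ φU : Fin 4 → NC F 4
        φ = lookup (U′ ⊗ gen (# 0) ∷ U′ ∷ _⊖_ F (gen (# 2)) ((gen (# 3) ⊗ U′) ⊗ gen (# 0)) ∷ _·_ F (F.- F.1#) (gen (# 3) ⊗ U′) ∷ [])
        φU = lookup (X ⊗ φ (# 0) ∷ X ∷ _⊖_ F (φ (# 2)) ((φ (# 3) ⊗ X) ⊗ φ (# 0)) ∷ _·_ F (F.- F.1#) (φ (# 3) ⊗ X) ∷ [])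

      involution : U′ ⊗ Q ~ con F.1# → Q ⊗ U′ ~ con F.1# → X ⊗ U′ ~ con F.1# → ∀ i → φU i ~ gen i
      involution uq qu xu = gather
        ( I.identity rs′ tt van′ rules 9 (x ⊗ (u ⊗ p)) p [] tt
        , I.identity rs′ tt van′ rules 9 x q [] tt
        , I.identity rs′ tt van′ rules 9 ((r ⊝ (s ⊗ u) ⊗ p) ⊝ (((:- 𝟙) ⋆ (s ⊗ u)) ⊗ x) ⊗ (u ⊗ p)) r [] tt
        , I.identity rs′ tt van′ rules 9 ((:- 𝟙) ⋆ (((:- 𝟙) ⋆ (s ⊗ u)) ⊗ x)) s [] tt , lift tt)
        where
        module I = Identity F S (env F F.1# F.1# []) (F.*-identityˡ _) (nth (con F.0#) (gen (# 0) ∷ Q ∷ gen (# 2) ∷ gen (# 3) ∷ U′ ∷ X ∷ []))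
        open Ring (ncRing F S) hiding (zero)
        rs rs′ : List (NC 𝕊 6)
        rs = u ⊗ q ⊝ con 𝟙 ∷ q ⊗ u ⊝ con 𝟙 ∷ x ⊗ u ⊝ con 𝟙 ∷ []
        rs′ = x ⊝ q ∷ rs
        rules : List Monic
        rules = (5 ∷ [] , :- 𝟙 , 0) ∷ (4 ∷ 1 ∷ [] , :- 𝟙 , 1) ∷ (1 ∷ 4 ∷ [] , :- 𝟙 , 2) ∷ []
        ze : ∀ {x} → x ~ con F.1# → x ⊕ con (F.- F.1#) ⊗ con F.1# ~ con F.0#
        ze e = trans (+-congʳ e) (-‿inverseʳ _)
        van : I.Vanish rs
        van = ze uq , ze qu , ze xu , lift tt
        van′ : I.Vanish rs′
        van′ = I.identity rs tt van [] 9 (x ⊝ q) (con 𝟘) ((:- 𝟙 , 5 ∷ [] , 0 , []) ∷ (𝟙 , [] , 2 , 1 ∷ []) ∷ []) tt , van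

    -- Resultants of f₁, f₂ restricted to the line through e₁, e₂ and to the line through e₁, e₃.
    -- The swap interchanges them, and the isomorphism for it needs both to be nonzero.
    res₁₂ res₁₃ : Model F four → F.Carrier
    res₁₂ f = d 1 5 F.* d 1 5 F.+ F.- (d 1 2 F.* d 2 5)
      where open Four F f
    res₁₃ f = d 1 8 F.* d 1 8 F.+ F.- (d 1 3 F.* d 3 8)
      where open Four F f

    -- R(0) for the quartic R of q; for a model in normal form this is `res₁₃`.
    quarticConstant : Model F four → F.Carrier
    quarticConstant f = f (# 7) F.* f (# 7) F.+ f (# 2) F.* f (# 2) F.* f (# 17)

    -- The swap is an involution on models in normal form. So the inverse is given by the same
    -- substitution for the swapped model, whose q is invertible by the other resultant.
    conn-swap-normal : ∀ g {i i′} → i F.* quarticConstant g F.≈ F.1# → i′ F.* quarticConstant (swap₂₃ (normal₄ F g)) F.≈ F.1# →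
      Conn F four (F.- F.1#) (normal₄ F g) (swap₂₃ (normal₄ F g))
    conn-swap-normal g {i} {i′} e e′ = conn-resp F
      (gather (spread {P = λ i → normal₄ F g i F.≈ normal₄ F g i} λ _ → F.refl))
      (gather (spread {P = λ i → swap₂₃ (normal₄ F g) i F.≈ swap₂₃ (normal₄ F g) i} λ _ → F.refl))
      (connect F (A.swapStep U UQ QU) φ (gather (spread {n = 9} {P = λ i → Eqv F B.S (sub F φ (relsA F four B.f′ i)) (con F.0#)} (Step.ok stepB)))
        (gather (spread (involution B.S U′ (sub F φ U) UQ′ QU′ (subHom F φ okφ UQ))))
        (gather (spread (involution A.S U (sub F ψ U′) UQ QU (subHom F ψ okψ UQ′)))))
      where
      module A = Inverted F g
      module B = Inverted F (swap₂₃ (normal₄ F g))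
      U = proj₁ (A.inverse-q i e)
      UQ = proj₁ (proj₂ (A.inverse-q i e))
      QU = proj₂ (proj₂ (A.inverse-q i e))
      U′ = proj₁ (B.inverse-q i′ e′)
      UQ′ = proj₁ (proj₂ (B.inverse-q i′ e′))
      QU′ = proj₂ (proj₂ (B.inverse-q i′ e′))
      stepB = B.swapStep U′ UQ′ QU′
      φ ψ : Subst F four
      φ = B.swapImage U′ UQ′ QU′
      ψ = A.swapImage U UQ QU
      okφ : ∀ i → Eqv F B.S (sub F φ (A.S i)) (con F.0#)
      okφ = gather (spread {n = 9} {P = λ i → Eqv F B.S (sub F φ (relsA F four B.f′ i)) (con F.0#)} (Step.ok stepB))
      okψ : ∀ i → Eqv F A.S (sub F ψ (B.S i)) (con F.0#)
      okψ = gather (spread {n = 9} {P = λ i → Eqv F A.S (sub F ψ (relsA F four A.f′ i)) (con F.0#)} (Step.ok (A.swapStep U UQ QU)))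

  private
    -- The new relations are combinations of the old ones, with the generators kept. All minors dᵢⱼ
    -- are multiplied by det N; D is linear in them and ξ quadratic.
    mixStep : StepData four
    mixStep = record
      { source = varModel four ; target = Moves4.mix 𝕊 N (varModel four) ; image = gen ; factor = D ; const = 𝟘 ; inner = con 𝟘
      ; depth = 0 ; monic = [] ; ξ-cert = [] ; D-cert = λ _ → []
      ; ok-cert = lookup (row n₁ n₂ 0 ∷ row n₁ n₂ 1 ∷ row n₁ n₂ 2 ∷ row n₃ n₄ 0 ∷ row n₃ n₄ 1 ∷ row n₃ n₄ 2
          ∷ one 6 ∷ one 7 ∷ one 8 ∷ []) }
      where
      n₁ n₂ n₃ n₄ D : SE
      n₁ = var 22
      n₂ = var 23
      n₃ = var 24
      n₄ = var 25
      D = n₁ :* n₄ :+ :- (n₂ :* n₃)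
      N : Mat 𝕊 2
      N = lookup (lookup (n₁ ∷ n₂ ∷ []) ∷ lookup (n₃ ∷ n₄ ∷ []) ∷ [])
      row : SE → SE → ℕ → Cert
      row a b i = (a , [] , i , []) ∷ (b , [] , 3 ℕ.+ i , []) ∷ []
      one : ℕ → Cert
      one i = (𝟙 , [] , i , []) ∷ []

  module Mix4 {c ℓ : Level} (F : Field c ℓ) where
    private module F = Field F
    open Moves4 F
    open Scalar F

    det₂ : Mat F 2 → F.Carrier
    det₂ N = N (# 0) (# 0) F.* N (# 1) (# 1) F.+ F.- (N (# 0) (# 1) F.* N (# 1) (# 0))

    private
      entries : Mat F 2 → List F.Carrier
      entries N = N (# 0) (# 0) ∷ N (# 0) (# 1) ∷ N (# 1) (# 0) ∷ N (# 1) (# 1) ∷ []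

      stepFor : ∀ N (f : Model F four) → Step F four (det₂ N) (evM F (env F F.1# F.1# (tabulate f ++ᴸ entries N)) (varModel four)) (evM F (env F F.1# F.1# (tabulate f ++ᴸ entries N)) (StepData.target mixStep))
      stepFor N f = step F F.1# F.1# (F.*-identityˡ _) (tabulate f ++ᴸ entries N) four mixStep tt

      reflexive : ∀ {g k} {S : Fin k → NC F g} {x y} → x ≡ y → Eqv F S x y
      reflexive refl = refl′

      sub-id : ∀ {g} (ψ : Fin g → NC F g) → (∀ i → ψ i ≡ gen i) → ∀ x → sub F ψ x ≡ x
      sub-id ψ h (con a) = refl
      sub-id ψ h (gen i) = h i
      sub-id ψ h (x ⊕ y) = ≡.cong₂ _⊕_ (sub-id ψ h x) (sub-id ψ h y)
      sub-id ψ h (x ⊗ y) = ≡.cong₂ _⊗_ (sub-id ψ h x) (sub-id ψ h y)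

    conn-mix : ∀ N N′ f → (∀ i → f i F.≈ mix N′ (mix N f) i) → Conn F four (det₂ N) f (mix N f)
    conn-mix N N′ f h = conn-resp F (evVar F four F.1# F.1# f (entries N))
      (gather (spread {P = λ i → mix N f i F.≈ mix N f i} λ _ → F.refl))
      (connect F (stepFor N f) gen ok′ (λ i → reflexive (≡.trans (sub-gen F _) (nth-tabulate gen [] i))) (λ i → reflexive (nth-tabulate gen [] i)))
      where
      S = relsA F four (mix N f)
      f̂ = evM F (env F F.1# F.1# (tabulate f ++ᴸ entries N)) (varModel four)
      back : ∀ i → Eqv F S (relsA F four (mix N′ (mix N f)) i) (con F.0#)
      back = gather (spread {n = 9} {P = λ i → Eqv F S (relsA F four (mix N′ (mix N f)) i) (con F.0#)} λ i →
        ≡.subst (λ z → Eqv F S z (con F.0#)) (sub-id _ (nth-tabulate gen []) _) (ok″ i))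
        where
        ψ = Step.ψ (stepFor N′ (mix N f))
        ok″ : ∀ i → Eqv F S (sub F ψ (relsA F four (mix N′ (mix N f)) i)) (con F.0#)
        ok″ = gather (spread {n = 9} {P = λ i → Eqv F S (sub F ψ (relsA F four (mix N′ (mix N f)) i)) (con F.0#)} (Step.ok (stepFor N′ (mix N f))))
      ok′ : ∀ i → Eqv F S (sub F gen (relsA F four f̂ i)) (con F.0#)
      ok′ i = ≡.subst (λ z → Eqv F S z (con F.0#)) (≡.sym (sub-gen F _))
        (trans′ (rels-cong F four (λ i → F.trans (F.sym (evVar F four F.1# F.1# f (entries N) i)) (h i)) S i) (back i))

open Swapping public

-- Reduction of degree 4 models to the normal form

module Normalisation where
  module _ {c ℓ : Level} (F : Field c ℓ) where
    private module F = Field F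

    -- What the clause on η uses about A_f for n = 3, 4. It is proved for a normal form and
    -- transported from there.
    record Good (n : Deg) (f : Model F n) : Set (c ⊔ ℓ) where
      field
        D-cong    : ∀ {x y} → Eqv F (relsA F n f) x y → Eqv F (relsA F n f) (DA F n f x) (DA F n f y)
        ξ-central : Central F (relsA F n f) (ξA F n f)

    -- ψ is injective, and ψ(Dx) = δD₀(ψx) + [κ, ψx] depends only on the class of x; likewise
    -- ψ([ξ, x]) = δ²[ξ₀, ψx].
    good-conn : ∀ {n δ} {f₀ f : Model F n} → Conn F n δ f₀ f → Good n f₀ → Good n f
    good-conn {n} {δ} {f₀} {f} C G = record
      { D-cong = λ p → injective (trans (D-eq _) (trans (+-cong (*-congˡ (G.D-cong (h.fun-cong p)))
          (+-cong (*-congˡ (h.fun-cong p)) (*-congˡ (*-congʳ (h.fun-cong p))))) (sym (D-eq _))))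
      ; ξ-central = λ x → injective (trans (hom-⟦⟧ F to (ξA F n f) x) (trans (br-cong ξ-eq) (trans
          (shifted (ψ x)) (trans (*-congˡ (G.ξ-central (ψ x))) (trans (zeroʳ _) (sym (h.con-hom _))))))) }
      where
      open Conn C
      module G = Good G
      module h = AlgHom to
      open Ring (ncRing F (relsA F n f₀)) hiding (zero)
      injective : ∀ {x y} → Eqv F (relsA F n f₀) (ψ x) (ψ y) → Eqv F (relsA F n f) x y
      injective p = trans′ (sym′ (from∘to _)) (trans′ (AlgHom.fun-cong from p) (from∘to _))
      br-cong : ∀ {u v x} → u ≈ v → ⟦_,_⟧ F u x ≈ ⟦_,_⟧ F v x
      br-cong p = +-cong (*-congʳ p) (*-congˡ (*-congˡ p))
      shifted : ∀ x → ⟦_,_⟧ F (_·_ F (δ F.* δ) (ξA F n f₀) ⊕ con ρ) x ≈ con (δ F.* δ) ⊗ ⟦_,_⟧ F (ξA F n f₀) x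
      shifted x = I.identity {h = 2} [] tt (lift tt) [] 0
        (⟦_,_⟧ 𝕊 (_·_ 𝕊 (var 2 :* var 2) (gen (# 0)) ⊕ con (var 3)) (gen (# 1)))
        (con (var 2 :* var 2) ⊗ ⟦_,_⟧ 𝕊 (gen (# 0)) (gen (# 1))) [] tt
        where
        module I = Identity F (relsA F n f₀) (env F F.1# F.1# (δ ∷ ρ ∷ [])) (F.*-identityˡ _) (nth (con F.0#) (ξA F n f₀ ∷ x ∷ []))

    infixr 5 _▷_
    _▷_ : ∀ {n δ₁ δ₂} {f f′ f″ : Model F n} → Conn F n δ₁ f f′ → Conn F n δ₂ f′ f″ → Conn F n (δ₂ F.* δ₁) f f″
    _▷_ = conn-trans F

    infixr 5 _▷₁_
    _▷₁_ : ∀ {n δ} {f f′ f″ : Model F n} → Conn F n F.1# f f′ → Conn F n δ f′ f″ → Conn F n δ f f″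
    C ▷₁ C′ = conn-δ F (F.*-identityʳ _) (C ▷ C′)

    okM : ∀ {n} → (Fin n → SE) → Bool
    okM x = allB λ i → okS (x i)

    congM : ∀ {n} (x : Fin n → SE) → T (okM x) → ∀ {ρ ρ′} → (∀ k → ρ k F.≈ ρ′ k) → AllF n (λ i → evS F ρ (x i) F.≈ evS F ρ′ (x i))
    congM x t h = spread λ i → evS-cong F {g = 0} {k = 0} (λ ()) h (x i) (allB-sound (λ i → okS (x i)) t i)

    env-cong : ∀ {a b m} (f f′ : Fin m → F.Carrier) xs → (∀ i → f i F.≈ f′ i) → ∀ k →
      env F a b (tabulate f ++ᴸ xs) k F.≈ env F a b (tabulate f′ ++ᴸ xs) k
    env-cong f f′ xs h zero          = F.refl
    env-cong f f′ xs h (suc zero)    = F.refl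
    env-cong f f′ xs h (suc (suc k)) = go f f′ h k
      where
      go : ∀ {m} (f f′ : Fin m → F.Carrier) → (∀ i → f i F.≈ f′ i) → ∀ k →
        nth F.0# (tabulate f ++ᴸ xs) k F.≈ nth F.0# (tabulate f′ ++ᴸ xs) k
      go {zero}  f f′ h k       = F.refl
      go {suc m} f f′ h zero    = h zero
      go {suc m} f f′ h (suc k) = go (f ∘ suc) (f′ ∘ suc) (h ∘ suc) k

  module _ {c ℓ : Level} (F : Field c ℓ) where
    private module F = Field F
    open Moves4 F using (shear₁₂; flip₁₂; flip₃₄; lift₃₁)

    shear₂₁ lift₄₁ : F.Carrier → Model F four → Model F four
    shear₂₁ t f = flip₁₂ (shear₁₂ t (flip₁₂ f))
    lift₄₁ t f = flip₃₄ (lift₃₁ t (flip₃₄ f))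

    lifts : F.Carrier → F.Carrier → F.Carrier → Model F four → Model F four
    lifts t₂ t₃ t₄ f = lift₄₁ t₄ (lift₃₁ t₃ (shear₂₁ t₂ f))

  module Normalise4 {c ℓ : Level} (F : Field c ℓ) where
    private module F = Field F
    open Conn4 F
    open Scalar F
    open Mix4 F
    open Swap4 F using (res₁₂; res₁₃; quarticConstant; conn-swap-normal)

    conn-shear₂₁ : ∀ t f → Conn F four F.1# f (shear₂₁ F t f)
    conn-shear₂₁ t f = conn-δ F (sc [] (:- 𝟙 :* 𝟙 :* :- 𝟙) 𝟙 tt)
      (_▷_ F (conn-flip₁₂ f) (_▷_ F (conn-shear₁₂ t _) (conn-flip₁₂ _)))

    conn-lift₄₁ : ∀ t f → Conn F four F.1# f (lift₄₁ F t f)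
    conn-lift₄₁ t f = conn-δ F (sc [] (:- 𝟙 :* 𝟙 :* :- 𝟙) 𝟙 tt)
      (_▷_ F (conn-flip₃₄ f) (_▷_ F (conn-lift₃₁ t _) (conn-flip₃₄ _)))

    conn-lifts : ∀ t₂ t₃ t₄ f → Conn F four F.1# f (lifts F t₂ t₃ t₄ f)
    conn-lifts t₂ t₃ t₄ f = _▷₁_ F (conn-shear₂₁ t₂ f) (_▷₁_ F (conn-lift₃₁ t₃ _) (conn-lift₄₁ t₄ _))

    private
      fₛ : Model 𝕊 four
      fₛ = varModel four
      module M = Moves4 𝕊
      Nₛ N′ₛ : SE → SE → SE → SE → Mat 𝕊 2
      Nₛ x y α β = lookup (lookup (y ∷ :- x ∷ []) ∷ lookup (α ∷ β ∷ []) ∷ [])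
      N′ₛ x y α β = lookup (lookup (β ∷ x ∷ []) ∷ lookup (:- α ∷ y ∷ []) ∷ [])
      x₀ y₀ α₀ β₀ : SE
      x₀ = var 22
      y₀ = var 23
      α₀ = var 24
      β₀ = var 25
      times : SE → Model 𝕊 four → Model 𝕊 four
      times a f i = a :* f i

    module _ (x y α β : F.Carrier) (e : α F.* x F.+ β F.* y F.≈ F.1#) where
      -- In the application x and y are the values of f₁ and f₂ at e₁. The first row of N makes the
      -- first form vanish there, the second row gives the second form the value 1; det N = αx + βy
      -- = 1, and N′ is the inverse of N.
      N N′ : Mat F 2
      N = lookup (lookup (y ∷ F.- x ∷ []) ∷ lookup (α ∷ β ∷ []) ∷ [])
      N′ = lookup (lookup (β ∷ x ∷ []) ∷ lookup (F.- α ∷ y ∷ []) ∷ [])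

      private
        scale1 : ∀ z → (α F.* x F.+ β F.* y) F.* z F.≈ z
        scale1 z = F.trans (F.*-congʳ e) (F.*-identityˡ _)

        xs : List F.Carrier
        xs = x ∷ y ∷ α ∷ β ∷ []

        e′ : SE
        e′ = α₀ :* x₀ :+ β₀ :* y₀

      N′N : ∀ (f : Model F four) i → mix N′ (mix N f) i F.≈ f i
      N′N f i = F.trans (gather {P = λ i → mix N′ (mix N f) i F.≈ (α F.* x F.+ β F.* y) F.* f i}
        (scM (tabulate f ++ᴸ xs) (M.mix (N′ₛ x₀ y₀ α₀ β₀) (M.mix (Nₛ x₀ y₀ α₀ β₀) fₛ)) (times e′ fₛ) tt) i) (scale1 _)

      NN′ : ∀ (f : Model F four) i → mix N (mix N′ f) i F.≈ f i
      NN′ f i = F.trans (gather {P = λ i → mix N (mix N′ f) i F.≈ (α F.* x F.+ β F.* y) F.* f i}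
        (scM (tabulate f ++ᴸ xs) (M.mix (Nₛ x₀ y₀ α₀ β₀) (M.mix (N′ₛ x₀ y₀ α₀ β₀) fₛ)) (times e′ fₛ) tt) i) (scale1 _)

      det-N : det₂ N F.≈ F.1#
      det-N = F.trans (sc xs (var 3 :* var 5 :+ :- (:- var 2 :* var 4)) (var 4 :* var 2 :+ var 5 :* var 3) tt) e

      det-N′ : det₂ N′ F.≈ F.1#
      det-N′ = F.trans (sc xs (var 5 :* var 3 :+ :- (var 2 :* :- var 4)) (var 4 :* var 2 :+ var 5 :* var 3) tt) e

      conn-N : ∀ f → Conn F four F.1# f (mix N f)
      conn-N f = conn-δ F det-N (conn-mix N N′ f (λ i → F.sym (N′N f i)))

      conn-N′ : ∀ f → Conn F four F.1# f (mix N′ f)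
      conn-N′ f = conn-δ F det-N′ (conn-mix N′ N f (λ i → F.sym (NN′ f i)))

    swap-mix : ∀ (N : Mat F 2) f i → mix N (swap₂₃ f) i F.≈ swap₂₃ (mix N f) i
    swap-mix N f = gather (spread {P = λ i → mix N (swap₂₃ f) i F.≈ mix N (swap₂₃ f) i} λ _ → F.refl)

    swap-cong : ∀ {f f′ : Model F four} → (∀ i → f i F.≈ f′ i) → ∀ i → swap₂₃ f i F.≈ swap₂₃ f′ i
    swap-cong {f} {f′} h = gather (congM F (M.swap₂₃ fₛ) tt (env-cong F {F.1#} {F.1#} f f′ [] h))

    lifts-inverse : ∀ t₂ t₃ t₄ f i → lifts F (F.- t₂) (F.- t₃) (F.- t₄) (lifts F t₂ t₃ t₄ f) i F.≈ f i
    lifts-inverse t₂ t₃ t₄ f = gather (scM (tabulate f ++ᴸ t₂ ∷ t₃ ∷ t₄ ∷ [])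
      (lifts 𝕊 (:- var 22) (:- var 23) (:- var 24) (lifts 𝕊 (var 22) (var 23) (var 24) fₛ)) fₛ tt)

    -- The lifts add multiples of e₁ to e₂, e₃, e₄, and the swap exchanges e₂ with e₃; so after the
    -- swap they are undone with t₂ and t₃ interchanged.
    lifts-swap : ∀ t₂ t₃ t₄ f i → lifts F (F.- t₃) (F.- t₂) (F.- t₄) (swap₂₃ (lifts F t₂ t₃ t₄ f)) i F.≈ swap₂₃ f i
    lifts-swap t₂ t₃ t₄ f = gather (scM (tabulate f ++ᴸ t₂ ∷ t₃ ∷ t₄ ∷ [])
      (lifts 𝕊 (:- var 23) (:- var 22) (:- var 24) (M.swap₂₃ (lifts 𝕊 (var 22) (var 23) (var 24) fₛ))) (M.swap₂₃ fₛ) tt)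

    res₁₃-lifts : ∀ t₂ t₃ t₄ f → res₁₃ (lifts F t₂ t₃ t₄ f) F.≈ res₁₃ f
    res₁₃-lifts t₂ t₃ t₄ f = sc (tabulate f ++ᴸ t₂ ∷ t₃ ∷ t₄ ∷ []) (Swap4.res₁₃ 𝕊 (lifts 𝕊 (var 22) (var 23) (var 24) fₛ)) (Swap4.res₁₃ 𝕊 fₛ) tt

    res₁₂-lifts : ∀ t₂ t₃ t₄ f → res₁₂ (lifts F t₂ t₃ t₄ f) F.≈ res₁₂ f
    res₁₂-lifts t₂ t₃ t₄ f = sc (tabulate f ++ᴸ t₂ ∷ t₃ ∷ t₄ ∷ []) (Swap4.res₁₂ 𝕊 (lifts 𝕊 (var 22) (var 23) (var 24) fₛ)) (Swap4.res₁₂ 𝕊 fₛ) tt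

    res₁₃-mix : ∀ N f → res₁₃ (mix N f) F.≈ det₂ N F.* det₂ N F.* res₁₃ f
    res₁₃-mix N f = sc (tabulate f ++ᴸ N (# 0) (# 0) ∷ N (# 0) (# 1) ∷ N (# 1) (# 0) ∷ N (# 1) (# 1) ∷ [])
      (Swap4.res₁₃ 𝕊 (M.mix Nₓ fₛ)) (Mix4.det₂ 𝕊 Nₓ :* Mix4.det₂ 𝕊 Nₓ :* Swap4.res₁₃ 𝕊 fₛ) tt
      where Nₓ = lookup (lookup (x₀ ∷ y₀ ∷ []) ∷ lookup (α₀ ∷ β₀ ∷ []) ∷ [])

    res₁₂-mix : ∀ N f → res₁₂ (mix N f) F.≈ det₂ N F.* det₂ N F.* res₁₂ f
    res₁₂-mix N f = sc (tabulate f ++ᴸ N (# 0) (# 0) ∷ N (# 0) (# 1) ∷ N (# 1) (# 0) ∷ N (# 1) (# 1) ∷ [])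
      (Swap4.res₁₂ 𝕊 (M.mix Nₓ fₛ)) (Mix4.det₂ 𝕊 Nₓ :* Mix4.det₂ 𝕊 Nₓ :* Swap4.res₁₂ 𝕊 fₛ) tt
      where Nₓ = lookup (lookup (x₀ ∷ y₀ ∷ []) ∷ lookup (α₀ ∷ β₀ ∷ []) ∷ [])

    res₁₃-cong : ∀ {f f′ : Model F four} → (∀ i → f i F.≈ f′ i) → res₁₃ f F.≈ res₁₃ f′
    res₁₃-cong {f} {f′} h = evS-cong F {g = 0} {k = 0} (λ ()) (env-cong F {F.1#} {F.1#} f f′ [] h) (Swap4.res₁₃ 𝕊 fₛ) tt

    res₁₂-cong : ∀ {f f′ : Model F four} → (∀ i → f i F.≈ f′ i) → res₁₂ f F.≈ res₁₂ f′
    res₁₂-cong {f} {f′} h = evS-cong F {g = 0} {k = 0} (λ ()) (env-cong F {F.1#} {F.1#} f f′ [] h) (Swap4.res₁₂ 𝕊 fₛ) tt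

    module Reduce (2≉0 : ¬ (F.1# F.+ F.1#) F.≈ F.0#) (g : Model F four)
      (α β : F.Carrier) (e : α F.* g (# 0) F.+ β F.* g (# 10) F.≈ F.1#) where
      x = g (# 0)
      y = g (# 10)
      g₁ = mix (N x y α β e) g
      g₁-0 : g₁ (# 0) F.≈ F.0#
      g₁-0 = sc (x ∷ y ∷ []) (var 3 :* var 2 :+ :- var 2 :* var 3) 𝟘 tt
      t₂ t₃ t₄ : F.Carrier
      -- Completing the square in x₁: adding tᵢe₁ to eᵢ adds 2tᵢ to the coefficient of x₁xᵢ in the
      -- second form, where x₁² has coefficient 1.
      t₂ = F.- (half F F.* g₁ (# 11))
      t₃ = F.- (half F F.* g₁ (# 12))
      t₄ = F.- (half F F.* g₁ (# 13))
      g₄ = lifts F t₂ t₃ t₄ g₁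

      private
        cancel : ∀ b z → z F.≈ F.1# → b F.+ nat F 2 F.* F.- (half F F.* b) F.* z F.≈ F.0#
        -- Here 2 and ½ are supplied as the inverse pair of variables, so that they do cancel.
        cancel b z h = F.trans (sc₁ (F.inverse _ 2≉0) (b ∷ z ∷ []) (var 2 :+ nat 𝕊 2 :* :- (var 1 :* var 2) :* var 3)
            (var 2 :* (𝟙 :+ :- ((𝟙 :+ 𝟙) :* var 1 :* var 3))) tt)
          (F.trans (F.*-congˡ (F.trans (F.+-congˡ (F.-‿cong (F.trans (F.*-cong (F.inverse _ 2≉0) h) (F.*-identityˡ _)))) (F.-‿inverseʳ _))) (F.zeroʳ _))
        entry : ∀ i a → T (checkS (lifts 𝕊 (var 22) (var 23) (var 24) fₛ i) a) →
          evS F (env F F.1# F.1# (tabulate g₁ ++ᴸ t₂ ∷ t₃ ∷ t₄ ∷ [])) (lifts 𝕊 (var 22) (var 23) (var 24) fₛ i) F.≈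
          evS F (env F F.1# F.1# (tabulate g₁ ++ᴸ t₂ ∷ t₃ ∷ t₄ ∷ [])) a
        entry i a t = sc (tabulate g₁ ++ᴸ t₂ ∷ t₃ ∷ t₄ ∷ []) (lifts 𝕊 (var 22) (var 23) (var 24) fₛ i) a t

      normal : ∀ i → g₄ i F.≈ normal₄ F g₄ i
      normal = gather (F.trans (entry (# 0) (var 2) tt) g₁-0 , r , r , r , r , r , r , r , r , r ,
        F.trans (entry (# 10) (var 12) tt) e ,
        F.trans (entry (# 11) (var 13 :+ nat 𝕊 2 :* var 22 :* var 12) tt) (cancel _ _ e) ,
        F.trans (entry (# 12) (var 14 :+ nat 𝕊 2 :* var 23 :* var 12) tt) (cancel _ _ e) ,
        F.trans (entry (# 13) (var 15 :+ nat 𝕊 2 :* var 24 :* var 12) tt) (cancel _ _ e) , r , r , r , r , r , r , lift tt)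
        where
        r : ∀ {x} → x F.≈ x
        r = F.refl

      to-normal : Conn F four F.1# g (normal₄ F g₄)
      to-normal = _▷₁_ F (conn-N x y α β e g) (_▷₁_ F (conn-lifts t₂ t₃ t₄ g₁) (conn-≈ F normal))

      from-normal : Conn F four F.1# (normal₄ F g₄) g
      from-normal = _▷₁_ F (conn-≈ F (λ i → F.sym (normal i)))
        (_▷₁_ F (conn-resp F (λ _ → F.refl) (lifts-inverse t₂ t₃ t₄ g₁) (conn-lifts (F.- t₂) (F.- t₃) (F.- t₄) g₄))
          (conn-resp F (λ _ → F.refl) (N′N x y α β e g) (conn-N′ x y α β e g₁)))

      res₁₃-normal : quarticConstant g₄ F.≈ res₁₃ g
      res₁₃-normal = F.trans (sc (tabulate g₄) (Swap4.quarticConstant 𝕊 fₛ) (Swap4.res₁₃ 𝕊 (normal₄ 𝕊 fₛ)) tt)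
        (F.trans (F.sym (res₁₃-cong normal)) (F.trans (res₁₃-lifts t₂ t₃ t₄ g₁) (F.trans (res₁₃-mix (N x y α β e) g)
          (F.trans (F.*-congʳ (F.trans (F.*-cong (det-N x y α β e) (det-N x y α β e)) (F.*-identityˡ _))) (F.*-identityˡ _)))))

      res₁₂-normal : quarticConstant (swap₂₃ (normal₄ F g₄)) F.≈ res₁₂ g
      res₁₂-normal = F.trans (sc (tabulate g₄) (Swap4.quarticConstant 𝕊 (M.swap₂₃ (normal₄ 𝕊 fₛ))) (Swap4.res₁₂ 𝕊 (normal₄ 𝕊 fₛ)) tt)
        (F.trans (F.sym (res₁₂-cong normal)) (F.trans (res₁₂-lifts t₂ t₃ t₄ g₁) (F.trans (res₁₂-mix (N x y α β e) g)
          (F.trans (F.*-congʳ (F.trans (F.*-cong (det-N x y α β e) (det-N x y α β e)) (F.*-identityˡ _))) (F.*-identityˡ _)))))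

      good : Good F four g
      good = good-conn F from-normal (record { D-cong = Inverted.D-cong F g₄ ; ξ-central = Inverted.ξ-central F g₄ })

      -- The swap of the normal form, conjugated by the reduction to it; each step of the reduction
      -- is undone on the swapped model.
      conn-swap′ : ¬ res₁₂ g F.≈ F.0# → ¬ res₁₃ g F.≈ F.0# → Conn F four (F.- F.1#) g (swap₂₃ g)
      conn-swap′ h₁₂ h₁₃ = _▷₁_ F to-normal (conn-δ F (F.*-identityˡ _) (_▷_ F
        (conn-swap-normal g₄ (F.trans (F.*-congˡ res₁₃-normal) (unit h₁₃)) (F.trans (F.*-congˡ res₁₂-normal) (unit h₁₂)))
        (_▷₁_ F (conn-≈ F (swap-cong (λ i → F.sym (normal i))))
          (_▷₁_ F (conn-resp F (λ _ → F.refl) (lifts-swap t₂ t₃ t₄ g₁) (conn-lifts (F.- t₃) (F.- t₂) (F.- t₄) (swap₂₃ g₄)))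
            (conn-resp F (λ _ → F.refl) (λ i → F.trans (swap-mix (N′ x y α β e) g₁ i) (swap-cong (N′N x y α β e g) i))
              (conn-N′ x y α β e (swap₂₃ g₁)))))))

open Normalisation public

-- Degree 3 with arbitrary c; elimination and exchange of vectors

module Elimination where
  normal₃ : ∀ {c ℓ} (F : Field c ℓ) → Model F three → Model F three
  normal₃ F f = lookup (f (# 0) ∷ f (# 1) ∷ Field.1# F ∷ f (# 3) ∷ f (# 4) ∷ f (# 5) ∷ f (# 6) ∷ f (# 7) ∷ f (# 8) ∷ f (# 9) ∷ [])

  private
    X Y : NC 𝕊 2
    X = gen (# 0)
    Y = gen (# 1)
    n₃ : Model 𝕊 three
    n₃ = normal₃ 𝕊 (varModel three)
    m₃ : List Monic
    m₃ = (0 ∷ 0 ∷ 0 ∷ [] , :- 𝟙 , 0) ∷ (1 ∷ 0 ∷ 0 ∷ [] , :- 𝟙 , 1) ∷ (1 ∷ 1 ∷ 0 ∷ [] , :- 𝟙 , 2) ∷ (1 ∷ 1 ∷ 1 ∷ [] , :- 𝟙 , 3) ∷ []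

  module General3 {c ℓ : Level} (F : Field c ℓ) where
    private module F = Field F
    open Conn3 F
    open Scalar F

    private
      v₃ : Model 𝕊 three
      v₃ = varModel three
      module M = Moves3 𝕊

      c≈1 : ∀ {f : Model F three} → f (# 2) F.≈ F.1# → ∀ i → f i F.≈ normal₃ F f i
      c≈1 h = gather (r , r , h , r , r , r , r , r , r , r , lift tt)
        where
        r : ∀ {x} → x F.≈ x
        r = F.refl

    shear₃-cong : ∀ t {f f′ : Model F three} → (∀ i → f i F.≈ f′ i) → ∀ i → shear₃ t f i F.≈ shear₃ t f′ i
    shear₃-cong t {f} {f′} h = gather (congM F (M.shear₃ (var 12) v₃) tt (env-cong F {F.1#} {F.1#} f f′ (t ∷ []) h))
    lift₃-cong : ∀ t {f f′ : Model F three} → (∀ i → f i F.≈ f′ i) → ∀ i → lift₃ t f i F.≈ lift₃ t f′ i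
    lift₃-cong t {f} {f′} h = gather (congM F (M.lift₃ (var 12) v₃) tt (env-cong F {F.1#} {F.1#} f f′ (t ∷ []) h))
    flip₃-cong : ∀ {f f′ : Model F three} → (∀ i → f i F.≈ f′ i) → ∀ i → flip₃ f i F.≈ flip₃ f′ i
    flip₃-cong {f} {f′} h = gather (congM F (M.flip₃ v₃) tt (env-cong F {F.1#} {F.1#} f f′ [] h))
    swap₃-cong : ∀ {f f′ : Model F three} → (∀ i → f i F.≈ f′ i) → ∀ i → swap₃ f i F.≈ swap₃ f′ i
    swap₃-cong {f} {f′} h = gather (congM F (M.swap₃ v₃) tt (env-cong F {F.1#} {F.1#} f f′ [] h))

    module Monic (f : Model F three) (h : f (# 2) F.≈ F.1#) where
      private
        src : ∀ xs i → f i F.≈ evM F (env F F.1# F.1# (tabulate f ++ᴸ xs)) n₃ i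
        src xs = gather (r , r , h , r , r , r , r , r , r , r , lift tt)
          where
          r : ∀ {x} → x F.≈ x
          r = F.refl

      conn-shear : ∀ t → Conn F three F.1# f (shear₃ t f)
      conn-shear t = conn-resp F (src (t ∷ [])) (gather (spread (shear₃-cong t {normal₃ F f} {f} (λ i → F.sym (c≈1 {f} h i)))))
        (move F F.1# F.1# (F.*-identityˡ _) (tabulate f ++ᴸ t ∷ []) shearData₃ tt)
      conn-lift : ∀ t → Conn F three F.1# f (lift₃ t f)
      conn-lift t = conn-resp F (src (t ∷ [])) (gather (spread (lift₃-cong t {normal₃ F f} {f} (λ i → F.sym (c≈1 {f} h i)))))
        (move F F.1# F.1# (F.*-identityˡ _) (tabulate f ++ᴸ t ∷ []) liftData₃ tt)
      conn-flip : Conn F three (F.- F.1#) f (flip₃ f)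
      conn-flip = conn-resp F (src []) (gather (spread (flip₃-cong {normal₃ F f} {f} (λ i → F.sym (c≈1 {f} h i)))))
        (move F F.1# F.1# (F.*-identityˡ _) (tabulate f ++ᴸ []) flipData₃ tt)
      conn-swap : ¬ f (# 0) F.≈ F.0# → Conn F three (F.- F.1#) f (swap₃ f)
      conn-swap a≉0 = conn-resp F
        -- The coefficient a and its inverse fill the places of the inverse pair of variables.
        (gather {P = λ i → f i F.≈ evM F (env F (f (# 0)) (f (# 0) F.⁻¹) (tabulate f ++ᴸ [])) (MoveData.source swapData₃) i} (r , r , h , r , r , r , r , r , r , r , lift tt))
        (gather (spread (swap₃-cong {normal₃ F f} {f} (λ i → F.sym (c≈1 {f} h i)))))
        (move F (f (# 0)) (f (# 0) F.⁻¹) (F.inverse _ a≉0) (tabulate f ++ᴸ []) swapData₃ tt)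
        where
        r : ∀ {x} → x F.≈ x
        r = F.refl

      private
        ρ = env F F.1# F.1# (tabulate f)
        f̂ = evM F ρ n₃
        module I = Identity F (relsA F three f̂) ρ (F.*-identityˡ _) (letters F [])
        Rs : List (NC 𝕊 2)
        Rs = relList three n₃
        van : I.Vanish Rs
        van = rel (# 0) , rel (# 1) , rel (# 2) , rel (# 3) , lift tt
        D-rel : Fin 4 → NC 𝕊 2
        D-rel i = extDer 𝕊 (Three.Dgen 𝕊 n₃) (relsA 𝕊 three n₃ i)
        comm : Fin 2 → NC 𝕊 2
        comm i = ⟦_,_⟧ 𝕊 (Three.ξ 𝕊 n₃) (gen i)

      -- For c = 1 the four rules alone reduce D of each relation, and each commutator of ξ with a
      -- generator, to 0.
      good : Good F three f
      good = good-conn F (conn-≈ F (λ i → F.sym (src [] i))) (record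
        { D-cong = extDer-cong F (relsA F three f̂) (Three.Dgen F f̂) (gather (spread {P = λ i → ev₀ F ρ (D-rel i) I.~ con F.0#} λ i →
            I.identity Rs tt van m₃ 20 (D-rel i) (con 𝟘) [] (allB-sound (λ i → identity? 20 Rs m₃ (D-rel i) (con 𝟘) []) tt i)))
        ; ξ-central = central-gens F (relsA F three f̂) _ (gather (spread {P = λ i → ev₀ F ρ (comm i) I.~ con F.0#} λ i →
            I.identity Rs tt van m₃ 20 (comm i) (con 𝟘) [] (allB-sound (λ i → identity? 20 Rs m₃ (comm i) (con 𝟘) []) tt i))) })

    module _ (f : Model F three) (c≉0 : ¬ f (# 2) F.≈ F.0#) where
      private
        c₀ = f (# 2)
        f₁ = twist₃ (c₀ F.⁻¹) f
        e = unit c≉0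
        module M₁ = Monic f₁ e
        -- Dividing f by c leads to the case c = 1; the factors c⁻¹ and c of the two twists cancel
        -- in δ.
        untwist : ∀ {δ} (T : Model F three → Model F three) → Conn F three δ f₁ (T f₁) →
          (∀ i → twist₃ c₀ (T f₁) i F.≈ T f i) → Conn F three δ f (T f)
        untwist {δ} T C h = conn-δ F (sc₁ (F.inverse _ c≉0) (δ ∷ []) (var 0 :* var 2 :* var 1) (var 2) tt)
          (_▷_ F (conn-twist₃ e f) (_▷_ F C (conn-resp F (λ _ → F.refl) h (conn-twist₃ (F.inverse _ c≉0) (T f₁)))))
        scM₁ : ∀ xs (x y : Fin 10 → SE) → T (checkM x y) →
          AllF 10 (λ i → evS F (env F c₀ (c₀ F.⁻¹) xs) (x i) F.≈ evS F (env F c₀ (c₀ F.⁻¹) xs) (y i))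
        scM₁ xs x y t = spread λ i → sc₁ (F.inverse _ c≉0) xs (x i) (y i) (allB-sound (λ i → checkS (x i) (y i)) t i)

      conn-shear₃ : ∀ t → Conn F three F.1# f (shear₃ t f)
      conn-shear₃ t = untwist (shear₃ t) (M₁.conn-shear t)
        (gather (scM₁ (tabulate f ++ᴸ t ∷ []) (M.twist₃ (var 0) (M.shear₃ (var 12) (M.twist₃ (var 1) v₃))) (M.shear₃ (var 12) v₃) tt))
      conn-lift₃ : ∀ t → Conn F three F.1# f (lift₃ t f)
      conn-lift₃ t = untwist (lift₃ t) (M₁.conn-lift t)
        (gather (scM₁ (tabulate f ++ᴸ t ∷ []) (M.twist₃ (var 0) (M.lift₃ (var 12) (M.twist₃ (var 1) v₃))) (M.lift₃ (var 12) v₃) tt))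
      conn-flip₃ : Conn F three (F.- F.1#) f (flip₃ f)
      conn-flip₃ = untwist flip₃ M₁.conn-flip
        (gather (scM₁ (tabulate f) (M.twist₃ (var 0) (M.flip₃ (M.twist₃ (var 1) v₃))) (M.flip₃ v₃) tt))
      conn-swap₃ : ¬ f (# 0) F.≈ F.0# → Conn F three (F.- F.1#) f (swap₃ f)
      conn-swap₃ a≉0 = untwist swap₃ (M₁.conn-swap (λ h → a≉0 (F.trans (F.sym (F.trans (F.sym (F.*-assoc _ _ _))
          (F.trans (F.*-congʳ (F.inverse _ c≉0)) (F.*-identityˡ _)))) (F.trans (F.*-congˡ h) (F.zeroʳ _)))))
        (gather (scM₁ (tabulate f) (M.twist₃ (var 0) (M.swap₃ (M.twist₃ (var 1) v₃))) (M.swap₃ v₃) tt))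
      good₃ : Good F three f
      good₃ = good-conn F (conn-resp F (λ _ → F.refl) (gather (scM₁ (tabulate f) (M.twist₃ (var 0) (M.twist₃ (var 1) v₃)) v₃ tt))
        (conn-twist₃ (F.inverse _ c≉0) f₁)) M₁.good

  -- Equality in F is not decidable, but x x⁻¹ is 1 if x ≠ 0 and 0 if x = 0.
  module Select {c ℓ : Level} (F : Field c ℓ) where
    private module F = Field F
    open Scalar F

    V : ℕ → Set c
    V m = Fin m → F.Carrier

    infix 4 _≐_
    _≐_ : ∀ {m} → V m → V m → Set ℓ
    u ≐ v = ∀ i → u i F.≈ v i

    infixl 6 _⊞_
    infixr 7 _⊡_
    _⊞_ : ∀ {m} → V m → V m → V m
    (u ⊞ v) i = u i F.+ v i
    _⊡_ : ∀ {m} → F.Carrier → V m → V m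
    (a ⊡ v) i = a F.* v i

    select : F.Carrier → F.Carrier → F.Carrier → F.Carrier
    select x a b = x F.* x F.⁻¹ F.* a F.+ (F.1# F.- x F.* x F.⁻¹) F.* b

    selectV : ∀ {m} → F.Carrier → V m → V m → V m
    selectV x u v i = select x (u i) (v i)

    private
      at1 : ∀ e a b → e F.≈ F.1# → e F.* a F.+ (F.1# F.- e) F.* b F.≈ a
      at1 e a b h = F.trans (F.+-cong (F.*-congʳ h) (F.*-congʳ (F.+-congˡ (F.-‿cong h))))
        (sc (a ∷ b ∷ []) (𝟙 :* var 2 :+ (𝟙 :+ :- 𝟙) :* var 3) (var 2) tt)
      at0 : ∀ e a b → e F.≈ F.0# → e F.* a F.+ (F.1# F.- e) F.* b F.≈ b
      at0 e a b h = F.trans (F.+-cong (F.*-congʳ h) (F.*-congʳ (F.+-congˡ (F.-‿cong h))))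
        (sc (a ∷ b ∷ []) (𝟘 :* var 2 :+ (𝟙 :+ :- 𝟘) :* var 3) (var 3) tt)

    select-≉ : ∀ {x} → ¬ x F.≈ F.0# → ∀ a b → select x a b F.≈ a
    select-≉ h a b = at1 _ a b (F.inverse _ h)

    select-≈ : ∀ {x} → x F.≈ F.0# → ∀ a b → select x a b F.≈ b
    select-≈ h a b = at0 _ a b (F.trans (F.*-congʳ h) (F.zeroˡ _))

    -- A negated goal may be proved by cases on x = 0 without deciding x = 0, because the excluded
    -- middle holds under a double negation.
    cases : ∀ {p} {P : Set p} x → (¬ x F.≈ F.0# → ¬ P) → (x F.≈ F.0# → ¬ P) → ¬ P
    cases x h₁ h₂ p = h₁ (λ e → h₂ e p) p

    ≉-resp : ∀ {x y} → x F.≈ y → ¬ x F.≈ F.0# → ¬ y F.≈ F.0#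
    ≉-resp e h h′ = h (F.trans e h′)

    neg-≉ : ∀ {x y} → y F.≈ F.- x → ¬ x F.≈ F.0# → ¬ y F.≈ F.0#
    neg-≉ {x} e h h′ = h (F.trans (sc (x ∷ []) (var 2) (:- (:- var 2)) tt)
      (F.trans (F.-‿cong (F.trans (F.sym e) h′)) (sc [] (:- 𝟘) 𝟘 tt)))

    *-≉ : ∀ {x y} → ¬ x F.≈ F.0# → ¬ y F.≈ F.0# → ¬ (x F.* y) F.≈ F.0#
    *-≉ {x} {y} hx hy e = hy (F.trans (F.sym (F.trans (F.sym (F.*-assoc _ _ _)) (F.trans (F.*-congʳ (unit hx)) (F.*-identityˡ _))))
      (F.trans (F.*-congˡ e) (F.zeroʳ _)))

    -- Bringing a pair of vectors x, y to a pair w₃, w₄ by elementary operations,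
    -- modulo translations in Z.
    module Pair {m : ℕ} {p q : Level} (Z : V m → Set p) (L : (x y x′ y′ : V m) → Set q)
      (L-trans : ∀ {x y x′ y′ x″ y″} → L x y x′ y′ → L x′ y′ x″ y″ → L x y x″ y″)
      (L-≐ : ∀ {x y x′ y′} → x ≐ x′ → y ≐ y′ → L x y x′ y′)
      (L-add : ∀ t {x y} → L x y (x ⊞ t ⊡ y) y)
      (L-scale : ∀ {g h} → g F.* h F.≈ F.1# → ∀ {x y} → L x y (g ⊡ x) y)
      (L-flip : ∀ {x y} → L x y y x)
      (L-translate : ∀ {z} → Z z → ∀ {x y} → L x y (x ⊞ z) y)
      (Z-lin : ∀ {u v} t → Z u → Z v → Z (u ⊞ t ⊡ v)) where

      -- Elimination with a pivot found uniformly: x is first taken to w₃ + s w₄, with s = 0 if γ₃ ≠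
      -- 0 and s = 1 otherwise, so that the pivot g is nonzero because the determinant is. Then y is
      -- taken to w₄, with k the determinant divided by g, and s w₄ is subtracted again.
      transform : ∀ {x y z₃ z₄ w₃ w₄} {γ₃ δ₃ γ₄ δ₄ : F.Carrier} → Z z₃ → Z z₄ →
        w₃ ≐ (γ₃ ⊡ x ⊞ δ₃ ⊡ y) ⊞ z₃ → w₄ ≐ (γ₄ ⊡ x ⊞ δ₄ ⊡ y) ⊞ z₄ →
        ¬ (γ₃ F.* δ₄ F.- γ₄ F.* δ₃) F.≈ F.0# → L x y w₃ w₄
      transform {x} {y} {z₃} {z₄} {w₃} {w₄} {γ₃} {δ₃} {γ₄} {δ₄} Z₃ Z₄ h₃ h₄ det≉0 =
        L-trans (L-scale (F.inverse g g≉0)) (L-trans (L-add h) (L-trans (L-translate Zζ) (L-trans L-flip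
        (L-trans (L-scale (F.inverse k k≉0)) (L-trans (L-add q₄) (L-trans (L-translate Zζ′) (L-trans (L-≐ w₄≐ (λ _ → F.refl)) (L-trans L-flip
        (L-trans (L-add (F.- s)) (L-≐ w₃≐ (λ _ → F.refl)))))))))))
        where
        s g h q₄ k : F.Carrier
        s = select γ₃ F.0# F.1#
        g = γ₃ F.+ s F.* γ₄
        h = δ₃ F.+ s F.* δ₄
        q₄ = γ₄ F.* g F.⁻¹
        k = δ₄ F.- q₄ F.* h
        g≉0 : ¬ g F.≈ F.0#
        g≉0 = cases γ₃
          (λ n e → n (F.trans (F.sym (F.trans (F.+-congˡ (F.*-congʳ (select-≉ n _ _))) (sc (γ₃ ∷ γ₄ ∷ []) (var 2 :+ 𝟘 :* var 3) (var 2) tt))) e))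
          (λ z e → det≉0 (F.trans (F.+-cong (F.*-congʳ z) (F.-‿cong (F.*-congʳ
              (F.trans (F.sym (F.trans (F.+-cong z (F.*-congʳ (select-≈ z _ _))) (sc (γ₄ ∷ []) (𝟘 :+ 𝟙 :* var 2) (var 2) tt))) e))))
            (sc (δ₃ ∷ δ₄ ∷ []) (𝟘 :* var 3 :+ :- (𝟘 :* var 2)) 𝟘 tt)))
        k≉0 : ¬ k F.≈ F.0#
        k≉0 e = det≉0 (F.trans (sc (γ₃ ∷ γ₄ ∷ δ₃ ∷ δ₄ ∷ s ∷ [])
            (var 2 :* var 5 :+ :- (var 3 :* var 4)) ((var 2 :+ var 6 :* var 3) :* var 5 :+ :- (var 3 :* (var 4 :+ var 6 :* var 5))) tt)
          (F.trans (sc₁ (F.inverse g g≉0) (γ₄ ∷ δ₄ ∷ h ∷ []) (var 0 :* var 3 :+ :- (var 2 :* var 4)) (var 0 :* (var 3 :+ :- (var 2 :* var 1 :* var 4))) tt)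
            (F.trans (F.*-congˡ e) (F.zeroʳ _))))
        ζ ζ′ : V m
        ζ = z₃ ⊞ s ⊡ z₄
        ζ′ = z₄ ⊞ (F.- q₄) ⊡ ζ
        Zζ : Z ζ
        Zζ = Z-lin s Z₃ Z₄
        Zζ′ : Z ζ′
        Zζ′ = Z-lin (F.- q₄) Z₄ Zζ
        w₄≐ : ((k ⊡ y) ⊞ q₄ ⊡ ((g ⊡ x ⊞ h ⊡ y) ⊞ ζ)) ⊞ ζ′ ≐ w₄
        w₄≐ i = F.trans (sc₁ (F.inverse g g≉0) (γ₄ ∷ δ₄ ∷ h ∷ x i ∷ y i ∷ ζ i ∷ z₄ i ∷ [])
          (((var 3 :+ :- (var 2 :* var 1 :* var 4)) :* var 6 :+ (var 2 :* var 1) :* ((var 0 :* var 5 :+ var 4 :* var 6) :+ var 7)) :+ (var 8 :+ :- (var 2 :* var 1) :* var 7))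
          ((var 2 :* var 5 :+ var 3 :* var 6) :+ var 8) tt) (F.sym (h₄ i))
        w₃≐ : ((g ⊡ x ⊞ h ⊡ y) ⊞ ζ) ⊞ (F.- s) ⊡ w₄ ≐ w₃
        w₃≐ i = F.trans (F.+-congˡ (F.*-congˡ (h₄ i))) (F.trans (sc (γ₃ ∷ γ₄ ∷ δ₃ ∷ δ₄ ∷ s ∷ x i ∷ y i ∷ z₃ i ∷ z₄ i ∷ [])
          ((((var 2 :+ var 6 :* var 3) :* var 7 :+ (var 4 :+ var 6 :* var 5) :* var 8) :+ (var 9 :+ var 6 :* var 10)) :+ (:- var 6) :* ((var 3 :* var 7 :+ var 5 :* var 8) :+ var 10))
          ((var 2 :* var 7 :+ var 4 :* var 8) :+ var 9) tt) (F.sym (h₃ i)))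

    -- Exchanging the first vector A of a frame (A, V, W) for B through an auxiliary
    -- vector C = H + τA with N(C) ≠ 0.
    module Exchange {m : ℕ} {q : Level} (D : V m → V m → V m → F.Carrier) (N : V m → F.Carrier)
      (L : (a b c a′ b′ c′ : V m) → Set q)
      (L-trans : ∀ {a b c a′ b′ c′ a″ b″ c″} → L a b c a′ b′ c′ → L a′ b′ c′ a″ b″ c″ → L a b c a″ b″ c″)
      (L-fix : ∀ {a b c b′ c′} → ¬ N a F.≈ F.0# → ¬ D a b c F.≈ F.0# → ¬ D a b′ c′ F.≈ F.0# → L a b c a b′ c′)
      (L-swap : ∀ {a b c} → ¬ N a F.≈ F.0# → ¬ N b F.≈ F.0# → L a b c b a c)
      (D-cong : ∀ {a b c a′ b′ c′} → a ≐ a′ → b ≐ b′ → c ≐ c′ → D a b c F.≈ D a′ b′ c′)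
      (N-cong : ∀ {a a′} → a ≐ a′ → N a F.≈ N a′)
      (D-swap : ∀ a b c → D b a c F.≈ F.- D a b c)
      (D-add₁ : ∀ a h g τ → D a (h ⊞ τ ⊡ a) g F.≈ F.- D a g h)
      (D-add₂ : ∀ a h b τ → D (h ⊞ τ ⊡ a) b a F.≈ F.- D a b h)
      (D-add₃ : ∀ a h b g τ → D (h ⊞ τ ⊡ a) b g F.≈ D h b g F.+ τ F.* D a b g)
      (N-generic : ∀ a h → ¬ N a F.≈ F.0# → ¬ (∀ (k : Fin 5) → N (h ⊞ nat F (toℕ k) ⊡ a) F.≈ F.0#))
      (N-degenerate : ∀ a v w b → ¬ D a v w F.≈ F.0# → D a b v F.≈ F.0# → D a b w F.≈ F.0# → D w b v F.≈ F.0# → N b F.≈ F.0#)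
      where

      -- The path is (A, V, W), (A, C, G), (C, A, G), (C, B, E), (B, C, E), which needs D(A, C, G)
      -- and D(C, B, E) to be nonzero. If d₁ or d₂ is nonzero, then G = B and E = A, and H is the
      -- vector that occurs in that determinant. Otherwise G = E = V and H = W, and D(C, B, V) =
      -- D(W, B, V) is nonzero because N(B) is.
      exchange : ∀ {A Vₒ W B} → ¬ N A F.≈ F.0# → ¬ N B F.≈ F.0# → ¬ D A Vₒ W F.≈ F.0# →
        Σ (V m) λ V′ → Σ (V m) λ W′ → ¬ D B V′ W′ F.≈ F.0# × L A Vₒ W B V′ W′
      exchange {A} {Vₒ} {W} {B} NA NB D≉0 = C , E ,
        neg-≉ (D-swap C B E) DCBE ,
        L-trans (L-fix NA D≉0 DACG) (L-trans (L-swap NA NC≉0) (L-trans (L-fix NC≉0 (neg-≉ (D-swap A C G) DACG) DCBE) (L-swap NC≉0 NB)))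
        where
        d₁ = D A B Vₒ
        d₂ = D A B W
        G H E : V m
        G = selectV d₁ B (selectV d₂ B Vₒ)
        H = selectV d₁ Vₒ W
        E = selectV d₁ A (selectV d₂ A Vₒ)
        n : ℕ → F.Carrier
        n k = N (H ⊞ nat F k ⊡ A)
        τ : F.Carrier
        -- The first of 0, ..., 3 at which N(H + τA) does not vanish, with 4 as the default;
        -- `N-generic` excludes that all five values vanish.
        τ = select (n 0) (nat F 0) (select (n 1) (nat F 1) (select (n 2) (nat F 2) (select (n 3) (nat F 3) (nat F 4))))
        C = H ⊞ τ ⊡ A
        C≐ : ∀ {k} → τ F.≈ nat F k → C ≐ H ⊞ nat F k ⊡ A
        C≐ e i = F.+-congˡ (F.*-congʳ e)
        hit : ∀ {k} → τ F.≈ nat F k → N C F.≈ F.0# → n k F.≈ F.0#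
        hit {k} e z = F.trans (F.sym (N-cong (C≐ {k} e))) z
        NC≉0 : ¬ N C F.≈ F.0#
        NC≉0 = cases (n 0) (λ h z → h (hit {0} (select-≉ h _ _) z)) λ z₀ →
          cases (n 1) (λ h z → h (hit {1} (F.trans (select-≈ z₀ _ _) (select-≉ h _ _)) z)) λ z₁ →
          cases (n 2) (λ h z → h (hit {2} (F.trans (select-≈ z₀ _ _) (F.trans (select-≈ z₁ _ _) (select-≉ h _ _))) z)) λ z₂ →
          cases (n 3) (λ h z → h (hit {3} (F.trans (select-≈ z₀ _ _) (F.trans (select-≈ z₁ _ _) (F.trans (select-≈ z₂ _ _) (select-≉ h _ _)))) z)) λ z₃ z →
          N-generic A H NA (gather (z₀ , z₁ , z₂ , z₃ ,
            hit {4} (F.trans (select-≈ z₀ _ _) (F.trans (select-≈ z₁ _ _) (F.trans (select-≈ z₂ _ _) (select-≈ z₃ _ _)))) z , lift tt))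
        split : ∀ {p} {P : Set p} →
          (¬ d₁ F.≈ F.0# → G ≐ B → H ≐ Vₒ → E ≐ A → ¬ P) →
          (¬ d₂ F.≈ F.0# → G ≐ B → H ≐ W → E ≐ A → ¬ P) →
          (d₁ F.≈ F.0# → d₂ F.≈ F.0# → G ≐ Vₒ → H ≐ W → E ≐ Vₒ → ¬ P) → ¬ P
        split k₁ k₂ k₃ = cases d₁
          (λ h → k₁ h (λ i → select-≉ h _ _) (λ i → select-≉ h _ _) (λ i → select-≉ h _ _))
          (λ z → cases d₂
            (λ h → k₂ h (λ i → F.trans (select-≈ z _ _) (select-≉ h _ _)) (λ i → select-≈ z _ _) (λ i → F.trans (select-≈ z _ _) (select-≉ h _ _)))
            (λ z′ → k₃ z z′ (λ i → F.trans (select-≈ z _ _) (select-≈ z′ _ _)) (λ i → select-≈ z _ _) (λ i → F.trans (select-≈ z _ _) (select-≈ z′ _ _))))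
        r : ∀ {u : V m} → u ≐ u
        r i = F.refl
        DACG : ¬ D A C G F.≈ F.0#
        DACG = neg-≉ (D-add₁ A H G τ) (split
          (λ h g′ h′ _ → ≉-resp (F.sym (D-cong r g′ h′)) h)
          (λ h g′ h′ _ → ≉-resp (F.sym (D-cong r g′ h′)) h)
          (λ _ _ g′ h′ _ → ≉-resp (F.sym (D-cong r g′ h′)) D≉0))
        DCBE : ¬ D C B E F.≈ F.0#
        DCBE = split
          (λ h _ h′ e′ → neg-≉ (F.trans (D-cong r r e′) (D-add₂ A H B τ)) (≉-resp (F.sym (D-cong r r h′)) h))
          (λ h _ h′ e′ → neg-≉ (F.trans (D-cong r r e′) (D-add₂ A H B τ)) (≉-resp (F.sym (D-cong r r h′)) h))
          (λ z z′ _ h′ e′ → ≉-resp (F.sym (F.trans (D-cong r r e′) (F.trans (D-add₃ A H B Vₒ τ)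
              (F.trans (F.+-cong (D-cong h′ r r) (F.trans (F.*-congˡ z) (F.zeroʳ _))) (F.+-identityʳ _)))))
            (λ e → NB (N-degenerate A Vₒ W B D≉0 z z′ e)))

open Elimination public

-- Quadratic extensions and resultants of binary quadratic forms

module Resultants where
  open import Algebra.Bundles using (CommutativeRing)
  open import Data.Empty using (⊥)

  -- The field K(√Δ); elements are pairs (a, b) = a + b√Δ.
  module Quadratic {c ℓ : Level} (F : Field c ℓ) (Δ : Field.Carrier F) where
    open Field F using (Carrier; _+_; _*_; -_; 0#; 1#; _⁻¹)

    times : Carrier × Carrier → Carrier × Carrier → Carrier × Carrier
    times (a , b) (c , d) = a * c + Δ * (b * d) , a * d + b * c

    plus : Carrier × Carrier → Carrier × Carrier → Carrier × Carrier
    plus (a , b) (c , d) = a + c , b + d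

    scalar : Carrier → Carrier × Carrier
    scalar a = a , 0#

    -- the binary quadratic form (g₁, g₂, g₅) at the point (x₁, x₂)
    value : (g₁ g₂ g₅ : Carrier) (x₁ x₂ : Carrier × Carrier) → Carrier × Carrier
    value g₁ g₂ g₅ x₁ x₂ = plus (plus (times (scalar g₁) (times x₁ x₁)) (times (scalar g₂) (times x₁ x₂))) (times (scalar g₅) (times x₂ x₂))

  module QuadraticField {c ℓ : Level} (F : Field c ℓ) (Δ : Field.Carrier F)
    (nonsquare : ∀ s → ¬ Field._≈_ F (Field._*_ F s s) Δ) where
    private module F = Field F
    open Quadratic F Δ
    open Scalar F
    open Select F using (cases; *-≉)

    private
      module Q = Quadratic 𝕊 (var 2)
      d : List F.Carrier → List F.Carrier
      d xs = Δ ∷ xs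
      x y z : SE × SE
      x = var 3 , var 4
      y = var 5 , var 6
      z = var 7 , var 8
      infix 4 _≋_
      _≋_ : F.Carrier × F.Carrier → F.Carrier × F.Carrier → Set ℓ
      (a , b) ≋ (a′ , b′) = a F.≈ a′ × b F.≈ b′
      pair! : ∀ (X Y Z : F.Carrier × F.Carrier) (l r : SE × SE) → T (checkS (proj₁ l) (proj₁ r)) → T (checkS (proj₂ l) (proj₂ r)) →
        let ρ = env F F.1# F.1# (Δ ∷ proj₁ X ∷ proj₂ X ∷ proj₁ Y ∷ proj₂ Y ∷ proj₁ Z ∷ proj₂ Z ∷ []) in
        (evS F ρ (proj₁ l) , evS F ρ (proj₂ l)) ≋ (evS F ρ (proj₁ r) , evS F ρ (proj₂ r))
      pair! X Y Z l r t t′ = sc xs (proj₁ l) (proj₁ r) t , sc xs (proj₂ l) (proj₂ r) t′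
        where xs = Δ ∷ proj₁ X ∷ proj₂ X ∷ proj₁ Y ∷ proj₂ Y ∷ proj₁ Z ∷ proj₂ Z ∷ []

    square-zero : ∀ a → a F.* a F.≈ F.0# → ¬ ¬ a F.≈ F.0#
    square-zero a h k = *-≉ k k h

    quadratic : Field c ℓ
    quadratic = record
      { commutativeRing = record
        { Carrier = F.Carrier × F.Carrier ; _≈_ = _≋_ ; _+_ = plus ; _*_ = times
        ; -_ = λ (a , b) → F.- a , F.- b ; 0# = F.0# , F.0# ; 1# = F.1# , F.0#
        ; isCommutativeRing = record
          { isRing = record
            { +-isAbelianGroup = record
              { isGroup = record
                { isMonoid = record
                  { isSemigroup = record
                    { isMagma = record
                      { isEquivalence = record
                        { refl = F.refl , F.refl ; sym = λ (p , q) → F.sym p , F.sym q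
                        ; trans = λ (p , q) (p′ , q′) → F.trans p p′ , F.trans q q′ }
                      ; ∙-cong = λ (p , q) (p′ , q′) → F.+-cong p p′ , F.+-cong q q′ }
                    ; assoc = λ X Y Z → pair! X Y Z (Q.plus (Q.plus x y) z) (Q.plus x (Q.plus y z)) tt tt }
                  ; identity = (λ X → pair! X X X (Q.plus (𝟘 , 𝟘) x) x tt tt) , λ X → pair! X X X (Q.plus x (𝟘 , 𝟘)) x tt tt }
                ; inverse = (λ X → pair! X X X (Q.plus (:- var 3 , :- var 4) x) (𝟘 , 𝟘) tt tt)
                          , (λ X → pair! X X X (Q.plus x (:- var 3 , :- var 4)) (𝟘 , 𝟘) tt tt)
                ; ⁻¹-cong = λ (p , q) → F.-‿cong p , F.-‿cong q }
              ; comm = λ X Y → pair! X Y X (Q.plus x y) (Q.plus y x) tt tt }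
            ; *-cong = λ (p , q) (p′ , q′) → F.+-cong (F.*-cong p p′) (F.*-congˡ (F.*-cong q q′)) , F.+-cong (F.*-cong p q′) (F.*-cong q p′)
            ; *-assoc = λ X Y Z → pair! X Y Z (Q.times (Q.times x y) z) (Q.times x (Q.times y z)) tt tt
            ; *-identity = (λ X → pair! X X X (Q.times (𝟙 , 𝟘) x) x tt tt) , λ X → pair! X X X (Q.times x (𝟙 , 𝟘)) x tt tt
            ; distrib = (λ X Y Z → pair! X Y Z (Q.times x (Q.plus y z)) (Q.plus (Q.times x y) (Q.times x z)) tt tt)
                      , (λ X Y Z → pair! X Y Z (Q.times (Q.plus y z) x) (Q.plus (Q.times y x) (Q.times z x)) tt tt) }
          ; *-comm = λ X Y → pair! X Y X (Q.times x y) (Q.times y x) tt tt } }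
      ; _⁻¹ = λ (a , b) → a F.* norm a b F.⁻¹ , F.- b F.* norm a b F.⁻¹
      ; 0≉1 = λ (p , _) → F.0≉1 p
      ; inverse = λ (a , b) h → F.trans (sc (Δ ∷ a ∷ b ∷ norm a b F.⁻¹ ∷ [])
            (var 3 :* (var 3 :* var 5) :+ var 2 :* (var 4 :* (:- var 4 :* var 5))) ((var 3 :* var 3 :+ :- (var 2 :* (var 4 :* var 4))) :* var 5) tt)
            (F.inverse _ (norm≉0 a b h))
          , sc (Δ ∷ a ∷ b ∷ norm a b F.⁻¹ ∷ []) (var 3 :* (:- var 4 :* var 5) :+ var 4 :* (var 3 :* var 5)) 𝟘 tt }
      where
      norm : F.Carrier → F.Carrier → F.Carrier
      norm a b = a F.* a F.+ F.- (Δ F.* (b F.* b))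
      -- If b ≠ 0 and a² = Δb², then a/b is a square root of Δ. If b = 0, then a² = 0.
      norm≉0 : ∀ a b → ¬ (a F.≈ F.0# × b F.≈ F.0#) → ¬ norm a b F.≈ F.0#
      norm≉0 a b h = cases b
        (λ n e → nonsquare (a F.* b F.⁻¹) (F.trans (sc₁ (F.inverse _ n) (Δ ∷ a ∷ [])
            ((var 3 :* var 1) :* (var 3 :* var 1)) ((var 3 :* var 3 :+ :- (var 2 :* (var 0 :* var 0))) :* (var 1 :* var 1) :+ var 2) tt)
            (F.trans (F.+-congʳ (F.trans (F.*-congʳ e) (F.zeroˡ _))) (F.+-identityˡ _))))
        (λ z e → square-zero a (F.trans (F.trans (sc (Δ ∷ a ∷ b ∷ []) (var 3 :* var 3)
            ((var 3 :* var 3 :+ :- (var 2 :* (var 4 :* var 4))) :+ var 2 :* (var 4 :* var 4)) tt)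
            (F.+-cong e (F.trans (F.*-congˡ (F.trans (F.*-congʳ z) (F.zeroˡ _))) (F.zeroʳ _)))) (F.+-identityˡ _)) (λ a0 → h (a0 , z)))

    inclusion : FieldHom F quadratic
    inclusion = record
      { ⟦_⟧ = scalar ; ⟦⟧-cong = λ p → p , F.refl
      ; +-hom = λ a b → F.refl , F.sym (F.+-identityˡ _)
      ; *-hom = λ a b → sc (Δ ∷ a ∷ b ∷ []) (var 3 :* var 4) (var 3 :* var 4 :+ var 2 :* (𝟘 :* 𝟘)) tt , sc (a ∷ b ∷ []) 𝟘 (var 2 :* 𝟘 :+ 𝟘 :* var 3) tt
      ; 1-hom = F.refl , F.refl }

  module Resultant {c ℓ : Level} (F : Field c ℓ) (2≉0 : ¬ Field._≈_ F (Field._+_ F (Field.1# F) (Field.1# F)) (Field.0# F)) where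
    private module F = Field F
    open Scalar F
    open Select F using (cases; *-≉; neg-≉; ≉-resp)
    open Swap4 F using (res₁₂)

    private
      idHom : FieldHom F F
      idHom = record { ⟦_⟧ = λ x → x ; ⟦⟧-cong = λ p → p ; +-hom = λ _ _ → F.refl ; *-hom = λ _ _ → F.refl ; 1-hom = F.refl }

      g′ h′ : Fin 10 → SE
      g′ i = var (2 ℕ.+ toℕ i)
      h′ i = var (12 ℕ.+ toℕ i)
      m : ℕ → ℕ → SE
      m i j = at 𝕊 g′ i :* at 𝕊 h′ j :+ :- (at 𝕊 g′ j :* at 𝕊 h′ i)
      val : (Fin 10 → SE) → SE → SE → SE
      val g x y = g (# 0) :* (x :* x) :+ g (# 1) :* (x :* y) :+ g (# 4) :* (y :* y)
      r : SE
      r = m 1 5 :* m 1 5 :+ :- (m 1 2 :* m 2 5)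

    module _ (g h : Fin 10 → F.Carrier) where
      minor : ℕ → ℕ → F.Carrier
      minor i j = at F g i F.* at F h j F.+ F.- (at F g j F.* at F h i)

      res : F.Carrier
      res = minor 1 5 F.* minor 1 5 F.+ F.- (minor 1 2 F.* minor 2 5)

      Free : Set _
      Free = (L : Field c ℓ) (e : FieldHom F L) (x₁ x₂ : Field.Carrier L) →
        ¬ (Field._≈_ L x₁ (Field.0# L) × Field._≈_ L x₂ (Field.0# L)) →
        ¬ (Field._≈_ L (Qval F L e g x₁ x₂) (Field.0# L) × Field._≈_ L (Qval F L e h x₁ x₂) (Field.0# L))

      private
        xs : List F.Carrier
        xs = tabulate g ++ᴸ tabulate h

        G : ℕ → F.Carrier
        G i = at F g i

        vanish₂ : ∀ a z → F.0# F.≈ F.0# → z F.≈ F.0# → a F.* z F.≈ F.0#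
        vanish₂ a z _ e = F.trans (F.*-congˡ e) (F.zeroʳ _)

        cancel : ∀ {a z} → ¬ a F.≈ F.0# → a F.* z F.≈ F.0# → z F.≈ F.0#
        cancel {a} {z} n e = F.trans (F.sym (F.trans (F.sym (F.*-assoc _ _ _)) (F.trans (F.*-congʳ (unit n)) (F.*-identityˡ _))))
          (F.trans (F.*-congˡ e) (F.zeroʳ _))

      -- The forms are proportional and the first one has a root in a quadratic extension.
      proportional : Free → ¬ G 1 F.≈ F.0# → minor 1 2 F.≈ F.0# → minor 1 5 F.≈ F.0# → ⊥
      proportional free g₁≉0 m₁₂ m₁₅ = free L.quadratic L.inclusion x₁ x₂
        (λ (_ , p , _) → *-≉ 2≉0 g₁≉0 p)
        (zeroG , (cancel g₁≉0 (F.trans (sc (Δ ∷ xs) (G1 :* proj₁ vh) (H1 :* proj₁ vg :+ m₁₂′ :* proj₁ (Q.times X₁ X₂) :+ m₁₅′ :* proj₁ (Q.times X₂ X₂)) tt)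
            (sum₃ (vanish₂ _ _ F.refl (proj₁ zeroG)) m₁₂ m₁₅))
          , cancel g₁≉0 (F.trans (sc (Δ ∷ xs) (G1 :* proj₂ vh) (H1 :* proj₂ vg :+ m₁₂′ :* proj₂ (Q.times X₁ X₂) :+ m₁₅′ :* proj₂ (Q.times X₂ X₂)) tt)
            (sum₃ (vanish₂ _ _ F.refl (proj₂ zeroG)) m₁₂ m₁₅))))
        where
        Δ : F.Carrier
        Δ = G 2 F.* G 2 F.+ F.- (nat F 4 F.* G 1 F.* G 5)
        sum₃ : ∀ {a b c x y} → a F.≈ F.0# → b F.≈ F.0# → c F.≈ F.0# → a F.+ b F.* x F.+ c F.* y F.≈ F.0#
        sum₃ {x = x} {y} p q s = F.trans (F.+-cong (F.+-cong p (F.*-congʳ q)) (F.*-congʳ s)) (sc (x ∷ y ∷ []) (𝟘 :+ 𝟘 :* var 2 :+ 𝟘 :* var 3) 𝟘 tt)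
        -- A square root s of Δ = g₂² - 4g₁g₅ would give the common zero (s - g₂ : 2g₁) over K
        -- itself. So Δ is not a square, and the same point, with √Δ for s, is available over the
        -- field K(√Δ).
        rational : ∀ s → ¬ s F.* s F.≈ Δ
        rational s e = free F idHom (s F.- G 2) ((F.1# F.+ F.1#) F.* G 1)
          (λ (_ , p) → *-≉ 2≉0 g₁≉0 p)
          (root , cancel g₁≉0 (F.trans (sc (s ∷ xs) (w 2 :* val h″ x y) (w 12 :* val g″ x y :+ μ₁₂ :* (x :* y) :+ μ₁₅ :* (y :* y)) tt)
            (sum₃ (vanish₂ _ _ F.refl root) m₁₂ m₁₅)))
          where
          w : ℕ → SE
          w i = var (suc i)
          g″ h″ : Fin 10 → SE
          g″ i = var (3 ℕ.+ toℕ i)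
          h″ i = var (13 ℕ.+ toℕ i)
          x y μ₁₂ μ₁₅ : SE
          x = var 2 :+ :- w 3
          y = (𝟙 :+ 𝟙) :* w 2
          μ₁₂ = w 2 :* w 13 :+ :- (w 3 :* w 12)
          μ₁₅ = w 2 :* w 16 :+ :- (w 6 :* w 12)
          root : Qval F F idHom g (s F.- G 2) ((F.1# F.+ F.1#) F.* G 1) F.≈ F.0#
          root = F.trans (sc (s ∷ xs) (val g″ x y) (w 2 :* (var 2 :* var 2 :+ :- (w 3 :* w 3 :+ :- (nat 𝕊 4 :* w 2 :* w 6)))) tt)
            (F.trans (F.*-congˡ (F.trans (F.+-congʳ e) (F.-‿inverseʳ _))) (F.zeroʳ _))
        module L = QuadraticField F Δ rational
        module P = Quadratic F Δ
        x₁ x₂ : F.Carrier × F.Carrier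
        x₁ = F.- G 2 , F.1#
        x₂ = (F.1# F.+ F.1#) F.* G 1 , F.0#
        module Q = Quadratic 𝕊 (var 2)
        G1 G2 G5 H1 H2 H5 m₁₂′ m₁₅′ : SE
        G1 = var 3
        G2 = var 4
        G5 = var 7
        H1 = var 13
        H2 = var 14
        H5 = var 17
        m₁₂′ = G1 :* H2 :+ :- (G2 :* H1)
        m₁₅′ = G1 :* H5 :+ :- (G5 :* H1)
        X₁ X₂ vg vh : SE × SE
        X₁ = :- G2 , 𝟙
        X₂ = (𝟙 :+ 𝟙) :* G1 , 𝟘
        vg = Q.value G1 G2 G5 X₁ X₂
        vh = Q.value H1 H2 H5 X₁ X₂
        zeroG : proj₁ (P.value (G 1) (G 2) (G 5) x₁ x₂) F.≈ F.0# × proj₂ (P.value (G 1) (G 2) (G 5) x₁ x₂) F.≈ F.0#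
        zeroG = sc xs (proj₁ vg₀) 𝟘 tt , sc xs (proj₂ vg₀) 𝟘 tt
          where
          g1 g2 g5 : SE
          g1 = var 2
          g2 = var 3
          g5 = var 6
          module Q₀ = Quadratic 𝕊 (g2 :* g2 :+ :- (nat 𝕊 4 :* g1 :* g5))
          vg₀ : SE × SE
          vg₀ = Q₀.value g1 g2 g5 (:- g2 , 𝟙) ((𝟙 :+ 𝟙) :* g1 , 𝟘)

    free-sym : ∀ {g h} → Free g h → Free h g
    free-sym free L e x₁ x₂ n (p , q) = free L e x₁ x₂ n (q , p)

    -- If the resultant vanishes, (-m₁₅ : m₁₂) and (m₂₅ : -m₁₅) are common zeros, provided that m₁₂,
    -- respectively m₂₅, is nonzero. If both are zero, so is m₁₅; the forms are then proportional,
    -- or both vanish at (1 : 0).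
    free⇒res≉0 : ∀ {g h} → Free g h → ¬ res g h F.≈ F.0#
    free⇒res≉0 {g} {h} free = cases (minor g h 1 2)
      (λ n e → point (F.- minor g h 1 5) (minor g h 1 2) (λ (_ , p) → n p)
        (F.trans (sc xs (val g′ (:- m 1 5) (m 1 2)) (g′ (# 0) :* r) tt) (times0 e))
        (F.trans (sc xs (val h′ (:- m 1 5) (m 1 2)) (h′ (# 0) :* r) tt) (times0 e)))
      λ z₁₂ → cases (minor g h 2 5)
      (λ n e → point (minor g h 2 5) (F.- minor g h 1 5) (λ (p , _) → n p)
        (F.trans (sc xs (val g′ (m 2 5) (:- m 1 5)) (g′ (# 4) :* r) tt) (times0 e))
        (F.trans (sc xs (val h′ (m 2 5) (:- m 1 5)) (h′ (# 4) :* r) tt) (times0 e)))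
      λ z₂₅ → cases (minor g h 1 5)
      (λ n e → *-≉ n n (F.trans (F.trans (sc (minor g h 1 5 F.* minor g h 1 5 ∷ minor g h 1 2 ∷ minor g h 2 5 ∷ [])
          (var 2) ((var 2 :+ :- (var 3 :* var 4)) :+ var 3 :* var 4) tt) (F.+-cong e (F.trans (F.*-congʳ z₁₂) (F.zeroˡ _)))) (F.+-identityˡ _)))
      λ z₁₅ → cases (g (# 0))
      (λ n _ → proportional g h free n z₁₂ z₁₅)
      λ g0 → cases (h (# 0))
      (λ n _ → proportional h g (free-sym {g} {h} free) n (swap-minor 1 2 z₁₂) (swap-minor 1 5 z₁₅))
      λ h0 _ → point F.1# F.0# (λ (p , _) → F.0≉1 (F.sym p))
        (F.trans (sc xs (val g′ 𝟙 𝟘) (g′ (# 0)) tt) g0) (F.trans (sc xs (val h′ 𝟙 𝟘) (h′ (# 0)) tt) h0)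
      where
      xs = tabulate g ++ᴸ tabulate h
      times0 : ∀ {a z} → z F.≈ F.0# → a F.* z F.≈ F.0#
      times0 e = F.trans (F.*-congˡ e) (F.zeroʳ _)
      point : ∀ x y → ¬ (x F.≈ F.0# × y F.≈ F.0#) → Qval F F idHom g x y F.≈ F.0# → Qval F F idHom h x y F.≈ F.0# → ⊥
      point x y n p q = free F idHom x y n (p , q)
      swap-minor : ∀ i j → minor g h i j F.≈ F.0# → minor h g i j F.≈ F.0#
      swap-minor i j e = F.trans (sc (at F g i ∷ at F g j ∷ at F h i ∷ at F h j ∷ [])
        (var 4 :* var 3 :+ :- (var 5 :* var 2)) (:- (var 2 :* var 5 :+ :- (var 3 :* var 4))) tt) (F.trans (F.-‿cong e) (sc [] (:- 𝟘) 𝟘 tt))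

    noMeet⇒res≉0 : ∀ (f : Model F four) → NoMeet F f → ¬ res₁₂ f F.≈ F.0#
    noMeet⇒res≉0 f free = free⇒res≉0 {fst4 F f} {snd4 F f} free

open Resultants public

-- Resultants on lines in projective space

module LineResultants where
  module Forms {c ℓ : Level} (F : Field c ℓ) where
    open Field F using (Carrier; _+_; _*_; -_)

    quad : (Fin 10 → Carrier) → (Fin 4 → Carrier) → Carrier
    quad g u = g (# 0) * (x * x) + g (# 1) * (x * y) + g (# 2) * (x * z) + g (# 3) * (x * w) + g (# 4) * (y * y)
      + g (# 5) * (y * z) + g (# 6) * (y * w) + g (# 7) * (z * z) + g (# 8) * (z * w) + g (# 9) * (w * w)
      where
      x = u (# 0)
      y = u (# 1)
      z = u (# 2)
      w = u (# 3)

    -- The polar form g(u + v) - g(u) - g(v).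
    polar : (Fin 10 → Carrier) → (u v : Fin 4 → Carrier) → Carrier
    polar g u v = nat F 2 * (g (# 0) * m (# 0) (# 0)) + g (# 1) * n (# 0) (# 1) + g (# 2) * n (# 0) (# 2) + g (# 3) * n (# 0) (# 3)
      + nat F 2 * (g (# 4) * m (# 1) (# 1)) + g (# 5) * n (# 1) (# 2) + g (# 6) * n (# 1) (# 3) + nat F 2 * (g (# 7) * m (# 2) (# 2))
      + g (# 8) * n (# 2) (# 3) + nat F 2 * (g (# 9) * m (# 3) (# 3))
      where
      m n : Fin 4 → Fin 4 → Carrier
      m i j = u i * v j
      n i j = u i * v j + u j * v i

    -- the resultant of the binary quadratic forms (aᵢ, mᵢ, cᵢ)
    res₂ : (a m c a′ m′ c′ : Carrier) → Carrier
    res₂ a m c a′ m′ c′ = (a * c′ + - (c * a′)) * (a * c′ + - (c * a′)) + - ((a * m′ + - (m * a′)) * (m * c′ + - (c * m′)))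

    module _ (f : Model F four) where
      q₁ q₂ : (Fin 4 → Carrier) → Carrier
      q₁ = quad (fst4 F f)
      q₂ = quad (snd4 F f)
      b₁ b₂ : (u v : Fin 4 → Carrier) → Carrier
      b₁ = polar (fst4 F f)
      b₂ = polar (snd4 F f)

      resLine : (u v : Fin 4 → Carrier) → Carrier
      resLine u v = res₂ (q₁ u) (b₁ u v) (q₁ v) (q₂ u) (b₂ u v) (q₂ v)

  module Lines {c ℓ : Level} (F : Field c ℓ)
    (2≉0 : ¬ Field._≈_ F (Field._+_ F (Field.1# F) (Field.1# F)) (Field.0# F))
    (3≉0 : ¬ Field._≈_ F (Field._+_ F (Field._+_ F (Field.1# F) (Field.1# F)) (Field.1# F)) (Field.0# F)) where
    private module F = Field F
    open Forms F
    open Scalar F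
    open Select F

    private
      24≉0 : ¬ nat F 24 F.≈ F.0#
      24≉0 e = *-≉ 2≉0 (*-≉ 2≉0 (*-≉ 2≉0 3≉0)) (F.trans (sc [] ((𝟙 :+ 𝟙) :* ((𝟙 :+ 𝟙) :* ((𝟙 :+ 𝟙) :* (𝟙 :+ 𝟙 :+ 𝟙)))) (nat 𝕊 24) tt) e)

      cancel : ∀ {a z} → ¬ a F.≈ F.0# → a F.* z F.≈ F.0# → z F.≈ F.0#
      cancel {a} {z} n e = F.trans (F.sym (F.trans (F.sym (F.*-assoc _ _ _)) (F.trans (F.*-congʳ (unit n)) (F.*-identityˡ _))))
        (F.trans (F.*-congˡ e) (F.zeroʳ _))

      -- a² = 0 implies a = 0 only up to double negation
      square : ∀ {p} {P : Set p} {a} → a F.* a F.≈ F.0# → (a F.≈ F.0# → ¬ P) → ¬ P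
      square {a = a} h k = cases a (λ n _ → *-≉ n n h) k

      zero-sum : ∀ {a b} → a F.≈ F.0# → b F.≈ F.0# → a F.+ b F.≈ F.0#
      zero-sum p q = F.trans (F.+-cong p q) (F.+-identityˡ _)

      times0 : ∀ {a z} → z F.≈ F.0# → a F.* z F.≈ F.0#
      times0 e = F.trans (F.*-congˡ e) (F.zeroʳ _)

    -- A(τ)² − (A l′ − A′ l) l for A = a + mτ + cτ² and l = p + rτ
    Quartic : (a m c a′ m′ c′ p r p′ r′ τ : F.Carrier) → F.Carrier
    Quartic a m c a′ m′ c′ p r p′ r′ τ = A F.* A F.+ F.- ((A F.* l′ F.+ F.- (A′ F.* l)) F.* l)
      where
      A = a F.+ m F.* τ F.+ c F.* (τ F.* τ)
      A′ = a′ F.+ m′ F.* τ F.+ c′ F.* (τ F.* τ)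
      l = p F.+ r F.* τ
      l′ = p′ F.+ r′ F.* τ

    private
      quarticₛ : (a m c a′ m′ c′ p r p′ r′ τ : SE) → SE
      quarticₛ a m c a′ m′ c′ p r p′ r′ τ = A :* A :+ :- ((A :* l′ :+ :- (A′ :* l)) :* l)
        where
        A = a :+ m :* τ :+ c :* (τ :* τ)
        A′ = a′ :+ m′ :* τ :+ c′ :* (τ :* τ)
        l = p :+ r :* τ
        l′ = p′ :+ r′ :* τ

    -- If l = rτ, then A = τ(m + cτ) and the quartic is τ² times
    -- (m + cτ)(m + cτ − r l′) + r² A′, so that m + cτ divides A and r² A′.
    double-root : ∀ a m c a′ m′ c′ r p′ r′ → ¬ r F.≈ F.0# → a F.≈ F.0# →
      m F.* (m F.- r F.* p′) F.+ a′ F.* (r F.* r) F.≈ F.0# →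
      m F.* (c F.- r F.* r′) F.+ c F.* (m F.- r F.* p′) F.+ m′ F.* (r F.* r) F.≈ F.0# →
      c F.* (c F.- r F.* r′) F.+ c′ F.* (r F.* r) F.≈ F.0# → res₂ a m c a′ m′ c′ F.≈ F.0#
    double-root a m c a′ m′ c′ r p′ r′ r≉0 a0 s₀ s₁ s₂ =
      cancel (*-≉ (*-≉ r≉0 r≉0) (*-≉ r≉0 r≉0)) (F.trans
        (sc (a ∷ m ∷ c ∷ a′ ∷ m′ ∷ c′ ∷ r ∷ p′ ∷ r′ ∷ [])
          ((R :* R :* (R :* R)) :* Forms.res₂ 𝕊 A M C A′ M′ C′)
          (A :* ((R :* R :* (R :* R)) :* (A :* C′ :* C′ :+ :- (nat 𝕊 2 :* C :* A′ :* C′) :+ :- (M′ :* (M :* C′ :+ :- (C :* M′)))))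
            :+ S₀ :* K₀ :+ S₁ :* K₁ :+ S₂ :* K₂) tt)
        (zero-sum (zero-sum (zero-sum (z a0) (z s₀)) (z s₁)) (z s₂)))
      where
      z : ∀ {x y} → x F.≈ F.0# → x F.* y F.≈ F.0#
      z e = F.trans (F.*-congʳ e) (F.zeroˡ _)
      A M C A′ M′ C′ R P′ R′ S₀ S₁ S₂ U W K₀ K₁ K₂ : SE
      A = var 2
      M = var 3
      C = var 4
      A′ = var 5
      M′ = var 6
      C′ = var 7
      R = var 8
      P′ = var 9
      R′ = var 10
      U = M :+ :- (R :* P′)
      W = C :+ :- (R :* R′)
      S₀ = M :* U :+ A′ :* (R :* R)
      S₁ = M :* W :+ C :* U :+ M′ :* (R :* R)
      S₂ = C :* W :+ C′ :* (R :* R)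
      K₀ = (R :* R) :* (C :* C :* A′ :+ M :* M :* C′ :+ :- (M :* C :* M′)) :+ :- (C :* C :* M :* U)
      K₁ = M :* M :* C :* U
      K₂ = :- (M :* M :* M :* U)

    module Generic (a m c a′ m′ c′ p r p′ r′ : F.Carrier) (res≉0 : ¬ res₂ a m c a′ m′ c′ F.≈ F.0#) where
      private
        Rₜ : F.Carrier → F.Carrier
        Rₜ = Quartic a m c a′ m′ c′ p r p′ r′
        xs : List F.Carrier
        xs = a ∷ m ∷ c ∷ a′ ∷ m′ ∷ c′ ∷ p ∷ r ∷ p′ ∷ r′ ∷ []
        R̂ : SE → SE
        R̂ = quarticₛ (var 2) (var 3) (var 4) (var 5) (var 6) (var 7) (var 8) (var 9) (var 10) (var 11)

        Lead : F.Carrier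
        Lead = c F.* c F.+ F.- ((c F.* r′ F.+ F.- (c′ F.* r)) F.* r)

      -- A quartic that vanishes at 0, ..., 4 vanishes identically. At the root of l, possibly at
      -- infinity, A² and hence A vanishes; then A/l is a common factor of A and A′, and the
      -- resultant is 0. If l = 0, then A = 0.
      not-all-zero : ¬ (∀ (k : Fin 5) → Rₜ (nat F (toℕ k)) F.≈ F.0#)
      not-all-zero h = cases r case₁ case₂ tt
        where
        h0 = h (# 0)
        h1 = h (# 1)
        h2 = h (# 2)
        h3 = h (# 3)
        h4 = h (# 4)
        n : ℕ → SE
        n = nat 𝕊
        sum₅ : ∀ {x0 x1 x2 x3 x4} c0 c1 c2 c3 c4 → x0 F.≈ F.0# → x1 F.≈ F.0# → x2 F.≈ F.0# → x3 F.≈ F.0# → x4 F.≈ F.0# →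
          c0 F.* x0 F.+ c1 F.* x1 F.+ c2 F.* x2 F.+ c3 F.* x3 F.+ c4 F.* x4 F.≈ F.0#
        sum₅ _ _ _ _ _ e0 e1 e2 e3 e4 = zero-sum (zero-sum (zero-sum (zero-sum (times0 e0) (times0 e1)) (times0 e2)) (times0 e3)) (times0 e4)

        lead : Lead F.≈ F.0#
        lead = cancel 24≉0 (F.trans (sc xs (n 24 :* (var 4 :* var 4 :+ :- ((var 4 :* var 11 :+ :- (var 7 :* var 9)) :* var 9)))
          (𝟙 :* R̂ (n 0) :+ (:- n 4) :* R̂ (n 1) :+ n 6 :* R̂ (n 2) :+ (:- n 4) :* R̂ (n 3) :+ 𝟙 :* R̂ (n 4)) tt) (sum₅ _ _ _ _ _ h0 h1 h2 h3 h4))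

        -- Lagrange interpolation at 0, …, 4
        all-zero : ∀ τ → Rₜ τ F.≈ F.0#
        all-zero τ = cancel 24≉0 (F.trans (sc (xs ++ᴸ τ ∷ []) (n 24 :* R̂ t)
          ((t₁ :* t₂ :* t₃ :* t₄) :* R̂ (n 0) :+ (:- n 4 :* t :* t₂ :* t₃ :* t₄) :* R̂ (n 1) :+ (n 6 :* t :* t₁ :* t₃ :* t₄) :* R̂ (n 2)
            :+ (:- n 4 :* t :* t₁ :* t₂ :* t₄) :* R̂ (n 3) :+ (t :* t₁ :* t₂ :* t₃) :* R̂ (n 4)) tt) (sum₅ _ _ _ _ _ h0 h1 h2 h3 h4))
          where
          t t₁ t₂ t₃ t₄ : SE
          t = var 12
          t₁ = t :+ :- n 1
          t₂ = t :+ :- n 2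
          t₃ = t :+ :- n 3
          t₄ = t :+ :- n 4

        -- r ≠ 0: shift the root of l to 0
        case₁ : ¬ r F.≈ F.0# → ¬ ⊤
        case₁ r≉0 _ = square A0² (λ A0 _ → res≉0 (F.trans shifted (double-root A₀ M₀ c A₀′ M₀′ c′ r P₀′ r′ r≉0 A0
            (twice (F.trans (s₀-eq A0) (zero-sum (zero-sum (all-zero (τ₀ F.+ F.1#)) (all-zero (τ₀ F.- F.1#))) (times0 lead))))
            (twice (F.trans (s₁-eq A0) (zero-sum (all-zero (τ₀ F.+ F.1#)) (F.trans (F.-‿cong (all-zero (τ₀ F.- F.1#))) (sc [] (:- 𝟘) 𝟘 tt)))))
            (F.trans (sc xs (var 4 :* (var 4 :+ :- (var 9 :* var 11)) :+ var 7 :* (var 9 :* var 9)) (var 4 :* var 4 :+ :- ((var 4 :* var 11 :+ :- (var 7 :* var 9)) :* var 9)) tt) lead)))) tt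
          where
          twice : ∀ {x} → (F.1# F.+ F.1#) F.* x F.≈ F.0# → x F.≈ F.0#
          twice = cancel 2≉0
          i = r F.⁻¹
          e = F.inverse r r≉0
          τ₀ A₀ M₀ A₀′ M₀′ P₀′ : F.Carrier
          τ₀ = F.- (p F.* i)
          A₀ = a F.+ m F.* τ₀ F.+ c F.* (τ₀ F.* τ₀)
          M₀ = m F.+ nat F 2 F.* c F.* τ₀
          A₀′ = a′ F.+ m′ F.* τ₀ F.+ c′ F.* (τ₀ F.* τ₀)
          M₀′ = m′ F.+ nat F 2 F.* c′ F.* τ₀
          P₀′ = p′ F.+ r′ F.* τ₀
          ys : List F.Carrier
          ys = a ∷ m ∷ c ∷ a′ ∷ m′ ∷ c′ ∷ p ∷ p′ ∷ r′ ∷ []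
          â m̂ ĉ â′ m̂′ ĉ′ p̂ p̂′ r̂′ r̂ t Â M̂ Â′ M̂′ P̂′ Û Ŵ Ŝ₀ Ŝ₁ : SE
          r̂ = var 0
          â = var 2
          m̂ = var 3
          ĉ = var 4
          â′ = var 5
          m̂′ = var 6
          ĉ′ = var 7
          p̂ = var 8
          p̂′ = var 9
          r̂′ = var 10
          t = :- (p̂ :* var 1)
          Â = â :+ m̂ :* t :+ ĉ :* (t :* t)
          M̂ = m̂ :+ nat 𝕊 2 :* ĉ :* t
          Â′ = â′ :+ m̂′ :* t :+ ĉ′ :* (t :* t)
          M̂′ = m̂′ :+ nat 𝕊 2 :* ĉ′ :* t
          P̂′ = p̂′ :+ r̂′ :* t
          Û = M̂ :+ :- (r̂ :* P̂′)
          Ŵ = ĉ :+ :- (r̂ :* r̂′)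
          Ŝ₀ = M̂ :* Û :+ Â′ :* (r̂ :* r̂)
          Ŝ₁ = M̂ :* Ŵ :+ ĉ :* Û :+ M̂′ :* (r̂ :* r̂)
          Qₛ : SE → SE
          Qₛ = quarticₛ â m̂ ĉ â′ m̂′ ĉ′ p̂ r̂ p̂′ r̂′
          A0² : A₀ F.* A₀ F.≈ F.0#
          A0² = F.trans (sc₁ e ys (Â :* Â) (Qₛ t) tt) (all-zero τ₀)
          shifted : res₂ a m c a′ m′ c′ F.≈ res₂ A₀ M₀ c A₀′ M₀′ c′
          shifted = sc₁ e ys (Forms.res₂ 𝕊 â m̂ ĉ â′ m̂′ ĉ′) (Forms.res₂ 𝕊 Â M̂ ĉ Â′ M̂′ ĉ′) tt
          drop : ∀ {x y z} → A₀ F.≈ F.0# → x F.≈ y F.+ A₀ F.* z → x F.≈ y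
          drop A0 h = F.trans h (F.trans (F.+-congˡ (F.trans (F.*-congʳ A0) (F.zeroˡ _))) (F.+-identityʳ _))
          -- Modulo A₀ the quartic is τ²(S₀ + S₁τ + S₂τ²) about τ₀. So S₀ and S₁ are obtained from
          -- its values at τ₀ + 1 and τ₀ - 1, and S₂ is its leading coefficient.
          s₀-eq : A₀ F.≈ F.0# → (F.1# F.+ F.1#) F.* (M₀ F.* (M₀ F.- r F.* P₀′) F.+ A₀′ F.* (r F.* r)) F.≈
            Rₜ (τ₀ F.+ F.1#) F.+ Rₜ (τ₀ F.- F.1#) F.+ F.- (F.1# F.+ F.1#) F.* Lead
          s₀-eq A0 = drop A0 (sc₁ e ys ((𝟙 :+ 𝟙) :* Ŝ₀)
            (Qₛ (t :+ 𝟙) :+ Qₛ (t :+ :- 𝟙) :+ (:- (𝟙 :+ 𝟙)) :* (ĉ :* ĉ :+ :- ((ĉ :* r̂′ :+ :- (ĉ′ :* r̂)) :* r̂))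
              :+ Â :* (:- (nat 𝕊 2 :* Â :+ nat 𝕊 4 :* ĉ :+ :- (nat 𝕊 2 :* r̂ :* r̂′)))) tt)
          s₁-eq : A₀ F.≈ F.0# → (F.1# F.+ F.1#) F.* (M₀ F.* (c F.- r F.* r′) F.+ c F.* (M₀ F.- r F.* P₀′) F.+ M₀′ F.* (r F.* r)) F.≈
            Rₜ (τ₀ F.+ F.1#) F.+ F.- Rₜ (τ₀ F.- F.1#)
          s₁-eq A0 = drop A0 (sc₁ e ys ((𝟙 :+ 𝟙) :* Ŝ₁)
            (Qₛ (t :+ 𝟙) :+ :- Qₛ (t :+ :- 𝟙) :+ Â :* (:- (nat 𝕊 4 :* M̂ :+ :- (nat 𝕊 2 :* r̂ :* P̂′)))) tt)

        -- r = 0 ≠ p: the double root is at infinity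
        case₂ : r F.≈ F.0# → ¬ ⊤
        case₂ r0 _ = square c² (λ c0 _ → cases p
            (λ p≉0 _ → res≉0 (F.trans (sc xs (Forms.res₂ 𝕊 (var 2) (var 3) (var 4) (var 5) (var 6) (var 7)) (Forms.res₂ 𝕊 (var 4) (var 3) (var 2) (var 7) (var 6) (var 5)) tt)
              (double-root c m a c′ m′ a′ p r′ p′ p≉0 c0
                (cancel 2≉0 (F.trans (drop₂ c0 r0 (sc xs ((𝟙 :+ 𝟙) :* (var 3 :* (var 3 :+ :- (var 8 :* var 11)) :+ var 7 :* (var 8 :* var 8)))
                    (Qₛ 𝟙 :+ Qₛ (:- 𝟙) :+ (:- (𝟙 :+ 𝟙)) :* Qₛ 𝟘 :+ var 4 :* k₀ :+ var 9 :* k₀′) tt))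
                  (zero-sum (zero-sum (all-zero F.1#) (all-zero (F.- F.1#))) (times0 (all-zero F.0#)))))
                (cancel 2≉0 (F.trans (drop₂ c0 r0 (sc xs ((𝟙 :+ 𝟙) :* (var 3 :* (var 2 :+ :- (var 8 :* var 10)) :+ var 2 :* (var 3 :+ :- (var 8 :* var 11)) :+ var 6 :* (var 8 :* var 8)))
                    (Qₛ 𝟙 :+ :- Qₛ (:- 𝟙) :+ var 4 :* k₁ :+ var 9 :* k₁′) tt))
                  (zero-sum (all-zero F.1#) (F.trans (F.-‿cong (all-zero (F.- F.1#))) (sc [] (:- 𝟘) 𝟘 tt)))))
                (F.trans (sc xs (var 2 :* (var 2 :+ :- (var 8 :* var 10)) :+ var 5 :* (var 8 :* var 8)) (Qₛ 𝟘) tt) (all-zero F.0#)))))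
            (λ p0 _ → square (a² p0) (λ a0 _ → square (m² a0 c0 p0) (λ m0 _ → res≉0 (F.trans
              (sc xs (Forms.res₂ 𝕊 (var 2) (var 3) (var 4) (var 5) (var 6) (var 7))
                (var 2 :* (var 7 :* (var 2 :* var 7 :+ :- (var 4 :* var 5)) :+ :- (var 6 :* (var 3 :* var 7 :+ :- (var 4 :* var 6))))
                 :+ var 3 :* (var 5 :* (var 3 :* var 7 :+ :- (var 4 :* var 6))) :+ var 4 :* (:- (var 5 :* (var 2 :* var 7 :+ :- (var 4 :* var 5))))) tt)
              (zero-sum (zero-sum (z a0) (z m0)) (z c0)))) tt) tt) tt) tt
          where
          z : ∀ {x y} → x F.≈ F.0# → x F.* y F.≈ F.0#
          z e = F.trans (F.*-congʳ e) (F.zeroˡ _)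
          Qₛ : SE → SE
          Qₛ = R̂
          drop₂ : ∀ {x y k k′} → c F.≈ F.0# → r F.≈ F.0# → x F.≈ y F.+ c F.* k F.+ r F.* k′ → x F.≈ y
          drop₂ c0 r0 h = F.trans h (F.trans (F.+-cong (F.trans (F.+-congˡ (z c0)) (F.+-identityʳ _)) (z r0)) (F.+-identityʳ _))
          c² : c F.* c F.≈ F.0#
          c² = F.trans (sc xs (var 4 :* var 4) ((var 4 :* var 4 :+ :- ((var 4 :* var 11 :+ :- (var 7 :* var 9)) :* var 9)) :+ var 9 :* (var 4 :* var 11 :+ :- (var 7 :* var 9))) tt)
            (zero-sum lead (z r0))
          a² : p F.≈ F.0# → a F.* a F.≈ F.0#
          a² p0 = F.trans (sc xs (var 2 :* var 2) (Qₛ 𝟘 :+ var 8 :* (var 2 :* var 10 :+ :- (var 5 :* var 8))) tt) (zero-sum (all-zero F.0#) (z p0))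
          m² : a F.≈ F.0# → c F.≈ F.0# → p F.≈ F.0# → m F.* m F.≈ F.0#
          m² a0 c0 p0 = F.trans (sc xs (var 3 :* var 3)
              (Qₛ 𝟙 :+ (var 8 :+ var 9) :* ((var 2 :+ var 3 :+ var 4) :* (var 10 :+ var 11) :+ :- ((var 5 :+ var 6 :+ var 7) :* (var 8 :+ var 9)))
                :+ var 2 :* (:- (var 2 :+ nat 𝕊 2 :* var 3)) :+ var 4 :* (:- (var 4 :+ nat 𝕊 2 :* var 3 :+ nat 𝕊 2 :* var 2))) tt)
            (zero-sum (zero-sum (zero-sum (all-zero F.1#) (F.trans (F.*-congʳ (zero-sum p0 r0)) (F.zeroˡ _))) (z a0)) (z c0))
          k₀ k₀′ k₁ k₁′ : SE
          k₀ = :- (nat 𝕊 4 :* var 2) :+ :- (nat 𝕊 2 :* var 4) :+ nat 𝕊 2 :* var 8 :* var 10 :+ nat 𝕊 2 :* var 9 :* var 11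
          k₀′ = nat 𝕊 2 :* var 2 :* var 11 :+ nat 𝕊 2 :* var 3 :* var 10 :+ :- (nat 𝕊 2 :* var 5 :* var 9) :+ :- (nat 𝕊 4 :* var 6 :* var 8) :+ :- (nat 𝕊 2 :* var 7 :* var 9)
          k₁ = :- (nat 𝕊 4 :* var 3) :+ nat 𝕊 2 :* var 9 :* var 10 :+ nat 𝕊 2 :* var 8 :* var 11
          k₁′ = nat 𝕊 2 :* var 2 :* var 10 :+ nat 𝕊 2 :* var 3 :* var 11 :+ :- (nat 𝕊 4 :* var 5 :* var 8) :+ :- (nat 𝕊 2 :* var 6 :* var 9) :+ :- (nat 𝕊 4 :* var 7 :* var 8)

    unimodular : ∀ k₁ k₂ → ¬ (k₁ F.≈ F.0# × k₂ F.≈ F.0#) → Σ F.Carrier λ α → Σ F.Carrier λ β → α F.* k₁ F.+ β F.* k₂ F.≈ F.1#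
    unimodular k₁ k₂ h = w F.⁻¹ , w F.⁻¹ F.* s , F.trans (sc (k₁ ∷ k₂ ∷ s ∷ w F.⁻¹ ∷ []) (var 5 :* var 2 :+ var 5 :* var 4 :* var 3) (var 5 :* (var 2 :+ var 4 :* var 3)) tt) (unit w≉0)
      where
      s w : F.Carrier
      -- s = 0 if k₁ ≠ 0 and s = 1 otherwise, so that w is k₁ or, if k₁ = 0, k₂.
      s = select k₁ F.0# F.1#
      w = k₁ F.+ s F.* k₂
      w≉0 : ¬ w F.≈ F.0#
      w≉0 = cases k₁
        (λ n e → n (F.trans (sc (k₁ ∷ k₂ ∷ []) (var 2) (var 2 :+ 𝟘 :* var 3) tt) (F.trans (F.+-congˡ (F.*-congʳ (F.sym (select-≉ n _ _)))) e)))
        (λ z e → h (z , F.trans (sc (k₂ ∷ []) (var 2) (𝟘 :+ 𝟙 :* var 2) tt) (F.trans (F.+-cong (F.sym z) (F.*-congʳ (F.sym (select-≈ z _ _)))) e)))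

    res₂-cong : ∀ {a m c a′ m′ c′ x y z x′ y′ z′} → a F.≈ x → m F.≈ y → c F.≈ z → a′ F.≈ x′ → m′ F.≈ y′ → c′ F.≈ z′ →
      res₂ a m c a′ m′ c′ F.≈ res₂ x y z x′ y′ z′
    res₂-cong p q r p′ q′ r′ = F.+-cong (F.*-cong (d p r p′ r′) (d p r p′ r′)) (F.-‿cong (F.*-cong (d p q p′ q′) (d q r q′ r′)))
      where
      d : ∀ {a b c d x y z w} → a F.≈ x → b F.≈ y → c F.≈ z → d F.≈ w → a F.* d F.+ F.- (b F.* c) F.≈ x F.* w F.+ F.- (y F.* z)
      d p q r s = F.+-cong (F.*-cong p s) (F.-‿cong (F.*-cong q r))

    res₂-sym : ∀ a m c a′ m′ c′ → res₂ a m c a′ m′ c′ F.≈ res₂ c m a c′ m′ a′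
    res₂-sym a m c a′ m′ c′ = sc (a ∷ m ∷ c ∷ a′ ∷ m′ ∷ c′ ∷ [])
      (Forms.res₂ 𝕊 (var 2) (var 3) (var 4) (var 5) (var 6) (var 7)) (Forms.res₂ 𝕊 (var 4) (var 3) (var 2) (var 7) (var 6) (var 5)) tt

    -- the resultant on the line through u + τv and w, where x, y, z are the
    -- coefficients of the quadratic forms on u, v, and p, r those of the linear
    -- forms obtained by polarising with w
    lineRes : (x₁ y₁ z₁ p₁ r₁ k₁ x₂ y₂ z₂ p₂ r₂ k₂ τ : F.Carrier) → F.Carrier
    lineRes x₁ y₁ z₁ p₁ r₁ k₁ x₂ y₂ z₂ p₂ r₂ k₂ τ = res₂
      (x₁ F.+ y₁ F.* τ F.+ z₁ F.* (τ F.* τ)) (p₁ F.+ r₁ F.* τ) k₁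
      (x₂ F.+ y₂ F.* τ F.+ z₂ F.* (τ F.* τ)) (p₂ F.+ r₂ F.* τ) k₂

    -- The fourth difference of a quartic in τ is 24 times its leading coefficient, and here that
    -- coefficient is the resultant of the terms of highest degree.
    lineRes-lead : ∀ x₁ y₁ z₁ p₁ r₁ k₁ x₂ y₂ z₂ p₂ r₂ k₂ →
      (∀ (k : Fin 5) → lineRes x₁ y₁ z₁ p₁ r₁ k₁ x₂ y₂ z₂ p₂ r₂ k₂ (nat F (toℕ k)) F.≈ F.0#) → res₂ z₁ r₁ k₁ z₂ r₂ k₂ F.≈ F.0#
    lineRes-lead x₁ y₁ z₁ p₁ r₁ k₁ x₂ y₂ z₂ p₂ r₂ k₂ w = cancel 24≉0 (F.trans
        (sc (x₁ ∷ y₁ ∷ z₁ ∷ p₁ ∷ r₁ ∷ k₁ ∷ x₂ ∷ y₂ ∷ z₂ ∷ p₂ ∷ r₂ ∷ k₂ ∷ [])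
          (m 24 :* Forms.res₂ 𝕊 (var 4) (var 6) (var 7) (var 10) (var 12) (var 13))
          (𝟙 :* ρ 0 :+ (:- m 4) :* ρ 1 :+ m 6 :* ρ 2 :+ (:- m 4) :* ρ 3 :+ 𝟙 :* ρ 4) tt)
        (zero-sum (zero-sum (zero-sum (zero-sum (times0 (w (# 0))) (times0 (w (# 1)))) (times0 (w (# 2)))) (times0 (w (# 3)))) (times0 (w (# 4)))))
      where
      m : ℕ → SE
      m = nat 𝕊
      ρ : ℕ → SE
      ρ k = Forms.res₂ 𝕊 (var 2 :+ var 3 :* m k :+ var 4 :* (m k :* m k)) (var 5 :+ var 6 :* m k) (var 7)
                         (var 8 :+ var 9 :* m k :+ var 10 :* (m k :* m k)) (var 11 :+ var 12 :* m k) (var 13)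

    -- A change of basis of determinant 1 among the two forms replaces (k₁, k₂) by (0, 1). The
    -- resultant on the line then becomes `Quartic`, to which `not-all-zero` applies.
    lineRes-nonzero : ∀ x₁ y₁ z₁ p₁ r₁ k₁ x₂ y₂ z₂ p₂ r₂ k₂ → ¬ res₂ x₁ y₁ z₁ x₂ y₂ z₂ F.≈ F.0# → ¬ (k₁ F.≈ F.0# × k₂ F.≈ F.0#) →
      ¬ (∀ (k : Fin 5) → lineRes x₁ y₁ z₁ p₁ r₁ k₁ x₂ y₂ z₂ p₂ r₂ k₂ (nat F (toℕ k)) F.≈ F.0#)
    lineRes-nonzero x₁ y₁ z₁ p₁ r₁ k₁ x₂ y₂ z₂ p₂ r₂ k₂ n k≉0 z with unimodular k₁ k₂ k≉0
    ... | α , β , e = Generic.not-all-zero (δ x₁ x₂) (δ y₁ y₂) (δ z₁ z₂) (λ′ x₁ x₂) (λ′ y₁ y₂) (λ′ z₁ z₂) (δ p₁ p₂) (δ r₁ r₂) (λ′ p₁ p₂) (λ′ r₁ r₂)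
          (λ h → n (F.trans (F.sym one) (F.trans (F.sym res-eq) h)))
          (λ k → F.trans (quartic-eq (nat F (toℕ k))) (F.trans (F.+-cong (z k)
            (F.trans (F.*-congʳ (F.trans (F.+-congˡ (F.-‿cong e)) (F.-‿inverseʳ _))) (F.zeroˡ _))) (F.+-identityˡ _)))
      where
      δ λ′ : F.Carrier → F.Carrier → F.Carrier
      δ a b = a F.* k₂ F.+ F.- (b F.* k₁)
      λ′ a b = α F.* a F.+ β F.* b
      xs : List F.Carrier
      xs = x₁ ∷ x₂ ∷ y₁ ∷ y₂ ∷ z₁ ∷ z₂ ∷ p₁ ∷ p₂ ∷ r₁ ∷ r₂ ∷ k₁ ∷ k₂ ∷ α ∷ β ∷ []
      δₛ λₛ : ℕ → SE
      δₛ i = var i :* var 13 :+ :- (var (suc i) :* var 12)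
      λₛ i = var 14 :* var i :+ var 15 :* var (suc i)
      eₛ : SE
      eₛ = var 14 :* var 12 :+ var 15 :* var 13
      one : (α F.* k₁ F.+ β F.* k₂) F.* (α F.* k₁ F.+ β F.* k₂) F.* res₂ x₁ y₁ z₁ x₂ y₂ z₂ F.≈ res₂ x₁ y₁ z₁ x₂ y₂ z₂
      one = F.trans (F.*-congʳ (F.trans (F.*-cong e e) (F.*-identityˡ _))) (F.*-identityˡ _)
      res-eq : res₂ (δ x₁ x₂) (δ y₁ y₂) (δ z₁ z₂) (λ′ x₁ x₂) (λ′ y₁ y₂) (λ′ z₁ z₂) F.≈ (α F.* k₁ F.+ β F.* k₂) F.* (α F.* k₁ F.+ β F.* k₂) F.* res₂ x₁ y₁ z₁ x₂ y₂ z₂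
      res-eq = sc xs (Forms.res₂ 𝕊 (δₛ 2) (δₛ 4) (δₛ 6) (λₛ 2) (λₛ 4) (λₛ 6)) (eₛ :* eₛ :* Forms.res₂ 𝕊 (var 2) (var 4) (var 6) (var 3) (var 5) (var 7)) tt
      quartic-eq : ∀ τ → Quartic (δ x₁ x₂) (δ y₁ y₂) (δ z₁ z₂) (λ′ x₁ x₂) (λ′ y₁ y₂) (λ′ z₁ z₂) (δ p₁ p₂) (δ r₁ r₂) (λ′ p₁ p₂) (λ′ r₁ r₂) τ F.≈
        res₂ (x₁ F.+ y₁ F.* τ F.+ z₁ F.* (τ F.* τ)) (p₁ F.+ r₁ F.* τ) k₁ (x₂ F.+ y₂ F.* τ F.+ z₂ F.* (τ F.* τ)) (p₂ F.+ r₂ F.* τ) k₂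
        F.+ (F.1# F.+ F.- (α F.* k₁ F.+ β F.* k₂)) F.* (((x₁ F.+ y₁ F.* τ F.+ z₁ F.* (τ F.* τ)) F.* (p₂ F.+ r₂ F.* τ) F.+ F.- ((x₂ F.+ y₂ F.* τ F.+ z₂ F.* (τ F.* τ)) F.* (p₁ F.+ r₁ F.* τ)))
          F.* ((p₁ F.+ r₁ F.* τ) F.* k₂ F.+ F.- ((p₂ F.+ r₂ F.* τ) F.* k₁)))
      quartic-eq τ = sc (xs ++ᴸ τ ∷ [])
        (quarticₛ (δₛ 2) (δₛ 4) (δₛ 6) (λₛ 2) (λₛ 4) (λₛ 6) (δₛ 8) (δₛ 10) (λₛ 8) (λₛ 10) t)
        (Forms.res₂ 𝕊 A₁ l₁ (var 12) A₂ l₂ (var 13) :+ (𝟙 :+ :- eₛ) :* ((A₁ :* l₂ :+ :- (A₂ :* l₁)) :* (l₁ :* var 13 :+ :- (l₂ :* var 12)))) tt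
        where
        t A₁ A₂ l₁ l₂ : SE
        t = var 16
        A₁ = var 2 :+ var 4 :* t :+ var 6 :* (t :* t)
        A₂ = var 3 :+ var 5 :* t :+ var 7 :* (t :* t)
        l₁ = var 8 :+ var 10 :* t
        l₂ = var 9 :+ var 11 :* t

    module _ (f : Model F four) where
      private
        R = resLine f
        g₁ = fst4 F f
        g₂ = snd4 F f

      private
        gₛ : Fin 10 → SE
        gₛ i = var (2 ℕ.+ toℕ i)
        uₛ vₛ wₛ : Fin 4 → SE
        uₛ i = var (12 ℕ.+ toℕ i)
        vₛ i = var (16 ℕ.+ toℕ i)
        wₛ i = var (20 ℕ.+ toℕ i)
        tₛ : SE
        tₛ = var 24
        u+tvₛ : Fin 4 → SE
        u+tvₛ i = uₛ i :+ tₛ :* vₛ i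
        env₄ : (Fin 10 → F.Carrier) → (u v w : V 4) → F.Carrier → List F.Carrier
        env₄ g u v w t = tabulate g ++ᴸ tabulate u ++ᴸ tabulate v ++ᴸ tabulate w ++ᴸ t ∷ []

      quad-add : ∀ g (u v : V 4) t → quad g (u ⊞ t ⊡ v) F.≈ quad g u F.+ polar g u v F.* t F.+ quad g v F.* (t F.* t)
      quad-add g u v t = sc (env₄ g u v u t) (Forms.quad 𝕊 gₛ u+tvₛ)
        (Forms.quad 𝕊 gₛ uₛ :+ Forms.polar 𝕊 gₛ uₛ vₛ :* tₛ :+ Forms.quad 𝕊 gₛ vₛ :* (tₛ :* tₛ)) tt

      polar-addˡ : ∀ g (u v w : V 4) t → polar g (u ⊞ t ⊡ v) w F.≈ polar g u w F.+ polar g v w F.* t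
      polar-addˡ g u v w t = sc (env₄ g u v w t) (Forms.polar 𝕊 gₛ u+tvₛ wₛ) (Forms.polar 𝕊 gₛ uₛ wₛ :+ Forms.polar 𝕊 gₛ vₛ wₛ :* tₛ) tt

      polar-sym : ∀ g (u v : V 4) → polar g u v F.≈ polar g v u
      polar-sym g u v = sc (env₄ g u v u F.0#) (Forms.polar 𝕊 gₛ uₛ vₛ) (Forms.polar 𝕊 gₛ vₛ uₛ) tt

      quad-cong : ∀ g {u v : V 4} → u ≐ v → quad g u F.≈ quad g v
      quad-cong g {u} {v} h = evS-cong F {g = 0} {k = 0} (λ ()) {env F F.1# F.1# (tabulate u ++ᴸ tabulate g)} {env F F.1# F.1# (tabulate v ++ᴸ tabulate g)}
        (env-cong F {F.1#} {F.1#} u v (tabulate g) h) (Forms.quad 𝕊 (λ i → var (6 ℕ.+ toℕ i)) (λ i → var (2 ℕ.+ toℕ i))) tt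

      polar-congˡ : ∀ g {u v : V 4} w → u ≐ v → polar g u w F.≈ polar g v w
      polar-congˡ g {u} {v} w h = evS-cong F {g = 0} {k = 0} (λ ()) {env F F.1# F.1# (tabulate u ++ᴸ (tabulate g ++ᴸ tabulate w))} {env F F.1# F.1# (tabulate v ++ᴸ (tabulate g ++ᴸ tabulate w))}
        (env-cong F {F.1#} {F.1#} u v (tabulate g ++ᴸ tabulate w) h) (Forms.polar 𝕊 (λ i → var (6 ℕ.+ toℕ i)) (λ i → var (2 ℕ.+ toℕ i)) (λ i → var (16 ℕ.+ toℕ i))) tt

      R-sym : ∀ u v → R u v F.≈ R v u
      R-sym u v = F.trans (res₂-sym (q₁ f u) (b₁ f u v) (q₁ f v) (q₂ f u) (b₂ f u v) (q₂ f v))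
        (res₂-cong {q₁ f v} {b₁ f u v} {q₁ f u} {q₂ f v} {b₂ f u v} {q₂ f u} {q₁ f v} {b₁ f v u} {q₁ f u} {q₂ f v} {b₂ f v u} {q₂ f u}
          F.refl (polar-sym g₁ u v) F.refl F.refl (polar-sym g₂ u v) F.refl)

      R-congˡ : ∀ {u v} w → u ≐ v → R u w F.≈ R v w
      R-congˡ {u} {v} w h = res₂-cong {q₁ f u} {b₁ f u w} {q₁ f w} {q₂ f u} {b₂ f u w} {q₂ f w} {q₁ f v} {b₁ f v w} {q₁ f w} {q₂ f v} {b₂ f v w} {q₂ f w}
        (quad-cong g₁ h) (polar-congˡ g₁ w h) F.refl (quad-cong g₂ h) (polar-congˡ g₂ w h) F.refl

      R-congʳ : ∀ u {v w} → v ≐ w → R u v F.≈ R u w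
      R-congʳ u {v} {w} h = F.trans (R-sym u v) (F.trans (R-congˡ {v} {w} u h) (R-sym w u))

      R-line : ∀ u v w t → R (u ⊞ t ⊡ v) w F.≈
        lineRes (q₁ f u) (b₁ f u v) (q₁ f v) (b₁ f u w) (b₁ f v w) (q₁ f w) (q₂ f u) (b₂ f u v) (q₂ f v) (b₂ f u w) (b₂ f v w) (q₂ f w) t
      R-line u v w t = res₂-cong {q₁ f (u ⊞ t ⊡ v)} {b₁ f (u ⊞ t ⊡ v) w} {q₁ f w} {q₂ f (u ⊞ t ⊡ v)} {b₂ f (u ⊞ t ⊡ v) w} {q₂ f w}
        (quad-add g₁ u v t) (polar-addˡ g₁ u v w t) F.refl (quad-add g₂ u v t) (polar-addˡ g₂ u v w t) F.refl

      quad-scale : ∀ g (u : V 4) t → quad g (t ⊡ u) F.≈ t F.* t F.* quad g u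
      quad-scale g u t = sc (env₄ g u u u t) (Forms.quad 𝕊 gₛ (λ i → tₛ :* uₛ i)) (tₛ :* tₛ :* Forms.quad 𝕊 gₛ uₛ) tt

      polar-scale : ∀ g (u : V 4) t → polar g u (t ⊡ u) F.≈ nat F 2 F.* t F.* quad g u
      polar-scale g u t = sc (env₄ g u u u t) (Forms.polar 𝕊 gₛ uₛ (λ i → tₛ :* uₛ i)) (nat 𝕊 2 :* tₛ :* Forms.quad 𝕊 gₛ uₛ) tt

      R-multiple : ∀ e t → R e (t ⊡ e) F.≈ F.0#
      R-multiple e t = F.trans (res₂-cong {q₁ f e} {b₁ f e (t ⊡ e)} {q₁ f (t ⊡ e)} {q₂ f e} {b₂ f e (t ⊡ e)} {q₂ f (t ⊡ e)}
          F.refl (polar-scale g₁ e t) (quad-scale g₁ e t) F.refl (polar-scale g₂ e t) (quad-scale g₂ e t))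
        (zero₂ (q₁ f e) (q₂ f e) t)
        where
        zero₂ : ∀ x y t → res₂ x (nat F 2 F.* t F.* x) (t F.* t F.* x) y (nat F 2 F.* t F.* y) (t F.* t F.* y) F.≈ F.0#
        zero₂ x y t = sc (x ∷ y ∷ t ∷ []) (Forms.res₂ 𝕊 (var 2) (nat 𝕊 2 :* var 4 :* var 2) (var 4 :* var 4 :* var 2)
          (var 3) (nat 𝕊 2 :* var 4 :* var 3) (var 4 :* var 4 :* var 3)) 𝟘 tt

      -- the coefficient of τ⁴ in R(e, h + τa) is R(e, a)
      R-generic : ∀ e a h → ¬ R e a F.≈ F.0# → ¬ (∀ (k : Fin 5) → R e (h ⊞ nat F (toℕ k) ⊡ a) F.≈ F.0#)
      R-generic e a h n z = n (F.trans (R-sym e a) (lineRes-lead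
        (q₁ f h) (b₁ f h a) (q₁ f a) (b₁ f h e) (b₁ f a e) (q₁ f e) (q₂ f h) (b₂ f h a) (q₂ f a) (b₂ f h e) (b₂ f a e) (q₂ f e)
        (λ k → F.trans (F.sym (R-line h a e (nat F (toℕ k)))) (F.trans (R-sym (h ⊞ nat F (toℕ k) ⊡ a) e) (z k)))))

      -- Since the line through u and v misses the curve, the plane through it and w
      -- contains a line through w that misses the curve.
      R-plane : ∀ u v w → ¬ R u v F.≈ F.0# → ¬ (q₁ f w F.≈ F.0# × q₂ f w F.≈ F.0#) →
        ¬ (∀ (k : Fin 5) → R (u ⊞ nat F (toℕ k) ⊡ v) w F.≈ F.0#)
      R-plane u v w n k≉0 z = lineRes-nonzero
        (q₁ f u) (b₁ f u v) (q₁ f v) (b₁ f u w) (b₁ f v w) (q₁ f w) (q₂ f u) (b₂ f u v) (q₂ f v) (b₂ f u w) (b₂ f v w) (q₂ f w)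
        n k≉0 (λ k → F.trans (F.sym (R-line u v w (nat F (toℕ k)))) (z k))

open LineResultants public

-- Coefficients of polynomials by tables

module CoefficientTables where
  -- Tables of coefficients: a polynomial in m variables is a nested list, indexed
  -- by the exponents of the variables up to the bound d.
  data Tab : ℕ → Set where
    zt   : ∀ {m} → Tab m
    leaf : CP → Tab 0
    node : ∀ {m} → List (Tab m) → Tab (suc m)

  -- `coeff` unfolds the convolutions anew for every exponent vector; a table produces all
  -- coefficients of a product together. Exponents above d are dropped, which does not affect the
  -- coefficients with exponents at most d.
  module Table (d : ℕ) where
    upto : ∀ {a} {A : Set a} → (ℕ → A) → ℕ → List A
    upto g zero    = []
    upto g (suc n) = g 0 ∷ upto (g ∘ suc) n

    addT : ∀ {m} → Tab m → Tab m → Tab m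
    addT zt t = t
    addT s zt = s
    addT (leaf a) (leaf b) = leaf (addCP a b)
    addT {suc m} (node ss) (node ts) = node (upto (λ a → addT (nth zt ss a) (nth zt ts a)) (suc d))

    sumT : ∀ {m} → List (Tab m) → Tab m
    sumT = foldr addT zt

    mulT′ : ∀ {m} → Tab m → Tab m → Tab m
    mulT′ zt t = zt
    mulT′ s zt = zt
    mulT′ (leaf a) (leaf b) = leaf (mulCP a b)
    mulT′ {suc m} (node ss) (node ts) =
      node (upto (λ a → sumT (upto (λ i → mulT′ (nth zt ss i) (nth zt ts (a ℕ.∸ i))) (suc a))) (suc d))

    constT : ∀ {m} → CP → Tab m
    constT {zero}  c = leaf c
    constT {suc m} c = node (constT c ∷ [])

    varT : ∀ {m} → Fin m → Tab m
    varT zero    = node (zt ∷ constT oneCP ∷ [])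
    varT (suc i) = node (varT i ∷ [])

    tab : ∀ {m} → Poly 𝕊 m → Tab m
    tab (pc a)   = constT (nS a)
    tab (pv i)   = varT i
    tab (p p+ q) = addT (tab p) (tab q)
    tab (p p* q) = mulT′ (tab p) (tab q)

    okP : ∀ {m} → Poly 𝕊 m → Bool
    okP (pc a)   = okS a
    okP (pv i)   = true
    okP (p p+ q) = okP p ∧ okP q
    okP (p p* q) = okP p ∧ okP q

    entry : ∀ {m} → Tab m → Vec ℕ m → CP
    entry zt        α       = []
    entry (leaf c)  []      = c
    entry (node ts) (a ∷ α) = entry (nth zt ts a) α

    bounded? : ∀ {m} → Vec ℕ m → Bool
    bounded? []      = true
    bounded? (a ∷ α) = (a ℕ.≤ᵇ d) ∧ bounded? α

    matches? : ∀ {k m} → (Fin k → Vec ℕ m) → Poly 𝕊 m → (Fin k → SE) → Bool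
    matches? E P x = okP P ∧ allB λ i → bounded? (E i) ∧ okS (x i) ∧ zeroCP (addCP (entry (tab P) (E i)) (negCP (nS (x i))))

    module Sound {c ℓ : Level} (F : Field c ℓ) (ρ : ℕ → Field.Carrier F)
      (inv01 : Field._≈_ F (Field._*_ F (ρ 0) (ρ 1)) (Field.1# F)) where
      private module F = Field F
      open CommSound F ρ inv01
      open import Data.List.Base using (concatMap; upTo; applyUpTo)
      open import Data.Nat.Properties using (≤ᵇ⇒≤)

      evP : ∀ {m} → Poly 𝕊 m → Poly F m
      evP (pc a)   = pc (evS F ρ a)
      evP (pv i)   = pv i
      evP (p p+ q) = evP p p+ evP q
      evP (p p* q) = evP p p* evP q

      Bounded : ∀ {m} → Vec ℕ m → Set
      Bounded []      = ⊤
      Bounded (a ∷ α) = a ℕ.≤ d × Bounded α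

      bounded-sound : ∀ {m} (α : Vec ℕ m) → T (bounded? α) → Bounded α
      bounded-sound []      _ = tt
      bounded-sound (a ∷ α) t = ≤ᵇ⇒≤ a d (proj₁ (T-∧ {a ℕ.≤ᵇ d} t)) , bounded-sound α (proj₂ (T-∧ {a ℕ.≤ᵇ d} t))

      nth-upto : ∀ {a} {A : Set a} {z : A} (g : ℕ → A) n k → k ℕ.< n → nth z (upto g n) k ≡ g k
      nth-upto g (suc n) zero    _           = refl
      nth-upto g (suc n) (suc k) (ℕ.s≤s k<n) = nth-upto (g ∘ suc) n k k<n

      coef : ∀ {m} → Tab m → Vec ℕ m → F.Carrier
      coef t α = ⟦ entry t α ⟧

      add-coef : ∀ {m} (s t : Tab m) α → Bounded α → coef (addT s t) α F.≈ coef s α F.+ coef t α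
      add-coef zt t α _ = F.sym (F.+-identityˡ _)
      add-coef (leaf a) zt [] _ = F.sym (F.+-identityʳ _)
      add-coef (node ss) zt (a ∷ α) _ = F.sym (F.+-identityʳ _)
      add-coef (leaf a) (leaf b) [] _ = add-sound a b
      add-coef {suc m} (node ss) (node ts) (a ∷ α) (h , hs)
        rewrite nth-upto {z = zt} (λ a → addT (nth zt ss a) (nth zt ts a)) (suc d) a (ℕ.s≤s h) = add-coef (nth zt ss a) (nth zt ts a) α hs

      sumC : List F.Carrier → F.Carrier
      sumC = foldr F._+_ F.0#

      sum-coef : ∀ {m} (l : List (Tab m)) α → Bounded α → coef (sumT l) α F.≈ sumC (mapL (λ t → coef t α) l)
      sum-coef []      α h = F.refl
      sum-coef (t ∷ l) α h = F.trans (add-coef t (sumT l) α h) (F.+-congˡ (sum-coef l α h))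

      sumC-++ : ∀ xs ys → sumC (xs ++ᴸ ys) F.≈ sumC xs F.+ sumC ys
      sumC-++ []       ys = F.sym (F.+-identityˡ _)
      sumC-++ (x ∷ xs) ys = F.trans (F.+-congˡ (sumC-++ xs ys)) (F.sym (F.+-assoc _ _ _))

      sumC-zero : ∀ {A : Set} (g : A → F.Carrier) l → (∀ x → g x F.≈ F.0#) → sumC (mapL g l) F.≈ F.0#
      sumC-zero g []      h = F.refl
      sumC-zero g (x ∷ l) h = F.trans (F.+-cong (h x) (sumC-zero g l h)) (F.+-identityˡ _)

      conv : ∀ {m} (f g : Vec ℕ m → F.Carrier) → List (Vec ℕ m × Vec ℕ m) → F.Carrier
      conv f g l = sumC (mapL (λ { (β , γ) → f β F.* g γ }) l)

      conv-zero : ∀ {m} (f g : Vec ℕ m → F.Carrier) l → (∀ β γ → f β F.* g γ F.≈ F.0#) → conv f g l F.≈ F.0#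
      conv-zero f g []            h = F.refl
      conv-zero f g ((β , γ) ∷ l) h = F.trans (F.+-cong (h β γ) (conv-zero f g l h)) (F.+-identityˡ _)

      -- `splits` lists the first exponent from 0 to a and then the splittings of the rest, in the
      -- order of the sums in `mulT′`; the induction runs along this list.
      mul-coef : ∀ {m} (s t : Tab m) α → Bounded α → coef (mulT′ s t) α F.≈ conv (coef s) (coef t) (splits F α)
      mul-coef zt t α _ = F.sym (conv-zero _ _ (splits F α) (λ _ _ → F.zeroˡ _))
      mul-coef (leaf a) zt [] _ = F.sym (F.trans (F.+-identityʳ _) (F.zeroʳ _))
      mul-coef (node ss) zt (a ∷ α) _ = F.sym (conv-zero (coef (node ss)) _ (splits F (a ∷ α)) (λ _ _ → F.zeroʳ _))
      mul-coef (leaf a) (leaf b) [] _ = F.trans (mul-sound a b) (F.sym (F.+-identityʳ _))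
      mul-coef {suc m} (node ss) (node ts) (a ∷ α) (h , hs)
        rewrite nth-upto {z = zt} (λ a → sumT (upto (λ i → mulT′ (nth zt ss i) (nth zt ts (a ℕ.∸ i))) (suc a))) (suc d) a (ℕ.s≤s h) =
        F.trans (sum-coef (upto (λ i → mulT′ (nth zt ss i) (nth zt ts (a ℕ.∸ i))) (suc a)) α hs) (go (λ i → i) (suc a))
        where
        inner : ∀ i (l : List (Vec ℕ m × Vec ℕ m)) → conv (coef (nth zt ss i)) (coef (nth zt ts (a ℕ.∸ i))) l F.≈
          conv (coef (node ss)) (coef (node ts)) (mapL (λ { (β , γ) → (i ∷ β , (a ℕ.∸ i) ∷ γ) }) l)
        inner i []            = F.refl
        inner i ((β , γ) ∷ l) = F.+-congˡ (inner i l)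
        mapL-++ : ∀ {A B : Set} (g : A → B) xs ys → mapL g (xs ++ᴸ ys) ≡ mapL g xs ++ᴸ mapL g ys
        mapL-++ g []       ys = refl
        mapL-++ g (x ∷ xs) ys = ≡.cong (g x ∷_) (mapL-++ g xs ys)
        conv-++ : ∀ (l l′ : List (Vec ℕ (suc m) × Vec ℕ (suc m))) → conv (coef (node ss)) (coef (node ts)) (l ++ᴸ l′) F.≈
          conv (coef (node ss)) (coef (node ts)) l F.+ conv (coef (node ss)) (coef (node ts)) l′
        conv-++ []      l′ = F.sym (F.+-identityˡ _)
        conv-++ (x ∷ l) l′ = F.trans (F.+-congˡ (conv-++ l l′)) (F.sym (F.+-assoc _ _ _))
        go : ∀ (k : ℕ → ℕ) n → sumC (mapL (λ t → coef t α) (upto (λ i → mulT′ (nth zt ss (k i)) (nth zt ts (a ℕ.∸ k i))) n)) F.≈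
          conv (coef (node ss)) (coef (node ts)) (concatMap (λ i → mapL (λ { (β , γ) → (i ∷ β , (a ℕ.∸ i) ∷ γ) }) (splits F α)) (applyUpTo k n))
        go k zero    = F.refl
        go k (suc n) = F.trans (F.+-cong
          (F.trans (mul-coef (nth zt ss (k 0)) (nth zt ts (a ℕ.∸ k 0)) α hs) (inner (k 0) (splits F α))) (go (k ∘ suc) n))
          (F.sym (conv-++ (mapL (λ { (β , γ) → (k 0 ∷ β , (a ℕ.∸ k 0) ∷ γ) }) (splits F α)) _))

      const-coef : ∀ {m} c (α : Vec ℕ m) → coef (constT c) α F.≈ (if allZero F α then ⟦ c ⟧ else F.0#)
      const-coef c []          = F.refl
      const-coef c (zero ∷ α)  = const-coef c α
      const-coef c (suc a ∷ α) = F.refl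

      var-coef : ∀ {m} (i : Fin m) (α : Vec ℕ m) → coef (varT i) α F.≈ (if isUnit F i α then F.1# else F.0#)
      var-coef zero    (zero ∷ α)        = F.refl
      var-coef zero    (suc zero ∷ α)    = F.trans (const-coef oneCP α) (if-one (allZero F α))
        where
        if-one : ∀ b → (if b then ⟦ oneCP ⟧ else F.0#) F.≈ (if b then F.1# else F.0#)
        if-one true  = ⟦one⟧
        if-one false = F.refl
      var-coef zero    (suc (suc _) ∷ α) = F.refl
      var-coef (suc i) (zero ∷ α)        = var-coef i α
      var-coef (suc i) (suc _ ∷ α)       = F.refl

      -- Tables agree with `coeff` up to exponent d only. In the convolution for a bounded exponent
      -- vector both parts are bounded again, so the agreement passes to products.
      BoundedSplits : ∀ {m} → List (Vec ℕ m × Vec ℕ m) → Set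
      BoundedSplits []            = ⊤
      BoundedSplits ((β , γ) ∷ l) = (Bounded β × Bounded γ) × BoundedSplits l

      splits-bounded : ∀ {m} (α : Vec ℕ m) → Bounded α → BoundedSplits (splits F α)
      splits-bounded []      h        = (tt , tt) , tt
      splits-bounded {suc m} (a ∷ α) (h , hs) = go (λ i → i) (suc a) (λ i i<n → ℕ.s≤s⁻¹ i<n)
        where
        open import Data.Nat.Properties using (≤-trans; m∸n≤m)
        app : ∀ {n} (l l′ : List (Vec ℕ n × Vec ℕ n)) → BoundedSplits l → BoundedSplits l′ → BoundedSplits (l ++ᴸ l′)
        app []      l′ _        q = q
        app (x ∷ l) l′ (p , ps) q = p , app l l′ ps q
        one : ∀ i → i ℕ.≤ a → (l : List (Vec ℕ m × Vec ℕ m)) → BoundedSplits l → BoundedSplits (mapL (λ { (β , γ) → (i ∷ β , (a ℕ.∸ i) ∷ γ) }) l)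
        one i i≤a []            _              = tt
        one i i≤a ((β , γ) ∷ l) ((p , q) , ps) = ((≤-trans i≤a h , p) , (≤-trans (m∸n≤m a i) h , q)) , one i i≤a l ps
        go : ∀ (k : ℕ → ℕ) n → (∀ i → i ℕ.< n → k i ℕ.≤ a) →
          BoundedSplits (concatMap (λ i → mapL (λ { (β , γ) → (i ∷ β , (a ℕ.∸ i) ∷ γ) }) (splits F α)) (applyUpTo k n))
        go k zero    b = tt
        go k (suc n) b = app (mapL (λ { (β , γ) → (k 0 ∷ β , (a ℕ.∸ k 0) ∷ γ) }) (splits F α)) _
          (one (k 0) (b 0 (ℕ.s≤s ℕ.z≤n)) (splits F α) (splits-bounded α hs)) (go (k ∘ suc) n (λ i h → b (suc i) (ℕ.s≤s h)))

      conv-cong : ∀ {m} {f f′ g g′ : Vec ℕ m → F.Carrier} l → BoundedSplits l →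
        (∀ β → Bounded β → f β F.≈ f′ β) → (∀ γ → Bounded γ → g γ F.≈ g′ γ) → conv f g l F.≈ conv f′ g′ l
      conv-cong []            _              hf hg = F.refl
      conv-cong ((β , γ) ∷ l) ((p , q) , ps) hf hg = F.+-cong (F.*-cong (hf β p) (hg γ q)) (conv-cong l ps hf hg)

      tab-sound : ∀ {m} (P : Poly 𝕊 m) → T (okP P) → ∀ α → Bounded α → coef (tab P) α F.≈ coeff F (evP P) α
      tab-sound (pc a) o α h = F.trans (const-coef (nS a) α) (if-cong (allZero F α))
        where
        if-cong : ∀ b → (if b then ⟦ nS a ⟧ else F.0#) F.≈ (if b then evS F ρ a else F.0#)
        if-cong true  = nS-sound a o
        if-cong false = F.refl
      tab-sound (pv i) o α h = var-coef i α
      tab-sound (p p+ q) o α h = F.trans (add-coef (tab p) (tab q) α h)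
        (F.+-cong (tab-sound p (proj₁ (T-∧ {okP p} o)) α h) (tab-sound q (proj₂ (T-∧ {okP p} o)) α h))
      tab-sound (p p* q) o α h = F.trans (mul-coef (tab p) (tab q) α h) (F.trans
        (conv-cong (splits F α) (splits-bounded α h) (tab-sound p (proj₁ (T-∧ {okP p} o))) (tab-sound q (proj₂ (T-∧ {okP p} o))))
        (same (splits F α)))
        where
        same : ∀ l → conv (coeff F (evP p)) (coeff F (evP q)) l F.≈ sumL F (mapL (λ { (β , γ) → coeff F (evP p) β F.* coeff F (evP q) γ }) l)
        same []            = F.refl
        same ((β , γ) ∷ l) = F.+-congˡ (same l)

      coeffs-sound : ∀ {k m} (E : Fin k → Vec ℕ m) P x → T (matches? E P x) → ∀ i → evS F ρ (x i) F.≈ coeffsOf F E (evP P) i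
      coeffs-sound E P x t i = F.trans (F.sym (F.trans e (nS-sound (x i) ox))) (tab-sound P oP (E i) (bounded-sound (E i) oB))
        where
        oP = proj₁ (T-∧ {okP P} t)
        tᵢ = allB-sound (λ i → bounded? (E i) ∧ okS (x i) ∧ zeroCP (addCP (entry (tab P) (E i)) (negCP (nS (x i))))) (proj₂ (T-∧ {okP P} t)) i
        oB = proj₁ (T-∧ {bounded? (E i)} tᵢ)
        t₂ = proj₂ (T-∧ {bounded? (E i)} tᵢ)
        ox = proj₁ (T-∧ {okS (x i)} t₂)
        e = RingProps.x∙y⁻¹≈ε⇒x≈y F.ring _ _ (F.trans (F.sym (F.trans (add-sound (entry (tab P) (E i)) _) (F.+-congˡ (neg-sound (nS (x i))))))
          (zero-sound _ (proj₂ (T-∧ {okS (x i)} t₂))))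

open CoefficientTables public

-- The group action as a change of frame

module FrameModels where
  module Frames {c ℓ : Level} (F : Field c ℓ) where
    open Field F using (Carrier; _+_; _*_; -_; 1#)
    open Forms F

    actPoly₂ : Carrier → Mat F 2 → Model F two → Poly F 2
    actPoly₂ l M f = pc (l * l) p* subst F (lin F M) (formOf F (E2 F) f)

    actPoly₃ : Carrier → Mat F 3 → Model F three → Poly F 3
    actPoly₃ l M f = pc l p* subst F (lin F M) (formOf F (E3 F) f)

    actPoly₄ : (l₁ l₂ : Carrier) → Mat F 4 → Model F four → Poly F 4
    actPoly₄ l₁ l₂ M f = pc l₁ p* subst F (lin F M) (formOf F (E4 F) (fst4 F f)) p+ pc l₂ p* subst F (lin F M) (formOf F (E4 F) (snd4 F f))

    -- frame₂ f u v, frame₃ f u v w, frame₄ f u v w z are the coefficients of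
    -- f(xu + yv + …), obtained by polarising the monomials of f.
    frame₂ : Model F two → (u v : Fin 2 → Carrier) → Model F two
    frame₂ f u v = lookup (sum (λ i j k l → u i * u j * u k * u l)
      ∷ sum (λ i j k l → v i * u j * u k * u l + u i * v j * u k * u l + u i * u j * v k * u l + u i * u j * u k * v l)
      ∷ sum (λ i j k l → v i * v j * u k * u l + v i * u j * v k * u l + v i * u j * u k * v l + u i * v j * v k * u l + u i * v j * u k * v l + u i * u j * v k * v l)
      ∷ sum (λ i j k l → u i * v j * v k * v l + v i * u j * v k * v l + v i * v j * u k * v l + v i * v j * v k * u l)
      ∷ sum (λ i j k l → v i * v j * v k * v l) ∷ [])
      where
      sum : (Fin 2 → Fin 2 → Fin 2 → Fin 2 → Carrier) → Carrier
      sum m = f (# 0) * m (# 0) (# 0) (# 0) (# 0) + f (# 1) * m (# 0) (# 0) (# 0) (# 1) + f (# 2) * m (# 0) (# 0) (# 1) (# 1)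
        + f (# 3) * m (# 0) (# 1) (# 1) (# 1) + f (# 4) * m (# 1) (# 1) (# 1) (# 1)

    module _ (f : Model F three) where
      private
        sum : (Fin 3 → Fin 3 → Fin 3 → Carrier) → Carrier
        sum m = f (# 0) * m (# 0) (# 0) (# 0) + f (# 1) * m (# 1) (# 1) (# 1) + f (# 2) * m (# 2) (# 2) (# 2)
          + f (# 3) * m (# 0) (# 0) (# 1) + f (# 4) * m (# 0) (# 0) (# 2) + f (# 5) * m (# 0) (# 1) (# 1) + f (# 6) * m (# 1) (# 1) (# 2)
          + f (# 7) * m (# 0) (# 2) (# 2) + f (# 8) * m (# 1) (# 2) (# 2) + f (# 9) * m (# 0) (# 1) (# 2)

      cubic : (Fin 3 → Carrier) → Carrier
      cubic u = sum λ i j k → u i * u j * u k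

      cubicPolar : (u v : Fin 3 → Carrier) → Carrier
      cubicPolar u v = sum λ i j k → v i * u j * u k + u i * v j * u k + u i * u j * v k

      cubicTrilinear : (u v w : Fin 3 → Carrier) → Carrier
      cubicTrilinear u v w = sum λ i j k → u i * v j * w k + u i * w j * v k + v i * u j * w k + v i * w j * u k + w i * u j * v k + w i * v j * u k

      frame₃ : (u v w : Fin 3 → Carrier) → Model F three
      frame₃ u v w = lookup (cubic u ∷ cubic v ∷ cubic w ∷ cubicPolar u v ∷ cubicPolar u w ∷ cubicPolar v u ∷ cubicPolar v w
        ∷ cubicPolar w u ∷ cubicPolar w v ∷ cubicTrilinear u v w ∷ [])

    frameForm : (Fin 10 → Carrier) → (u v w z : Fin 4 → Carrier) → Fin 10 → Carrier
    frameForm g u v w z = lookup (quad g u ∷ polar g u v ∷ polar g u w ∷ polar g u z ∷ quad g v ∷ polar g v w ∷ polar g v z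
      ∷ quad g w ∷ polar g w z ∷ quad g z ∷ [])

    frame₄ : Model F four → (u v w z : Fin 4 → Carrier) → Model F four
    frame₄ f u v w z = [ frameForm (fst4 F f) u v w z , frameForm (snd4 F f) u v w z ]′ ∘ splitAt 10

  private
    rows : ∀ {n} m → ℕ → Fin m → Fin n → SE
    rows {n} m k i j = var (k ℕ.+ n ℕ.* toℕ i ℕ.+ toℕ j)
    module G = Frames 𝕊
    module M₂ = Moves2 𝕊
    module M₃ = Moves3 𝕊

  module ActSound {c ℓ : Level} (F : Field c ℓ) where
    private module F = Field F
    open Frames F

    module _ (l : F.Carrier) (M : Mat F 2) (f : Model F two) where
      private
        open Table 4
        xs = tabulate f ++ᴸ (l ∷ tabulate (M (# 0)) ++ᴸ tabulate (M (# 1)))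
        open Sound F (env F F.1# F.1# xs) (F.*-identityˡ _)
        M̂ : Mat 𝕊 2
        M̂ = rows 2 8
        P = G.actPoly₂ (var 7) M̂ (varModel two)
        P-eq : evP P ≡ actPoly₂ l M f
        P-eq = refl
        x : Fin 5 → SE
        x = M₂.twist₂ (var 7) (G.frame₂ (varModel two) (M̂ (# 0)) (M̂ (# 1)))

      -- `lin M` replaces xᵢ by Σⱼ Mⱼᵢxⱼ and so sends eⱼ to the j-th row of M; hence the frame
      -- consists of the rows of M.
      act₂ : ∀ i → act F two (l , M) f i F.≈ Moves2.twist₂ F l (frame₂ f (M (# 0)) (M (# 1))) i
      act₂ = gather (spread {P = λ i → coeffsOf F (E2 F) (actPoly₂ l M f) i F.≈ evS F (env F F.1# F.1# xs) (x i)} λ i →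
        F.sym (F.trans (coeffs-sound (E2 𝕊) P x tt i) (F.reflexive (≡.cong (λ P → coeffsOf F (E2 F) P i) P-eq))))

    module _ (l : F.Carrier) (M : Mat F 3) (f : Model F three) where
      private
        open Table 3
        xs = tabulate f ++ᴸ (l ∷ tabulate (M (# 0)) ++ᴸ tabulate (M (# 1)) ++ᴸ tabulate (M (# 2)))
        open Sound F (env F F.1# F.1# xs) (F.*-identityˡ _)
        M̂ : Mat 𝕊 3
        M̂ = rows 3 13
        P = G.actPoly₃ (var 12) M̂ (varModel three)
        P-eq : evP P ≡ actPoly₃ l M f
        P-eq = refl
        x : Fin 10 → SE
        x = M₃.twist₃ (var 12) (G.frame₃ (varModel three) (M̂ (# 0)) (M̂ (# 1)) (M̂ (# 2)))

      act₃ : ∀ i → act F three (l , M) f i F.≈ Moves3.twist₃ F l (frame₃ f (M (# 0)) (M (# 1)) (M (# 2))) i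
      act₃ = gather (spread {P = λ i → coeffsOf F (E3 F) (actPoly₃ l M f) i F.≈ evS F (env F F.1# F.1# xs) (x i)} λ i →
        F.sym (F.trans (coeffs-sound (E3 𝕊) P x tt i) (F.reflexive (≡.cong (λ P → coeffsOf F (E3 F) P i) P-eq))))

    module _ (l₁ l₂ : F.Carrier) (M : Mat F 4) (f : Model F four) where
      private
        open Table 2
        xs = tabulate f ++ᴸ (l₁ ∷ l₂ ∷ tabulate (M (# 0)) ++ᴸ tabulate (M (# 1)) ++ᴸ tabulate (M (# 2)) ++ᴸ tabulate (M (# 3)))
        open Sound F (env F F.1# F.1# xs) (F.*-identityˡ _)
        M̂ : Mat 𝕊 4
        M̂ = rows 4 24
        P = G.actPoly₄ (var 22) (var 23) M̂ (varModel four)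
        P-eq : evP P ≡ actPoly₄ l₁ l₂ M f
        P-eq = refl
        form : (Fin 10 → SE) → Fin 10 → SE
        form g = G.frameForm g (M̂ (# 0)) (M̂ (# 1)) (M̂ (# 2)) (M̂ (# 3))
        x : Fin 10 → SE
        x k = var 22 :* form (fst4 𝕊 (varModel four)) k :+ var 23 :* form (snd4 𝕊 (varModel four)) k

      act₄-row : ∀ k → coeffsOf F (E4 F) (actPoly₄ l₁ l₂ M f) k F.≈
        l₁ F.* frameForm (fst4 F f) (M (# 0)) (M (# 1)) (M (# 2)) (M (# 3)) k F.+ l₂ F.* frameForm (snd4 F f) (M (# 0)) (M (# 1)) (M (# 2)) (M (# 3)) k
      act₄-row = gather (spread {P = λ i → coeffsOf F (E4 F) (actPoly₄ l₁ l₂ M f) i F.≈ evS F (env F F.1# F.1# xs) (x i)} λ i →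
        F.sym (F.trans (coeffs-sound (E4 𝕊) P x tt i) (F.reflexive (≡.cong (λ P → coeffsOf F (E4 F) P i) P-eq))))

    act₄ : ∀ Λ M f i → act F four (Λ , M) f i F.≈ Moves4.mix F Λ (frame₄ f (M (# 0)) (M (# 1)) (M (# 2)) (M (# 3))) i
    act₄ Λ M f = split
      where
      g : Model F four
      g = frame₄ f (M (# 0)) (M (# 1)) (M (# 2)) (M (# 3))
      form : (Fin 10 → F.Carrier) → Fin 10 → F.Carrier
      form h = frameForm h (M (# 0)) (M (# 1)) (M (# 2)) (M (# 3))
      fst-frame : ∀ k → form (fst4 F f) k F.≈ fst4 F g k
      fst-frame = gather {P = λ k → form (fst4 F f) k F.≈ fst4 F g k} (spread {P = λ k → form (fst4 F f) k F.≈ form (fst4 F f) k} λ _ → F.refl)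
      snd-frame : ∀ k → form (snd4 F f) k F.≈ snd4 F g k
      snd-frame = gather {P = λ k → form (snd4 F f) k F.≈ snd4 F g k} (spread {P = λ k → form (snd4 F f) k F.≈ form (snd4 F f) k} λ _ → F.refl)
      row : ∀ i k → coeffsOf F (E4 F) (actPoly₄ (Λ i (# 0)) (Λ i (# 1)) M f) k F.≈ Λ i (# 0) F.* fst4 F g k F.+ Λ i (# 1) F.* snd4 F g k
      row i k = F.trans (act₄-row (Λ i (# 0)) (Λ i (# 1)) M f k) (F.+-cong (F.*-congˡ (fst-frame k)) (F.*-congˡ (snd-frame k)))
      split : ∀ i → act F four (Λ , M) f i F.≈ Moves4.mix F Λ g i
      split i with splitAt 10 i
      ... | inj₁ k = row (# 0) k
      ... | inj₂ k = row (# 1) k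

open FrameModels public

-- Connections between frames, and frames in degree 2

module FrameLinks where
  open import Data.List.Relation.Binary.Pointwise using (Pointwise; []; _∷_; ++⁺; tabulate⁺)

  private
    vec : ∀ {m} → ℕ → Fin m → SE
    vec k i = var (k ℕ.+ toℕ i)
    infixl 6 _⊞̂_
    infixr 7 _⊡̂_
    _⊞̂_ : ∀ {m} (u v : Fin m → SE) → Fin m → SE
    (u ⊞̂ v) i = u i :+ v i
    _⊡̂_ : ∀ {m} → SE → (Fin m → SE) → Fin m → SE
    (a ⊡̂ v) i = a :* v i
    v₂ : Model 𝕊 two
    v₂ = varModel two
    v₃ : Model 𝕊 three
    v₃ = varModel three
    module M₂ = Moves2 𝕊
    module M₃ = Moves3 𝕊
    module G = Frames 𝕊

  basis : ∀ {c ℓ} (F : Field c ℓ) {m} → Fin m → Fin m → Field.Carrier F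
  basis F zero    zero    = Field.1# F
  basis F zero    (suc j) = Field.0# F
  basis F (suc i) zero    = Field.0# F
  basis F (suc i) (suc j) = basis F i j

  module Links {c ℓ : Level} (F : Field c ℓ) where
    private module F = Field F

    -- a connection whose factor is the quotient of the volumes of two frames
    Link : (n : Deg) (f f′ : Model F n) (d d′ : F.Carrier) → Set (c ⊔ ℓ)
    Link n f f′ d d′ = Σ F.Carrier λ δ → Conn F n δ f f′ × δ F.* d F.≈ d′

    link-trans : ∀ {n f f′ f″ d d′ d″} → Link n f f′ d d′ → Link n f′ f″ d′ d″ → Link n f f″ d d″
    link-trans (δ , C , e) (δ′ , C′ , e′) = δ′ F.* δ , conn-trans F C C′ , F.trans (F.*-assoc _ _ _) (F.trans (F.*-congˡ e) e′)

    link-≈ : ∀ {n} {f f′ : Model F n} {d d′} → (∀ i → f i F.≈ f′ i) → d F.≈ d′ → Link n f f′ d d′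
    link-≈ h e = F.1# , conn-≈ F h , F.trans (F.*-identityˡ _) e

    link : ∀ {n δ} {f f₁ f′ : Model F n} {d d′} → Conn F n δ f f₁ → (∀ i → f₁ i F.≈ f′ i) → δ F.* d F.≈ d′ → Link n f f′ d d′
    link C h e = _ , conn-resp F (λ _ → F.refl) h C , e

    -- Indexed by frames rather than by their models: unification can recover the frames from a
    -- record type, but not from the models and volumes.
    record Joined {i} {I : Set i} (n : Deg) (frame : I → Model F n) (vol : I → F.Carrier) (x y : I) : Set (c ⊔ ℓ) where
      constructor joined
      field
        path : Link n (frame x) (frame y) (vol x) (vol y)

    open Joined public

    joined-trans : ∀ {i} {I : Set i} {n} {frame : I → Model F n} {vol : I → F.Carrier} {x y z} →
      Joined n frame vol x y → Joined n frame vol y z → Joined n frame vol x z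
    joined-trans (joined l) (joined l′) = joined (link-trans l l′)

    env-pointwise : ∀ {a b xs ys} → Pointwise F._≈_ xs ys → ∀ k → env F a b xs k F.≈ env F a b ys k
    env-pointwise h zero          = F.refl
    env-pointwise h (suc zero)    = F.refl
    env-pointwise h (suc (suc k)) = go h k
      where
      go : ∀ {xs ys} → Pointwise F._≈_ xs ys → ∀ k → nth F.0# xs k F.≈ nth F.0# ys k
      go []      k       = F.refl
      go (e ∷ h) zero    = e
      go (e ∷ h) (suc k) = go h k

    refls : ∀ {m} (u : Fin m → F.Carrier) → Pointwise F._≈_ (tabulate u) (tabulate u)
    refls u = tabulate⁺ λ _ → F.refl

    congS : ∀ x → T (okS x) → ∀ {xs ys} → Pointwise F._≈_ xs ys → evS F (env F F.1# F.1# xs) x F.≈ evS F (env F F.1# F.1# ys) x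
    congS x t h = evS-cong F {g = 0} {k = 0} (λ ()) (env-pointwise h) x t

  module Frame2 {c ℓ : Level} (F : Field c ℓ) (f : Model F two) where
    private module F = Field F
    open Scalar F
    open Select F
    open Links F
    open Conn2 F
    open Frames F using (frame₂)

    private
      D : V 2 → V 2 → F.Carrier
      D x y = det F (lookup (x ∷ y ∷ []))
      L : (x y x′ y′ : V 2) → Set (c ⊔ ℓ)
      L x y x′ y′ = Joined two (λ (x , y) → frame₂ f x y) (λ (x , y) → D x y) (x , y) (x′ , y′)
      D̂ : (x y : Fin 2 → SE) → SE
      D̂ x y = det 𝕊 (lookup (x ∷ y ∷ []))
      x̂ ŷ : Fin 2 → SE
      x̂ = vec 7
      ŷ = vec 9
      t̂ : SE
      t̂ = var 11
      xs : (x y : V 2) → F.Carrier → List F.Carrier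
      xs x y t = tabulate f ++ᴸ tabulate x ++ᴸ tabulate y ++ᴸ t ∷ []
      point : ∀ {x y x′ y′ : V 2} → x ≐ x′ → y ≐ y′ → Pointwise F._≈_ (xs x y F.0#) (xs x′ y′ F.0#)
      point h h′ = ++⁺ (refls f) (++⁺ (tabulate⁺ h) (++⁺ (tabulate⁺ h′) (F.refl ∷ [])))

      L-≐ : ∀ {x y x′ y′} → x ≐ x′ → y ≐ y′ → L x y x′ y′
      L-≐ {x} {y} {x′} {y′} h h′ = joined $ link-≈ (gather {P = λ i → frame₂ f x y i F.≈ frame₂ f x′ y′ i}
          (congM F (G.frame₂ v₂ x̂ ŷ) tt (env-pointwise {F.1#} {F.1#} (point h h′))))
        (congS (D̂ x̂ ŷ) tt (point h h′))
      L-add : ∀ t {x y} → L x y (x ⊞ t ⊡ y) y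
      L-add t {x} {y} = joined $ link (conn-shear₂ t (frame₂ f x y)) (gather {P = λ i → shear₂ t (frame₂ f x y) i F.≈ frame₂ f (x ⊞ t ⊡ y) y i}
          (scM (xs x y t) (M₂.shear₂ t̂ (G.frame₂ v₂ x̂ ŷ)) (G.frame₂ v₂ (x̂ ⊞̂ t̂ ⊡̂ ŷ) ŷ) tt))
        (sc (xs x y t) (𝟙 :* D̂ x̂ ŷ) (D̂ (x̂ ⊞̂ t̂ ⊡̂ ŷ) ŷ) tt)
      L-scale : ∀ {g h} → g F.* h F.≈ F.1# → ∀ {x y} → L x y (g ⊡ x) y
      L-scale {g} e {x} {y} = joined $ link (conn-scale₂ e (frame₂ f x y)) (gather {P = λ i → scale₂ g (frame₂ f x y) i F.≈ frame₂ f (g ⊡ x) y i}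
          (scM (xs x y g) (M₂.scale₂ t̂ (G.frame₂ v₂ x̂ ŷ)) (G.frame₂ v₂ (t̂ ⊡̂ x̂) ŷ) tt))
        (sc (xs x y g) (t̂ :* D̂ x̂ ŷ) (D̂ (t̂ ⊡̂ x̂) ŷ) tt)
      L-flip : ∀ {x y} → L x y y x
      L-flip {x} {y} = joined $ link (conn-flip₂ (frame₂ f x y)) (gather {P = λ i → flip₂ (frame₂ f x y) i F.≈ frame₂ f y x i}
          (scM (xs x y F.0#) (M₂.flip₂ (G.frame₂ v₂ x̂ ŷ)) (G.frame₂ v₂ ŷ x̂) tt))
        (sc (xs x y F.0#) (:- 𝟙 :* D̂ x̂ ŷ) (D̂ ŷ x̂) tt)
      zeroV : V 2
      zeroV _ = F.0#
      add-zero : ∀ {x z : V 2} → z ≐ zeroV → x ≐ x ⊞ z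
      add-zero h i = F.sym (F.trans (F.+-congˡ (h i)) (F.+-identityʳ _))

      Z : V 2 → Set ℓ
      Z z = z ≐ zeroV
      L-translate : ∀ {z} → Z z → ∀ {x y} → L x y (x ⊞ z) y
      L-translate {z} h {x} = L-≐ (add-zero {x} {z} h) (λ _ → F.refl)
      Z-lin : ∀ {u v} t → Z u → Z v → Z (u ⊞ t ⊡ v)
      Z-lin t h h′ i = F.trans (F.+-cong (h i) (F.*-congˡ (h′ i))) (sc (t ∷ []) (𝟘 :+ var 2 :* 𝟘) 𝟘 tt)

    -- f is its own frame model for the standard basis, whose volume is 1; so the factor of the link
    -- is det M. In degree 2 no point has to be avoided, and `Pair` applies with trivial
    -- translations.
    frame-link : ∀ M → ¬ det F M F.≈ F.0# → Link two f (frame₂ f (M (# 0)) (M (# 1))) F.1# (det F M)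
    frame-link M det≉0 = link-trans
      (link-≈ {d′ = D (basis F (# 0)) (basis F (# 1))} (gather {P = λ i → f i F.≈ frame₂ f (basis F (# 0)) (basis F (# 1)) i}
        (scM (tabulate f) v₂ (G.frame₂ v₂ (basis 𝕊 (# 0)) (basis 𝕊 (# 1))) tt)) (sc [] 𝟙 (D̂ (basis 𝕊 (# 0)) (basis 𝕊 (# 1))) tt))
      (path (P.transform {x = basis F (# 0)} {basis F (# 1)} {zeroV} {zeroV} {M (# 0)} {M (# 1)} {M (# 0) (# 0)} {M (# 0) (# 1)} {M (# 1) (# 0)} {M (# 1) (# 1)}
        (λ _ → F.refl) (λ _ → F.refl) (decompose (M (# 0))) (decompose (M (# 1)))
        (≉-resp (sc (tabulate (M (# 0)) ++ᴸ tabulate (M (# 1))) (D̂ (vec 2) (vec 4)) (var 2 :* var 5 :+ :- (var 4 :* var 3)) tt) det≉0)))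
      where
      module P = Pair Z L joined-trans L-≐ L-add L-scale L-flip L-translate Z-lin
      decompose : ∀ (u : V 2) → u ≐ (u (# 0) ⊡ basis F (# 0) ⊞ u (# 1) ⊡ basis F (# 1)) ⊞ zeroV
      decompose u = gather {P = λ i → u i F.≈ (u (# 0) F.* basis F (# 0) i F.+ u (# 1) F.* basis F (# 1) i) F.+ F.0#}
        (scM (tabulate u) (vec 2) (λ i → (var 2 :* basis 𝕊 {2} (# 0) i :+ var 3 :* basis 𝕊 {2} (# 1) i) :+ 𝟘) tt)

  -- Moving the last two vectors of a frame (a, b, c), modulo the span Z a of the
  -- vectors that stay fixed.
  module Fixing {c ℓ : Level} (F : Field c ℓ) where
    open Field F hiding (refl; zero)
    open Select F
    open Scalar F

    module Fix {m : ℕ} {p q : Level}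
      (D : V m → V m → V m → Carrier) (N : V m → Carrier) (Z : V m → V m → Set p) (L : (a b c a′ b′ c′ : V m) → Set q)
      (L-trans : ∀ {a b c a′ b′ c′ a″ b″ c″} → L a b c a′ b′ c′ → L a′ b′ c′ a″ b″ c″ → L a b c a″ b″ c″)
      (L-≐ : ∀ {a b c b′ c′} → b ≐ b′ → c ≐ c′ → L a b c a b′ c′)
      (L-add : ∀ {a} → ¬ N a ≈ 0# → ∀ t {b c} → L a b c a (b ⊞ t ⊡ c) c)
      (L-scale : ∀ {a} → ¬ N a ≈ 0# → ∀ {g h} → g * h ≈ 1# → ∀ {b c} → L a b c a (g ⊡ b) c)
      (L-flip : ∀ {a} → ¬ N a ≈ 0# → ∀ {b c} → L a b c a c b)
      (L-translate : ∀ {a} → ¬ N a ≈ 0# → ∀ {z} → Z a z → ∀ {b c} → L a b c a (b ⊞ z) c)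
      (Z-lin : ∀ {a u v} t → Z a u → Z a v → Z a (u ⊞ t ⊡ v))
      (Z-scale : ∀ {a u} t → Z a u → Z a (t ⊡ u))
      (cramer : ∀ a b c w → Σ (V m) λ z → Z a z × D a b c ⊡ w ≐ (D a w c ⊡ b ⊞ D a b w ⊡ c) ⊞ z)
      (plücker : ∀ a b c b′ c′ → D a b′ c * D a b c′ + - (D a c′ c * D a b b′) ≈ D a b c * D a b′ c′)
      where

      -- By Cramer's rule b′ has the coordinates D(a, b′, c)/D(a, b, c) and D(a, b, b′)/D(a, b, c)
      -- modulo Z a, and c′ likewise. By the Plücker relation the determinant of these coordinates
      -- is D(a, b′, c′)/D(a, b, c).
      fix : ∀ {a b c b′ c′} → ¬ N a ≈ 0# → ¬ D a b c ≈ 0# → ¬ D a b′ c′ ≈ 0# → L a b c a b′ c′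
      fix {a} {b} {c} {b′} {c′} Na d≉0 d′≉0 = P.transform (Z-scale x (proj₁ (proj₂ (cramer a b c b′)))) (Z-scale x (proj₁ (proj₂ (cramer a b c c′))))
        (coords b′) (coords c′)
        (≉-resp (trans (*-congˡ (*-congˡ (sym (plücker a b c b′ c′))))
          (sc (x ∷ D a b′ c ∷ D a b c′ ∷ D a c′ c ∷ D a b b′ ∷ []) (var 2 :* (var 2 :* (var 3 :* var 4 :+ :- (var 5 :* var 6))))
            (var 2 :* var 3 :* (var 2 :* var 4) :+ :- (var 2 :* var 5 :* (var 2 :* var 6))) tt))
          (*-≉ x≉0 (≉-resp (sym (trans (sym (*-assoc _ _ _)) (trans (*-congʳ (unit d≉0)) (*-identityˡ _)))) d′≉0)))
        where
        x = D a b c ⁻¹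
        x≉0 : ¬ x ≈ 0#
        x≉0 e = 0≉1 (trans (sym (zeroˡ _)) (trans (*-congʳ (sym e)) (unit d≉0)))
        module P = Pair (Z a) (λ b c b′ c′ → L a b c a b′ c′) L-trans L-≐ (L-add Na) (L-scale Na) (L-flip Na) (L-translate Na) Z-lin
        coords : ∀ w → w ≐ ((x * D a w c) ⊡ b ⊞ (x * D a b w) ⊡ c) ⊞ x ⊡ proj₁ (cramer a b c w)
        coords w i = trans (sym (trans (sym (*-assoc _ _ _)) (trans (*-congʳ (unit d≉0)) (*-identityˡ _))))
          (trans (*-congˡ (proj₂ (proj₂ (cramer a b c w)) i))
            (sc (x ∷ D a w c ∷ b i ∷ D a b w ∷ c i ∷ proj₁ (cramer a b c w) i ∷ [])
              (var 2 :* ((var 3 :* var 4 :+ var 5 :* var 6) :+ var 7)) (((var 2 :* var 3) :* var 4 :+ (var 2 :* var 5) :* var 6) :+ var 2 :* var 7) tt))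

open FrameLinks public

-- Frames in degree 3

module Frames3 where
  open import Data.List.Relation.Binary.Pointwise using (Pointwise; []; _∷_; ++⁺; tabulate⁺)

  private
    vec : ∀ {m} → ℕ → Fin m → SE
    vec k i = var (k ℕ.+ toℕ i)
    infixl 6 _⊞̂_
    infixr 7 _⊡̂_
    _⊞̂_ : ∀ {m} (u v : Fin m → SE) → Fin m → SE
    (u ⊞̂ v) i = u i :+ v i
    _⊡̂_ : ∀ {m} → SE → (Fin m → SE) → Fin m → SE
    (a ⊡̂ v) i = a :* v i
    v₃ : Model 𝕊 three
    v₃ = varModel three
    module M₃ = Moves3 𝕊
    module G = Frames 𝕊

  module Frame3 {c ℓ : Level} (F : Field c ℓ)
    (2≉0 : ¬ Field._≈_ F (Field._+_ F (Field.1# F) (Field.1# F)) (Field.0# F))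
    (3≉0 : ¬ Field._≈_ F (Field._+_ F (Field._+_ F (Field.1# F) (Field.1# F)) (Field.1# F)) (Field.0# F))
    (f : Model F three) where
    private module F = Field F
    open Scalar F
    open Select F
    open Links F
    open Conn3 F
    open General3 F
    open Frames F using (frame₃; cubic; cubicPolar)

    private
      N : V 3 → F.Carrier
      N = cubic f
      -- The distinguished vector a comes last in the frame model, at the point (0 : 0 : 1), where
      -- the cubic must not vanish; the determinant follows that order.
      D : V 3 → V 3 → V 3 → F.Carrier
      D a b c = det F (lookup (b ∷ c ∷ a ∷ []))
      fr : V 3 → V 3 → V 3 → Model F three
      fr a b c = frame₃ f b c a
      L : (x y z x′ y′ z′ : V 3) → Set (c ⊔ ℓ)
      L a b c a′ b′ c′ = Joined three (λ (a , b , c) → fr a b c) (λ (a , b , c) → D a b c) (a , b , c) (a′ , b′ , c′)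
      Z : V 3 → V 3 → Set (c ⊔ ℓ)
      Z a z = Σ F.Carrier λ t → z ≐ t ⊡ a
      D̂ : (a b c : Fin 3 → SE) → SE
      D̂ a b c = det 𝕊 (lookup (b ∷ c ∷ a ∷ []))
      f̂r : (a b c : Fin 3 → SE) → Model 𝕊 three
      f̂r a b c = G.frame₃ v₃ b c a
      â b̂ ĉ ŵ ẑ : Fin 3 → SE
      â = vec 12
      b̂ = vec 15
      ĉ = vec 18
      ŵ = vec 22
      ẑ = vec 25
      t̂ : SE
      t̂ = var 21
      xs : (a b c : V 3) → F.Carrier → List F.Carrier
      xs a b c t = tabulate f ++ᴸ tabulate a ++ᴸ tabulate b ++ᴸ tabulate c ++ᴸ t ∷ []
      ys : (a b c w z : V 3) → List F.Carrier
      ys a b c w z = tabulate f ++ᴸ tabulate a ++ᴸ tabulate b ++ᴸ tabulate c ++ᴸ F.0# ∷ tabulate w ++ᴸ tabulate z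
      point : ∀ {a b c a′ b′ c′ : V 3} → a ≐ a′ → b ≐ b′ → c ≐ c′ → Pointwise F._≈_ (xs a b c F.0#) (xs a′ b′ c′ F.0#)
      point h h′ h″ = ++⁺ (refls f) (++⁺ (tabulate⁺ h) (++⁺ (tabulate⁺ h′) (++⁺ (tabulate⁺ h″) (F.refl ∷ []))))
      r : ∀ {u : V 3} → u ≐ u
      r _ = F.refl

      D-cong : ∀ {a b c a′ b′ c′} → a ≐ a′ → b ≐ b′ → c ≐ c′ → D a b c F.≈ D a′ b′ c′
      D-cong h h′ h″ = congS (D̂ â b̂ ĉ) tt (point h h′ h″)
      N-cong : ∀ {a a′} → a ≐ a′ → N a F.≈ N a′
      N-cong h = congS (G.cubic v₃ â) tt (++⁺ (refls f) (tabulate⁺ h))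
      L-≐ : ∀ {a b c b′ c′} → b ≐ b′ → c ≐ c′ → L a b c a b′ c′
      L-≐ {a} {b} {c} {b′} {c′} h h′ = joined $ link-≈ (gather {P = λ i → fr a b c i F.≈ fr a b′ c′ i}
          (congM F (f̂r â b̂ ĉ) tt (env-pointwise {F.1#} {F.1#} (point {a} {b} {c} r h h′))))
        (D-cong {a} {b} {c} r h h′)
      L-add : ∀ {a} → ¬ N a F.≈ F.0# → ∀ t {b c} → L a b c a (b ⊞ t ⊡ c) c
      L-add {a} n t {b} {c} = joined $ link (conn-shear₃ (fr a b c) n t) (gather {P = λ i → shear₃ t (fr a b c) i F.≈ fr a (b ⊞ t ⊡ c) c i}
          (scM (xs a b c t) (M₃.shear₃ t̂ (f̂r â b̂ ĉ)) (f̂r â (b̂ ⊞̂ t̂ ⊡̂ ĉ) ĉ) tt))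
        (sc (xs a b c t) (𝟙 :* D̂ â b̂ ĉ) (D̂ â (b̂ ⊞̂ t̂ ⊡̂ ĉ) ĉ) tt)
      L-scale : ∀ {a} → ¬ N a F.≈ F.0# → ∀ {g h} → g F.* h F.≈ F.1# → ∀ {b c} → L a b c a (g ⊡ b) c
      L-scale {a} _ {g} e {b} {c} = joined $ link (conn-scale₃ e (fr a b c)) (gather {P = λ i → scale₃ g (fr a b c) i F.≈ fr a (g ⊡ b) c i}
          (scM (xs a b c g) (M₃.scale₃ t̂ (f̂r â b̂ ĉ)) (f̂r â (t̂ ⊡̂ b̂) ĉ) tt))
        (sc (xs a b c g) (t̂ :* D̂ â b̂ ĉ) (D̂ â (t̂ ⊡̂ b̂) ĉ) tt)
      L-flip : ∀ {a} → ¬ N a F.≈ F.0# → ∀ {b c} → L a b c a c b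
      L-flip {a} n {b} {c} = joined $ link (conn-flip₃ (fr a b c) n) (gather {P = λ i → flip₃ (fr a b c) i F.≈ fr a c b i}
          (scM (xs a b c F.0#) (M₃.flip₃ (f̂r â b̂ ĉ)) (f̂r â ĉ b̂) tt))
        (sc (xs a b c F.0#) (:- 𝟙 :* D̂ â b̂ ĉ) (D̂ â ĉ b̂) tt)
      L-translate : ∀ {a} → ¬ N a F.≈ F.0# → ∀ {z} → Z a z → ∀ {b c} → L a b c a (b ⊞ z) c
      L-translate {a} n (t , h) {b} {c} = joined-trans (joined $ link {f′ = fr a (b ⊞ t ⊡ a) c} {d′ = D a (b ⊞ t ⊡ a) c} (conn-lift₃ (fr a b c) n t)
          (gather {P = λ i → lift₃ t (fr a b c) i F.≈ fr a (b ⊞ t ⊡ a) c i}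
            (scM (xs a b c t) (M₃.lift₃ t̂ (f̂r â b̂ ĉ)) (f̂r â (b̂ ⊞̂ t̂ ⊡̂ â) ĉ) tt))
          (sc (xs a b c t) (𝟙 :* D̂ â b̂ ĉ) (D̂ â (b̂ ⊞̂ t̂ ⊡̂ â) ĉ) tt))
        (L-≐ {a} {b ⊞ t ⊡ a} {c} (λ i → F.+-congˡ (F.sym (h i))) r)
      L-swap : ∀ {a b c} → ¬ N a F.≈ F.0# → ¬ N b F.≈ F.0# → L a b c b a c
      L-swap {a} {b} {c} n n′ = joined $ link (conn-swap₃ (fr a b c) n n′) (gather {P = λ i → swap₃ (fr a b c) i F.≈ fr b a c i}
          (scM (xs a b c F.0#) (M₃.swap₃ (f̂r â b̂ ĉ)) (f̂r b̂ â ĉ) tt))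
        (sc (xs a b c F.0#) (:- 𝟙 :* D̂ â b̂ ĉ) (D̂ b̂ â ĉ) tt)
      cramer : ∀ a b c w → Σ (V 3) λ z → Z a z × D a b c ⊡ w ≐ (D a w c ⊡ b ⊞ D a b w ⊡ c) ⊞ z
      cramer a b c w = D w b c ⊡ a , (D w b c , r) , gather {P = λ i → D a b c F.* w i F.≈ (D a w c F.* b i F.+ D a b w F.* c i) F.+ D w b c F.* a i}
        (scM (ys a b c w w) (D̂ â b̂ ĉ ⊡̂ ŵ) ((D̂ â ŵ ĉ ⊡̂ b̂ ⊞̂ D̂ â b̂ ŵ ⊡̂ ĉ) ⊞̂ D̂ ŵ b̂ ĉ ⊡̂ â) tt)
      plücker : ∀ a b c b′ c′ → D a b′ c F.* D a b c′ F.+ F.- (D a c′ c F.* D a b b′) F.≈ D a b c F.* D a b′ c′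
      plücker a b c b′ c′ = sc (ys a b c b′ c′) (D̂ â ŵ ĉ :* D̂ â b̂ ẑ :+ :- (D̂ â ẑ ĉ :* D̂ â b̂ ŵ)) (D̂ â b̂ ĉ :* D̂ â ŵ ẑ) tt

      Z-lin : ∀ {a u v} t → Z a u → Z a v → Z a (u ⊞ t ⊡ v)
      Z-lin {a} t (α , h) (β , k) = α F.+ t F.* β , λ i → F.trans (F.+-cong (h i) (F.*-congˡ (k i)))
        (sc (α ∷ β ∷ t ∷ a i ∷ []) (var 2 :* var 5 :+ var 4 :* (var 3 :* var 5)) ((var 2 :+ var 4 :* var 3) :* var 5) tt)
      Z-scale : ∀ {a u} t → Z a u → Z a (t ⊡ u)
      Z-scale t (α , h) = t F.* α , λ i → F.trans (F.*-congˡ (h i)) (F.sym (F.*-assoc _ _ _))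

      open Fixing F
      open Fix D N Z L joined-trans L-≐ L-add L-scale L-flip L-translate Z-lin Z-scale cramer plücker

      6N : ∀ p q s n → nat F 6 F.* n F.≈ ((p F.+ q F.* nat F 3 F.+ s F.* (nat F 3 F.* nat F 3) F.+ n F.* (nat F 3 F.* nat F 3 F.* nat F 3))
          F.+ F.- nat F 3 F.* (p F.+ q F.* nat F 2 F.+ s F.* (nat F 2 F.* nat F 2) F.+ n F.* (nat F 2 F.* nat F 2 F.* nat F 2))
          F.+ nat F 3 F.* (p F.+ q F.* nat F 1 F.+ s F.* (nat F 1 F.* nat F 1) F.+ n F.* (nat F 1 F.* nat F 1 F.* nat F 1)))
          F.+ F.- (p F.+ q F.* nat F 0 F.+ s F.* (nat F 0 F.* nat F 0) F.+ n F.* (nat F 0 F.* nat F 0 F.* nat F 0))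
      6N p q s n = sc (p ∷ q ∷ s ∷ n ∷ []) (nat 𝕊 6 :* var 5) (k 3 :+ :- nat 𝕊 3 :* k 2 :+ nat 𝕊 3 :* k 1 :+ :- k 0) tt
        where
        k : ℕ → SE
        k n = var 2 :+ var 3 :* nat 𝕊 n :+ var 4 :* (nat 𝕊 n :* nat 𝕊 n) :+ var 5 :* (nat 𝕊 n :* nat 𝕊 n :* nat 𝕊 n)
      6≉0 : ¬ nat F 6 F.≈ F.0#
      6≉0 = ≉-resp (sc [] ((𝟙 :+ 𝟙) :* (𝟙 :+ 𝟙 :+ 𝟙)) (nat 𝕊 6) tt) (*-≉ 2≉0 3≉0)
      cubic-add : ∀ h a t → N (h ⊞ t ⊡ a) F.≈ N h F.+ cubicPolar f h a F.* t F.+ cubicPolar f a h F.* (t F.* t) F.+ N a F.* (t F.* t F.* t)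
      cubic-add h a t = sc (xs a h h t) (G.cubic v₃ (b̂ ⊞̂ t̂ ⊡̂ â))
        (G.cubic v₃ b̂ :+ G.cubicPolar v₃ b̂ â :* t̂ :+ G.cubicPolar v₃ â b̂ :* (t̂ :* t̂) :+ G.cubic v₃ â :* (t̂ :* t̂ :* t̂)) tt

      -- The third difference of N along a is 6 N(a).
      N-generic : ∀ a h → ¬ N a F.≈ F.0# → ¬ (∀ (k : Fin 5) → N (h ⊞ nat F (toℕ k) ⊡ a) F.≈ F.0#)
      N-generic a h n z = *-≉ 6≉0 n (F.trans (6N (N h) (cubicPolar f h a) (cubicPolar f a h) (N a))
        (F.trans (F.+-cong (F.+-cong (F.+-cong (z′ (# 3)) (F.*-congˡ (z′ (# 2)))) (F.*-congˡ (z′ (# 1)))) (F.-‿cong (z′ (# 0))))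
          (sc [] (𝟘 :+ :- nat 𝕊 3 :* 𝟘 :+ nat 𝕊 3 :* 𝟘 :+ :- 𝟘) 𝟘 tt)))
        where
        z′ : ∀ (k : Fin 5) → N h F.+ cubicPolar f h a F.* nat F (toℕ k) F.+ cubicPolar f a h F.* (nat F (toℕ k) F.* nat F (toℕ k))
          F.+ N a F.* (nat F (toℕ k) F.* nat F (toℕ k) F.* nat F (toℕ k)) F.≈ F.0#
        z′ k = F.trans (F.sym (cubic-add h a (nat F (toℕ k)))) (z k)

      -- Up to sign the three determinants are D(a, v, w) times the coordinates of b in the frame
      -- (a, v, w); so b = 0.
      N-degenerate : ∀ a v w b → ¬ D a v w F.≈ F.0# → D a b v F.≈ F.0# → D a b w F.≈ F.0# → D w b v F.≈ F.0# → N b F.≈ F.0#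
      N-degenerate a v w b d≉0 e₁ e₂ e₃ = F.trans (N-cong b≐0) (sc (tabulate f) (G.cubic v₃ (λ _ → 𝟘)) 𝟘 tt)
        where
        b≐0 : b ≐ λ _ → F.0#
        b≐0 i = F.trans (F.sym (F.trans (F.sym (F.*-assoc _ _ _)) (F.trans (F.*-congʳ (unit d≉0)) (F.*-identityˡ _))))
          (F.trans (F.*-congˡ (F.trans (proj₂ (proj₂ (cramer a v w b)) i) (F.trans
            (F.+-cong (F.+-cong (F.*-congʳ e₂)
              (F.*-congʳ (F.trans (sc (ys a v w b b) (D̂ â b̂ ŵ) (:- D̂ â ŵ b̂) tt) (F.-‿cong e₁))))
              (F.*-congʳ (F.trans (sc (ys a v w b b) (D̂ ŵ b̂ ĉ) (D̂ ĉ ŵ b̂) tt) e₃)))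
            (sc (v i ∷ w i ∷ a i ∷ []) (𝟘 :* var 2 :+ :- 𝟘 :* var 3 :+ 𝟘 :* var 4) 𝟘 tt)))) (F.zeroʳ _))

      open Exchange D N L joined-trans fix L-swap D-cong N-cong
        (λ a b c → sc (xs a b c F.0#) (D̂ b̂ â ĉ) (:- D̂ â b̂ ĉ) tt)
        (λ a h g τ → sc (xs a h g τ) (D̂ â (b̂ ⊞̂ t̂ ⊡̂ â) ĉ) (:- D̂ â ĉ b̂) tt)
        (λ a h b τ → sc (xs a h b τ) (D̂ (b̂ ⊞̂ t̂ ⊡̂ â) ĉ â) (:- D̂ â ĉ b̂) tt)
        (λ a h b g τ → sc (tabulate f ++ᴸ tabulate a ++ᴸ tabulate h ++ᴸ tabulate b ++ᴸ τ ∷ tabulate g)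
          (D̂ (b̂ ⊞̂ t̂ ⊡̂ â) ĉ ŵ) (D̂ b̂ ĉ ŵ :+ t̂ :* D̂ â ĉ ŵ) tt)
        N-generic N-degenerate

      e₁ e₂ e₃ : V 3
      e₁ = basis F (# 0)
      e₂ = basis F (# 1)
      e₃ = basis F (# 2)
      f≈fr : ∀ i → f i F.≈ fr e₃ e₁ e₂ i
      f≈fr = gather {P = λ i → f i F.≈ fr e₃ e₁ e₂ i} (scM (tabulate f) v₃ (f̂r (basis 𝕊 (# 2)) (basis 𝕊 (# 0)) (basis 𝕊 (# 1))) tt)
      1≈D : F.1# F.≈ D e₃ e₁ e₂
      1≈D = sc [] 𝟙 (D̂ (basis 𝕊 (# 2)) (basis 𝕊 (# 0)) (basis 𝕊 (# 1))) tt

    frame-link : ∀ M → ¬ f (# 2) F.≈ F.0# → ¬ frame₃ f (M (# 0)) (M (# 1)) (M (# 2)) (# 2) F.≈ F.0# → ¬ det F M F.≈ F.0# →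
      Link three f (frame₃ f (M (# 0)) (M (# 1)) (M (# 2))) F.1# (det F M)
    frame-link M c≉0 c′≉0 det≉0 =
      -- First e₃ is exchanged for the last row of M; then the other two vectors are adjusted with
      -- that row fixed.
      let V′ , W′ , d≉0 , l = exchange {e₃} {e₁} {e₂} {M (# 2)} (≉-resp (f≈fr (# 2)) c≉0) c′≉0 (≉-resp 1≈D (λ h → F.0≉1 (F.sym h)))
      in link-trans (link-≈ f≈fr 1≈D) (path (joined-trans l (fix {M (# 2)} {V′} {W′} {M (# 0)} {M (# 1)} c′≉0 d≉0 det≉0)))

open Frames3 public

-- Frames in degree 4

module Frames4 where
  open import Data.List.Relation.Binary.Pointwise using (Pointwise; []; _∷_; ++⁺; tabulate⁺)

  private
    vec : ∀ {m} → ℕ → Fin m → SE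
    vec k i = var (k ℕ.+ toℕ i)
    infixl 6 _⊞̂_
    infixr 7 _⊡̂_
    _⊞̂_ : ∀ {m} (u v : Fin m → SE) → Fin m → SE
    (u ⊞̂ v) i = u i :+ v i
    _⊡̂_ : ∀ {m} → SE → (Fin m → SE) → Fin m → SE
    (a ⊡̂ v) i = a :* v i
    v₄ : Model 𝕊 four
    v₄ = varModel four
    module M₄ = Moves4 𝕊
    module G = Frames 𝕊
    module A = Forms 𝕊

  module Frame4 {c ℓ : Level} (F : Field c ℓ)
    (2≉0 : ¬ Field._≈_ F (Field._+_ F (Field.1# F) (Field.1# F)) (Field.0# F))
    (3≉0 : ¬ Field._≈_ F (Field._+_ F (Field._+_ F (Field.1# F) (Field.1# F)) (Field.1# F)) (Field.0# F))
    (f : Model F four) where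
    private module F = Field F
    open Scalar F
    open Select F
    open Links F
    open Conn4 F
    open Forms F
    open Lines F 2≉0 3≉0
    open Frames F using (frame₄)

    private
      vol : (u v w z : V 4) → F.Carrier
      vol u v w z = det F (lookup (u ∷ v ∷ w ∷ z ∷ []))
      vol̂ : (u v w z : Fin 4 → SE) → SE
      vol̂ u v w z = det 𝕊 (lookup (u ∷ v ∷ w ∷ z ∷ []))
      r : ∀ {u : V 4} → u ≐ u
      r _ = F.refl
      ê â b̂ ĉ ŵ ẑ : Fin 4 → SE
      ê = vec 22
      â = vec 26
      b̂ = vec 30
      ĉ = vec 34
      ŵ = vec 39
      ẑ = vec 43
      t̂ : SE
      t̂ = var 38
      f̂r : (e a b c : Fin 4 → SE) → Model 𝕊 four
      f̂r = G.frame₄ v₄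
      xs₄ : (e a b c : V 4) → F.Carrier → List F.Carrier
      xs₄ e a b c t = tabulate f ++ᴸ tabulate e ++ᴸ tabulate a ++ᴸ tabulate b ++ᴸ tabulate c ++ᴸ t ∷ []

      lift₃₂ : F.Carrier → Model F four → Model F four
      lift₃₂ t g = flip₁₂ (lift₃₁ t (flip₁₂ g))
      conn-lift₃₂ : ∀ t g → Conn F four F.1# g (lift₃₂ t g)
      conn-lift₃₂ t g = conn-δ F (sc [] (:- 𝟙 :* 𝟙 :* :- 𝟙) 𝟙 tt)
        (_▷_ F (conn-flip₁₂ g) (_▷_ F (conn-lift₃₁ t _) (conn-flip₁₂ _)))

      not-both-zero : ∀ a m c a′ m′ c′ → ¬ res₂ a m c a′ m′ c′ F.≈ F.0# → ¬ (a F.≈ F.0# × a′ F.≈ F.0#)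
      not-both-zero a m c a′ m′ c′ n (h , h′) = n (F.trans (res₂-cong {a} {m} {c} {a′} {m′} {c′} {F.0#} {m} {c} {F.0#} {m′} {c′} h F.refl F.refl h′ F.refl F.refl)
        (sc (m ∷ c ∷ m′ ∷ c′ ∷ []) (A.res₂ 𝟘 (var 2) (var 3) 𝟘 (var 4) (var 5)) 𝟘 tt))

      -- u + tv and v span the same line as u and v, and the change of coordinates on it has
      -- determinant 1.
      R-shear : ∀ u v t → resLine f (u ⊞ t ⊡ v) v F.≈ resLine f u v
      R-shear u v t = F.trans (R-line f u v v t) (F.trans
        (res₂-cong {x₁ F.+ y₁ F.* t F.+ z₁ F.* (t F.* t)} {y₁ F.+ b₁ f v v F.* t} {z₁} {x₂ F.+ y₂ F.* t F.+ z₂ F.* (t F.* t)} {y₂ F.+ b₂ f v v F.* t} {z₂}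
          {x₁ F.+ y₁ F.* t F.+ z₁ F.* (t F.* t)} {y₁ F.+ nat F 2 F.* z₁ F.* t} {z₁} {x₂ F.+ y₂ F.* t F.+ z₂ F.* (t F.* t)} {y₂ F.+ nat F 2 F.* z₂ F.* t} {z₂}
          F.refl (F.+-congˡ (F.*-congʳ (self (fst4 F f)))) F.refl F.refl (F.+-congˡ (F.*-congʳ (self (snd4 F f)))) F.refl)
        (scalar x₁ y₁ z₁ x₂ y₂ z₂))
        where
        x₁ = q₁ f u
        y₁ = b₁ f u v
        z₁ = q₁ f v
        x₂ = q₂ f u
        y₂ = b₂ f u v
        z₂ = q₂ f v
        self : ∀ g → polar g v v F.≈ nat F 2 F.* quad g v
        self g = sc (tabulate g ++ᴸ tabulate v) (A.polar (vec 2) (vec 12) (vec 12)) (nat 𝕊 2 :* A.quad (vec 2) (vec 12)) tt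
        scalar : ∀ x y z x′ y′ z′ → res₂ (x F.+ y F.* t F.+ z F.* (t F.* t)) (y F.+ nat F 2 F.* z F.* t) z (x′ F.+ y′ F.* t F.+ z′ F.* (t F.* t)) (y′ F.+ nat F 2 F.* z′ F.* t) z′
          F.≈ res₂ x y z x′ y′ z′
        scalar x y z x′ y′ z′ = sc (x ∷ y ∷ z ∷ x′ ∷ y′ ∷ z′ ∷ t ∷ [])
          (A.res₂ (var 2 :+ var 3 :* var 8 :+ var 4 :* (var 8 :* var 8)) (var 3 :+ nat 𝕊 2 :* var 4 :* var 8) (var 4)
                  (var 5 :+ var 6 :* var 8 :+ var 7 :* (var 8 :* var 8)) (var 6 :+ nat 𝕊 2 :* var 7 :* var 8) (var 7))
          (A.res₂ (var 2) (var 3) (var 4) (var 5) (var 6) (var 7)) tt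

      -- Extracts a parameter, as data, from the mere impossibility that all five values vanish.
      choose : (g : F.Carrier → F.Carrier) → (∀ {s t} → s F.≈ t → g s F.≈ g t) → ¬ (∀ (k : Fin 5) → g (nat F (toℕ k)) F.≈ F.0#) →
        Σ F.Carrier λ τ → ¬ g τ F.≈ F.0#
      choose g g-cong n = τ , cases (x 0) (λ h z → h (hit {0} (select-≉ h _ _) z)) λ z₀ →
          cases (x 1) (λ h z → h (hit {1} (F.trans (select-≈ z₀ _ _) (select-≉ h _ _)) z)) λ z₁ →
          cases (x 2) (λ h z → h (hit {2} (F.trans (select-≈ z₀ _ _) (F.trans (select-≈ z₁ _ _) (select-≉ h _ _))) z)) λ z₂ →
          cases (x 3) (λ h z → h (hit {3} (F.trans (select-≈ z₀ _ _) (F.trans (select-≈ z₁ _ _) (F.trans (select-≈ z₂ _ _) (select-≉ h _ _)))) z)) λ z₃ z →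
          n (gather (z₀ , z₁ , z₂ , z₃ ,
            hit {4} (F.trans (select-≈ z₀ _ _) (F.trans (select-≈ z₁ _ _) (F.trans (select-≈ z₂ _ _) (select-≈ z₃ _ _)))) z , lift tt))
        where
        x : ℕ → F.Carrier
        x k = g (nat F k)
        τ : F.Carrier
        τ = select (x 0) (nat F 0) (select (x 1) (nat F 1) (select (x 2) (nat F 2) (select (x 3) (nat F 3) (nat F 4))))
        hit : ∀ {k} → τ F.≈ nat F k → g τ F.≈ F.0# → x k F.≈ F.0#
        hit e z = F.trans (F.sym (g-cong e)) z

    module _ (E : V 4) where
      private
        -- With E fixed, the resultant on the line through E and A takes the part that the value of
        -- the cubic at A has in degree 3.
        N : V 4 → F.Carrier
        N = resLine f E
        D : V 4 → V 4 → V 4 → F.Carrier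
        D = vol E
        fr : V 4 → V 4 → V 4 → Model F four
        fr = frame₄ f E
        D̂ : (a b c : Fin 4 → SE) → SE
        D̂ = vol̂ ê
        ĝ : (a b c : Fin 4 → SE) → Model 𝕊 four
        ĝ = f̂r ê
        xs : (a b c : V 4) → F.Carrier → List F.Carrier
        xs = xs₄ E
        ys : (a b c w z : V 4) → List F.Carrier
        ys a b c w z = tabulate f ++ᴸ tabulate E ++ᴸ tabulate a ++ᴸ tabulate b ++ᴸ tabulate c ++ᴸ F.0# ∷ tabulate w ++ᴸ tabulate z
        point : ∀ {a b c a′ b′ c′ : V 4} → a ≐ a′ → b ≐ b′ → c ≐ c′ → Pointwise F._≈_ (xs a b c F.0#) (xs a′ b′ c′ F.0#)
        point h h′ h″ = ++⁺ (refls f) (++⁺ (refls E) (++⁺ (tabulate⁺ h) (++⁺ (tabulate⁺ h′) (++⁺ (tabulate⁺ h″) (F.refl ∷ [])))))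
        Z : V 4 → V 4 → Set (c ⊔ ℓ)
        Z a z = Σ F.Carrier λ s → Σ F.Carrier λ t → z ≐ s ⊡ E ⊞ t ⊡ a

      OnLine : (x y z x′ y′ z′ : V 4) → Set (c ⊔ ℓ)
      OnLine x y z x′ y′ z′ = Joined four (λ (a , b , c) → frame₄ f E a b c) (λ (a , b , c) → vol E a b c) (x , y , z) (x′ , y′ , z′)

      private
        L = OnLine
        D-cong : ∀ {a b c a′ b′ c′} → a ≐ a′ → b ≐ b′ → c ≐ c′ → D a b c F.≈ D a′ b′ c′
        D-cong h h′ h″ = congS (D̂ â b̂ ĉ) tt (point h h′ h″)
        L-≐ : ∀ {a b c b′ c′} → b ≐ b′ → c ≐ c′ → L a b c a b′ c′
        L-≐ {a} {b} {c} {b′} {c′} h h′ = joined $ link-≈ (gather {P = λ i → fr a b c i F.≈ fr a b′ c′ i}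
            (congM F (ĝ â b̂ ĉ) tt (env-pointwise {F.1#} {F.1#} (point {a} {b} {c} r h h′))))
          (D-cong {a} {b} {c} r h h′)
        L-add : ∀ {a} → ¬ N a F.≈ F.0# → ∀ t {b c} → L a b c a (b ⊞ t ⊡ c) c
        L-add {a} n t {b} {c} = joined $ link (conn-shear₃₄ t (fr a b c)) (gather {P = λ i → shear₃₄ t (fr a b c) i F.≈ fr a (b ⊞ t ⊡ c) c i}
            (scM (xs a b c t) (M₄.shear₃₄ t̂ (ĝ â b̂ ĉ)) (ĝ â (b̂ ⊞̂ t̂ ⊡̂ ĉ) ĉ) tt))
          (sc (xs a b c t) (𝟙 :* D̂ â b̂ ĉ) (D̂ â (b̂ ⊞̂ t̂ ⊡̂ ĉ) ĉ) tt)
        L-scale : ∀ {a} → ¬ N a F.≈ F.0# → ∀ {g h} → g F.* h F.≈ F.1# → ∀ {b c} → L a b c a (g ⊡ b) c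
        L-scale {a} _ {g} e {b} {c} = joined $ link (conn-scale₄ e (fr a b c)) (gather {P = λ i → scale₄ g (fr a b c) i F.≈ fr a (g ⊡ b) c i}
            (scM (xs a b c g) (M₄.scale₄ t̂ (ĝ â b̂ ĉ)) (ĝ â (t̂ ⊡̂ b̂) ĉ) tt))
          (sc (xs a b c g) (t̂ :* D̂ â b̂ ĉ) (D̂ â (t̂ ⊡̂ b̂) ĉ) tt)
        L-flip : ∀ {a} → ¬ N a F.≈ F.0# → ∀ {b c} → L a b c a c b
        L-flip {a} n {b} {c} = joined $ link (conn-flip₃₄ (fr a b c)) (gather {P = λ i → flip₃₄ (fr a b c) i F.≈ fr a c b i}
            (scM (xs a b c F.0#) (M₄.flip₃₄ (ĝ â b̂ ĉ)) (ĝ â ĉ b̂) tt))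
          (sc (xs a b c F.0#) (:- 𝟙 :* D̂ â b̂ ĉ) (D̂ â ĉ b̂) tt)
        L-liftE : ∀ {a} t {b c} → L a b c a (b ⊞ t ⊡ E) c
        L-liftE {a} t {b} {c} = joined $ link (conn-lift₃₁ t (fr a b c)) (gather {P = λ i → lift₃₁ t (fr a b c) i F.≈ fr a (b ⊞ t ⊡ E) c i}
            (scM (xs a b c t) (M₄.lift₃₁ t̂ (ĝ â b̂ ĉ)) (ĝ â (b̂ ⊞̂ t̂ ⊡̂ ê) ĉ) tt))
          (sc (xs a b c t) (𝟙 :* D̂ â b̂ ĉ) (D̂ â (b̂ ⊞̂ t̂ ⊡̂ ê) ĉ) tt)
        L-lift : ∀ {a} t {b c} → L a b c a (b ⊞ t ⊡ a) c
        L-lift {a} t {b} {c} = joined $ link (conn-lift₃₂ t (fr a b c)) (gather {P = λ i → lift₃₂ t (fr a b c) i F.≈ fr a (b ⊞ t ⊡ a) c i}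
            (scM (xs a b c t) (M₄.flip₁₂ (M₄.lift₃₁ t̂ (M₄.flip₁₂ (ĝ â b̂ ĉ)))) (ĝ â (b̂ ⊞̂ t̂ ⊡̂ â) ĉ) tt))
          (sc (xs a b c t) (𝟙 :* D̂ â b̂ ĉ) (D̂ â (b̂ ⊞̂ t̂ ⊡̂ â) ĉ) tt)
        L-translate : ∀ {a} → ¬ N a F.≈ F.0# → ∀ {z} → Z a z → ∀ {b c} → L a b c a (b ⊞ z) c
        L-translate {a} n (s , t , h) {b} {c} = joined-trans (L-liftE s) (joined-trans (L-lift t)
          (L-≐ {a} {b ⊞ s ⊡ E ⊞ t ⊡ a} {c} (λ i → F.trans (F.+-assoc _ _ _) (F.+-congˡ (F.sym (h i)))) r))
        L-swap : ∀ {a b c} → ¬ N a F.≈ F.0# → ¬ N b F.≈ F.0# → L a b c b a c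
        L-swap {a} {b} {c} n n′ = joined $ link
          -- The forms do not both vanish at E, since E lies on a line with nonzero resultant. The
          -- two conditions of the swap are the resultants on the lines (E, a) and (E, b).
          (let α , β , e = unimodular (q₁ f E) (q₂ f E) (not-both-zero (q₁ f E) (b₁ f E a) (q₁ f a) (q₂ f E) (b₂ f E a) (q₂ f a) n)
           in Normalise4.Reduce.conn-swap′ F 2≉0 (fr a b c) α β e n n′)
          (gather {P = λ i → swap₂₃ (fr a b c) i F.≈ fr b a c i}
            (scM (xs a b c F.0#) (M₄.swap₂₃ (ĝ â b̂ ĉ)) (ĝ b̂ â ĉ) tt))
          (sc (xs a b c F.0#) (:- 𝟙 :* D̂ â b̂ ĉ) (D̂ b̂ â ĉ) tt)
        cramer : ∀ a b c w → Σ (V 4) λ z → Z a z × D a b c ⊡ w ≐ (D a w c ⊡ b ⊞ D a b w ⊡ c) ⊞ z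
        cramer a b c w = vol w a b c ⊡ E ⊞ D w b c ⊡ a , (vol w a b c , D w b c , r) ,
          gather {P = λ i → D a b c F.* w i F.≈ (D a w c F.* b i F.+ D a b w F.* c i) F.+ (vol w a b c F.* E i F.+ D w b c F.* a i)}
            (scM (ys a b c w w) (D̂ â b̂ ĉ ⊡̂ ŵ) ((D̂ â ŵ ĉ ⊡̂ b̂ ⊞̂ D̂ â b̂ ŵ ⊡̂ ĉ) ⊞̂ (vol̂ ŵ â b̂ ĉ ⊡̂ ê ⊞̂ D̂ ŵ b̂ ĉ ⊡̂ â)) tt)
        -- Expand b′ by `cramer` in D(a, -, c′), where the components along E and a drop out.
        plücker : ∀ a b c b′ c′ → D a b′ c F.* D a b c′ F.+ F.- (D a c′ c F.* D a b b′) F.≈ D a b c F.* D a b′ c′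
        plücker a b c b′ c′ = F.trans
          (sc (D a b′ c ∷ D a b c′ ∷ D a c′ c ∷ D a b b′ ∷ []) (var 2 :* var 3 :+ :- (var 4 :* var 5)) (var 2 :* var 3 :+ var 5 :* :- var 4) tt)
          (F.trans (F.+-congˡ (F.*-congˡ (sc (ys a c c′ c c) (:- D̂ â ĉ b̂) (D̂ â b̂ ĉ) tt)))
          (F.trans (F.sym (linear (D a b′ c) (D a b b′) (vol b′ a b c) (D b′ b c)))
          (F.trans (D-cong {a} {u} {c′} {a} {D a b c ⊡ b′} {c′} r (λ i → F.sym (proj₂ (proj₂ (cramer a b c b′)) i)) r)
            (sc (xs a b′ c′ (D a b c)) (D̂ â (t̂ ⊡̂ b̂) ĉ) (t̂ :* D̂ â b̂ ĉ) tt))))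
          where
          u : V 4
          u = (D a b′ c ⊡ b ⊞ D a b b′ ⊡ c) ⊞ (vol b′ a b c ⊡ E ⊞ D b′ b c ⊡ a)
          linear : ∀ α β s t → D a ((α ⊡ b ⊞ β ⊡ c) ⊞ (s ⊡ E ⊞ t ⊡ a)) c′ F.≈ α F.* D a b c′ F.+ β F.* D a c c′
          linear α β s t = sc (ys a b c c′ c′ ++ᴸ α ∷ β ∷ s ∷ t ∷ [])
            (D̂ â ((var 47 ⊡̂ b̂ ⊞̂ var 48 ⊡̂ ĉ) ⊞̂ (var 49 ⊡̂ ê ⊞̂ var 50 ⊡̂ â)) ŵ) (var 47 :* D̂ â b̂ ŵ :+ var 48 :* D̂ â ĉ ŵ) tt

        Z-lin : ∀ {a u v} t → Z a u → Z a v → Z a (u ⊞ t ⊡ v)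
        Z-lin {a} t (α , α′ , h) (β , β′ , k) = α F.+ t F.* β , α′ F.+ t F.* β′ , λ i → F.trans (F.+-cong (h i) (F.*-congˡ (k i)))
          (sc (α ∷ α′ ∷ β ∷ β′ ∷ t ∷ E i ∷ a i ∷ []) ((var 2 :* var 7 :+ var 3 :* var 8) :+ var 6 :* (var 4 :* var 7 :+ var 5 :* var 8))
            ((var 2 :+ var 6 :* var 4) :* var 7 :+ (var 3 :+ var 6 :* var 5) :* var 8) tt)
        Z-scale : ∀ {a u} t → Z a u → Z a (t ⊡ u)
        Z-scale {a} t (α , α′ , h) = t F.* α , t F.* α′ , λ i → F.trans (F.*-congˡ (h i))
          (sc (α ∷ α′ ∷ t ∷ E i ∷ a i ∷ []) (var 4 :* (var 2 :* var 5 :+ var 3 :* var 6)) (var 4 :* var 2 :* var 5 :+ var 4 :* var 3 :* var 6) tt)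
        N-cong : ∀ {a a′} → a ≐ a′ → N a F.≈ N a′
        N-cong {a} {a′} = R-congʳ f E {a} {a′}

      open Fixing F
      open Fix D N Z L joined-trans L-≐ L-add L-scale L-flip L-translate Z-lin Z-scale cramer plücker public

      private
        -- The components of b along a, v and w vanish. So b is a multiple of E, and the resultant
        -- for E and a multiple of E is 0.
        N-degenerate : ∀ a v w b → ¬ D a v w F.≈ F.0# → D a b v F.≈ F.0# → D a b w F.≈ F.0# → D w b v F.≈ F.0# → N b F.≈ F.0#
        N-degenerate a v w b d≉0 e₁ e₂ e₃ = F.trans (R-congʳ f E {b} {(D a v w F.⁻¹ F.* vol b a v w) ⊡ E} multiple) (R-multiple f E _)
          where
          multiple : b ≐ (D a v w F.⁻¹ F.* vol b a v w) ⊡ E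
          multiple i = F.trans (F.sym (F.trans (F.sym (F.*-assoc _ _ _)) (F.trans (F.*-congʳ (unit d≉0)) (F.*-identityˡ _))))
            (F.trans (F.*-congˡ (F.trans (proj₂ (proj₂ (cramer a v w b)) i)
              (F.+-cong (F.+-cong (F.*-congʳ e₂)
                (F.*-congʳ (F.trans (sc (ys a v w b b) (D̂ â b̂ ŵ) (:- D̂ â ŵ b̂) tt) (F.-‿cong e₁))))
                (F.+-congˡ (F.*-congʳ (F.trans (sc (ys a v w b b) (D̂ ŵ b̂ ĉ) (D̂ ĉ ŵ b̂) tt) e₃))))))
              (sc (v i ∷ w i ∷ a i ∷ D a v w F.⁻¹ ∷ vol b a v w ∷ E i ∷ [])
                (var 5 :* (𝟘 :* var 2 :+ :- 𝟘 :* var 3 :+ (var 6 :* var 7 :+ 𝟘 :* var 4))) (var 5 :* var 6 :* var 7) tt))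

      open Exchange D N L joined-trans fix L-swap D-cong N-cong
        (λ a b c → sc (xs a b c F.0#) (D̂ b̂ â ĉ) (:- D̂ â b̂ ĉ) tt)
        (λ a h g τ → sc (xs a h g τ) (D̂ â (b̂ ⊞̂ t̂ ⊡̂ â) ĉ) (:- D̂ â ĉ b̂) tt)
        (λ a h b τ → sc (xs a h b τ) (D̂ (b̂ ⊞̂ t̂ ⊡̂ â) ĉ â) (:- D̂ â ĉ b̂) tt)
        (λ a h b g τ → sc (tabulate f ++ᴸ tabulate E ++ᴸ tabulate a ++ᴸ tabulate h ++ᴸ tabulate b ++ᴸ τ ∷ tabulate g)
          (D̂ (b̂ ⊞̂ t̂ ⊡̂ â) ĉ ŵ) (D̂ b̂ ĉ ŵ :+ t̂ :* D̂ â ĉ ŵ) tt)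
        (R-generic f E) N-degenerate public

    private
      e₁ e₂ e₃ e₄ : V 4
      e₁ = basis F (# 0)
      e₂ = basis F (# 1)
      e₃ = basis F (# 2)
      e₄ = basis F (# 3)
      ê₁ ê₂ ê₃ ê₄ : Fin 4 → SE
      ê₁ = basis 𝕊 (# 0)
      ê₂ = basis 𝕊 (# 1)
      ê₃ = basis 𝕊 (# 2)
      ê₄ = basis 𝕊 (# 3)
      1≈vol : F.1# F.≈ vol e₁ e₂ e₃ e₄
      1≈vol = sc [] 𝟙 (vol̂ ê₁ ê₂ ê₃ ê₄) tt

    standard : ∀ i → f i F.≈ frame₄ f e₁ e₂ e₃ e₄ i
    standard = gather {P = λ i → f i F.≈ frame₄ f e₁ e₂ e₃ e₄ i} (scM (tabulate f) v₄ (f̂r ê₁ ê₂ ê₃ ê₄) tt)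

    -- The line through e₁ and e₂ is moved to the line through M₀ and M₁ in two
    -- steps, via the line through M₀ and a point P = e₁ + τe₂.
    module _ (M : Mat F 4) (n′ : ¬ resLine f (M (# 0)) (M (# 1)) F.≈ F.0#) (det≉0 : ¬ det F M F.≈ F.0#) where
      private
        M₀ M₁ M₂ M₃ : V 4
        M₀ = M (# 0)
        M₁ = M (# 1)
        M₂ = M (# 2)
        M₃ = M (# 3)

        FromLine : (u v w z : V 4) → Set (c ⊔ ℓ)
        FromLine u v w z = Link four (frame₄ f u v w z) (frame₄ f M₀ M₁ M₂ M₃) (vol u v w z) (vol M₀ M₁ M₂ M₃)

        Exchanged : (E A v w B : V 4) → Set (c ⊔ ℓ)
        Exchanged E A v w B = Σ (V 4) λ v′ → Σ (V 4) λ w′ → ¬ vol E B v′ w′ F.≈ F.0# × OnLine E A v w B v′ w′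

        last : ∀ {P v w} → Exchanged M₀ P v w M₁ → FromLine M₀ P v w
        last (v′ , w′ , d≉0 , l) = path (joined-trans l (fix M₀ {M₁} {v′} {w′} {M₂} {M₃} n′ d≉0 det≉0))

        flip : ∀ P v w → Link four (frame₄ f P M₀ v w) (frame₄ f M₀ P v w) (vol P M₀ v w) (vol M₀ P v w)
        flip P v w = link (conn-flip₁₂ (frame₄ f P M₀ v w)) (gather {P = λ i → flip₁₂ (frame₄ f P M₀ v w) i F.≈ frame₄ f M₀ P v w i}
          (scM (xs₄ P M₀ v w F.0#) (M₄.flip₁₂ (f̂r ê â b̂ ĉ)) (f̂r â ê b̂ ĉ) tt))
          (sc (xs₄ P M₀ v w F.0#) (:- 𝟙 :* vol̂ ê â b̂ ĉ) (vol̂ â ê b̂ ĉ) tt)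

        -- The vector kept by `exchange` comes first; the flip makes M₀ the kept one, while P is
        -- then exchanged for M₁.
        middle : ∀ {P A v w} → ¬ resLine f P M₀ F.≈ F.0# → Exchanged P A v w M₀ → FromLine P A v w
        middle {P} h (v′ , w′ , d≉0 , l) = link-trans (path l) (link-trans (flip P v′ w′) (last {P} {v′} {w′} (exchange M₀ {P} {v′} {w′} {M₁}
          (≉-resp (R-sym f P M₀) h) n′
          (neg-≉ (sc (xs₄ P M₀ v′ w′ F.0#) (vol̂ â ê b̂ ĉ) (:- vol̂ ê â b̂ ĉ) tt) d≉0))))

        first : ∀ u v w z τ → ¬ resLine f u v F.≈ F.0# → ¬ vol u v w z F.≈ F.0# → ¬ resLine f (u ⊞ τ ⊡ v) M₀ F.≈ F.0# → FromLine u v w z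
        first u v w z τ n d≉0 h = link-trans
          (link {f′ = frame₄ f (u ⊞ τ ⊡ v) v w z} {d = vol u v w z} {d′ = vol (u ⊞ τ ⊡ v) v w z} (conn-shear₁₂ τ (frame₄ f u v w z)) (gather {P = λ i → shear₁₂ τ (frame₄ f u v w z) i F.≈ frame₄ f (u ⊞ τ ⊡ v) v w z i}
            (scM (xs₄ u v w z τ) (M₄.shear₁₂ t̂ (f̂r ê â b̂ ĉ)) (f̂r (ê ⊞̂ t̂ ⊡̂ â) â b̂ ĉ) tt)) (F.trans (F.*-identityˡ _) volume))
          (middle {u ⊞ τ ⊡ v} {v} {w} {z} h (exchange (u ⊞ τ ⊡ v) {v} {w} {z} {M₀} (≉-resp (F.sym (R-shear u v τ)) n) h (≉-resp volume d≉0)))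
          where
          volume : vol u v w z F.≈ vol (u ⊞ τ ⊡ v) v w z
          volume = sc (xs₄ u v w z τ) (vol̂ ê â b̂ ĉ) (vol̂ (ê ⊞̂ t̂ ⊡̂ â) â b̂ ĉ) tt

        through : ∀ u v w z → ¬ resLine f u v F.≈ F.0# → ¬ vol u v w z F.≈ F.0# →
          Σ F.Carrier (λ τ → ¬ resLine f (u ⊞ τ ⊡ v) M₀ F.≈ F.0#) → FromLine u v w z
        through u v w z n d≉0 (τ , h) = first u v w z τ n d≉0 h

        moved : ∀ u v w z → ¬ resLine f u v F.≈ F.0# → ¬ vol u v w z F.≈ F.0# → FromLine u v w z
        moved u v w z n d≉0 = through u v w z n d≉0 (choose (λ τ → resLine f (u ⊞ τ ⊡ v) M₀)
          (λ {s} {t} e → R-congˡ f {u ⊞ s ⊡ v} {u ⊞ t ⊡ v} M₀ (λ i → F.+-congˡ (F.*-congʳ e)))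
          (R-plane f u v M₀ n (not-both-zero (q₁ f M₀) (b₁ f M₀ M₁) (q₁ f M₁) (q₂ f M₀) (b₂ f M₀ M₁) (q₂ f M₁) n′)))

      frame-link : ¬ resLine f e₁ e₂ F.≈ F.0# → Link four f (frame₄ f (M (# 0)) (M (# 1)) (M (# 2)) (M (# 3))) F.1# (det F M)
      frame-link n = link-trans (link-≈ {d = F.1#} {d′ = vol e₁ e₂ e₃ e₄} standard 1≈vol) (moved e₁ e₂ e₃ e₄ n (≉-resp 1≈vol (λ h → F.0≉1 (F.sym h))))

open Frames4 public

-- The clause on η

module Conclusions where
  module Conclude {c ℓ : Level} (F : Field c ℓ) where
    private module F = Field F

    Conclusion : (n : Deg) (δ : F.Carrier) (f f′ : Model F n) → Set (c ⊔ ℓ)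
    Conclusion n δ f f′ =
      Σ (AlgIso F (relsA F n f′) (relsA F n f)) λ Ψ → Σ F.Carrier λ ρ → Σ F.Carrier λ σ → Σ F.Carrier λ τ →
        Eqv F (relsA F n f) (AlgIso.ψ Ψ (ξA F n f′)) (_·_ F (δ F.* δ) (ξA F n f) ⊕ con ρ)
        × Eqv F (relsA F n f) (AlgIso.ψ Ψ (ηA F n f′)) (_·_ F (δ F.* δ F.* δ) (ηA F n f) ⊕ _·_ F σ (ξA F n f) ⊕ con τ)
        × SigmaTauZero F n σ τ
        × Σ (NC F (ngen F n)) λ κ → ∀ x →
            Eqv F (relsA F n f) (AlgIso.ψ Ψ (DA F n f′ x)) (_·_ F δ (DA F n f (AlgIso.ψ Ψ x)) ⊕ ⟦_,_⟧ F κ (AlgIso.ψ Ψ x))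

    conclude₂ : ∀ {δ} {f f′ : Model F two} → Conn F two δ f f′ → Conclusion two δ f f′
    conclude₂ {f = f} C = iso , ρ , F.0# , F.0# , ξ-eq ,
      trans η-eq (sym (trans (+-identityʳ _) (trans (+-congˡ (zeroˡ _)) (+-identityʳ _)))) , (F.refl , F.refl) , κ , D-eq
      where
      open Conn C
      open Ring (ncRing F (relsA F two f)) hiding (zero; refl)

    private
      br : ∀ {g} → NC 𝕊 g → NC 𝕊 g → NC 𝕊 g
      br = ⟦_,_⟧ 𝕊
      infixr 7 _⋆_
      _⋆_ : ∀ {g} → SE → NC 𝕊 g → NC 𝕊 g
      _⋆_ = _·_ 𝕊
      infixl 6 _⊝_
      _⊝_ : ∀ {g} → NC 𝕊 g → NC 𝕊 g → NC 𝕊 g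
      _⊝_ = _⊖_ 𝕊
      X E K : NC 𝕊 3
      X = gen (# 0)
      E = gen (# 1)
      K = gen (# 2)
      δ̂ ρ̂ ĥ : SE
      δ̂ = var 2
      ρ̂ = var 3
      ĥ = var 4
      -- δ D(ψ(ξ′)) + [κ, ψ(ξ′)], where ψ(ξ′) = δ²ξ + ρ
      image : NC 𝕊 3
      image = δ̂ ⋆ (con 𝟘 ⊗ X ⊕ con (δ̂ :* δ̂) ⊗ E ⊕ con 𝟘) ⊕ br K ((δ̂ :* δ̂) ⋆ X ⊕ con ρ̂)

    -- D(ψ(ξ′)) is known because D is well defined, and [κ, ψ(ξ′)] = 0.
    module _ {n : Deg} {δ : F.Carrier} {f f′ : Model F n} (C : Conn F n δ f f′) (G : Good F n f) where
      open Conn C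
      open Good G

      D-ξ : (∀ x y → DA F n f (x ⊕ y) ≡ DA F n f x ⊕ DA F n f y) → (∀ x y → DA F n f (x ⊗ y) ≡ DA F n f x ⊗ y ⊕ x ⊗ DA F n f y) → (∀ a → DA F n f (con a) ≡ con F.0#) →
        Eqv F (relsA F n f) (ψ (DA F n f′ (ξA F n f′)))
          (_·_ F δ (con F.0# ⊗ ξA F n f ⊕ con (δ F.* δ) ⊗ DA F n f (ξA F n f) ⊕ con F.0#) ⊕ ⟦_,_⟧ F κ (_·_ F (δ F.* δ) (ξA F n f) ⊕ con ρ))
      D-ξ D-⊕ D-⊗ D-con = trans′ (D-eq (ξA F n f′)) (⊕-cong (⊗-cong refl′ (trans′ (D-cong ξ-eq) (reflexive
          (≡.trans (D-⊕ _ _) (≡.cong₂ _⊕_ (≡.trans (D-⊗ _ _) (≡.cong (λ z → z ⊗ ξA F n f ⊕ con (δ F.* δ) ⊗ DA F n f (ξA F n f)) (D-con _))) (D-con _))))))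
        (⊕-cong (⊗-cong refl′ ξ-eq) (⊗-cong refl′ (⊗-cong ξ-eq refl′))))
        where
        reflexive : ∀ {x y} → x ≡ y → Eqv F (relsA F n f) x y
        reflexive refl = refl′

    conclude₃ : ∀ {δ} {f f′ : Model F three} → Conn F three δ f f′ → Good F three f → Conclusion three δ f f′
    conclude₃ {δ₀} {f} {f′} C G = iso , C.ρ , σ , τ , ξ-eq ,
      trans (hom-· F {three} {f} {f′} to _ _) (trans (*-congˡ (trans (h.⊕-hom _ _) (+-cong (trans (h.⊕-hom _ _) (+-cong
          (D-ξ C G (λ _ _ → refl) (λ _ _ → refl) (λ _ → refl))
          (trans (hom-· F {three} {f} {f′} to _ _) (*-congˡ (trans (hom-· F {three} {f} {f′} to _ _) (*-congˡ ξ-eq))))))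
          (trans (hom-· F {three} {f} {f′} to _ _) (*-congˡ (h.con-hom _))))))
        (I.identity Rs tt (Good.ξ-central G C.κ , lift tt) [] 0
          (ĥ ⋆ (image ⊝ var 6 ⋆ ((δ̂ :* δ̂) ⋆ X ⊕ con ρ̂) ⊝ con (var 8)))
          ((δ̂ :* δ̂ :* δ̂) ⋆ (ĥ ⋆ (E ⊝ var 5 ⋆ X ⊝ con (var 7)))
            ⊕ (ĥ :* (δ̂ :* δ̂ :* δ̂ :* var 5 :+ :- (var 6 :* (δ̂ :* δ̂)))) ⋆ X
            ⊕ con (ĥ :* (δ̂ :* δ̂ :* δ̂ :* var 7 :+ :- (var 6 :* ρ̂) :+ :- var 8)))
          ((:- (ĥ :* δ̂ :* δ̂) , [] , 0 , []) ∷ []) tt)) ,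
      _ , C.κ , D-eq
      where
      module C = Conn C
      open Conn C using (iso; to; ξ-eq; D-eq)
      module h = AlgHom to
      open Ring (ncRing F (relsA F three f)) hiding (zero; refl)
      m = f (# 9)
      m′ = f′ (# 9)
      A = Three.a3′ F f
      A′ = Three.a3′ F f′
      -- From η = ½(Dξ - mξ - a₃′) and the same formula for η′: subtracting δ³η from ψ(η′) leaves
      -- the terms in m and m′, in ρ, and the two constants a₃′.
      σ = half F F.* (δ₀ F.* δ₀ F.* δ₀ F.* m F.+ F.- (m′ F.* (δ₀ F.* δ₀)))
      τ = half F F.* (δ₀ F.* δ₀ F.* δ₀ F.* A F.+ F.- (m′ F.* C.ρ) F.+ F.- A′)
      Rs : List (NC 𝕊 3)
      Rs = br X K ∷ []
      module I = Identity F (relsA F three f) (env F F.1# F.1# (δ₀ ∷ C.ρ ∷ half F ∷ m ∷ m′ ∷ A ∷ A′ ∷ [])) (F.*-identityˡ _)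
        (nth (con F.0#) (ξA F three f ∷ DA F three f (ξA F three f) ∷ C.κ ∷ []))

    conclude₄ : ∀ {δ} {f f′ : Model F four} → Conn F four δ f f′ → Good F four f → Conclusion four δ f f′
    conclude₄ {δ₀} {f} {f′} C G = iso , C.ρ , F.0# , F.0# , ξ-eq ,
      trans (hom-· F {four} {f} {f′} to _ _) (trans (*-congˡ (D-ξ C G (λ _ _ → refl) (λ _ _ → refl) (λ _ → refl)))
        (I.identity Rs tt (Good.ξ-central G C.κ , lift tt) [] 0
          (ĥ ⋆ image) ((δ̂ :* δ̂ :* δ̂) ⋆ (ĥ ⋆ E) ⊕ 𝟘 ⋆ X ⊕ con 𝟘) ((:- (ĥ :* δ̂ :* δ̂) , [] , 0 , []) ∷ []) tt)) ,
      (F.refl , F.refl) , C.κ , D-eq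
      where
      module C = Conn C
      open Conn C using (iso; to; ξ-eq; D-eq)
      open Ring (ncRing F (relsA F four f)) hiding (zero; refl)
      Rs : List (NC 𝕊 3)
      Rs = br X K ∷ []
      module I = Identity F (relsA F four f) (env F F.1# F.1# (δ₀ ∷ C.ρ ∷ half F ∷ [])) (F.*-identityˡ _)
        (nth (con F.0#) (ξA F four f ∷ DA F four f (ξA F four f) ∷ C.κ ∷ []))

open Conclusions public

-- Invertible changes of the pencil, and assembly of the three degrees

private
  det₂-expand : ∀ {c ℓ} (F : Field c ℓ) (N : Mat F 2) → Field._≈_ F (Mix4.det₂ F N) (det F N)
  det₂-expand F N = Scalar.sc F (tabulate (N (# 0)) ++ᴸ tabulate (N (# 1))) (Mix4.det₂ 𝕊 N̂) (det 𝕊 N̂) tt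
    where
    N̂ : Mat 𝕊 2
    N̂ i j = var (2 ℕ.+ 2 ℕ.* toℕ i ℕ.+ toℕ j)

module Invert4 {c ℓ : Level} (F : Field c ℓ) where
  private module F = Field F
  open Moves4 F
  open Scalar F
  open Mix4 F

  conn-mix-invertible : ∀ N f → ¬ det₂ N F.≈ F.0# → Conn F four (det₂ N) f (mix N f)
  conn-mix-invertible N f n = conn-mix N N′ f λ i → F.sym (F.trans (restored i) (F.trans (F.*-congʳ (unit n)) (F.*-identityˡ _)))
    where
    x = det₂ N F.⁻¹
    N′ : Mat F 2
    -- The adjugate of N divided by det N.
    N′ = lookup (lookup (x F.* N (# 1) (# 1) ∷ x F.* F.- N (# 0) (# 1) ∷ []) ∷ lookup (x F.* F.- N (# 1) (# 0) ∷ x F.* N (# 0) (# 0) ∷ []) ∷ [])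
    N̂ N̂′ : Mat 𝕊 2
    N̂ = lookup (lookup (var 22 ∷ var 23 ∷ []) ∷ lookup (var 24 ∷ var 25 ∷ []) ∷ [])
    N̂′ = lookup (lookup (var 26 :* var 25 ∷ var 26 :* :- var 23 ∷ []) ∷ lookup (var 26 :* :- var 24 ∷ var 26 :* var 22 ∷ []) ∷ [])
    restored : ∀ i → mix N′ (mix N f) i F.≈ x F.* det₂ N F.* f i
    restored = gather {P = λ i → mix N′ (mix N f) i F.≈ x F.* det₂ N F.* f i}
      (scM (tabulate f ++ᴸ N (# 0) (# 0) ∷ N (# 0) (# 1) ∷ N (# 1) (# 0) ∷ N (# 1) (# 1) ∷ x ∷ [])
        (Moves4.mix 𝕊 N̂′ (Moves4.mix 𝕊 N̂ (varModel four))) (λ i → var 26 :* Mix4.det₂ 𝕊 N̂ :* varModel four i) tt)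

theorem4p1 : ∀ {c ℓ : Level} (F : Field c ℓ) →
    ¬ (Field._≈_ F (Field._+_ F (Field.1# F) (Field.1# F)) (Field.0# F)) →
    ¬ (Field._≈_ F (Field._+_ F (Field._+_ F (Field.1# F) (Field.1# F)) (Field.1# F)) (Field.0# F)) →
    (n : Deg) (f f′ : Model F n) → Hyp F n f → Hyp F n f′ →
    (γ : GElt F n) → Valid F n γ →
    (∀ i → Field._≈_ F (f′ i) (act F n γ f i)) →
    Σ (AlgIso F (relsA F n f′) (relsA F n f)) λ Ψ →
      Σ (Field.Carrier F) λ ρ → Σ (Field.Carrier F) λ σ → Σ (Field.Carrier F) λ τ →
        Eqv F (relsA F n f) (AlgIso.ψ Ψ (ξA F n f′))
          (_⊕_ (_·_ F (Field._*_ F (detG F n γ) (detG F n γ)) (ξA F n f)) (con ρ))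
        × Eqv F (relsA F n f) (AlgIso.ψ Ψ (ηA F n f′))
          (_⊕_ (_⊕_ (_·_ F (Field._*_ F (Field._*_ F (detG F n γ) (detG F n γ)) (detG F n γ)) (ηA F n f))
                        (_·_ F σ (ξA F n f)))
                 (con τ))
        × SigmaTauZero F n σ τ
        × Σ (NC F (ngen F n)) λ κ → ∀ x →
            Eqv F (relsA F n f) (AlgIso.ψ Ψ (DA F n f′ x))
              (_⊕_ (_·_ F (detG F n γ) (DA F n f (AlgIso.ψ Ψ x))) (⟦_,_⟧ F κ (AlgIso.ψ Ψ x)))
theorem4p1 F 2≉0 3≉0 two f f′ _ _ (l , M) (l≉0 , det≉0) h =
  let δ , C , e = Frame2.frame-link F f M det≉0
      g = Frames.frame₂ F f (M (# 0)) (M (# 1))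
  in Conclude.conclude₂ F (conn-δ F (*-congˡ (trans (sym (*-identityʳ _)) e)) (_▷_ F C
       (conn-resp F (λ _ → F.refl) (λ i → sym (trans (h i) (ActSound.act₂ F l M f i))) (Conn2.conn-twist₂ F (inverse l l≉0) g))))
  where
  module F = Field F
  open Field F hiding (refl; zero)
theorem4p1 F 2≉0 3≉0 three f f′ (lift c≉0) (lift c′≉0) (l , M) (l≉0 , det≉0) h =
  let δ , C , e = Frame3.frame-link F 2≉0 3≉0 f M c≉0
        -- f′(0, 0, 1) is l times the value of f at the last row of M.
        (λ z → c′≉0 (trans (h (# 2)) (trans (ActSound.act₃ F l M f (# 2)) (trans (*-congˡ z) (zeroʳ _))))) det≉0
  in Conclude.conclude₃ F (conn-δ F (*-congˡ (trans (sym (*-identityʳ _)) e)) (_▷_ F C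
       (conn-resp F (λ _ → F.refl) (λ i → sym (trans (h i) (ActSound.act₃ F l M f i))) (Conn3.conn-twist₃ F (inverse l l≉0) g))))
       (General3.good₃ F f c≉0)
  where
  module F = Field F
  open Field F hiding (refl; zero)
  g = Frames.frame₃ F f (M (# 0)) (M (# 1)) (M (# 2))
theorem4p1 F 2≉0 3≉0 four f f′ misses misses′ (Λ , M) (detΛ≉0 , det≉0) h =
  let δ , C , e = T.frame-link M res′≉0 det≉0 (λ z → res≉0 (trans (res₁₂-cong T.standard) z))
      -- f₁ and f₂ do not both vanish at e₁, which lies on the line {x₃ = x₄ = 0}. Some combination
      -- of them is therefore 1 there, as the normal form requires.
      α , β , u = Lines.unimodular F 2≉0 3≉0 (f (# 0)) (f (# 10)) both-zero
  in Conclude.conclude₄ F (conn-δ F (*-cong (det₂-expand F Λ) (trans (sym (*-identityʳ _)) e)) (_▷_ F C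
       (conn-resp F (λ _ → F.refl) (λ i → sym (f′≈ i)) (Invert4.conn-mix-invertible F Λ g (λ z → detΛ≉0 (trans (sym (det₂-expand F Λ)) z))))))
       (Normalise4.Reduce.good F 2≉0 f α β u)
  where
  module F = Field F
  open Field F hiding (refl; zero)
  open Swap4 F using (res₁₂)
  open Normalise4 F using (res₁₂-cong; res₁₂-mix)
  module T = Frame4 F 2≉0 3≉0 f
  g = Frames.frame₄ F f (M (# 0)) (M (# 1)) (M (# 2)) (M (# 3))
  f′≈ : ∀ i → f′ i ≈ Moves4.mix F Λ g i
  f′≈ i = trans (h i) (ActSound.act₄ F Λ M f i)
  res≉0 : ¬ res₁₂ f ≈ 0#
  res≉0 = Resultant.noMeet⇒res≉0 F 2≉0 f misses
  res′≉0 : ¬ res₁₂ g ≈ 0#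
  -- f′ is the frame model g mixed by Λ, so its resultant is (det Λ)² times that of g.
  res′≉0 z = Resultant.noMeet⇒res≉0 F 2≉0 f′ misses′
    (trans (res₁₂-cong f′≈) (trans (res₁₂-mix Λ g) (trans (*-congˡ z) (zeroʳ _))))
  both-zero : ¬ (f (# 0) ≈ 0# × f (# 10) ≈ 0#)
  both-zero (z , z′) = res≉0 (trans (+-cong (*-cong (dz (# 4) (# 14)) (dz (# 4) (# 14))) (-‿cong (*-congʳ (dz (# 1) (# 11)))))
    (Scalar.sc F (Four.d F f 2 5 ∷ []) (𝟘 :* 𝟘 :+ :- (𝟘 :* var 2)) 𝟘 tt))
    where
    dz : ∀ i j → f (# 0) * f j + - (f i * f (# 10)) ≈ 0#
    dz i j = trans (+-cong (*-congʳ z) (-‿cong (*-congˡ z′))) (Scalar.sc F (f i ∷ f j ∷ []) (𝟘 :* var 3 :+ :- (var 2 :* 𝟘)) 𝟘 tt)
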